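{- For every $n\ge1$: (1) $(\mathbb{P}_f)_f$, $f$ ranging over red-packed forests of weight $n$, is a basis of $\mathbf{WQSym}^*_n$; (2) $(\mathbb{P}_t)_t$, $t$ ranging over red-packed trees of weight $n$, is a basis of $\mathrm{Prim}^*_n$; (3) $(\mathbb{P}_t)_t$, $t$ ranging over red-packed trees of weight $n$ whose root has an empty left forest, is a basis of $\mathrm{TPrim}^*_n$.
   Context: Words are finite words over the positive integers; $|w|$ is the length, $\max(w)$ the largest letter ($\max(\varepsilon)=0$), $w^{[k]}$ adds $k$ to every letter. A word is packed if every integer $1,\dots,\max(w)$ occurs in it; $\mathrm{PW}_n$ is the set of packed words of length $n$; $\mathrm{pack}(w)$ replaces the $j$-th smallest distinct letter by $j$. For $w\in\mathrm{PW}_n$, $p\ge1$ and $I=\{i_1<\dots<i_p\}$ a set of positive integers, if $i_p\le n+p$ then $\phi_I(w)$ is the word of length $n+p$ with letter $\max(w)+1$ at the positions in $I$ and the letters of $w$, in order, at the other positions. $\mathbf{WQSym}^*_n$ has basis $(\mathbb{R}_w)_{w\in\mathrm{PW}_n}$; $(\mathbf{WQSym}^*)_+=\bigoplus_{n\ge1}\mathbf{WQSym}^*_n$. For nonempty packed $u,v$, with $v'=v^{[\max(u)]}$: $\mathbb{R}_u\prec\mathbb{R}_v=\sum\mathbb{R}_w$ over the shuffles $w$ of $u$ and $v'$ whose last letter is the last letter of $u$, and $\mathbb{R}_u\succ\mathbb{R}_v=\sum\mathbb{R}_w$ over shuffles whose last letter is the last letter of $v'$ (extended bilinearly). For $u=u_1\cdots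 u_n$, $\Delta_\prec(\mathbb{R}_u)$ (resp. $\Delta_\succ(\mathbb{R}_u)$) is $\sum\mathbb{R}_{\mathrm{pack}(u_1\cdots u_i)}\otimes\mathbb{R}_{\mathrm{pack}(u_{i+1}\cdots u_n)}$ over $1\le i\le n-1$ with $\{u_1,\dots,u_i\}\cap\{u_{i+1},\dots,u_n\}=\emptyset$ and $\max(u)\in\{u_1,\dots,u_i\}$ (resp. $\notin$). $\mathrm{Prim}^*_n=\mathbf{WQSym}^*_n\cap\ker(\Delta_\prec+\Delta_\succ)$, $\mathrm{TPrim}^*_n=\mathbf{WQSym}^*_n\cap\ker\Delta_\prec\cap\ker\Delta_\succ$. The linear map $\Phi_I$ sends $\mathbb{R}_w$ ($w\in\mathrm{PW}_n$) to $\mathbb{R}_{\phi_I(w)}$ if $i_p\le n+p$ and to $0$ otherwise. Brace brackets: for $n\ge2$ and $p_1,\dots,p_n\in(\mathbf{WQSym}^*)_+$, $\langle p_1,\dots,p_{n-1};p_n\rangle=\sum_{i=0}^{n-1}(-1)^{n-1-i}\,(p_1\prec(p_2\prec(\cdots\prec p_i)\cdots))\succ p_n\prec((\cdots(p_{i+1}\succ p_{i+2})\succ\cdots)\succ p_{n-1})$, where for $i=0$ the left factor and "$\succ$" are omitted and for $i=n-1$ the right factor and "$\prec$" are omitted (the expression is unambiguous since $(a\succ b)\prec c=a\succ(b\prec c)$). Biplane trees: recursively $\mathrm{Node}(x,f_\ell,f_r)$ with root label $x$ and ordered (possibly empty) lists $f_\ell,f_r$ of trees; forests are ordered lists of trees.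 Red-packed trees are labeled by nonempty finite sets $I=\{i_1<\dots<i_p\}$ of positive integers; weight $\omega(\mathrm{Node}(I,f_\ell,f_r))=|I|+$ weights of all trees in $f_\ell,f_r$ (forest weight = sum). $\mathrm{Node}(I,[\ell_1..\ell_g],[r_1..r_d])$ is red-packed if all $\ell_j,r_j$ are red-packed and either ($d=0$, $I=\{1,\dots,p\}$) or ($d\ge1$, $1\le i_1\le\omega(r_1)$, $1\le p+\sum_j\omega(r_j)+1-i_p\le\omega(r_d)$). Red-packed forest: list of red-packed trees. Definition of $\mathbb{P}$: $\mathbb{P}_{[]}=\mathbb{R}_\varepsilon$; $\mathbb{P}_{[t_1,\dots,t_k]}=\mathbb{P}_{t_k}\prec(\mathbb{P}_{t_{k-1}}\prec(\cdots\prec\mathbb{P}_{t_1})\cdots)$ for $k\ge1$; $\mathbb{P}_{\mathrm{Node}(I,[],f_r)}=\Phi_I(\mathbb{P}_{f_r})$; and for $g\ge1$, $\mathbb{P}_{\mathrm{Node}(I,[\ell_1,\dots,\ell_g],f_r)}=\langle\mathbb{P}_{\ell_1},\dots,\mathbb{P}_{\ell_g};\mathbb{P}_{\mathrm{Node}(I,[],f_r)}\rangle$. -}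

module Defs where

open import Level using (Level) renaming (suc to lsuc; _⊔_ to _⊔ℓ_)
open import Algebra.Bundles using (CommutativeRing)
open import Data.Bool using (Bool; true; false; not; _∧_; if_then_else_)
open import Data.Nat using (ℕ; zero; suc; _+_; _∸_; _≤_; _<_; _≟_; _≤?_; _⊔_; _≡ᵇ_)
open import Data.List using (List; []; _∷_; _++_; map; foldr; foldl; concatMap; filter; length; take; drop; upTo; deduplicate; last; _∷ʳ_)
open import Data.Bool.ListAction using (all; any)
import Data.List.Properties as LP
import Data.Maybe.Properties as MP
open import Data.Maybe using (Maybe; just; nothing; maybe)
import Data.Maybe
import Data.Bool
open import Data.Product using (_×_; _,_; proj₁; proj₂; Σ; ∃; ∃-syntax)
open import Data.List.Relation.Unary.All using (All)
open import Data.List.Relation.Unary.Linked using (Linked)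
open import Data.List.Relation.Unary.Unique.Propositional using (Unique)
open import Data.List.Membership.Propositional using (_∈_)
open import Relation.Nullary using (¬_; Dec; yes; no)
open import Relation.Nullary.Decidable using (⌊_⌋)
open import Relation.Binary.PropositionalEquality using (_≡_)

record Field (c ℓ : Level) : Set (lsuc (c ⊔ℓ ℓ)) where
  field
    commutativeRing : CommutativeRing c ℓ
  open CommutativeRing commutativeRing public
  field
    0≉1 : ¬ (0# ≈ 1#)
    inverse : ∀ x → ¬ (x ≈ 0#) → ∃[ y ] (x * y ≈ 1#)

Word : Set
Word = List ℕ

maxW : Word → ℕ
maxW = foldr _⊔_ 0

shift : ℕ → Word → Word
shift k = map (k +_)

memb : ℕ → Word → Bool
memb a = any (λ b → ⌊ b ≟ a ⌋)

Packed : Word → Set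
Packed w = All (λ a → 1 ≤ a) w × (∀ j → 1 ≤ j → j ≤ maxW w → j ∈ w)

PW : ℕ → Word → Set
PW n w = Packed w × length w ≡ n

pack : Word → Word
pack w = map (λ a → length (deduplicate _≟_ (filter (λ b → b ≤? a) w))) w

shuffles : Word → Word → List Word
shuffles [] v = v ∷ []
shuffles (a ∷ u) [] = (a ∷ u) ∷ []
shuffles (a ∷ u) (b ∷ v) = map (a ∷_) (shuffles u (b ∷ v)) ++ map (b ∷_) (shuffles (a ∷ u) v)

_≟M_ : (x y : Maybe ℕ) → Dec (x ≡ y)
_≟M_ = MP.≡-dec _≟_

_≟W_ : (x y : Word) → Dec (x ≡ y)
_≟W_ = LP.≡-dec _≟_

precW : Word → Word → List Word
precW u v = filter (λ w → last w ≟M last u) (shuffles u (shift (maxW u) v))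

succW : Word → Word → List Word
succW u v = filter (λ w → last w ≟M last (shift (maxW u) v)) (shuffles u (shift (maxW u) v))

-- φ_I(w): positions are counted from k; m is the inserted letter max(w)+1.
-- Returns nothing when the condition i_p ≤ n + p fails.
phiGo : ℕ → ℕ → List ℕ → Word → Maybe Word
phiGo m k [] w = just w
phiGo m k (i ∷ I) [] =
  if i ≡ᵇ k then Data.Maybe.map (m ∷_) (phiGo m (suc k) I []) else nothing
phiGo m k (i ∷ I) (a ∷ w) =
  if i ≡ᵇ k then Data.Maybe.map (m ∷_) (phiGo m (suc k) I (a ∷ w))
            else Data.Maybe.map (a ∷_) (phiGo m (suc k) (i ∷ I) w)

phiW : List ℕ → Word → Maybe Word
phiW I w = phiGo (suc (maxW w)) 1 I w

splits : Word → List (Word × Word)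
splits u = map (λ i → take i u , drop i u) (map suc (upTo (length u ∸ 1)))

disjointB : Word → Word → Bool
disjointB p s = all (λ a → not (memb a s)) p

data Tree : Set where
  node : List ℕ → List Tree → List Tree → Tree

Forest : Set
Forest = List Tree

mutual
  ω : Tree → ℕ
  ω (node I fl fr) = length I + ωF fl + ωF fr

  ωF : Forest → ℕ
  ωF [] = 0
  ωF (t ∷ ts) = ω t + ωF ts

lastOr : {A : Set} → A → List A → A
lastOr x [] = x
lastOr x (y ∷ ys) = lastOr y ys

-- a label: nonempty (enforced by the constructors below), strictly increasing
-- list of positive integers, i.e. a nonempty finite set {i_1 < ... < i_p}
IsLabel : List ℕ → Set
IsLabel I = Linked _<_ I × All (λ a → 1 ≤ a) I

data RedPacked : Tree → Set where
  rp-noRight : ∀ {i is ls} →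
    All RedPacked ls → IsLabel (i ∷ is) →
    (i ∷ is) ≡ map suc (upTo (length (i ∷ is))) →
    RedPacked (node (i ∷ is) ls [])
  rp-right : ∀ {i is ls r rs} →
    All RedPacked ls → All RedPacked (r ∷ rs) → IsLabel (i ∷ is) →
    1 ≤ i → i ≤ ω r →
    1 ≤ (length (i ∷ is) + ωF (r ∷ rs) + 1) ∸ lastOr i is →
    (length (i ∷ is) + ωF (r ∷ rs) + 1) ∸ lastOr i is ≤ ω (lastOr r rs) →
    RedPacked (node (i ∷ is) ls (r ∷ rs))

RedPackedForest : Forest → Set
RedPackedForest = All RedPacked

RootLeftEmpty : Tree → Set
RootLeftEmpty (node I fl fr) = fl ≡ []

-- WQSym* over a field: elements are finite formal sums Σ a R_w,
-- represented by lists of (coefficient, word); equality is equality of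
-- all coefficients.

module WQSym {c ℓ} (F : Field c ℓ) where
  open Field F using () renaming
    (Carrier to K; _≈_ to _≈K_; _+_ to _+K_; _*_ to _*K_; -_ to -K_; 0# to 0K; 1# to 1K)

  V : Set c
  V = List (K × Word)

  -- tensor square elements Σ a R_u ⊗ R_v
  V2 : Set c
  V2 = List (K × Word × Word)

  R : Word → V
  R w = (1K , w) ∷ []

  coeff : V → Word → K
  coeff x w = foldr (λ p acc → if ⌊ proj₂ p ≟W w ⌋ then proj₁ p +K acc else acc) 0K x

  coeff2 : V2 → Word → Word → K
  coeff2 x u v = foldr (λ p acc → if ⌊ proj₁ (proj₂ p) ≟W u ⌋ ∧ ⌊ proj₂ (proj₂ p) ≟W v ⌋
                                   then proj₁ p +K acc else acc) 0K x

  _≈V_ : V → V → Set ℓ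
  x ≈V y = ∀ w → coeff x w ≈K coeff y w

  IsZero2 : V2 → Set ℓ
  IsZero2 x = ∀ u v → coeff2 x u v ≈K 0K

  scale : K → V → V
  scale a = map (λ p → a *K proj₁ p , proj₂ p)

  bilin : (Word → Word → List Word) → V → V → V
  bilin op x y = concatMap (λ p → concatMap (λ q →
                   map (λ w → proj₁ p *K proj₁ q , w) (op (proj₂ p) (proj₂ q))) y) x

  _≺_ : V → V → V
  _≺_ = bilin precW

  _≻_ : V → V → V
  _≻_ = bilin succW

  infixr 6 _≺_
  infixl 6 _≻_

  Φ : List ℕ → V → V
  Φ I = concatMap (λ p → maybe (λ w′ → (proj₁ p , w′) ∷ []) [] (phiW I (proj₂ p)))

  -- Δ≺ and Δ≻ (the Boolean flag selects ≺ : max(u) in the left part)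
  ΔW : Bool → Word → List (Word × Word)
  ΔW b u = filter (λ s → (disjointB (proj₁ s) (proj₂ s) ∧ ⌊ memb (maxW u) (proj₁ s) Data.Bool.≟ b ⌋) Data.Bool.≟ true)
                  (splits u)

  Δ : Bool → V → V2
  Δ b = concatMap (λ p → map (λ s → proj₁ p , pack (proj₁ s) , pack (proj₂ s)) (ΔW b (proj₂ p)))

  Δ≺ Δ≻ : V → V2
  Δ≺ = Δ true
  Δ≻ = Δ false

  InDeg : ℕ → V → Set ℓ
  InDeg n x = ∀ w → ¬ PW n w → coeff x w ≈K 0K

  InWQSym : ℕ → V → Set ℓ
  InWQSym = InDeg

  InPrim : ℕ → V → Set ℓ
  InPrim n x = InDeg n x × IsZero2 (Δ≺ x ++ Δ≻ x)

  InTPrim : ℕ → V → Set ℓ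
  InTPrim n x = InDeg n x × IsZero2 (Δ≺ x) × IsZero2 (Δ≻ x)

  sgn : ℕ → K
  sgn zero = 1K
  sgn (suc k) = -K (sgn k)

  leftNest : List V → Maybe V
  leftNest [] = nothing
  leftNest (x ∷ xs) = just (go x xs)
    where go : V → List V → V
          go x [] = x
          go x (y ∷ ys) = x ≺ go y ys

  rightNest : List V → Maybe V
  rightNest [] = nothing
  rightNest (x ∷ xs) = just (foldl _≻_ x xs)

  braceTerm : List V → List V → V → V
  braceTerm ls rs q = withL (leftNest ls) (withR (rightNest rs))
    where withR : Maybe V → V
          withR nothing = q
          withR (just r) = q ≺ r
          withL : Maybe V → V → V
          withL nothing y = y
          withL (just l) y = l ≻ y

  brace : List V → V → V
  brace ps q = concatMap (λ i → scale (sgn (length ps ∸ i)) (braceTerm (take i ps) (drop i ps) q))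
                         (upTo (suc (length ps)))

  mutual
    ℙ : Tree → V
    ℙ (node I [] fr) = Φ I (ℙF fr)
    ℙ (node I (l ∷ ls) fr) = brace (ℙs (l ∷ ls)) (Φ I (ℙF fr))

    ℙs : List Tree → List V
    ℙs [] = []
    ℙs (t ∷ ts) = ℙ t ∷ ℙs ts

    ℙF : Forest → V
    ℙF [] = R []
    ℙF (t ∷ ts) = goF (ℙ t) ts

    goF : V → Forest → V
    goF acc [] = acc
    goF acc (t ∷ ts) = goF (ℙ t ≺ acc) ts

  lincomb : {X : Set} → (X → V) → List (K × X) → V
  lincomb e = concatMap (λ p → scale (proj₁ p) (e (proj₂ p)))

  IsBasis : {X : Set} → (Idx : X → Set) → (e : X → V) → (S : V → Set ℓ) → Set (c ⊔ℓ ℓ)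
  IsBasis {X} Idx e S =
    (∀ x → Idx x → S (e x)) ×
    (∀ (cs : List (K × X)) → All (λ p → Idx (proj₂ p)) cs → Unique (map proj₂ cs) →
       lincomb e cs ≈V [] → All (λ p → proj₁ p ≈K 0K) cs) ×
    (∀ v → S v → ∃[ cs ] (All (λ p → Idx (proj₂ p)) cs × lincomb e cs ≈V v))

{-# OPTIONS --safe #-}

-- Write Δ_c for the part of the coproduct with left factor of degree c, trivial cuts
-- included, and Δ≻_c, Δ≺_c for its halves; let n be the degree.
--
-- All elements from primitive ones: Δ_c of ℙF (f ++ [t]) = ℙ t ≺ ℙF f is ℙF f ⊗ ℙ t for
-- c = ω f and 0 for ω f < c < n; and if Δ_c′ x = 0 for all c < c′ < n, then the right
-- factors of Δ_c x are primitive by coassociativity. Subtracting leading components one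
-- after the other gives the spanning property, comparing them gives independence.
--
-- Primitive elements from totally primitive ones: the same argument with Δ≻. The leading
-- component of the brace ⟨ls ; t⟩ is ℙF (reverse ls) ⊗ ℙ t, and the right factors of the
-- leading component of a primitive x are totally primitive because Δ≺ x = - Δ≻ x on
-- nontrivial cuts. Braces are primitive because the dendriform axioms give
-- Σ_i (-1)^i (p₁ ≺ (⋯ ≺ p_i)) · ((p_{i+1} ≻ ⋯) ≻ p_g) = 0.
--
-- Totally primitive elements from lower degrees: removing the maximal letters writes x
-- uniquely as Σ_I Φ_I x_I, and x is totally primitive iff Δ_c x_I = 0 for 1 ≤ c < i₁ and
-- for i_p - p ≤ c < deg x_I. As ℙF f deconcatenates along f, this selects exactly the
-- right forests allowed in a red-packed tree with root label I.
module Submission where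

open import Defs
open import Algebra.Bundles using (CommutativeMonoid)
open import Data.Bool using (Bool; true; false; not; _∧_; if_then_else_) renaming (_≟_ to _≟ᵇ_)
open import Data.Bool.Properties using (¬-not; ∧-assoc; ∧-identityʳ)
open import Data.Empty using (⊥; ⊥-elim)
open import Data.List using (List; []; _∷_; _++_; map; filter; length; deduplicate; last; upTo; applyUpTo; concatMap; _∷ʳ_; reverse; foldl; take; drop)
open import Data.List.Membership.Propositional using (_∈_; _∉_)
open import Data.List.Membership.Propositional.Properties using (∈-map⁺; ∈-map⁻; ∈-++⁺ˡ; ∈-++⁺ʳ; ∈-++⁻; ∈-filter⁺; ∈-filter⁻; ∈-deduplicate⁺; ∈-deduplicate⁻; ∈-concatMap⁺; ∈-upTo⁺)
open import Data.List.Properties using (length-map; map-∘; map-++; map-cong; map-cong-local; map-id; ++-assoc; ++-identityʳ; length-++; filter-++; filter-accept; filter-reject; map-upTo; unfold-reverse; length-drop; foldl-++; reverse-involutive; take-map; drop-map; take++drop≡id; ∷-injectiveˡ; ∷-injectiveʳ; ∷-injective; drop-all; upTo-∷ʳ)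
open import Data.List.Relation.Binary.Permutation.Propositional using (_↭_; ↭-refl; ↭-sym; ↭-trans; prep; ↭-reflexive)
open import Data.List.Relation.Binary.Permutation.Propositional.Properties using (∈-resp-↭; All-resp-↭; ↭-length; ↭-reverse) renaming (shift to ↭-shift)
open import Data.List.Relation.Unary.All as All using (All; []; _∷_; all?)
open import Data.List.Relation.Unary.Any as Any using (here; there)
open import Data.List.Relation.Unary.Linked using (Linked; []; [-]; _∷_)
open import Data.List.Relation.Unary.Unique.Propositional using (Unique; []; _∷_)
open import Data.List.Relation.Unary.Unique.Propositional.Properties using (upTo⁺)
open import Data.List.Reverse using (Reverse; reverseView; []; _∶_∶ʳ_)
open import Data.Maybe as Maybe using (Maybe; just; nothing; maybe)
open import Data.Maybe.Properties using (just-injective)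
open import Data.Nat using (_≤′_; ≤′-refl; ≤′-step; ℕ; zero; suc; _+_; _∸_; _≤_; _<_; _⊔_; z≤n; s≤s; _≟_; _≤?_; _≡ᵇ_; _<?_)
open import Data.Nat.Induction using (<-rec)
open import Data.Nat.Properties as ℕ using (≤-refl; ≤-trans; ≤-antisym; <⇒≤; +-suc)
open import Data.Product using (_×_; _,_; proj₁; proj₂; ∃-syntax; Σ-syntax)
open import Data.Product.Properties using () renaming (≡-dec to ×-≡-dec)
open import Data.Sum using (_⊎_; inj₁; inj₂)
open import Data.Unit using (⊤; tt)
open import Data.Unit.Polymorphic using () renaming (⊤ to ⊤ₚ; tt to ttₚ)
open import Level using (Level) renaming (_⊔_ to _⊔ˡ_; suc to lsuc)
open import Relation.Binary using (tri<; tri≈; tri>; DecidableEquality)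
open import Relation.Binary.PropositionalEquality as ≡ using (_≡_; refl; sym; trans; cong; cong₂; subst; _≢_; module ≡-Reasoning)
open import Relation.Nullary using (¬_; Dec; yes; no)
open import Relation.Nullary.Decidable using (⌊_⌋; _×-dec_)
import Data.List.Membership.DecPropositional as DecMem
import Data.List.Relation.Unary.All.Properties as Allₚ
import Data.List.Relation.Unary.Unique.DecPropositional.Properties as Uniqueₚ

-- Elements are only ever tested against functions `f` on words, through `⟪ x , f ⟫`; a coproduct
-- enters as its transpose `cop χ f`, a tensor as a form on functions of two words. Neither tensor
-- products nor the quotient by equal coefficients have to be built. Equality in `K` is not assumed
-- decidable, so zero terms cannot be discarded and no highest term with nonzero coefficient can be
-- chosen: cancellation is always the vanishing of collected coefficients, and `vanish` turns it
-- into the vanishing of sums.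
--
-- The three assertions depend on each other across degrees: forests of smaller weights yield the
-- trees with empty left root forest, these yield all trees, and these yield the forests of weight
-- `n`. The last two passages are instances of one triangularity argument, `FilteredFamily`.
--
-- Trivial cuts are kept because with them `ℙF f` has the plain deconcatenation of `f` as coproduct
-- and coassociativity needs no correction terms. The price is paid at products: the formula for the
-- coproduct of a half-product misses the cut with empty right part, whence the recurring hypothesis
-- `f p [] ≈ 0#` and the function `strip`.

private variable
  a b : Level
  A B : Set a

-- Boolean reflection

true≢false : true ≢ false
true≢false ()

bool-ext : ∀ {b c : Bool} → (b ≡ true → c ≡ true) → (c ≡ true → b ≡ true) → b ≡ c
bool-ext {true} {c} f g = sym (f refl)
bool-ext {false} {true} f g = g refl
bool-ext {false} {false} f g = refl

∧-split : ∀ b {c} → b ∧ c ≡ true → b ≡ true × c ≡ true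
∧-split true e = refl , e
∧-split false ()

∧-join : ∀ {b c} → b ≡ true → c ≡ true → b ∧ c ≡ true
∧-join refl refl = refl

memb⇒∈ : ∀ {a} w → memb a w ≡ true → a ∈ w
memb⇒∈ {a} (b ∷ w) e with b ≟ a
... | yes refl = here refl
... | no _ = there (memb⇒∈ w e)

∈⇒memb : ∀ {a w} → a ∈ w → memb a w ≡ true
∈⇒memb {a} {b ∷ w} i with b ≟ a
∈⇒memb {a} {b ∷ w} i | yes _ = refl
∈⇒memb {a} {b ∷ w} (here e) | no n = ⊥-elim (n (sym e))
∈⇒memb {a} {b ∷ w} (there i) | no _ = ∈⇒memb i

∉⇒memb : ∀ {a w} → a ∉ w → memb a w ≡ false
∉⇒memb {w = w} n = ¬-not (λ e → n (memb⇒∈ w e))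

memb⇒∉ : ∀ {a w} → memb a w ≡ false → a ∉ w
memb⇒∉ e i = true≢false (trans (sym (∈⇒memb i)) e)

memb-ext : ∀ {a b} v w → (a ∈ v → b ∈ w) → (b ∈ w → a ∈ v) → memb a v ≡ memb b w
memb-ext v w f g = bool-ext (λ e → ∈⇒memb (f (memb⇒∈ v e))) (λ e → ∈⇒memb (g (memb⇒∈ w e)))

Disjoint : Word → Word → Set
Disjoint p s = ∀ {a} → a ∈ p → a ∉ s

disjointB⇒ : ∀ p s → disjointB p s ≡ true → Disjoint p s
disjointB⇒ (x ∷ p) s e i j with memb x s in eq
disjointB⇒ (x ∷ p) s e (here refl) j | false = memb⇒∉ eq j
disjointB⇒ (x ∷ p) s e (there i) j | false = disjointB⇒ p s e i j

⇒disjointB : ∀ p s → Disjoint p s → disjointB p s ≡ true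
⇒disjointB [] s d = refl
⇒disjointB (x ∷ p) s d rewrite ∉⇒memb (d (here refl)) = ⇒disjointB p s (λ i → d (there i))

disjointB-ext : ∀ {p s p′ s′} → (Disjoint p s → Disjoint p′ s′) → (Disjoint p′ s′ → Disjoint p s) →
                disjointB p s ≡ disjointB p′ s′
disjointB-ext {p} {s} {p′} {s′} f g =
  bool-ext (λ e → ⇒disjointB p′ s′ (f (disjointB⇒ p s e))) (λ e → ⇒disjointB p s (g (disjointB⇒ p′ s′ e)))

-- Maximal letters

≤maxW : ∀ w → All (_≤ maxW w) w
≤maxW [] = []
≤maxW (a ∷ w) = ℕ.m≤m⊔n a _ ∷ All.map (λ p → ≤-trans p (ℕ.m≤n⊔m a _)) (≤maxW w)

maxW-lub : ∀ {M w} → All (_≤ M) w → maxW w ≤ M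
maxW-lub [] = z≤n
maxW-lub (p ∷ ps) = ℕ.⊔-lub p (maxW-lub ps)

maxW-∈ : ∀ a w → maxW (a ∷ w) ∈ a ∷ w
maxW-∈ a [] = here (ℕ.⊔-identityʳ a)
maxW-∈ a (b ∷ w) with ℕ.⊔-sel a (maxW (b ∷ w))
... | inj₁ e = here e
... | inj₂ e = there (subst (_∈ b ∷ w) (sym e) (maxW-∈ b w))

maxW-++ : ∀ u v → maxW (u ++ v) ≡ maxW u ⊔ maxW v
maxW-++ [] v = refl
maxW-++ (a ∷ u) v = trans (cong (a ⊔_) (maxW-++ u v)) (sym (ℕ.⊔-assoc a _ _))

maxW-shift : ∀ k v → k ⊔ maxW (shift k v) ≡ k + maxW v
maxW-shift k [] = trans (ℕ.⊔-identityʳ k) (sym (ℕ.+-identityʳ k))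
maxW-shift k (a ∷ v) = begin
  k ⊔ ((k + a) ⊔ maxW (shift k v)) ≡⟨ ℕ.⊔-assoc k (k + a) _ ⟨
  (k ⊔ (k + a)) ⊔ maxW (shift k v) ≡⟨ cong (_⊔ _) (ℕ.⊔-comm k (k + a)) ⟩
  ((k + a) ⊔ k) ⊔ maxW (shift k v) ≡⟨ ℕ.⊔-assoc (k + a) k _ ⟩
  (k + a) ⊔ (k ⊔ maxW (shift k v)) ≡⟨ cong ((k + a) ⊔_) (maxW-shift k v) ⟩
  (k + a) ⊔ (k + maxW v) ≡⟨ ℕ.+-distribˡ-⊔ k a (maxW v) ⟨
  k + (a ⊔ maxW v) ∎
  where open ≡-Reasoning

maxW-ext : ∀ {v w} → (∀ {a} → a ∈ v → a ∈ w) → (∀ {a} → a ∈ w → a ∈ v) → maxW v ≡ maxW w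
maxW-ext f g = ≤-antisym (maxW-lub (All.tabulate (λ i → All.lookup (≤maxW _) (f i))))
                         (maxW-lub (All.tabulate (λ i → All.lookup (≤maxW _) (g i))))

maxW-↭ : ∀ {v w} → v ↭ w → maxW v ≡ maxW w
maxW-↭ p = maxW-ext (∈-resp-↭ p) (∈-resp-↭ (↭-sym p))

maxW-product : ∀ u v {w} → w ↭ u ++ shift (maxW u) v → maxW w ≡ maxW u + maxW v
maxW-product u v p = trans (maxW-↭ p) (trans (maxW-++ u _) (maxW-shift (maxW u) v))

maxW-map : ∀ (ρ : ℕ → ℕ) a w → (∀ {x y} → x ≤ y → ρ x ≤ ρ y) → maxW (map ρ (a ∷ w)) ≡ ρ (maxW (a ∷ w))
maxW-map ρ a w mono = ≤-antisym
  (maxW-lub (Allₚ.map⁺ (All.map mono (≤maxW (a ∷ w)))))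
  (All.lookup (≤maxW _) (∈-map⁺ ρ (maxW-∈ a w)))

-- Ranks of letters and standardisation

Pos : Word → Set
Pos = All (1 ≤_)

b2n : Bool → ℕ
b2n true = 1
b2n false = 0

-- Only positive letters are counted: cnt w 0 = 0 even if 0 occurs in w.
cnt : Word → ℕ → ℕ
cnt w zero = 0
cnt w (suc a) = cnt w a + b2n (memb (suc a) w)

cnt-ext : ∀ {v w} a → (∀ j → 1 ≤ j → j ≤ a → memb j v ≡ memb j w) → cnt v a ≡ cnt w a
cnt-ext zero f = refl
cnt-ext (suc a) f = cong₂ _+_ (cnt-ext a (λ j p q → f j p (ℕ.m≤n⇒m≤1+n q)))
    (cong b2n (f (suc a) (s≤s z≤n) ≤-refl))

cnt-suc-∈ : ∀ {a w} → suc a ∈ w → cnt w (suc a) ≡ suc (cnt w a)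
cnt-suc-∈ {a} {w} i rewrite ∈⇒memb i = ℕ.+-comm (cnt w a) 1

cnt-suc-∉ : ∀ {a w} → suc a ∉ w → cnt w (suc a) ≡ cnt w a
cnt-suc-∉ {a} {w} n rewrite ∉⇒memb n = ℕ.+-identityʳ (cnt w a)

cnt-[] : ∀ a → cnt [] a ≡ 0
cnt-[] zero = refl
cnt-[] (suc a) = trans (ℕ.+-identityʳ _) (cnt-[] a)

cnt-mono : ∀ w {a b} → a ≤ b → cnt w a ≤ cnt w b
cnt-mono w {a} {b} p = go b (ℕ.≤⇒≤′ p)
  where
    go : ∀ b → a ≤′ b → cnt w a ≤ cnt w b
    go b ≤′-refl = ≤-refl
    go (suc b) (≤′-step q) = ≤-trans (go b q) (ℕ.m≤m+n _ _)

cnt-strict : ∀ {w a b} → a < b → b ∈ w → cnt w a < cnt w b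
cnt-strict {w} {a} {suc b} (s≤s p) i = subst (cnt w a <_) (sym (cnt-suc-∈ i)) (s≤s (cnt-mono w p))

cnt-injective : ∀ {w a b} → a ∈ w → b ∈ w → cnt w a ≡ cnt w b → a ≡ b
cnt-injective {w} {a} {b} i j e with ℕ.<-cmp a b
... | tri< p _ _ = ⊥-elim (ℕ.<⇒≢ (cnt-strict p j) e)
... | tri≈ _ p _ = p
... | tri> _ _ p = ⊥-elim (ℕ.<⇒≢ (cnt-strict p i) (sym e))

cnt-∷-above : ∀ {x w} a → a < x → cnt (x ∷ w) a ≡ cnt w a
cnt-∷-above {x} {w} a p = cnt-ext a (λ j _ q → memb-ext (x ∷ w) w
  (λ { (here e) → ⊥-elim (ℕ.<⇒≢ (ℕ.≤-<-trans q p) e) ; (there i) → i }) there)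

cnt-∷-fresh : ∀ {x w} a → x ∉ w → 1 ≤ x → x ≤ a → cnt (x ∷ w) a ≡ suc (cnt w a)
cnt-∷-fresh zero n (s≤s _) ()
cnt-∷-fresh {x} {w} (suc a) n p q with x ≟ suc a
... | yes refl = trans (cong (_+ 1) (cnt-∷-above a ≤-refl))
                       (trans (ℕ.+-comm _ 1) (cong suc (sym (cnt-suc-∉ n))))
... | no x≢ = cong₂ _+_ {u = b2n (memb (suc a) w)} (cnt-∷-fresh a n p (ℕ.≤-pred (ℕ.≤∧≢⇒< q x≢))) refl

length-unique : ∀ {w} a → Unique w → Pos w → All (_≤ a) w → length w ≡ cnt w a
length-unique a [] _ _ = sym (cnt-[] a)
length-unique a (f ∷ un) (p ∷ ps) (q ∷ qs) =
  trans (cong suc (length-unique a un ps qs)) (sym (cnt-∷-fresh a (λ i → All.lookup f i refl) p q))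

-- `pack` counts a list without repetitions, `cnt` sums membership bits up to a bound. The second
-- form depends only on the set of letters and allows induction on the bound.
rank≡cnt : ∀ {w} a → Pos w → length (deduplicate _≟_ (filter (_≤? a) w)) ≡ cnt w a
rank≡cnt {w} a ps = trans (length-unique a (Uniqueₚ.deduplicate-! _≟_ l) positive bound) (cnt-ext a same)
  where
    l : Word
    l = filter (_≤? a) w
    mem : ∀ {j} → j ∈ deduplicate _≟_ l → j ∈ w × j ≤ a
    mem i = ∈-filter⁻ (_≤? a) (∈-deduplicate⁻ _≟_ l i)
    positive : Pos (deduplicate _≟_ l)
    positive = All.tabulate (λ i → All.lookup ps (proj₁ (mem i)))
    bound : All (_≤ a) (deduplicate _≟_ l)
    bound = All.tabulate (λ i → proj₂ (mem i))
    same : ∀ j → 1 ≤ j → j ≤ a → memb j (deduplicate _≟_ l) ≡ memb j w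
    same j _ q = memb-ext (deduplicate _≟_ l) w (λ i → proj₁ (mem i))
        (λ i → ∈-deduplicate⁺ _≟_ (∈-filter⁺ (_≤? a) i q))

pack≡ : ∀ {w} → Pos w → pack w ≡ map (cnt w) w
pack≡ {w} ps = map-cong (λ a → rank≡cnt a ps) w

cnt-packed : ∀ {w} → Packed w → ∀ a → a ≤ maxW w → cnt w a ≡ a
cnt-packed pk zero p = refl
cnt-packed pk (suc a) p = trans (cnt-suc-∈ (proj₂ pk (suc a) (s≤s z≤n) p))
    (cong suc (cnt-packed pk a (<⇒≤ p)))

pack-packed : ∀ {w} → Packed w → pack w ≡ w
pack-packed {w} pk = trans (pack≡ (proj₁ pk))
  (trans (map-cong-local (All.map (λ {a} → cnt-packed pk a) (≤maxW w))) (map-id w))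

cnt-bounded : ∀ {w M} → All (_≤ M) w → cnt w M ≡ cnt w (maxW w)
cnt-bounded {w} {zero} b rewrite ℕ.n≤0⇒n≡0 (maxW-lub b) = refl
cnt-bounded {w} {suc M} b with maxW w ≟ suc M
... | yes e = cong (cnt w) (sym e)
... | no n = trans (cnt-suc-∉ notin) (cnt-bounded (All.tabulate
    (λ i → ≤-trans (All.lookup (≤maxW w) i) below)))
  where
    below : maxW w ≤ M
    below = ℕ.≤-pred (ℕ.≤∧≢⇒< (maxW-lub b) n)
    notin : suc M ∉ w
    notin i = ℕ.<⇒≱ (s≤s below) (All.lookup (≤maxW w) i)

maxW-pack : ∀ {w M} → Pos w → All (_≤ M) w → maxW (pack w) ≡ cnt w M
maxW-pack {[]} {M} ps b = sym (cnt-[] M)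
maxW-pack {a ∷ w} ps b = trans (cong maxW (pack≡ ps))
  (trans (maxW-map (cnt (a ∷ w)) a w (cnt-mono (a ∷ w))) (sym (cnt-bounded b)))

cnt-surjective : ∀ w a j → 1 ≤ j → j ≤ cnt w a → ∃[ b ] (b ∈ w × cnt w b ≡ j)
cnt-surjective w zero j (s≤s _) ()
cnt-surjective w (suc a) j p q with memb (suc a) w in eq
... | false = cnt-surjective w a j p (subst (j ≤_) (ℕ.+-identityʳ _) q)
... | true with j ≤? cnt w a
... | yes r = cnt-surjective w a j p r
... | no r = suc a , i , trans (cnt-suc-∈ i) (≤-antisym (ℕ.≰⇒> r) (subst (j ≤_) (ℕ.+-comm (cnt w a) 1) q))
  where
    i : suc a ∈ w
    i = memb⇒∈ w eq

cnt-pos : ∀ {w a} → 1 ≤ a → a ∈ w → 1 ≤ cnt w a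
cnt-pos {w} p i = ≤-trans (s≤s z≤n) (cnt-strict {w} {0} p i)

Packed-pack : ∀ {w} → Pos w → Packed (pack w)
Packed-pack {w} ps = subst Pos (sym (pack≡ ps)) (Allₚ.map⁺
    (All.tabulate (λ i → cnt-pos (All.lookup ps i) i))) , onto
  where
    onto : ∀ j → 1 ≤ j → j ≤ maxW (pack w) → j ∈ pack w
    onto j p q with cnt-surjective w (maxW w) j p (subst (j ≤_) (maxW-pack ps (≤maxW w)) q)
    ... | b , i , refl = subst (cnt w b ∈_) (sym (pack≡ ps)) (∈-map⁺ (cnt w) i)

length-pack : ∀ w → length (pack w) ≡ length w
length-pack w = length-map _ w

pack-≢[] : ∀ w → w ≢ [] → pack w ≢ []
pack-≢[] [] n = ⊥-elim (n refl)
pack-≢[] (_ ∷ _) n ()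

_⊆ʷ_ : Word → Word → Set
x ⊆ʷ y = ∀ {a} → a ∈ x → a ∈ y

∈-map-cnt⁻ : ∀ {x y a} → x ⊆ʷ y → a ∈ y → cnt y a ∈ map (cnt y) x → a ∈ x
∈-map-cnt⁻ {x} {y} sub i j with ∈-map⁻ (cnt y) j
... | b , k , e = subst (_∈ x) (sym (cnt-injective i (sub k) e)) k

-- A letter of `y` missing from `x` raises neither rank in `x`, and one lying in `x` raises both.
-- Hence a factor may be packed after the whole word has been packed, which coassociativity
-- requires.
cnt-cnt : ∀ {x y} → x ⊆ʷ y → ∀ a → cnt (map (cnt y) x) (cnt y a) ≡ cnt x a
cnt-cnt sub zero = refl
cnt-cnt {x} {y} sub (suc a) with memb (suc a) y in eq
... | false = trans (cong (cnt (map (cnt y) x)) (ℕ.+-identityʳ (cnt y a)))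
                    (trans (cnt-cnt sub a) (sym (cnt-suc-∉ (λ i → memb⇒∉ eq (sub i)))))
... | true = trans (cong (cnt (map (cnt y) x)) (ℕ.+-comm (cnt y a) 1))
                   (cong₂ _+_ (cnt-cnt sub a) (cong b2n (memb-ext (map (cnt y) x) x fwd bwd)))
  where
    i : suc a ∈ y
    i = memb⇒∈ y eq
    fwd : suc (cnt y a) ∈ map (cnt y) x → suc a ∈ x
    fwd j = ∈-map-cnt⁻ sub i (subst (_∈ map (cnt y) x) (sym (cnt-suc-∈ i)) j)
    bwd : suc a ∈ x → suc (cnt y a) ∈ map (cnt y) x
    bwd j = subst (_∈ map (cnt y) x) (cnt-suc-∈ i) (∈-map⁺ (cnt y) j)

Pos-⊆ : ∀ {x y} → x ⊆ʷ y → Pos y → Pos x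
Pos-⊆ sub ps = All.tabulate (λ i → All.lookup ps (sub i))

pack-map-cnt : ∀ {x y} → Pos y → x ⊆ʷ y → pack (map (cnt y) x) ≡ pack x
pack-map-cnt {x} {y} ps sub = begin
  pack (map (cnt y) x) ≡⟨ pack≡ (Allₚ.map⁺ (All.tabulate (λ i → cnt-pos (All.lookup ps (sub i)) (sub i)))) ⟩
  map (cnt (map (cnt y) x)) (map (cnt y) x) ≡⟨ map-∘ x ⟨
  map (λ a → cnt (map (cnt y) x) (cnt y a)) x ≡⟨ map-cong (cnt-cnt sub) x ⟩
  map (cnt x) x ≡⟨ pack≡ (Pos-⊆ sub ps) ⟨
  pack x ∎
  where open ≡-Reasoning

disjointB-map-cnt : ∀ {y} a b → a ⊆ʷ y → b ⊆ʷ y → disjointB (map (cnt y) a) (map (cnt y) b) ≡ disjointB a b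
disjointB-map-cnt {y} a b sa sb = disjointB-ext
  (λ d i j → d (∈-map⁺ (cnt y) i) (∈-map⁺ (cnt y) j))
  (λ d i j → case-map d i j)
  where
    case-map : Disjoint a b → Disjoint (map (cnt y) a) (map (cnt y) b)
    case-map d i j with ∈-map⁻ (cnt y) i
    ... | x , k , refl = d k (∈-map-cnt⁻ sb (sa k) j)

-- pack of a word whose letters are those of u and of the shift of v

cnt-low : ∀ {w u v M} a → Pos v → w ⊆ʷ (u ++ shift M v) → (u ++ shift M v) ⊆ʷ w → a ≤ M → cnt w a ≡ cnt u a
cnt-low {w} {u} {v} {M} a ps f g p = cnt-ext a λ j _ q → memb-ext w u (to j q) (λ i → g (∈-++⁺ˡ i))
  where
    to : ∀ j → j ≤ a → j ∈ w → j ∈ u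
    to j q i with ∈-++⁻ u (f i)
    ... | inj₁ k = k
    ... | inj₂ k with ∈-map⁻ (M +_) k
    ... | b , r , refl = ⊥-elim (ℕ.<⇒≱ (ℕ.m<m+n M (All.lookup ps r)) (≤-trans q p))

cnt-high : ∀ {w u v M} j → Pos v → All (_≤ M) u → w ⊆ʷ (u ++ shift M v) → (u ++ shift M v) ⊆ʷ w →
           cnt w (M + j) ≡ cnt u M + cnt v j
cnt-high {w} {u} {v} {M} zero ps b f g =
  trans (cong (cnt w) (ℕ.+-identityʳ M)) (trans (cnt-low M ps f g ≤-refl) (sym (ℕ.+-identityʳ _)))
cnt-high {w} {u} {v} {M} (suc j) ps b f g = begin
  cnt w (M + suc j) ≡⟨ cong (cnt w) (+-suc M j) ⟩
  cnt w (M + j) + b2n (memb (suc (M + j)) w) ≡⟨ cong₂ _+_ (cnt-high j ps b f g)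
      (cong b2n (memb-ext w v to from)) ⟩
  cnt u M + cnt v j + b2n (memb (suc j) v) ≡⟨ ℕ.+-assoc (cnt u M) _ _ ⟩
  cnt u M + (cnt v j + b2n (memb (suc j) v)) ∎
  where
    open ≡-Reasoning
    to : suc (M + j) ∈ w → suc j ∈ v
    to i with ∈-++⁻ u (f i)
    ... | inj₁ k = ⊥-elim (ℕ.<⇒≱ (s≤s (ℕ.m≤m+n M j)) (All.lookup b k))
    ... | inj₂ k with ∈-map⁻ (M +_) k
    ... | c , r , e = subst (_∈ v) (sym (ℕ.+-cancelˡ-≡ M _ _ (trans (+-suc M j) e))) r
    from : suc j ∈ v → suc (M + j) ∈ w
    from i = g (∈-++⁺ʳ u (subst (_∈ shift M v) (+-suc M j) (∈-map⁺ (M +_) i)))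

map-cnt-low : ∀ {u v M} → Pos u → Pos v → All (_≤ M) u → map (cnt (u ++ shift M v)) u ≡ pack u
map-cnt-low {u} pu pv b = trans (map-cong-local (All.map (λ {a} → cnt-low a pv (λ i → i) (λ i → i)) b))
    (sym (pack≡ pu))

-- The letters of `u` occupy the first `maxW (pack u)` ranks, so standardising turns the shift by
-- `M` into the shift belonging to the packed factors. `M` is only a bound for `u`, because `u` will
-- be a part of a longer word with maximum `M`.
map-cnt-high : ∀ {u v M} → Pos u → Pos v → All (_≤ M) u →
               map (cnt (u ++ shift M v)) (shift M v) ≡ shift (maxW (pack u)) (pack v)
map-cnt-high {u} {v} {M} pu pv b = begin
  map (cnt (u ++ shift M v)) (shift M v) ≡⟨ map-∘ v ⟨
  map (λ j → cnt (u ++ shift M v) (M + j)) v ≡⟨ map-cong (λ j → cnt-high j pv b (λ i → i) (λ i → i)) v ⟩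
  map (λ j → cnt u M + cnt v j) v ≡⟨ cong (λ k → map (λ j → k + cnt v j) v) (maxW-pack pu b) ⟨
  map (λ j → maxW (pack u) + cnt v j) v ≡⟨ map-∘ v ⟩
  shift (maxW (pack u)) (map (cnt v) v) ≡⟨ cong (shift _) (pack≡ pv) ⟨
  shift (maxW (pack u)) (pack v) ∎
  where open ≡-Reasoning

cnt-same : ∀ {v w} → v ⊆ʷ w → w ⊆ʷ v → ∀ a → cnt v a ≡ cnt w a
cnt-same {v} {w} f g a = cnt-ext a (λ j _ _ → memb-ext v w f g)

pack-↭ : ∀ {v w} → Pos v → w ↭ v → pack w ≡ map (cnt v) w
pack-↭ {v} {w} ps p = trans (pack≡ (All-resp-↭ (↭-sym p) ps))
    (map-cong (cnt-same (∈-resp-↭ p) (∈-resp-↭ (↭-sym p))) w)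

-- The common bound `k` separates the letters of `u₁`, `u₂` from all shifted ones, so a letter
-- shared by the two sides is shared within the `u` parts or within the `v` parts.
disjointB-product : ∀ {k u₁ u₂ v₁ v₂ w₁ w₂} → All (_≤ k) u₁ → All (_≤ k) u₂ → Pos v₁ → Pos v₂ →
  w₁ ↭ u₁ ++ shift k v₁ → w₂ ↭ u₂ ++ shift k v₂ → disjointB w₁ w₂ ≡ disjointB u₁ u₂ ∧ disjointB v₁ v₂
disjointB-product {k} {u₁} {u₂} {v₁} {v₂} {w₁} {w₂} b₁ b₂ p₁ p₂ e₁ e₂ = bool-ext fwd bwd
  where
    low-high : ∀ {a u v} → All (_≤ k) u → Pos v → a ∈ u → a ∈ shift k v → ⊥
    low-high b p i j with ∈-map⁻ (k +_) j
    ... | c , r , refl = ℕ.<⇒≱ (ℕ.m<m+n k (All.lookup p r)) (All.lookup b i)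
    fwd : disjointB w₁ w₂ ≡ true → disjointB u₁ u₂ ∧ disjointB v₁ v₂ ≡ true
    fwd d = ∧-join
      (⇒disjointB u₁ u₂ (λ i j → D (∈-resp-↭ (↭-sym e₁) (∈-++⁺ˡ i)) (∈-resp-↭ (↭-sym e₂) (∈-++⁺ˡ j))))
      (⇒disjointB v₁ v₂ (λ i j → D (∈-resp-↭ (↭-sym e₁) (∈-++⁺ʳ u₁ (∈-map⁺ (k +_) i)))
                                   (∈-resp-↭ (↭-sym e₂) (∈-++⁺ʳ u₂ (∈-map⁺ (k +_) j)))))
      where
        D : Disjoint w₁ w₂
        D = disjointB⇒ w₁ w₂ d
    bwd : disjointB u₁ u₂ ∧ disjointB v₁ v₂ ≡ true → disjointB w₁ w₂ ≡ true
    bwd d with ∧-split (disjointB u₁ u₂) d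
    ... | du , dv = ⇒disjointB w₁ w₂ (λ i j → go (∈-++⁻ u₁ (∈-resp-↭ e₁ i)) (∈-++⁻ u₂ (∈-resp-↭ e₂ j)))
      where
        go : ∀ {a} → a ∈ u₁ ⊎ a ∈ shift k v₁ → a ∈ u₂ ⊎ a ∈ shift k v₂ → ⊥
        go (inj₁ i) (inj₁ j) = disjointB⇒ u₁ u₂ du i j
        go (inj₁ i) (inj₂ j) = low-high b₁ p₂ i j
        go (inj₂ i) (inj₁ j) = low-high b₂ p₁ j i
        go (inj₂ i) (inj₂ j) with ∈-map⁻ (k +_) i | ∈-map⁻ (k +_) j
        ... | a , r , refl | b , s , e with ℕ.+-cancelˡ-≡ k a b e
        ... | refl = disjointB⇒ v₁ v₂ dv r s

memb-max-product : ∀ {k M u₁ v₁ w₁} → All (_≤ k) u₁ → 1 ≤ M → w₁ ↭ u₁ ++ shift k v₁ →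
  memb (k + M) w₁ ≡ memb M v₁
memb-max-product {k} {M} {u₁} {v₁} {w₁} b p e = memb-ext w₁ v₁ to
    (λ i → ∈-resp-↭ (↭-sym e) (∈-++⁺ʳ u₁ (∈-map⁺ (k +_) i)))
  where
    to : k + M ∈ w₁ → M ∈ v₁
    to i with ∈-++⁻ u₁ (∈-resp-↭ e i)
    ... | inj₁ j = ⊥-elim (ℕ.<⇒≱ (ℕ.m<m+n k p) (All.lookup b j))
    ... | inj₂ j with ∈-map⁻ (k +_) j
    ... | c , r , eq = subst (_∈ v₁) (sym (ℕ.+-cancelˡ-≡ k M c eq)) r

∈⇒maxW-∈ : ∀ {a w} → a ∈ w → maxW w ∈ w
∈⇒maxW-∈ {w = x ∷ w} _ = maxW-∈ x w

maxW-pos : ∀ {v} → Pos v → v ≢ [] → 1 ≤ maxW v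
maxW-pos {[]} p n = ⊥-elim (n refl)
maxW-pos {a ∷ v} (p ∷ _) n = ≤-trans p (ℕ.m≤m⊔n a _)

maxW-⊆ : ∀ {a w} → a ⊆ʷ w → maxW w ∈ a → maxW a ≡ maxW w
maxW-⊆ {a} {w} f i = ≤-antisym (maxW-lub (All.tabulate (λ j → All.lookup (≤maxW w) (f j))))
    (All.lookup (≤maxW a) i)

memb-max-map-cnt : ∀ {y a} → a ⊆ʷ y → memb (maxW (map (cnt y) y)) (map (cnt y) a) ≡ memb (maxW y) a
memb-max-map-cnt {[]} {[]} f = refl
memb-max-map-cnt {[]} {x ∷ a} f with f (here refl)
... | ()
memb-max-map-cnt {b ∷ y} {a} f = trans (cong (λ n → memb n (map (cnt (b ∷ y)) a))
    (maxW-map (cnt (b ∷ y)) b y (cnt-mono (b ∷ y))))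
  (memb-ext (map (cnt (b ∷ y)) a) a (∈-map-cnt⁻ f (maxW-∈ b y)) (∈-map⁺ (cnt (b ∷ y))))

Packed-product : ∀ {u v w} → Packed u → Packed v → w ↭ u ++ shift (maxW u) v → Packed w
Packed-product {u} {v} {w} pu pv e =
  All-resp-↭ (↭-sym e) (Allₚ.++⁺ (proj₁ pu) (Allₚ.map⁺
      (All.map (λ p → ≤-trans p (ℕ.m≤n+m _ _)) (proj₁ pv)))) , onto
  where
    onto : ∀ j → 1 ≤ j → j ≤ maxW w → j ∈ w
    onto j p q with j ≤? maxW u
    ... | yes r = ∈-resp-↭ (↭-sym e) (∈-++⁺ˡ (proj₂ pu j p r))
    ... | no r = ∈-resp-↭ (↭-sym e) (∈-++⁺ʳ u (subst (_∈ shift (maxW u) v) eq (∈-map⁺ (maxW u +_)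
            (proj₂ pv (j ∸ maxW u) (ℕ.m<n⇒0<n∸m (ℕ.≰⇒> r))
                (ℕ.≤-trans (ℕ.∸-monoˡ-≤ (maxW u) (subst (j ≤_) (maxW-product u v e) q))
                (ℕ.≤-reflexive (ℕ.m+n∸m≡n (maxW u) _)))))))
      where
        eq : maxW u + (j ∸ maxW u) ≡ j
        eq = ℕ.m+[n∸m]≡n (<⇒≤ (ℕ.≰⇒> r))

⊆-++ˡ : ∀ {x y w : Word} → x ++ y ≡ w → x ⊆ʷ w
⊆-++ˡ refl = ∈-++⁺ˡ

⊆-++ʳ : ∀ {x y w : Word} → x ++ y ≡ w → y ⊆ʷ w
⊆-++ʳ {x} refl = ∈-++⁺ʳ x

All-⊆ : ∀ {p} {R : ℕ → Set p} {x y} → x ⊆ʷ y → All R y → All R x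
All-⊆ f a = All.tabulate (λ i → All.lookup a (f i))

-- Deconcatenations and half-shuffles of lists

decs : List A → List (List A × List A)
decs [] = ([] , []) ∷ []
decs (x ∷ u) = ([] , x ∷ u) ∷ map (λ p → x ∷ proj₁ p , proj₂ p) (decs u)

decs-++ : ∀ (u : List A) → All (λ p → proj₁ p ++ proj₂ p ≡ u) (decs u)
decs-++ [] = refl ∷ []
decs-++ (x ∷ u) = refl ∷ Allₚ.map⁺ (All.map (cong (x ∷_)) (decs-++ u))

-- Three families of shuffles obeying the same recursion: all shuffles (S), those
-- ending with the last letter of the left word (P), of the right word (Q).
data Mode : Set where
  S P Q : Mode

private
  -- Shuffles with an empty left (right) word; P and Q exclude the pair of empty words.
  edgeˡ edgeʳ : Mode → List A → List (List A)
  edgeˡ S v = v ∷ []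
  edgeˡ P v = []
  edgeˡ Q [] = []
  edgeˡ Q (y ∷ v) = (y ∷ v) ∷ []
  edgeʳ S u = u ∷ []
  edgeʳ P u = u ∷ []
  edgeʳ Q u = []

shuf : Mode → List A → List A → List (List A)
shuf m [] v = edgeˡ m v
shuf m (x ∷ u) [] = edgeʳ m (x ∷ u)
shuf m (x ∷ u) (y ∷ v) = map (x ∷_) (shuf m u (y ∷ v)) ++ map (y ∷_) (shuf m (x ∷ u) v)

shuf-↭ : ∀ m (u v : List A) → All (_↭ u ++ v) (shuf m u v)
shuf-↭ S [] v = ↭-refl ∷ []
shuf-↭ P [] v = []
shuf-↭ Q [] [] = []
shuf-↭ Q [] (y ∷ v) = ↭-refl ∷ []
shuf-↭ S (x ∷ u) [] = ↭-reflexive (sym (++-identityʳ (x ∷ u))) ∷ []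
shuf-↭ P (x ∷ u) [] = ↭-reflexive (sym (++-identityʳ (x ∷ u))) ∷ []
shuf-↭ Q (x ∷ u) [] = []
shuf-↭ m (x ∷ u) (y ∷ v) = Allₚ.++⁺
  (Allₚ.map⁺ (All.map (prep x) (shuf-↭ m u (y ∷ v))))
  (Allₚ.map⁺ (All.map (λ p → ↭-trans (prep y p) (↭-sym (↭-shift y (x ∷ u) v))) (shuf-↭ m (x ∷ u) v)))

shuf-map : ∀ (ρ : A → B) m u v → shuf m (map ρ u) (map ρ v) ≡ map (map ρ) (shuf m u v)
shuf-map ρ S [] v = refl
shuf-map ρ P [] v = refl
shuf-map ρ Q [] [] = refl
shuf-map ρ Q [] (y ∷ v) = refl
shuf-map ρ S (x ∷ u) [] = refl
shuf-map ρ P (x ∷ u) [] = refl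
shuf-map ρ Q (x ∷ u) [] = refl
shuf-map ρ m (x ∷ u) (y ∷ v) =
  trans (cong₂ _++_ (push x (shuf-map ρ m u (y ∷ v))) (push y (shuf-map ρ m (x ∷ u) v)))
        (sym (map-++ (map ρ) (map (x ∷_) (shuf m u (y ∷ v))) _))
  where
    push : ∀ z {k l} → k ≡ map (map ρ) l → map (ρ z ∷_) k ≡ map (map ρ) (map (z ∷_) l)
    push z {l = l} refl = trans (sym (map-∘ l)) (map-∘ l)

shuffles≡shuf : ∀ u v → shuffles u v ≡ shuf S u v
shuffles≡shuf [] v = refl
shuffles≡shuf (x ∷ u) [] = refl
shuffles≡shuf (x ∷ u) (y ∷ v) = cong₂ _++_ (cong (map (x ∷_)) (shuffles≡shuf u (y ∷ v)))
    (cong (map (y ∷_)) (shuffles≡shuf (x ∷ u) v))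

last-∈ : ∀ {z : A} w → last w ≡ just z → z ∈ w
last-∈ (x ∷ []) refl = here refl
last-∈ (x ∷ y ∷ w) e = there (last-∈ (y ∷ w) e)

last-∷ : ∀ (x : A) w → w ≢ [] → last (x ∷ w) ≡ last w
last-∷ x [] n = ⊥-elim (n refl)
last-∷ x (y ∷ w) n = refl

↭-∷≢[] : ∀ {x : A} {u w} → w ↭ x ∷ u → w ≢ []
↭-∷≢[] p refl with ↭-length p
... | ()

shuf-≢[] : ∀ m (u : List A) y v → All (_≢ []) (shuf m u (y ∷ v))
shuf-≢[] m u y v = All.map (λ p → ↭-∷≢[] (↭-trans p (↭-shift y u v))) (shuf-↭ m u (y ∷ v))

filter-last-map : ∀ x (l : List Word) z → All (_≢ []) l →
  filter (λ w → last w ≟M z) (map (x ∷_) l) ≡ map (x ∷_) (filter (λ w → last w ≟M z) l)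
filter-last-map x [] z [] = refl
filter-last-map x (w ∷ l) z (n ∷ ns) rewrite last-∷ x w n with last w ≟M z
... | yes _ = cong ((x ∷ w) ∷_) (filter-last-map x l z ns)
... | no _ = filter-last-map x l z ns

-- Connects the selection by last letter in `precW` with the recursion of mode `P`. Because `z` is
-- absent from `v`, the value of the last letter reveals the word it comes from; for a shifted right
-- word this absence is automatic.
filter-last-P : ∀ u v z → last u ≡ just z → z ∉ v → filter (λ w → last w ≟M just z) (shuf S u v) ≡ shuf P u v
filter-last-P (x ∷ u) [] z e n = filter-accept (λ w → last w ≟M just z) {xs = []} e
filter-last-P (x ∷ u) (y ∷ v) z e n =
  trans (filter-++ (λ w → last w ≟M just z) (map (x ∷_) (shuf S u (y ∷ v))) _) (cong₂ _++_
    (trans (filter-last-map x (shuf S u (y ∷ v)) (just z) (shuf-≢[] S u y v))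
        (cong (map (x ∷_)) (leftPart u e)))
    (trans (filter-last-map y (shuf S (x ∷ u) v) (just z) (All.map ↭-∷≢[] (shuf-↭ S (x ∷ u) v)))
           (cong (map (y ∷_)) (filter-last-P (x ∷ u) v z e (λ i → n (there i))))))
  where
    leftPart : ∀ u → last (x ∷ u) ≡ just z → filter (λ w → last w ≟M just z) (shuf S u (y ∷ v)) ≡ shuf P u
        (y ∷ v)
    leftPart [] e = filter-reject (λ w → last w ≟M just z) {y ∷ v} {[]} (λ q → n (last-∈ (y ∷ v) q))
    leftPart (x′ ∷ u) e = filter-last-P (x′ ∷ u) (y ∷ v) z e n

filter-last-Q : ∀ u v z → last v ≡ just z → z ∉ u → filter (λ w → last w ≟M just z) (shuf S u v) ≡ shuf Q u v
filter-last-Q [] (y ∷ v) z e n = filter-accept (λ w → last w ≟M just z) {xs = []} e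
filter-last-Q (x ∷ u) (y ∷ v) z e n =
  trans (filter-++ (λ w → last w ≟M just z) (map (x ∷_) (shuf S u (y ∷ v))) _) (cong₂ _++_
    (trans (filter-last-map x (shuf S u (y ∷ v)) (just z) (shuf-≢[] S u y v))
           (cong (map (x ∷_)) (filter-last-Q u (y ∷ v) z e (λ i → n (there i)))))
    (trans (filter-last-map y (shuf S (x ∷ u) v) (just z) (All.map ↭-∷≢[] (shuf-↭ S (x ∷ u) v)))
           (cong (map (y ∷_)) (rightPart v e))))
  where
    rightPart : ∀ v → last (y ∷ v) ≡ just z → filter (λ w → last w ≟M just z) (shuf S (x ∷ u) v) ≡ shuf Q
        (x ∷ u) v
    rightPart [] e = filter-reject (λ w → last w ≟M just z) {x ∷ u} {[]} (λ q → n (last-∈ (x ∷ u) q))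
    rightPart (y′ ∷ v) e = filter-last-Q (x ∷ u) (y′ ∷ v) z e n

-- Positions (counted from k) of the letter m, and the word without m

posFrom : ℕ → ℕ → Word → List ℕ
posFrom k m [] = []
posFrom k m (a ∷ W) with a ≟ m
... | yes _ = k ∷ posFrom (suc k) m W
... | no _ = posFrom (suc k) m W

del : ℕ → Word → Word
del m [] = []
del m (a ∷ W) with a ≟ m
... | yes _ = del m W
... | no _ = a ∷ del m W

-- Strictly increasing lists with entries at least `k`, in a recursive form that follows the
-- position counter of `posFrom` and `phiGo`.
Sorted : ℕ → List ℕ → Set
Sorted k [] = ⊤
Sorted k (i ∷ I) = k ≤ i × Sorted (suc i) I

Sorted-weaken : ∀ {k l I} → k ≤ l → Sorted l I → Sorted k I
Sorted-weaken {I = []} p s = tt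
Sorted-weaken {I = i ∷ I} p (q , s) = ≤-trans p q , s

posFrom-sorted : ∀ k m W → Sorted k (posFrom k m W)
posFrom-sorted k m [] = tt
posFrom-sorted k m (a ∷ W) with a ≟ m
... | yes _ = ≤-refl , posFrom-sorted (suc k) m W
... | no _ = Sorted-weaken {I = posFrom (suc k) m W} (ℕ.n≤1+n k) (posFrom-sorted (suc k) m W)

posFrom-bound : ∀ k m W → All (_< k + length W) (posFrom k m W)
posFrom-bound k m [] = []
posFrom-bound k m (a ∷ W) with a ≟ m
... | yes _ = ℕ.m<m+n k (s≤s z≤n) ∷ subst (λ n → All (_< n) (posFrom (suc k) m W))
    (sym (+-suc k (length W))) (posFrom-bound (suc k) m W)
... | no _ = subst (λ n → All (_< n) (posFrom (suc k) m W)) (sym (+-suc k (length W)))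
    (posFrom-bound (suc k) m W)

length-posFrom : ∀ k m W → length (posFrom k m W) + length (del m W) ≡ length W
length-posFrom k m [] = refl
length-posFrom k m (a ∷ W) with a ≟ m
... | yes _ = cong suc (length-posFrom (suc k) m W)
... | no _ = trans (+-suc _ _) (cong suc (length-posFrom (suc k) m W))

posFrom-∈ : ∀ k {m W} → m ∈ W → posFrom k m W ≢ []
posFrom-∈ k {m} {a ∷ W} i with a ≟ m
posFrom-∈ k {m} {a ∷ W} i | yes _ = λ ()
posFrom-∈ k {m} {a ∷ W} (here e) | no n = ⊥-elim (n (sym e))
posFrom-∈ k {m} {a ∷ W} (there i) | no _ = posFrom-∈ (suc k) i

posFrom-∉ : ∀ k {m} W → m ∉ W → posFrom k m W ≡ []
posFrom-∉ k [] n = refl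
posFrom-∉ k {m} (a ∷ W) n with a ≟ m
... | yes e = ⊥-elim (n (here (sym e)))
... | no _ = posFrom-∉ (suc k) W (λ i → n (there i))

posFrom⇒∈ : ∀ k {m} W → posFrom k m W ≢ [] → m ∈ W
posFrom⇒∈ k [] n = ⊥-elim (n refl)
posFrom⇒∈ k {m} (a ∷ W) n with a ≟ m
... | yes e = here (sym e)
... | no _ = there (posFrom⇒∈ (suc k) W n)

del-∉ : ∀ {m} W → m ∉ W → del m W ≡ W
del-∉ [] n = refl
del-∉ {m} (a ∷ W) n with a ≟ m
... | yes e = ⊥-elim (n (here (sym e)))
... | no _ = cong (a ∷_) (del-∉ W (λ i → n (there i)))

∈-del⁻ : ∀ {m a} W → a ∈ del m W → a ∈ W × a ≢ m
∈-del⁻ {m} (b ∷ W) i with b ≟ m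
... | yes _ = there (proj₁ (∈-del⁻ W i)) , proj₂ (∈-del⁻ W i)
∈-del⁻ {m} (b ∷ W) (here refl) | no n = here refl , n
∈-del⁻ {m} (b ∷ W) (there i) | no _ = there (proj₁ (∈-del⁻ W i)) , proj₂ (∈-del⁻ W i)

∈-del⁺ : ∀ {m a W} → a ∈ W → a ≢ m → a ∈ del m W
∈-del⁺ {m} {a} {b ∷ W} i n with b ≟ m
∈-del⁺ {m} {a} {b ∷ W} (here refl) n | yes e = ⊥-elim (n e)
∈-del⁺ {m} {a} {b ∷ W} (there i) n | yes _ = ∈-del⁺ i n
∈-del⁺ {m} {a} {b ∷ W} (here e) n | no _ = here e
∈-del⁺ {m} {a} {b ∷ W} (there i) n | no _ = there (∈-del⁺ i n)

posFrom-++ : ∀ k m U W → posFrom k m (U ++ W) ≡ posFrom k m U ++ posFrom (k + length U) m W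
posFrom-++ k m [] W = cong (λ n → posFrom n m W) (sym (ℕ.+-identityʳ k))
posFrom-++ k m (a ∷ U) W with a ≟ m
... | yes _ = cong (k ∷_) (trans (posFrom-++ (suc k) m U W)
    (cong (λ n → posFrom (suc k) m U ++ posFrom n m W) (sym (+-suc k (length U)))))
... | no _ = trans (posFrom-++ (suc k) m U W) (cong (λ n → posFrom (suc k) m U ++ posFrom n m W)
    (sym (+-suc k (length U))))

posFrom-suc : ∀ k m W → posFrom (suc k) m W ≡ map suc (posFrom k m W)
posFrom-suc k m [] = refl
posFrom-suc k m (a ∷ W) with a ≟ m
... | yes _ = cong (suc k ∷_) (posFrom-suc (suc k) m W)
... | no _ = posFrom-suc (suc k) m W

posFrom-+ : ∀ j k m W → posFrom (j + k) m W ≡ map (j +_) (posFrom k m W)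
posFrom-+ zero k m W = sym (map-id _)
posFrom-+ (suc j) k m W = trans (posFrom-suc (j + k) m W)
    (trans (cong (map suc) (posFrom-+ j k m W)) (sym (map-∘ (posFrom k m W))))

-- The source of the condition on the label of a node with empty right forest: if nothing remains
-- after removing the maximal letters, they fill all positions from 1 on.
posFrom-all : ∀ m W → del m W ≡ [] → posFrom 1 m W ≡ map suc (upTo (length (posFrom 1 m W)))
posFrom-all m W e = trans shifted (cong (λ n → map suc (upTo n)) (sym len))
  where
    from0 : ∀ W → del m W ≡ [] → posFrom 0 m W ≡ upTo (length W)
    from0 [] e = refl
    from0 (a ∷ W) e with a ≟ m
    ... | yes _ = cong (0 ∷_) (trans (posFrom-suc 0 m W)
        (trans (cong (map suc) (from0 W e)) (map-upTo suc (length W))))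
    from0 (a ∷ W) () | no _
    shifted : posFrom 1 m W ≡ map suc (upTo (length W))
    shifted = trans (posFrom-suc 0 m W) (cong (map suc) (from0 W e))
    len : length (posFrom 1 m W) ≡ length W
    len = trans (sym (ℕ.+-identityʳ _)) (trans (cong (λ w → length (posFrom 1 m W) + length w) (sym e))
        (length-posFrom 1 m W))

posFrom-map : ∀ (ρ : ℕ → ℕ) k m W → (∀ {a} → a ∈ W → ρ a ≡ ρ m → a ≡ m) → posFrom k (ρ m) (map ρ W) ≡
    posFrom k m W
posFrom-map ρ k m [] inj = refl
posFrom-map ρ k m (a ∷ W) inj with ρ a ≟ ρ m | a ≟ m
... | yes _ | yes _ = cong (k ∷_) (posFrom-map ρ (suc k) m W (λ i → inj (there i)))
... | yes e | no n = ⊥-elim (n (inj (here refl) e))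
... | no n | yes e = ⊥-elim (n (cong ρ e))
... | no _ | no _ = posFrom-map ρ (suc k) m W (λ i → inj (there i))

del-map : ∀ (ρ : ℕ → ℕ) m W → (∀ {a} → a ∈ W → ρ a ≡ ρ m → a ≡ m) → del (ρ m) (map ρ W) ≡ map ρ (del m W)
del-map ρ m [] inj = refl
del-map ρ m (a ∷ W) inj with ρ a ≟ ρ m | a ≟ m
... | yes _ | yes _ = del-map ρ m W (λ i → inj (there i))
... | yes e | no n = ⊥-elim (n (inj (here refl) e))
... | no n | yes e = ⊥-elim (n (cong ρ e))
... | no _ | no _ = cong (ρ a ∷_) (del-map ρ m W (λ i → inj (there i)))

-- phiGo inserts at the given positions

≡ᵇ-refl : ∀ k → (k ≡ᵇ k) ≡ true
≡ᵇ-refl zero = refl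
≡ᵇ-refl (suc k) = ≡ᵇ-refl k

≡ᵇ-< : ∀ {k i} → k < i → (i ≡ᵇ k) ≡ false
≡ᵇ-< {zero} {suc i} p = refl
≡ᵇ-< {suc k} {suc i} (s≤s p) = ≡ᵇ-< p

phiGo-hit : ∀ m k I w → phiGo m k (k ∷ I) w ≡ Maybe.map (m ∷_) (phiGo m (suc k) I w)
phiGo-hit m k I [] rewrite ≡ᵇ-refl k = refl
phiGo-hit m k I (a ∷ w) rewrite ≡ᵇ-refl k = refl

phiGo-miss : ∀ m k i I a w → k < i → phiGo m k (i ∷ I) (a ∷ w) ≡ Maybe.map (a ∷_) (phiGo m (suc k) (i ∷ I) w)
phiGo-miss m k i I a w p rewrite ≡ᵇ-< p = refl

phiGo-pos : ∀ m k W → phiGo m k (posFrom k m W) (del m W) ≡ just W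
phiGo-pos m k [] = refl
phiGo-pos m k (a ∷ W) with a ≟ m
... | yes refl = trans (phiGo-hit a k (posFrom (suc k) a W) (del a W))
    (cong (Maybe.map (a ∷_)) (phiGo-pos a (suc k) W))
... | no n = go (posFrom (suc k) m W) (posFrom-sorted (suc k) m W) (phiGo-pos m (suc k) W)
  where
    go : ∀ I → Sorted (suc k) I → phiGo m (suc k) I (del m W) ≡ just W → phiGo m k I (a ∷ del m W) ≡ just
        (a ∷ W)
    go [] s e = cong (λ z → just (a ∷ z)) (just-injective e)
    go (i ∷ I) (p , s) e = trans (phiGo-miss m k i I a (del m W) p) (cong (Maybe.map (a ∷_)) e)

map-just : ∀ (x : ℕ) {r : Maybe Word} {W} → Maybe.map (x ∷_) r ≡ just W → ∃[ W′ ] (r ≡ just W′ × W ≡ x ∷ W′)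
map-just x {just W′} refl = W′ , refl , refl

posFrom-∷-hit : ∀ k m W → posFrom k m (m ∷ W) ≡ k ∷ posFrom (suc k) m W
posFrom-∷-hit k m W with m ≟ m
... | yes _ = refl
... | no n = ⊥-elim (n refl)

del-∷-hit : ∀ m W → del m (m ∷ W) ≡ del m W
del-∷-hit m W with m ≟ m
... | yes _ = refl
... | no n = ⊥-elim (n refl)

posFrom-∷-miss : ∀ k {m a} W → a ≢ m → posFrom k m (a ∷ W) ≡ posFrom (suc k) m W
posFrom-∷-miss k {m} {a} W n with a ≟ m
... | yes e = ⊥-elim (n e)
... | no _ = refl

del-∷-miss : ∀ {m a} W → a ≢ m → del m (a ∷ W) ≡ a ∷ del m W
del-∷-miss {m} {a} W n with a ≟ m
... | yes e = ⊥-elim (n e)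
... | no _ = refl

-- Since `m` does not occur in `w`, the inserted letters can be told from the old ones, so positions
-- and word are both recovered. This keeps the images of the maps `Φ I` for different `I` apart.
phiGo-inv : ∀ m k I w W → Sorted k I → m ∉ w → phiGo m k I w ≡ just W → posFrom k m W ≡ I × del m W ≡ w
phiGo-inv m k [] w W s n refl = posFrom-∉ k w n , del-∉ w n
phiGo-inv m k (i ∷ I) w W (p , s) n e with k ≟ i
phiGo-inv m k (.k ∷ I) w W (p , s) n e | yes refl with map-just m {phiGo m (suc k) I w}
    (trans (sym (phiGo-hit m k I w)) e)
... | W′ , e′ , refl with phiGo-inv m (suc k) I w W′ s n e′
... | q , r = trans (posFrom-∷-hit k m W′) (cong (k ∷_) q) , trans (del-∷-hit m W′) r
phiGo-inv m k (i ∷ I) [] W (p , s) n e | no k≢i rewrite ≡ᵇ-< (ℕ.≤∧≢⇒< p k≢i) with e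
... | ()
phiGo-inv m k (i ∷ I) (a ∷ w) W (p , s) n e | no k≢i
  with map-just a {phiGo m (suc k) (i ∷ I) w} (trans (sym (phiGo-miss m k i I a w (ℕ.≤∧≢⇒< p k≢i))) e)
... | W′ , e′ , refl with phiGo-inv m (suc k) (i ∷ I) w W′ (ℕ.≤∧≢⇒< p k≢i , s) (λ j → n (there j)) e′
... | q , r = trans (posFrom-∷-miss k W′ a≢m) q , trans (del-∷-miss W′ a≢m) (cong (a ∷_) r)
  where
    a≢m : a ≢ m
    a≢m refl = n (here refl)

last-lower : ∀ {k} i I → Sorted k (i ∷ I) → k + length I ≤ lastOr i I
last-lower {k} i [] (p , s) = subst (_≤ i) (sym (ℕ.+-identityʳ k)) p
last-lower {k} i (j ∷ I) (p , q , s) = ≤-trans (ℕ.≤-reflexive (+-suc k (length I)))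
    (last-lower j I (≤-trans (s≤s p) q , s))

-- For `k` equal to 1 the bound is the condition that the last position is at most n + p; the
-- general `k` is what the recursion sees after passing k - 1 positions.
phiGo-just : ∀ m k i I w → Sorted k (i ∷ I) → lastOr i I < k + (length w + suc (length I)) → ∃[ W ] phiGo
    m k (i ∷ I) w ≡ just W
phiGo-just m k i I w (p , s) lt with k ≟ i
phiGo-just m k .k [] w (p , s) lt | yes refl = m ∷ w , trans (phiGo-hit m k [] w) refl
phiGo-just m k .k (j ∷ I) w (p , s) lt | yes refl
  with phiGo-just m (suc k) j I w s (subst (lastOr j I <_)
      (trans (cong (k +_) (+-suc (length w) (suc (length I)))) (+-suc k _)) lt)
... | W , e = m ∷ W , trans (phiGo-hit m k (j ∷ I) w) (cong (Maybe.map (m ∷_)) e)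
phiGo-just m k i I [] (p , s) lt | no k≢i = ⊥-elim (ℕ.<⇒≱ lt
    (≤-trans (ℕ.≤-reflexive (+-suc k (length I))) (last-lower i I (ℕ.≤∧≢⇒< p k≢i , s))))
phiGo-just m k i I (a ∷ w) (p , s) lt | no k≢i
  with phiGo-just m (suc k) i I w (ℕ.≤∧≢⇒< p k≢i , s) (subst (lastOr i I <_) (+-suc k _) lt)
... | W , e = a ∷ W , trans (phiGo-miss m k i I a w (ℕ.≤∧≢⇒< p k≢i)) (cong (Maybe.map (a ∷_)) e)

-- Decomposition of packed words along their maximal letter

pos : Word → List ℕ
pos W = posFrom 1 (maxW W) W

rem : Word → Word
rem W = del (maxW W) W

maxW-rem : ∀ {W} → Packed W → W ≢ [] → suc (maxW (rem W)) ≡ maxW W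
maxW-rem {W} pk n = go (maxW W) refl (maxW-pos (proj₁ pk) n)
  where
    go : ∀ m → maxW W ≡ m → 1 ≤ m → suc (maxW (rem W)) ≡ maxW W
    go (suc m) e _ = trans (cong suc (≤-antisym (maxW-lub (All.tabulate upper)) lower)) (sym e)
      where
        upper : ∀ {a} → a ∈ rem W → a ≤ m
        upper i with ∈-del⁻ W i
        ... | j , ne = ℕ.≤-pred (ℕ.≤∧≢⇒< (subst (_ ≤_) e (All.lookup (≤maxW W) j))
            (λ q → ne (trans q (sym e))))
        lower′ : ∀ m → maxW W ≡ suc m → m ≤ maxW (rem W)
        lower′ zero e = z≤n
        lower′ (suc m) e = All.lookup (≤maxW (rem W))
            (∈-del⁺ (proj₂ pk (suc m) (s≤s z≤n) (subst (suc m ≤_) (sym e) (ℕ.n≤1+n _)))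
          (λ q → ℕ.m≢1+m+n (suc m) (trans q (trans e (cong suc (sym (ℕ.+-identityʳ (suc m))))))))
        lower : m ≤ maxW (rem W)
        lower = lower′ m e

Packed-rem : ∀ {W} → Packed W → W ≢ [] → Packed (rem W)
Packed-rem {W} pk n = All.tabulate (λ i → All.lookup (proj₁ pk) (proj₁ (∈-del⁻ W i))) , onto
  where
    onto : ∀ j → 1 ≤ j → j ≤ maxW (rem W) → j ∈ rem W
    onto j p q = ∈-del⁺ (proj₂ pk j p (<⇒≤ lt)) (ℕ.<⇒≢ lt)
      where
        lt : j < maxW W
        lt = subst (suc j ≤_) (maxW-rem pk n) (s≤s q)

phiW-pos : ∀ {W} → Packed W → W ≢ [] → phiW (pos W) (rem W) ≡ just W
phiW-pos {W} pk n = trans (cong (λ m → phiGo m 1 (pos W) (rem W)) (maxW-rem pk n)) (phiGo-pos (maxW W) 1 W)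

nonempty-∈ : ∀ {W : Word} → W ≢ [] → maxW W ∈ W
nonempty-∈ {[]} n = ⊥-elim (n refl)
nonempty-∈ {a ∷ W} n = maxW-∈ a W

pos-≢[] : ∀ {W} → W ≢ [] → pos W ≢ []
pos-≢[] n = posFrom-∈ 1 (nonempty-∈ n)

maxW-phi : ∀ {I w W} → Sorted 1 I → I ≢ [] → phiW I w ≡ just W → maxW W ≡ suc (maxW w) × pos W ≡ I × rem W ≡ w
maxW-phi {I} {w} {W} s ne e with phiGo-inv (suc (maxW w)) 1 I w W s
    (λ i → ℕ.<⇒≱ ≤-refl (All.lookup (≤maxW w) i)) e
... | q , r = eq , subst (λ m → posFrom 1 m W ≡ I) (sym eq) q , subst (λ m → del m W ≡ w) (sym eq) r
  where
    upper : ∀ {a} → a ∈ W → a ≤ suc (maxW w)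
    upper {a} i with a ≟ suc (maxW w)
    ... | yes refl = ≤-refl
    ... | no n = ℕ.m≤n⇒m≤1+n (All.lookup (≤maxW w) (subst (a ∈_) r (∈-del⁺ i n)))
    eq : maxW W ≡ suc (maxW w)
    eq = ≤-antisym (maxW-lub (All.tabulate upper)) (All.lookup (≤maxW W)
        (posFrom⇒∈ 1 W (λ z → ne (trans (sym q) z))))

phi-length : ∀ {I w W} → Sorted 1 I → I ≢ [] → phiW I w ≡ just W → length W ≡ length I + length w
phi-length {I} {w} {W} s ne e with maxW-phi s ne e
... | _ , q , r = trans (sym (length-posFrom 1 (maxW W) W)) (cong₂ (λ a b → length a + length b) q r)

phi-packed : ∀ {I w W} → Sorted 1 I → I ≢ [] → phiW I w ≡ just W → Packed w → Packed W
phi-packed {I} {w} {W} s ne e pk with maxW-phi s ne e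
... | m , q , r = All.tabulate positive , onto
  where
    positive : ∀ {a} → a ∈ W → 1 ≤ a
    positive {a} i with a ≟ maxW W
    ... | yes refl = subst (1 ≤_) (sym m) (s≤s z≤n)
    ... | no n = All.lookup (proj₁ pk) (subst (a ∈_) r (∈-del⁺ i n))
    onto : ∀ j → 1 ≤ j → j ≤ maxW W → j ∈ W
    onto j p le with j ≟ maxW W
    ... | yes refl = posFrom⇒∈ 1 W (λ z → ne (trans (sym q) z))
    ... | no n = proj₁ (∈-del⁻ W (subst (j ∈_) (sym r)
        (proj₂ pk j p (ℕ.≤-pred (subst (suc j ≤_) m (ℕ.≤∧≢⇒< le n))))))

pos-pack : ∀ {W} → Pos W → W ≢ [] → pos (pack W) ≡ pos W
pos-pack {[]} pw n = ⊥-elim (n refl)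
pos-pack {a ∷ W} pw n = trans (cong pos (pack≡ pw))
    (trans (cong (λ m → posFrom 1 m (map ρ (a ∷ W))) (maxW-map ρ a W (cnt-mono (a ∷ W))))
    (posFrom-map ρ 1 (maxW (a ∷ W)) (a ∷ W) (λ i e → cnt-injective i (maxW-∈ a W) e)))
  where ρ = cnt (a ∷ W)

rem-pack : ∀ {W} → Pos W → W ≢ [] → rem (pack W) ≡ pack (rem W)
rem-pack {[]} pw n = ⊥-elim (n refl)
rem-pack {a ∷ W} pw n = begin
  rem (pack (a ∷ W)) ≡⟨ cong rem (pack≡ pw) ⟩
  rem (map ρ (a ∷ W)) ≡⟨ cong (λ m → del m (map ρ (a ∷ W))) (maxW-map ρ a W (cnt-mono (a ∷ W))) ⟩
  del (ρ (maxW (a ∷ W))) (map ρ (a ∷ W)) ≡⟨ del-map ρ (maxW (a ∷ W)) (a ∷ W)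
      (λ i e → cnt-injective i (maxW-∈ a W) e) ⟩
  map ρ (rem (a ∷ W)) ≡⟨ map-cong-local (All.tabulate same) ⟩
  map (cnt (rem (a ∷ W))) (rem (a ∷ W)) ≡⟨ pack≡ (Pos-⊆ (λ i → proj₁ (∈-del⁻ (a ∷ W) i)) pw) ⟨
  pack (rem (a ∷ W)) ∎
  where
    open ≡-Reasoning
    ρ = cnt (a ∷ W)
    same : ∀ {x} → x ∈ rem (a ∷ W) → ρ x ≡ cnt (rem (a ∷ W)) x
    same {x} i with ∈-del⁻ (a ∷ W) i
    ... | j , ne = cnt-ext x (λ y _ le → memb-ext (a ∷ W) (rem (a ∷ W))
        (λ k → ∈-del⁺ k (ℕ.<⇒≢ (ℕ.≤-<-trans le (ℕ.≤∧≢⇒< (All.lookup (≤maxW (a ∷ W)) j) ne))))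
        (λ k → proj₁ (∈-del⁻ (a ∷ W) k)))

label-sorted : ∀ {I} → IsLabel I → Sorted 1 I
label-sorted (l , p) = go l p
  where
    go : ∀ {k I} → Linked _<_ I → All (k ≤_) I → Sorted k I
    go [] [] = tt
    go [-] (p ∷ []) = p , tt
    go (q ∷ l) (p ∷ ps) = p , go l (q ∷ above q l)
      where
        above : ∀ {i j I} → i < j → Linked _<_ (j ∷ I) → All (suc i ≤_) I
        above q [-] = []
        above q (r ∷ l) = ℕ.<-trans q r ∷ above (ℕ.<-trans q r) l

sorted-label : ∀ {k} I → 1 ≤ k → Sorted k I → IsLabel I
sorted-label I p s = linked I s , lower I p s
  where
    linked : ∀ {k} I → Sorted k I → Linked _<_ I
    linked [] s = []
    linked (i ∷ []) s = [-]
    linked (i ∷ j ∷ I) (_ , q , s) = q ∷ linked (j ∷ I) (q , s)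
    lower : ∀ {k} I → 1 ≤ k → Sorted k I → All (1 ≤_) I
    lower [] p s = []
    lower (i ∷ I) p (q , s) = ≤-trans p q ∷ lower I (s≤s z≤n) s

module Bases {c ℓ} (F : Field c ℓ) where

  open WQSym F

  open Field F using (0#; 1#; +-cong; +-congˡ; +-congʳ; *-cong; *-congˡ; *-congʳ; -‿cong;
    +-assoc; +-comm; +-identityˡ; +-identityʳ; *-assoc; *-comm; *-identityˡ; *-identityʳ;
    distribˡ; zeroˡ; zeroʳ; -‿inverseˡ; -‿inverseʳ)
    renaming (Carrier to K; _≈_ to infix 4 _≈_; _+_ to infixl 6 _⊕_; _*_ to infixl 7 _⊛_; -_ to infix 8 ⊖_;
              refl to ≈-refl; sym to ≈-sym; trans to ≈-trans; setoid to K-setoid; reflexive to ≈-reflexive)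
  open Field F using (ring; +-commutativeMonoid; *-commutativeMonoid)
  open import Algebra.Properties.Ring ring using (-‿distribˡ-*; -‿distribʳ-*; -0#≈0#; -‿+-comm)
  open import Algebra.Properties.CommutativeSemigroup
      (CommutativeMonoid.commutativeSemigroup +-commutativeMonoid)
    using () renaming (interchange to ⊕-interchange; x∙yz≈y∙xz to ⊕-swapˡ)
  open import Algebra.Properties.CommutativeSemigroup
      (CommutativeMonoid.commutativeSemigroup *-commutativeMonoid)
    using () renaming (x∙yz≈y∙xz to ⊛-swapˡ)
  open import Relation.Binary.Reasoning.Setoid K-setoid

  -- Finite sums and pairings of formal sums with functions

  ∑ : List A → (A → K) → K
  ∑ [] f = 0#
  ∑ (x ∷ l) f = f x ⊕ ∑ l f

  ∑-congᴬ : ∀ {l : List A} {f g : A → K} → All (λ x → f x ≈ g x) l → ∑ l f ≈ ∑ l g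
  ∑-congᴬ [] = ≈-refl
  ∑-congᴬ (p ∷ ps) = +-cong p (∑-congᴬ ps)

  ∑-cong : ∀ (l : List A) {f g : A → K} → (∀ x → f x ≈ g x) → ∑ l f ≈ ∑ l g
  ∑-cong l p = ∑-congᴬ (All.universal p l)

  ⊕-zero : ∀ {x y} → x ≈ 0# → y ≈ 0# → x ⊕ y ≈ 0#
  ⊕-zero p q = ≈-trans (+-cong p q) (+-identityˡ 0#)

  ∑-zeroᴬ : ∀ {l : List A} {f : A → K} → All (λ x → f x ≈ 0#) l → ∑ l f ≈ 0#
  ∑-zeroᴬ [] = ≈-refl
  ∑-zeroᴬ (p ∷ ps) = ⊕-zero p (∑-zeroᴬ ps)

  ∑-zero : ∀ (l : List A) {f : A → K} → (∀ x → f x ≈ 0#) → ∑ l f ≈ 0#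
  ∑-zero l p = ∑-zeroᴬ (All.universal p l)

  ∑-++ : ∀ (l m : List A) (f : A → K) → ∑ (l ++ m) f ≈ ∑ l f ⊕ ∑ m f
  ∑-++ [] m f = ≈-sym (+-identityˡ _)
  ∑-++ (x ∷ l) m f = ≈-trans (+-congˡ (∑-++ l m f)) (≈-sym (+-assoc _ _ _))

  ∑-map : ∀ (h : A → B) (l : List A) (f : B → K) → ∑ (map h l) f ≈ ∑ l (λ x → f (h x))
  ∑-map h [] f = ≈-refl
  ∑-map h (x ∷ l) f = +-congˡ (∑-map h l f)

  ∑-concatMap : ∀ (h : A → List B) (l : List A) (f : B → K) → ∑ (concatMap h l) f ≈ ∑ l (λ x → ∑ (h x) f)
  ∑-concatMap h [] f = ≈-refl
  ∑-concatMap h (x ∷ l) f = ≈-trans (∑-++ (h x) (concatMap h l) f) (+-congˡ (∑-concatMap h l f))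

  ∑-⊕ : ∀ (l : List A) (f g : A → K) → ∑ l (λ x → f x ⊕ g x) ≈ ∑ l f ⊕ ∑ l g
  ∑-⊕ [] f g = ≈-sym (+-identityˡ _)
  ∑-⊕ (x ∷ l) f g = ≈-trans (+-congˡ (∑-⊕ l f g)) (⊕-interchange _ _ _ _)

  ∑-⊛ : ∀ (k : K) (l : List A) (f : A → K) → k ⊛ ∑ l f ≈ ∑ l (λ x → k ⊛ f x)
  ∑-⊛ k [] f = zeroʳ k
  ∑-⊛ k (x ∷ l) f = ≈-trans (distribˡ _ _ _) (+-congˡ (∑-⊛ k l f))

  ∑-swap : ∀ (l : List A) (m : List B) (f : A → B → K) →
           ∑ l (λ x → ∑ m (f x)) ≈ ∑ m (λ y → ∑ l (λ x → f x y))
  ∑-swap [] m f = ≈-sym (∑-zero m (λ _ → ≈-refl))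
  ∑-swap (x ∷ l) m f = ≈-trans (+-congˡ (∑-swap l m f)) (≈-sym (∑-⊕ m (f x) _))

  infixr 8 [_]_
  [_]_ : Bool → K → K
  [ b ] x = if b then x else 0#

  []-cong : ∀ b {x y} → x ≈ y → [ b ] x ≈ [ b ] y
  []-cong true p = p
  []-cong false p = ≈-refl

  []-zero : ∀ b → [ b ] 0# ≈ 0#
  []-zero true = ≈-refl
  []-zero false = ≈-refl

  []-⊕ : ∀ b x y → [ b ] (x ⊕ y) ≈ [ b ] x ⊕ [ b ] y
  []-⊕ true x y = ≈-refl
  []-⊕ false x y = ≈-sym (+-identityˡ _)

  []-⊛ : ∀ b k x → k ⊛ [ b ] x ≈ [ b ] (k ⊛ x)
  []-⊛ true k x = ≈-refl
  []-⊛ false k x = zeroʳ k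

  []-swap : ∀ b c x → [ b ] [ c ] x ≡ [ c ] [ b ] x
  []-swap true c x = refl
  []-swap false true x = refl
  []-swap false false x = refl

  []-∑ : ∀ b (l : List A) (f : A → K) → ∑ l (λ x → [ b ] f x) ≈ [ b ] ∑ l f
  []-∑ true l f = ≈-refl
  []-∑ false l f = ∑-zero l (λ _ → ≈-refl)

  ⟪_,_⟫ : {A : Set a} → List (K × A) → (A → K) → K
  ⟪ x , f ⟫ = ∑ x (λ p → proj₁ p ⊛ f (proj₂ p))

  Supp : {A : Set a} → (A → Set b) → List (K × A) → Set _
  Supp T = All (λ p → T (proj₂ p))

  ⟪⟫-congᴬ : ∀ {x : List (K × A)} {f g : A → K} → Supp (λ w → f w ≈ g w) x → ⟪ x , f ⟫ ≈ ⟪ x , g ⟫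
  ⟪⟫-congᴬ p = ∑-congᴬ (All.map *-congˡ p)

  ⟪⟫-cong : ∀ (x : List (K × A)) {f g : A → K} → (∀ w → f w ≈ g w) → ⟪ x , f ⟫ ≈ ⟪ x , g ⟫
  ⟪⟫-cong x p = ⟪⟫-congᴬ {x = x} (All.universal (λ q → p (proj₂ q)) x)

  ⟪⟫-zeroᴬ : ∀ {x : List (K × A)} {f : A → K} → Supp (λ w → f w ≈ 0#) x → ⟪ x , f ⟫ ≈ 0#
  ⟪⟫-zeroᴬ p = ∑-zeroᴬ (All.map (λ q → ≈-trans (*-congˡ q) (zeroʳ _)) p)

  ⟪⟫-zero : ∀ (x : List (K × A)) {f : A → K} → (∀ w → f w ≈ 0#) → ⟪ x , f ⟫ ≈ 0#
  ⟪⟫-zero x p = ⟪⟫-zeroᴬ {x = x} (All.universal (λ q → p (proj₂ q)) x)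

  ⟪⟫-⊕ : ∀ (x : List (K × A)) (f g : A → K) → ⟪ x , (λ w → f w ⊕ g w) ⟫ ≈ ⟪ x , f ⟫ ⊕ ⟪ x , g ⟫
  ⟪⟫-⊕ x f g = ≈-trans (∑-cong x (λ _ → distribˡ _ _ _)) (∑-⊕ x _ _)

  ⟪⟫-⊛ : ∀ (k : K) (x : List (K × A)) (f : A → K) → ⟪ x , (λ w → k ⊛ f w) ⟫ ≈ k ⊛ ⟪ x , f ⟫
  ⟪⟫-⊛ k x f = ≈-trans (∑-cong x (λ _ → ⊛-swapˡ _ _ _)) (≈-sym (∑-⊛ k x _))

  ⟪⟫-⊖ : ∀ (x : List (K × A)) (f : A → K) → ⟪ x , (λ w → ⊖ f w) ⟫ ≈ ⊖ ⟪ x , f ⟫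
  ⟪⟫-⊖ [] f = ≈-sym -0#≈0#
  ⟪⟫-⊖ (p ∷ x) f = ≈-trans (+-cong (≈-sym (-‿distribʳ-* _ _)) (⟪⟫-⊖ x f)) (-‿+-comm _ _)

  ⟪⟫-∑ : ∀ (x : List (K × A)) (l : List B) (f : A → B → K) →
          ⟪ x , (λ w → ∑ l (f w)) ⟫ ≈ ∑ l (λ y → ⟪ x , (λ w → f w y) ⟫)
  ⟪⟫-∑ x l f = ≈-trans (∑-cong x (λ _ → ∑-⊛ _ l _)) (∑-swap x l _)

  ⟪⟫-⟪⟫ : ∀ (x : List (K × A)) (y : List (K × B)) (f : A → B → K) →
          ⟪ x , (λ u → ⟪ y , f u ⟫) ⟫ ≈ ⟪ y , (λ v → ⟪ x , (λ u → f u v) ⟫) ⟫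
  ⟪⟫-⟪⟫ x y f = ≈-trans (⟪⟫-∑ x y _) (∑-cong y (λ _ → ⟪⟫-⊛ _ x _))

  ⟪⟫-[] : ∀ b (x : List (K × A)) (f : A → K) → ⟪ x , (λ w → [ b ] f w) ⟫ ≈ [ b ] ⟪ x , f ⟫
  ⟪⟫-[] true x f = ≈-refl
  ⟪⟫-[] false x f = ⟪⟫-zero x (λ _ → ≈-refl)

  ⟪⟫-++ : ∀ (x y : List (K × A)) (f : A → K) → ⟪ x ++ y , f ⟫ ≈ ⟪ x , f ⟫ ⊕ ⟪ y , f ⟫
  ⟪⟫-++ x y f = ∑-++ x y _

  scaleBy : {A : Set a} → K → List (K × A) → List (K × A)
  scaleBy k = map (λ p → k ⊛ proj₁ p , proj₂ p)

  ⟪⟫-scale : ∀ k (x : List (K × A)) (f : A → K) → ⟪ scaleBy k x , f ⟫ ≈ k ⊛ ⟪ x , f ⟫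
  ⟪⟫-scale k x f = ≈-trans (∑-map _ x _) (≈-trans (∑-cong x (λ _ → *-assoc _ _ _)) (≈-sym (∑-⊛ k x _)))

  module Coeff {A : Set a} (_≟_ : DecidableEquality A) where

    δ : A → A → K
    δ x y = [ ⌊ y ≟ x ⌋ ] 1#

    δ-≡ : ∀ x → δ x x ≈ 1#
    δ-≡ x with x ≟ x
    ... | yes _ = ≈-refl
    ... | no q = ⊥-elim (q refl)

    δ-≢ : ∀ {x y} → y ≢ x → δ x y ≈ 0#
    δ-≢ {x} {y} q with y ≟ x
    ... | yes p = ⊥-elim (q p)
    ... | no _ = ≈-refl

    open DecMem _≟_ using (_∈?_)

    -- Induction on a finite list `U` outside of which `h` vanishes. The head `w` contributes `h w`
    -- times the collected coefficient of `w`, and one of these two factors is zero; the rest of `h`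
    -- lives on the tail.
    vanish-on : ∀ (l : List (K × A)) (U : List A) (h : A → K) →
                (∀ x → ⟪ l , δ x ⟫ ≈ 0# ⊎ h x ≈ 0#) → (∀ x → x ∉ U → h x ≈ 0#) → ⟪ l , h ⟫ ≈ 0#
    vanish-on l [] h p q = ⟪⟫-zero l (λ x → q x (λ ()))
    vanish-on l (w ∷ U) h p q = begin
        ⟪ l , h ⟫ ≈⟨ ⟪⟫-cong l split ⟩
        ⟪ l , (λ x → h w ⊛ δ w x ⊕ h′ x) ⟫ ≈⟨ ⟪⟫-⊕ l _ _ ⟩
        ⟪ l , (λ x → h w ⊛ δ w x) ⟫ ⊕ ⟪ l , h′ ⟫ ≈⟨ ⊕-zero (≈-trans (⟪⟫-⊛ _ l _) (head (p w)))
            (vanish-on l U h′ p′ q′) ⟩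
        0# ∎
      where
        h′ : A → K
        h′ x = if ⌊ x ≟ w ⌋ then 0# else h x
        split : ∀ x → h x ≈ h w ⊛ δ w x ⊕ h′ x
        split x with x ≟ w
        ... | yes refl = ≈-sym (≈-trans (+-identityʳ _) (*-identityʳ _))
        ... | no _ = ≈-sym (≈-trans (+-congʳ (zeroʳ _)) (+-identityˡ _))
        head : ⟪ l , δ w ⟫ ≈ 0# ⊎ h w ≈ 0# → h w ⊛ ⟪ l , δ w ⟫ ≈ 0#
        head (inj₁ e) = ≈-trans (*-congˡ e) (zeroʳ _)
        head (inj₂ e) = ≈-trans (*-congʳ e) (zeroˡ _)
        p′ : ∀ x → ⟪ l , δ x ⟫ ≈ 0# ⊎ h′ x ≈ 0#
        p′ x with x ≟ w
        ... | yes _ = inj₂ ≈-refl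
        ... | no _ = p x
        q′ : ∀ x → x ∉ U → h′ x ≈ 0#
        q′ x n with x ≟ w
        ... | yes _ = ≈-refl
        ... | no x≢w = q x (λ { (here e) → x≢w e ; (there i) → n i })

    -- Replaces the removal of terms with zero coefficient, which would need a zero test in `K`:
    -- repeated indices may stay in the list, as long as each index has zero collected coefficient
    -- or is annihilated by `h`.
    vanish : ∀ (l : List (K × A)) (h : A → K) →
             Supp (λ x → ⟪ l , δ x ⟫ ≈ 0# ⊎ h x ≈ 0#) l → ⟪ l , h ⟫ ≈ 0#
    vanish l h p = ≈-trans (⟪⟫-congᴬ {x = l} (All.tabulate agree)) (vanish-on l U h′ p′ q′)
      where
        -- Masking `h` by membership in the support extends the alternative, known only for indices
        -- of `l`, to all indices.
        U : List A
        U = map proj₂ l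
        h′ : A → K
        h′ x = [ ⌊ x ∈? U ⌋ ] h x
        agree : ∀ {r} → r ∈ l → h (proj₂ r) ≈ h′ (proj₂ r)
        agree {r} i with proj₂ r ∈? U
        ... | yes _ = ≈-refl
        ... | no n = ⊥-elim (n (∈-map⁺ proj₂ i))
        p′ : ∀ x → ⟪ l , δ x ⟫ ≈ 0# ⊎ h′ x ≈ 0#
        p′ x with x ∈? U
        ... | no _ = inj₂ ≈-refl
        ... | yes i with ∈-map⁻ proj₂ i
        ... | r , j , refl = All.lookup p j
        q′ : ∀ x → x ∉ U → h′ x ≈ 0#
        q′ x n with x ∈? U
        ... | yes i = ⊥-elim (n i)
        ... | no _ = ≈-refl

  -- Sums over the cuts of a list

  Cut : List A → (List A → List A → K) → K
  Cut u g = ∑ (decs u) (λ p → g (proj₁ p) (proj₂ p))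

  Cut-∷ : ∀ (x : A) u g → Cut (x ∷ u) g ≈ g [] (x ∷ u) ⊕ Cut u (λ p s → g (x ∷ p) s)
  Cut-∷ x u g = +-congˡ (∑-map _ (decs u) _)

  Cut-[] : ∀ (g : List A → List A → K) → Cut [] g ≈ g [] []
  Cut-[] g = +-identityʳ _

  Cut-cong : ∀ (u : List A) {f g} → (∀ p s → f p s ≈ g p s) → Cut u f ≈ Cut u g
  Cut-cong u h = ∑-cong (decs u) (λ _ → h _ _)

  Cut-cong∈ : ∀ (u : List A) {f g} → (∀ p s → p ++ s ≡ u → f p s ≈ g p s) → Cut u f ≈ Cut u g
  Cut-cong∈ u h = ∑-congᴬ (All.map (h _ _) (decs-++ u))

  Cut-zero∈ : ∀ (u : List A) {f} → (∀ p s → p ++ s ≡ u → f p s ≈ 0#) → Cut u f ≈ 0#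
  Cut-zero∈ u h = ∑-zeroᴬ (All.map (h _ _) (decs-++ u))

  Cut-⊕ : ∀ (u : List A) f g → Cut u (λ p s → f p s ⊕ g p s) ≈ Cut u f ⊕ Cut u g
  Cut-⊕ u f g = ∑-⊕ (decs u) _ _

  Cut-∷ʳ : ∀ (u : List A) x g → Cut (u ∷ʳ x) g ≈ Cut u (λ p s → g p (s ∷ʳ x)) ⊕ g (u ∷ʳ x) []
  Cut-∷ʳ [] x g = +-cong (≈-sym (Cut-[] (λ p s → g p (s ∷ʳ x)))) (+-identityʳ _)
  Cut-∷ʳ (y ∷ u) x g = begin
    Cut (y ∷ (u ∷ʳ x)) g ≈⟨ Cut-∷ y (u ∷ʳ x) g ⟩
    g [] (y ∷ (u ∷ʳ x)) ⊕ Cut (u ∷ʳ x) (λ p s → g (y ∷ p) s) ≈⟨ +-congˡ (Cut-∷ʳ u x _) ⟩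
    g [] (y ∷ (u ∷ʳ x)) ⊕ (Cut u (λ p s → g (y ∷ p) (s ∷ʳ x)) ⊕ g (y ∷ (u ∷ʳ x)) []) ≈⟨ +-assoc _ _ _ ⟨
    (g [] (y ∷ (u ∷ʳ x)) ⊕ Cut u (λ p s → g (y ∷ p) (s ∷ʳ x))) ⊕ g (y ∷ (u ∷ʳ x)) [] ≈⟨ +-congʳ
        (Cut-∷ y u _) ⟨
    Cut (y ∷ u) (λ p s → g p (s ∷ʳ x)) ⊕ g (y ∷ (u ∷ʳ x)) [] ∎

  Cut-reverse : ∀ (u : List A) g → Cut (reverse u) g ≈ Cut u (λ p s → g (reverse s) (reverse p))
  Cut-reverse [] g = ≈-refl
  Cut-reverse (x ∷ u) g = begin
    Cut (reverse (x ∷ u)) g ≡⟨ cong (λ r → Cut r g) (unfold-reverse x u) ⟩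
    Cut (reverse u ∷ʳ x) g ≈⟨ Cut-∷ʳ (reverse u) x g ⟩
    Cut (reverse u) (λ p s → g p (s ∷ʳ x)) ⊕ g (reverse u ∷ʳ x) []
      ≈⟨ +-cong (Cut-reverse u _) (≈-reflexive (cong (λ r → g r []) (sym (unfold-reverse x u)))) ⟩
    Cut u (λ p s → g (reverse s) (reverse p ∷ʳ x)) ⊕ g (reverse (x ∷ u)) []
      ≈⟨ +-comm _ _ ⟩
    g (reverse (x ∷ u)) [] ⊕ Cut u (λ p s → g (reverse s) (reverse p ∷ʳ x))
      ≈⟨ +-congˡ (Cut-cong u (λ p s → ≈-reflexive (cong (g (reverse s)) (sym (unfold-reverse x p))))) ⟩
    g (reverse (x ∷ u)) [] ⊕ Cut u (λ p s → g (reverse s) (reverse (x ∷ p))) ≈⟨ Cut-∷ x u _ ⟨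
    Cut (x ∷ u) (λ p s → g (reverse s) (reverse p)) ∎

  Cut-assoc : ∀ (u : List A) (g : List A → List A → List A → K) →
    Cut u (λ p y → Cut y (λ q r → g p q r)) ≈ Cut u (λ y r → Cut y (λ p q → g p q r))
  Cut-assoc [] g = ≈-refl
  Cut-assoc (x ∷ u) g = begin
    Cut (x ∷ u) (λ p y → Cut y (g p)) ≈⟨ Cut-∷ x u _ ⟩
    Cut (x ∷ u) (g []) ⊕ Cut u (λ p y → Cut y (g (x ∷ p))) ≈⟨ +-cong (Cut-∷ x u _)
        (Cut-assoc u (λ p → g (x ∷ p))) ⟩
    (g [] [] (x ∷ u) ⊕ Cut u (λ q r → g [] (x ∷ q) r)) ⊕ Cut u (λ y r → Cut y (λ p q → g (x ∷ p) q r))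
                                                                                  ≈⟨ +-assoc _ _ _ ⟩
    g [] [] (x ∷ u) ⊕ (Cut u (λ q r → g [] (x ∷ q) r) ⊕ Cut u (λ y r → Cut y (λ p q → g (x ∷ p) q r)))
                                                                                  ≈⟨ +-cong (Cut-[]
                                                                                      (λ p q → g p q
                                                                                      (x ∷ u))) (Cut-⊕ u _
                                                                                      _) ⟨
    Cut [] (λ p q → g p q (x ∷ u)) ⊕ Cut u (λ y r → g [] (x ∷ y) r ⊕ Cut y (λ p q → g (x ∷ p) q r))
                                                                                  ≈⟨ +-congˡ (Cut-cong u
                                                                                      (λ y r → Cut-∷ x y _)) ⟨
    Cut [] (λ p q → g p q (x ∷ u)) ⊕ Cut u (λ y r → Cut (x ∷ y) (λ p q → g p q r)) ≈⟨ Cut-∷ x u _ ⟨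
    Cut (x ∷ u) (λ y r → Cut y (λ p q → g p q r)) ∎

  Cut-last : ∀ (u : List A) g → (∀ p s → p ++ s ≡ u → s ≢ [] → g p s ≈ 0#) → Cut u g ≈ g u []
  Cut-last [] g h = Cut-[] g
  Cut-last (x ∷ u) g h = ≈-trans (Cut-∷ x u g) (≈-trans
      (+-cong (h [] (x ∷ u) refl (λ ())) (Cut-last u _ (λ p s e n → h (x ∷ p) s (cong (x ∷_) e) n)))
      (+-identityˡ _))

  Cut-first : ∀ (u : List A) g → (∀ p s → p ++ s ≡ u → p ≢ [] → g p s ≈ 0#) → Cut u g ≈ g [] u
  Cut-first [] g h = Cut-[] g
  Cut-first (x ∷ u) g h = ≈-trans (Cut-∷ x u g) (≈-trans
      (+-congˡ (Cut-zero∈ u (λ p s e → h (x ∷ p) s (cong (x ∷_) e) (λ ())))) (+-identityʳ _))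

  Cut-map : ∀ (ρ : A → B) u g → Cut (map ρ u) g ≈ Cut u (λ p s → g (map ρ p) (map ρ s))
  Cut-map ρ [] g = ≈-refl
  Cut-map ρ (x ∷ u) g = ≈-trans (Cut-∷ (ρ x) (map ρ u) g)
      (≈-trans (+-congˡ (Cut-map ρ u _)) (≈-sym (Cut-∷ x u _)))

  -- Sums over half-shuffles and the dendriform identities

  M : Mode → List A → List A → (List A → K) → K
  M m u v = ∑ (shuf m u v)

  M-∷ : ∀ m (x : A) u y v f → M m (x ∷ u) (y ∷ v) f ≈ M m u (y ∷ v) (λ w → f (x ∷ w)) ⊕ M m (x ∷ u) v
      (λ w → f (y ∷ w))
  M-∷ m x u y v f = ≈-trans (∑-++ (map (x ∷_) (shuf m u (y ∷ v))) _ f)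
      (+-cong (∑-map _ (shuf m u (y ∷ v)) f) (∑-map _ (shuf m (x ∷ u) v) f))

  M-cong : ∀ m (u v : List A) {f g} → (∀ w → f w ≈ g w) → M m u v f ≈ M m u v g
  M-cong m u v h = ∑-cong (shuf m u v) h

  M-cong∈ : ∀ m (u v : List A) {f g} → (∀ w → w ↭ u ++ v → f w ≈ g w) → M m u v f ≈ M m u v g
  M-cong∈ m u v h = ∑-congᴬ (All.map (h _) (shuf-↭ m u v))

  M-zero∈ : ∀ m (u v : List A) {f} → (∀ w → w ↭ u ++ v → f w ≈ 0#) → M m u v f ≈ 0#
  M-zero∈ m u v h = ∑-zeroᴬ (All.map (h _) (shuf-↭ m u v))

  M-map : ∀ (ρ : A → B) m u v f → M m (map ρ u) (map ρ v) f ≈ M m u v (λ w → f (map ρ w))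
  M-map ρ m u v f = ≈-trans (≈-reflexive (cong (λ l → ∑ l f) (shuf-map ρ m u v)))
      (∑-map (map ρ) (shuf m u v) f)

  S-unitˡ : ∀ (v : List A) f → M S [] v f ≈ f v
  S-unitˡ v f = +-identityʳ _

  S-unitʳ : ∀ (u : List A) f → M S u [] f ≈ f u
  S-unitʳ [] f = +-identityʳ _
  S-unitʳ (x ∷ u) f = +-identityʳ _

  P-zero : ∀ (v : List A) f → M P [] v f ≈ 0#
  P-zero v f = ≈-refl

  Q-zero : ∀ (u : List A) f → M Q u [] f ≈ 0#
  Q-zero [] f = ≈-refl
  Q-zero (x ∷ u) f = ≈-refl

  P-unit : ∀ (u : List A) f → u ≢ [] → M P u [] f ≈ f u
  P-unit [] f n = ⊥-elim (n refl)
  P-unit (x ∷ u) f n = +-identityʳ _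

  Q-unit : ∀ (v : List A) f → v ≢ [] → M Q [] v f ≈ f v
  Q-unit [] f n = ⊥-elim (n refl)
  Q-unit (y ∷ v) f n = +-identityʳ _

  -- The hypothesis excludes the pair of empty words, whose only shuffle has no last letter and so
  -- belongs to neither half.
  S≈P⊕Q : ∀ (u v : List A) f → 1 ≤ length u + length v → M S u v f ≈ M P u v f ⊕ M Q u v f
  S≈P⊕Q [] (y ∷ v) f _ = ≈-sym (+-identityˡ _)
  S≈P⊕Q (x ∷ u) [] f _ = ≈-sym (+-identityʳ _)
  S≈P⊕Q (x ∷ u) (y ∷ v) f _ = begin
    M S (x ∷ u) (y ∷ v) f ≈⟨ M-∷ S x u y v f ⟩
    M S u (y ∷ v) (λ w → f (x ∷ w)) ⊕ M S (x ∷ u) v (λ w → f (y ∷ w)) ≈⟨ +-cong (S≈P⊕Q u (y ∷ v) _ (ne u))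
        (S≈P⊕Q (x ∷ u) v _ (s≤s z≤n)) ⟩
    _ ≈⟨ ⊕-interchange _ _ _ _ ⟩
    _ ≈⟨ +-cong (M-∷ P x u y v f) (M-∷ Q x u y v f) ⟨
    M P (x ∷ u) (y ∷ v) f ⊕ M Q (x ∷ u) (y ∷ v) f ∎
    where
      ne : ∀ u → 1 ≤ length u + suc (length v)
      ne [] = s≤s z≤n
      ne (_ ∷ _) = s≤s z≤n

  -- The induction step shared by the identities for three words: the first letter of a triple
  -- shuffle comes from one of the three words, and once `f` has absorbed that letter, the identity
  -- for the shortened triple applies.
  M-step₃ : ∀ m₁ m₂ m₃ m₄ (x : A) u y v z w f →
    let AssocAt : List _ → List _ → List _ → (List _ → K) → Set _
        AssocAt u v w f = M m₁ u v (λ p → M m₂ p w f) ≈ M m₃ v w (λ q → M m₄ u q f)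
    in (∀ f → AssocAt u (y ∷ v) (z ∷ w) f) → (∀ f → AssocAt (x ∷ u) v (z ∷ w) f) →
        (∀ f → AssocAt (x ∷ u) (y ∷ v) w f) →
       AssocAt (x ∷ u) (y ∷ v) (z ∷ w) f
  M-step₃ m₁ m₂ m₃ m₄ x u y v z w f h₁ h₂ h₃ = begin
    M m₁ (x ∷ u) (y ∷ v) (λ p → M m₂ p (z ∷ w) f) ≈⟨ M-∷ m₁ x u y v _ ⟩
    M m₁ u (y ∷ v) (λ p → M m₂ (x ∷ p) (z ∷ w) f) ⊕ M m₁ (x ∷ u) v (λ p → M m₂ (y ∷ p) (z ∷ w) f)
      ≈⟨ +-cong (≈-trans (M-cong m₁ u (y ∷ v) (λ p → M-∷ m₂ x p z w f)) (∑-⊕ (shuf m₁ u (y ∷ v)) _ _))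
                (≈-trans (M-cong m₁ (x ∷ u) v (λ p → M-∷ m₂ y p z w f)) (∑-⊕ (shuf m₁ (x ∷ u) v) _ _)) ⟩
    (M m₁ u (y ∷ v) (λ p → M m₂ p (z ∷ w) fx) ⊕ M m₁ u (y ∷ v) (λ p → M m₂ (x ∷ p) w fz))
      ⊕ (M m₁ (x ∷ u) v (λ p → M m₂ p (z ∷ w) fy) ⊕ M m₁ (x ∷ u) v (λ p → M m₂ (y ∷ p) w fz))
      ≈⟨ ⊕-interchange _ _ _ _ ⟩
    (M m₁ u (y ∷ v) (λ p → M m₂ p (z ∷ w) fx) ⊕ M m₁ (x ∷ u) v (λ p → M m₂ p (z ∷ w) fy))
      ⊕ (M m₁ u (y ∷ v) (λ p → M m₂ (x ∷ p) w fz) ⊕ M m₁ (x ∷ u) v (λ p → M m₂ (y ∷ p) w fz))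
      ≈⟨ +-cong (+-cong (h₁ fx) (h₂ fy)) (≈-trans (≈-sym (M-∷ m₁ x u y v (λ p → M m₂ p w fz))) (h₃ fz)) ⟩
    (M m₃ (y ∷ v) (z ∷ w) (λ q → M m₄ u q fx) ⊕ M m₃ v (z ∷ w) (λ q → M m₄ (x ∷ u) q fy)) ⊕ M m₃ (y ∷ v) w
        (λ q → M m₄ (x ∷ u) q fz)
      ≈⟨ +-congʳ (+-congʳ (M-∷ m₃ y v z w _)) ⟩
    ((M m₃ v (z ∷ w) (λ q → M m₄ u (y ∷ q) fx) ⊕ M m₃ (y ∷ v) w (λ q → M m₄ u (z ∷ q) fx))
       ⊕ M m₃ v (z ∷ w) (λ q → M m₄ (x ∷ u) q fy)) ⊕ M m₃ (y ∷ v) w (λ q → M m₄ (x ∷ u) q fz)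
      ≈⟨ +-assoc _ _ _ ⟩
    (M m₃ v (z ∷ w) (λ q → M m₄ u (y ∷ q) fx) ⊕ M m₃ (y ∷ v) w (λ q → M m₄ u (z ∷ q) fx))
       ⊕ (M m₃ v (z ∷ w) (λ q → M m₄ (x ∷ u) q fy) ⊕ M m₃ (y ∷ v) w (λ q → M m₄ (x ∷ u) q fz))
      ≈⟨ ⊕-interchange _ _ _ _ ⟩
    (M m₃ v (z ∷ w) (λ q → M m₄ u (y ∷ q) fx) ⊕ M m₃ v (z ∷ w) (λ q → M m₄ (x ∷ u) q fy))
       ⊕ (M m₃ (y ∷ v) w (λ q → M m₄ u (z ∷ q) fx) ⊕ M m₃ (y ∷ v) w (λ q → M m₄ (x ∷ u) q fz))
      ≈⟨ +-cong (≈-trans (M-cong m₃ v (z ∷ w) (λ q → M-∷ m₄ x u y q f)) (∑-⊕ (shuf m₃ v (z ∷ w)) _ _))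
                (≈-trans (M-cong m₃ (y ∷ v) w (λ q → M-∷ m₄ x u z q f)) (∑-⊕ (shuf m₃ (y ∷ v) w) _ _)) ⟨
    M m₃ v (z ∷ w) (λ q → M m₄ (x ∷ u) (y ∷ q) f) ⊕ M m₃ (y ∷ v) w (λ q → M m₄ (x ∷ u) (z ∷ q) f)
      ≈⟨ M-∷ m₃ y v z w _ ⟨
    M m₃ (y ∷ v) (z ∷ w) (λ q → M m₄ (x ∷ u) q f) ∎
    where
      fx = λ q → f (x ∷ q)
      fy = λ q → f (y ∷ q)
      fz = λ q → f (z ∷ q)

  -- The axiom (u ≺ v) ≺ w = u ≺ (v · w). The conventions of `shuf` for empty words are chosen so
  -- that no nonemptiness has to be assumed.
  P-assoc : ∀ (u v w : List A) f → M P u v (λ p → M P p w f) ≈ M S v w (λ q → M P u q f)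
  P-assoc [] v w f = ≈-trans (P-zero v (λ p → M P p w f)) (≈-sym (∑-zero (shuf S v w) (λ q → P-zero q f)))
  P-assoc (x ∷ u) [] w f = ≈-trans (+-identityʳ _) (≈-sym (S-unitˡ w (λ q → M P (x ∷ u) q f)))
  P-assoc (x ∷ u) (y ∷ v) [] f = ≈-trans (M-cong∈ P (x ∷ u) (y ∷ v) (λ p e → P-unit p f (↭-∷≢[] e)))
      (≈-sym (S-unitʳ (y ∷ v) (λ q → M P (x ∷ u) q f)))
  P-assoc (x ∷ u) (y ∷ v) (z ∷ w) f = M-step₃ P P S P x u y v z w f
    (P-assoc u (y ∷ v) (z ∷ w)) (P-assoc (x ∷ u) v (z ∷ w)) (P-assoc (x ∷ u) (y ∷ v) w)

  -- The axiom (u · v) ≻ w = u ≻ (v ≻ w), again valid for empty words.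
  Q-assoc : ∀ (u v w : List A) f → M S u v (λ p → M Q p w f) ≈ M Q v w (λ q → M Q u q f)
  Q-assoc u v [] f = ≈-trans (∑-zero (shuf S u v) (λ p → Q-zero p f)) (≈-sym (Q-zero v _))
  Q-assoc u [] (z ∷ w) f = ≈-trans (S-unitʳ u _) (≈-sym (+-identityʳ _))
  Q-assoc [] (y ∷ v) (z ∷ w) f = ≈-trans (S-unitˡ (y ∷ v) (λ p → M Q p (z ∷ w) f))
    (M-cong∈ Q (y ∷ v) (z ∷ w) (λ q e → ≈-sym (Q-unit q f (↭-∷≢[] e))))
  Q-assoc (x ∷ u) (y ∷ v) (z ∷ w) f = M-step₃ S Q Q Q x u y v z w f
    (Q-assoc u (y ∷ v) (z ∷ w)) (Q-assoc (x ∷ u) v (z ∷ w)) (Q-assoc (x ∷ u) (y ∷ v) w)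

  -- A prefix of a shuffle is an arbitrary shuffle of two prefixes, while the suffix keeps the last
  -- letter and therefore the mode `m`. If the suffix is empty, the last letter lies in the prefix
  -- and the right-hand side cannot see the mode; `g p [] ≈ 0#` removes this cut.
  Cut-M : ∀ m (u v : List A) g → (∀ p → g p [] ≈ 0#) →
    M m u v (λ w → Cut w g) ≈ Cut u (λ u₁ u₂ → Cut v (λ v₁ v₂ → M S u₁ v₁ (λ w₁ → M m u₂ v₂ (g w₁))))
  Cut-M m [] v g g0 = ≈-sym (begin
    Cut [] (λ u₁ u₂ → Cut v (λ v₁ v₂ → M S u₁ v₁ (λ w₁ → M m u₂ v₂ (g w₁)))) ≈⟨ Cut-[]
        (λ u₁ u₂ → Cut v (λ v₁ v₂ → M S u₁ v₁ (λ w₁ → M m u₂ v₂ (g w₁)))) ⟩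
    Cut v (λ v₁ v₂ → M S [] v₁ (λ w₁ → M m [] v₂ (g w₁))) ≈⟨ Cut-cong v
        (λ v₁ v₂ → S-unitˡ v₁ (λ w₁ → M m [] v₂ (g w₁))) ⟩
    Cut v (λ v₁ v₂ → M m [] v₂ (g v₁)) ≈⟨ edge m v ⟩
    M m [] v (λ w → Cut w g) ∎)
    where
      Q-edge : ∀ v₁ v₂ → M Q [] v₂ (g v₁) ≈ g v₁ v₂
      Q-edge v₁ [] = ≈-sym (g0 v₁)
      Q-edge v₁ (y ∷ v₂) = +-identityʳ _
      edge : ∀ m v → Cut v (λ v₁ v₂ → M m [] v₂ (g v₁)) ≈ M m [] v (λ w → Cut w g)
      edge S v = ≈-trans (Cut-cong v (λ v₁ v₂ → S-unitˡ v₂ (g v₁))) (≈-sym (+-identityʳ _))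
      edge P v = ∑-zero (decs v) (λ _ → ≈-refl)
      edge Q [] = ≈-trans (Cut-[] (λ v₁ v₂ → M Q [] v₂ (g v₁))) ≈-refl
      edge Q (y ∷ v) = ≈-trans (Cut-cong (y ∷ v) Q-edge) (≈-sym (+-identityʳ _))
  Cut-M m (x ∷ u) [] g g0 = ≈-sym (begin
    Cut (x ∷ u) (λ u₁ u₂ → Cut [] (λ v₁ v₂ → M S u₁ v₁ (λ w₁ → M m u₂ v₂ (g w₁))))
      ≈⟨ Cut-cong (x ∷ u) (λ u₁ u₂ → ≈-trans (Cut-[] (λ v₁ v₂ → M S u₁ v₁ (λ w₁ → M m u₂ v₂ (g w₁))))
          (S-unitʳ u₁ (λ w₁ → M m u₂ [] (g w₁)))) ⟩
    Cut (x ∷ u) (λ u₁ u₂ → M m u₂ [] (g u₁)) ≈⟨ edge m ⟩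
    M m (x ∷ u) [] (λ w → Cut w g) ∎)
    where
      P-edge : ∀ u₁ u₂ → M P u₂ [] (g u₁) ≈ g u₁ u₂
      P-edge u₁ [] = ≈-sym (g0 u₁)
      P-edge u₁ (_ ∷ _) = +-identityʳ _
      edge : ∀ m → Cut (x ∷ u) (λ u₁ u₂ → M m u₂ [] (g u₁)) ≈ M m (x ∷ u) [] (λ w → Cut w g)
      edge S = ≈-trans (Cut-cong (x ∷ u) (λ u₁ u₂ → S-unitʳ u₂ (g u₁))) (≈-sym (+-identityʳ _))
      edge P = ≈-trans (Cut-cong (x ∷ u) P-edge) (≈-sym (+-identityʳ _))
      edge Q = ∑-zero (decs (x ∷ u)) (λ p → Q-zero (proj₂ p) (g (proj₁ p)))
  Cut-M {A = A} m (x ∷ u) (y ∷ v) g g0 = begin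
    M m (x ∷ u) (y ∷ v) (λ w → Cut w g) ≈⟨ M-∷ m x u y v _ ⟩
    M m u (y ∷ v) (λ w → Cut (x ∷ w) g) ⊕ M m (x ∷ u) v (λ w → Cut (y ∷ w) g)
      ≈⟨ +-cong (≈-trans (M-cong m u (y ∷ v) (λ w → Cut-∷ x w g)) (∑-⊕ (shuf m u (y ∷ v)) _ _))
                (≈-trans (M-cong m (x ∷ u) v (λ w → Cut-∷ y w g)) (∑-⊕ (shuf m (x ∷ u) v) _ _)) ⟩
    (M m u (y ∷ v) (λ w → g [] (x ∷ w)) ⊕ M m u (y ∷ v) (λ w → Cut w gx))
      ⊕ (M m (x ∷ u) v (λ w → g [] (y ∷ w)) ⊕ M m (x ∷ u) v (λ w → Cut w gy)) ≈⟨ ⊕-interchange _ _ _ _ ⟩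
    (M m u (y ∷ v) (λ w → g [] (x ∷ w)) ⊕ M m (x ∷ u) v (λ w → g [] (y ∷ w)))
      ⊕ (M m u (y ∷ v) (λ w → Cut w gx) ⊕ M m (x ∷ u) v (λ w → Cut w gy))
      ≈⟨ +-cong (M-∷ m x u y v (g [])) (+-cong (≈-sym
          (ihx (Cut-M m u (y ∷ v) (λ p → g (x ∷ p)) (λ p → g0 (x ∷ p)))))
          (≈-sym (ihy (Cut-M m (x ∷ u) v (λ p → g (y ∷ p)) (λ p → g0 (y ∷ p)))))) ⟨
    a₀ ⊕ ((X ⊕ Y₁) ⊕ (Z ⊕ Y₂)) ≈⟨ +-congˡ (≈-trans (+-congˡ (+-comm _ _))
        (≈-trans (+-assoc _ _ _) (≈-trans (+-congˡ (≈-trans (≈-sym (+-assoc _ _ _)) (+-comm _ _)))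
        (⊕-swapˡ _ _ _)))) ⟩
    a₀ ⊕ (Z ⊕ (X ⊕ (Y₁ ⊕ Y₂))) ≈⟨ +-assoc _ _ _ ⟨
    (a₀ ⊕ Z) ⊕ (X ⊕ (Y₁ ⊕ Y₂)) ≈⟨ +-cong headEq tailEq ⟨
    G [] (x ∷ u) ⊕ Cut u (λ u₁ u₂ → G (x ∷ u₁) u₂) ≈⟨ Cut-∷ x u G ⟨
    Cut (x ∷ u) G ∎
    where
      gx = λ p → g (x ∷ p)
      gy = λ p → g (y ∷ p)
      H : (List A → List A → K) → List A → List A → List A → List A → K
      H g u₁ u₂ v₁ v₂ = M S u₁ v₁ (λ w₁ → M m u₂ v₂ (g w₁))
      G : List A → List A → K
      G u₁ u₂ = Cut (y ∷ v) (H g u₁ u₂)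
      -- The terms are sorted by the prefixes cut off: none in `a₀`, only one of the left word in
      -- `X`, only one of the right word in `Z`, and both in `Y₁` and `Y₂`, where the shuffled
      -- prefix begins with `x` and `y` respectively.
      a₀ = M m (x ∷ u) (y ∷ v) (g [])
      X = Cut u (λ u₁ u₂ → M m u₂ (y ∷ v) (g (x ∷ u₁)))
      Z = Cut v (λ v₁ v₂ → M m (x ∷ u) v₂ (g (y ∷ v₁)))
      Y₁ = Cut u (λ u₁ u₂ → Cut v (λ v₁ v₂ → H gx u₁ u₂ (y ∷ v₁) v₂))
      Y₂ = Cut u (λ u₁ u₂ → Cut v (λ v₁ v₂ → H gy (x ∷ u₁) u₂ v₁ v₂))
      ihx : M m u (y ∷ v) (λ w → Cut w gx) ≈ Cut u (λ u₁ u₂ → Cut (y ∷ v) (H gx u₁ u₂)) → M m u (y ∷ v)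
          (λ w → Cut w gx) ≈ X ⊕ Y₁
      ihx h = begin
        M m u (y ∷ v) (λ w → Cut w gx) ≈⟨ h ⟩
        Cut u (λ u₁ u₂ → Cut (y ∷ v) (H gx u₁ u₂))
          ≈⟨ Cut-cong u (λ u₁ u₂ → ≈-trans (Cut-∷ y v (H gx u₁ u₂))
              (+-congʳ (S-unitʳ u₁ (λ w₁ → M m u₂ (y ∷ v) (gx w₁))))) ⟩
        Cut u (λ u₁ u₂ → M m u₂ (y ∷ v) (gx u₁) ⊕ Cut v (λ v₁ v₂ → H gx u₁ u₂ (y ∷ v₁) v₂)) ≈⟨ Cut-⊕ u _ _ ⟩
        X ⊕ Y₁ ∎
      ihy : M m (x ∷ u) v (λ w → Cut w gy) ≈ Cut (x ∷ u) (λ u₁ u₂ → Cut v (H gy u₁ u₂)) → M m (x ∷ u) v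
          (λ w → Cut w gy) ≈ Z ⊕ Y₂
      ihy h = begin
        M m (x ∷ u) v (λ w → Cut w gy) ≈⟨ h ⟩
        Cut (x ∷ u) (λ u₁ u₂ → Cut v (H gy u₁ u₂)) ≈⟨ Cut-∷ x u _ ⟩
        Cut v (H gy [] (x ∷ u)) ⊕ Y₂ ≈⟨ +-congʳ (Cut-cong v
            (λ v₁ v₂ → S-unitˡ v₁ (λ w₁ → M m (x ∷ u) v₂ (gy w₁)))) ⟩
        Z ⊕ Y₂ ∎
      headEq : G [] (x ∷ u) ≈ a₀ ⊕ Z
      headEq = ≈-trans (Cut-∷ y v (H g [] (x ∷ u)))
          (+-cong (+-identityʳ _) (Cut-cong v (λ v₁ v₂ → S-unitˡ (y ∷ v₁) (λ w₁ → M m (x ∷ u) v₂ (g w₁)))))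
      tailEq : Cut u (λ u₁ u₂ → G (x ∷ u₁) u₂) ≈ X ⊕ (Y₁ ⊕ Y₂)
      tailEq = begin
        Cut u (λ u₁ u₂ → G (x ∷ u₁) u₂)
          ≈⟨ Cut-cong u (λ u₁ u₂ → ≈-trans (Cut-∷ y v (H g (x ∷ u₁) u₂)) (+-cong (+-identityʳ _)
               (≈-trans (Cut-cong v (λ v₁ v₂ → M-∷ S x u₁ y v₁ (λ w₁ → M m u₂ v₂ (g w₁)))) (Cut-⊕ v _ _)))) ⟩
        Cut u (λ u₁ u₂ → M m u₂ (y ∷ v) (gx u₁) ⊕ (Cut v (λ v₁ v₂ → H gx u₁ u₂ (y ∷ v₁) v₂) ⊕ Cut v
            (λ v₁ v₂ → H gy (x ∷ u₁) u₂ v₁ v₂)))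
          ≈⟨ ≈-trans (Cut-⊕ u _ _) (+-congˡ (Cut-⊕ u _ _)) ⟩
        X ⊕ (Y₁ ⊕ Y₂) ∎

  -- The transposed coproduct: products and coassociativity

  []-∧ : ∀ b c x → [ b ∧ c ] x ≡ [ b ] [ c ] x
  []-∧ true c x = refl
  []-∧ false c x = refl

  -- cop χ f is the transpose of the coproduct on w, restricted to the cuts for
  -- which χ accepts the truth value of "max w lies in the left part". The trivial
  -- cuts are included.
  full right left : Bool → Bool
  full _ = true
  right b = not b
  left b = b

  accept : (Bool → Bool) → Word → Word → Word → Bool
  accept χ w p s = disjointB p s ∧ χ (memb (maxW w) p)

  cop : (Bool → Bool) → (Word → Word → K) → Word → K
  cop χ f w = Cut w (λ p s → [ accept χ w p s ] f (pack p) (pack s))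

  M• : Mode → Word → Word → (Word → K) → K
  M• m u v = M m u (shift (maxW u) v)

  cop-cong : ∀ χ w {f g} → (∀ p s → length p + length s ≡ length w → f p s ≈ g p s) → cop χ f w ≈ cop χ g w
  cop-cong χ w h = Cut-cong∈ w (λ p s e → []-cong (accept χ w p s) (h (pack p) (pack s) (len p s e)))
    where
      len : ∀ p s → p ++ s ≡ w → length (pack p) + length (pack s) ≡ length w
      len p s e = ≡.trans (cong₂ _+_ (length-pack p) (length-pack s))
          (≡.trans (≡.sym (length-++ p)) (cong length e))

  cop-⊕ : ∀ χ w f g → cop χ (λ p s → f p s ⊕ g p s) w ≈ cop χ f w ⊕ cop χ g w
  cop-⊕ χ w f g = ≈-trans (Cut-cong w (λ p s → []-⊕ (accept χ w p s) _ _)) (Cut-⊕ w _ _)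

  cop-zero : ∀ χ w {f} → (∀ p s → length p + length s ≡ length w → f p s ≈ 0#) → cop χ f w ≈ 0#
  cop-zero χ w h = ≈-trans (cop-cong χ w h) (∑-zero (decs w) (λ p → []-zero (accept χ w (proj₁ p) (proj₂ p))))

  -- The maximal letter of a product comes from the right factor; when that factor is
  -- empty, only a χ that ignores the position of the maximum is admissible.
  Compatible : (Bool → Bool) → Word → Set
  Compatible χ v = v ≢ [] ⊎ (∀ b → χ b ≡ true)

  -- The maximum of a shifted product belongs to its right factor, so `u` is cut freely and `χ`
  -- restricts the cut of `v` alone. The two sides of a cut are standardised separately, and each
  -- becomes a shifted shuffle of packed parts.
  cop-M : ∀ χ m u v f → Pos u → Pos v → Compatible χ v → (∀ p → f p [] ≈ 0#) →
    M• m u v (cop χ f) ≈ cop full (λ u₁ u₂ → cop χ (λ v₁ v₂ → M• S u₁ v₁ (λ w₁ → M• m u₂ v₂ (f w₁))) v) u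
  cop-M χ m u v f pu pv good f0 = begin
    M m u (shift k v) (cop χ f)
      ≈⟨ M-cong∈ m u (shift k v) (λ w e → Cut-cong w (λ p s →
           ≈-reflexive (cong (λ n → [ disjointB p s ∧ χ (memb n p) ] f (pack p) (pack s))
               (maxW-product u v e)))) ⟩
    M m u (shift k v) (λ w → Cut w g)
      ≈⟨ Cut-M m u (shift k v) g (λ p → ≈-trans ([]-cong (disjointB p [] ∧ χ (memb N p)) (f0 (pack p)))
          ([]-zero (disjointB p [] ∧ χ (memb N p)))) ⟩
    Cut u (λ u₁ u₂ → Cut (shift k v) (λ v₁ v₂ → M S u₁ v₁ (λ w₁ → M m u₂ v₂ (g w₁))))
      ≈⟨ Cut-cong u (λ u₁ u₂ → Cut-map (k +_) v _) ⟩
    Cut u (λ u₁ u₂ → Cut v (λ v₁ v₂ → M S u₁ (shift k v₁) (λ w₁ → M m u₂ (shift k v₂) (g w₁))))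
      ≈⟨ Cut-cong∈ u (λ u₁ u₂ eu → ≈-trans (Cut-cong∈ v (λ v₁ v₂ ev → point u₁ u₂ v₁ v₂ eu ev))
          ([]-∑ (accept full u u₁ u₂) (decs v) _)) ⟩
    cop full (λ u₁ u₂ → cop χ (λ v₁ v₂ → M• S u₁ v₁ (λ w₁ → M• m u₂ v₂ (f w₁))) v) u ∎
    where
      k = maxW u
      -- The maximum of every shuffle occurring here; with it the test depends on the two sides of
      -- the cut only, as `Cut-M` demands.
      N = maxW u + maxW v
      g : Word → Word → K
      g p s = [ disjointB p s ∧ χ (memb N p) ] f (pack p) (pack s)
      χ-eq : ∀ {u₁ v₁ w₁} → All (_≤ k) u₁ → w₁ ↭ u₁ ++ shift k v₁ → χ (memb N w₁) ≡ χ (memb (maxW v) v₁)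
      χ-eq {u₁} {v₁} {w₁} b e = go good
        where
          go : Compatible χ v → χ (memb N w₁) ≡ χ (memb (maxW v) v₁)
          go (inj₁ n) = cong χ (memb-max-product b (maxW-pos pv n) e)
          go (inj₂ t) = ≡.trans (t _) (≡.sym (t _))
      point : ∀ u₁ u₂ v₁ v₂ → u₁ ++ u₂ ≡ u → v₁ ++ v₂ ≡ v →
        M S u₁ (shift k v₁) (λ w₁ → M m u₂ (shift k v₂) (g w₁)) ≈
        [ accept full u u₁ u₂ ] [ accept χ v v₁ v₂ ] M• S (pack u₁) (pack v₁)
            (λ w₁ → M• m (pack u₂) (pack v₂) (f w₁))
      point u₁ u₂ v₁ v₂ eu ev = begin
        M S u₁ (shift k v₁) (λ w₁ → M m u₂ (shift k v₂) (g w₁))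
          ≈⟨ M-cong∈ S u₁ (shift k v₁) (λ w₁ e₁ → M-cong∈ m u₂ (shift k v₂)
              (λ w₂ e₂ → ≈-reflexive (term w₁ w₂ e₁ e₂))) ⟩
        M S u₁ (shift k v₁) (λ w₁ → M m u₂ (shift k v₂) (λ w₂ → [ C ] f (map ρ₁ w₁) (map ρ₂ w₂)))
          ≈⟨ M-cong S u₁ (shift k v₁) (λ w₁ → []-∑ C (shuf m u₂ (shift k v₂)) _) ⟩
        M S u₁ (shift k v₁) (λ w₁ → [ C ] M m u₂ (shift k v₂) (λ w₂ → f (map ρ₁ w₁) (map ρ₂ w₂)))
          ≈⟨ []-∑ C (shuf S u₁ (shift k v₁)) _ ⟩
        [ C ] M S u₁ (shift k v₁) (λ w₁ → M m u₂ (shift k v₂) (λ w₂ → f (map ρ₁ w₁) (map ρ₂ w₂)))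
          ≈⟨ []-cong C (≈-sym (M-map ρ₁ S u₁ (shift k v₁)
              (λ w₁ → M m u₂ (shift k v₂) (λ w₂ → f w₁ (map ρ₂ w₂))))) ⟩
        [ C ] M S (map ρ₁ u₁) (map ρ₁ (shift k v₁)) (λ w₁ → M m u₂ (shift k v₂) (λ w₂ → f w₁ (map ρ₂ w₂)))
          ≈⟨ []-cong C (M-cong S (map ρ₁ u₁) (map ρ₁ (shift k v₁))
              (λ w₁ → ≈-sym (M-map ρ₂ m u₂ (shift k v₂) (f w₁)))) ⟩
        [ C ] M S (map ρ₁ u₁) (map ρ₁ (shift k v₁)) (λ w₁ → M m (map ρ₂ u₂) (map ρ₂ (shift k v₂)) (f w₁))
          ≡⟨ cong₂ (λ a b → [ C ] M S a b (λ w₁ → M m (map ρ₂ u₂) (map ρ₂ (shift k v₂)) (f w₁)))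
               (map-cnt-low p₁ q₁ b₁) (map-cnt-high p₁ q₁ b₁) ⟩
        [ C ] M• S (pack u₁) (pack v₁) (λ w₁ → M m (map ρ₂ u₂) (map ρ₂ (shift k v₂)) (f w₁))
          ≡⟨ cong₂ (λ a b → [ C ] M• S (pack u₁) (pack v₁) (λ w₁ → M m a b (f w₁)))
               (map-cnt-low p₂ q₂ b₂) (map-cnt-high p₂ q₂ b₂) ⟩
        [ C ] M• S (pack u₁) (pack v₁) (λ w₁ → M• m (pack u₂) (pack v₂) (f w₁))
          ≡⟨ []-∧ (accept full u u₁ u₂) (accept χ v v₁ v₂) _ ⟩
        [ accept full u u₁ u₂ ] [ accept χ v v₁ v₂ ] M• S (pack u₁) (pack v₁)
            (λ w₁ → M• m (pack u₂) (pack v₂) (f w₁)) ∎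
        where
          p₁ = Pos-⊆ {u₁} (⊆-++ˡ eu) pu
          p₂ = Pos-⊆ {u₂} (⊆-++ʳ eu) pu
          q₁ = Pos-⊆ {v₁} (⊆-++ˡ ev) pv
          q₂ = Pos-⊆ {v₂} (⊆-++ʳ ev) pv
          b₁ = All-⊆ {x = u₁} (⊆-++ˡ eu) (≤maxW u)
          b₂ = All-⊆ {x = u₂} (⊆-++ʳ eu) (≤maxW u)
          C = accept full u u₁ u₂ ∧ accept χ v v₁ v₂
          ρ₁ = cnt (u₁ ++ shift k v₁)
          ρ₂ = cnt (u₂ ++ shift k v₂)
          pos-++ : ∀ {a b} → Pos a → Pos b → Pos (a ++ shift k b)
          pos-++ pa pb = Allₚ.++⁺ pa (Allₚ.map⁺ (All.map (λ p → ≤-trans p (ℕ.m≤n+m _ k)) pb))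
          term : ∀ w₁ w₂ → w₁ ↭ u₁ ++ shift k v₁ → w₂ ↭ u₂ ++ shift k v₂ →
                  g w₁ w₂ ≡ [ C ] f (map ρ₁ w₁) (map ρ₂ w₂)
          term w₁ w₂ e₁ e₂ rewrite pack-↭ (pos-++ p₁ q₁) e₁ | pack-↭ (pos-++ p₂ q₂) e₂
            | disjointB-product b₁ b₂ q₁ q₂ e₁ e₂ | χ-eq {u₁} {v₁} b₁ e₁
            | ∧-identityʳ (disjointB u₁ u₂) | ∧-assoc (disjointB u₁ u₂) (disjointB v₁ v₂)
                (χ (memb (maxW v) v₁)) = refl

  cop-pack : ∀ χ f y → Pos y → cop χ f (pack y) ≈ cop χ f y
  cop-pack χ f y py = begin
    cop χ f (pack y) ≡⟨ cong (cop χ f) (pack≡ py) ⟩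
    cop χ f (map (cnt y) y) ≈⟨ Cut-map (cnt y) y _ ⟩
    Cut y (λ p s → [ accept χ (map (cnt y) y) (map (cnt y) p) (map (cnt y) s) ] f (pack (map (cnt y) p))
        (pack (map (cnt y) s)))
      ≈⟨ Cut-cong∈ y (λ p s e → ≈-reflexive (same p s e)) ⟩
    cop χ f y ∎
    where
      same : ∀ p s → p ++ s ≡ y → [ accept χ (map (cnt y) y) (map (cnt y) p) (map (cnt y) s) ] f
          (pack (map (cnt y) p)) (pack (map (cnt y) s))
                                 ≡ [ accept χ y p s ] f (pack p) (pack s)
      same p s e rewrite disjointB-map-cnt {y} p s (⊆-++ˡ e) (⊆-++ʳ e) | memb-max-map-cnt {y} {p} (⊆-++ˡ e)
        | pack-map-cnt {p} py (⊆-++ˡ e) | pack-map-cnt {s} py (⊆-++ʳ e) = refl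

  -- The condition under which (id ⊗ Δ_χ₂) Δ_χ₁ and (Δ_χ₄ ⊗ id) Δ_χ₃ select the same cuts into three
  -- parts `p`, `q`, `r`. Its instances are coassociativity and two of the codendriform axioms.
  Coherent : (χ₁ χ₂ χ₃ χ₄ : Bool → Bool) → Set
  Coherent χ₁ χ₂ χ₃ χ₄ = ∀ p q r →
    χ₁ (memb (maxW (p ++ q ++ r)) p) ∧ χ₂ (memb (maxW (q ++ r)) q) ≡
    χ₃ (memb (maxW (p ++ q ++ r)) (p ++ q)) ∧ χ₄ (memb (maxW (p ++ q)) p)

  disjointB-assoc : ∀ p q r → disjointB p (q ++ r) ∧ disjointB q r ≡ disjointB (p ++ q) r ∧ disjointB p q
  disjointB-assoc p q r = bool-ext fwd bwd
    where
      fwd : disjointB p (q ++ r) ∧ disjointB q r ≡ true → disjointB (p ++ q) r ∧ disjointB p q ≡ true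
      fwd e with ∧-split (disjointB p (q ++ r)) e
      ... | d₁ , d₂ = ∧-join (⇒disjointB (p ++ q) r D)
          (⇒disjointB p q (λ i j → disjointB⇒ p (q ++ r) d₁ i (∈-++⁺ˡ j)))
        where
          D : Disjoint (p ++ q) r
          D i j with ∈-++⁻ p i
          ... | inj₁ k = disjointB⇒ p (q ++ r) d₁ k (∈-++⁺ʳ q j)
          ... | inj₂ k = disjointB⇒ q r d₂ k j
      bwd : disjointB (p ++ q) r ∧ disjointB p q ≡ true → disjointB p (q ++ r) ∧ disjointB q r ≡ true
      bwd e with ∧-split (disjointB (p ++ q) r) e
      ... | d₁ , d₂ = ∧-join (⇒disjointB p (q ++ r) D)
          (⇒disjointB q r (λ i j → disjointB⇒ (p ++ q) r d₁ (∈-++⁺ʳ p i) j))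
        where
          D : Disjoint p (q ++ r)
          D i j with ∈-++⁻ q j
          ... | inj₁ k = disjointB⇒ p q d₂ i k
          ... | inj₂ k = disjointB⇒ (p ++ q) r d₁ (∈-++⁺ˡ i) k

  ∧-interchange : ∀ a b c d → (a ∧ b) ∧ (c ∧ d) ≡ (a ∧ c) ∧ (b ∧ d)
  ∧-interchange false b c d = refl
  ∧-interchange true true c d = refl
  ∧-interchange true false true d = refl
  ∧-interchange true false false d = refl

  cop-coassoc : ∀ {χ₁ χ₂ χ₃ χ₄} → Coherent χ₁ χ₂ χ₃ χ₄ → ∀ (f : Word → Word → Word → K) w → Pos w →
    cop χ₁ (λ p y → cop χ₂ (f p) y) w ≈ cop χ₃ (λ y r → cop χ₄ (λ p q → f p q r) y) w
  cop-coassoc {χ₁} {χ₂} {χ₃} {χ₄} coh f w pw = begin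
    cop χ₁ (λ p y → cop χ₂ (f p) y) w
      ≈⟨ Cut-cong∈ w (λ p y e → ≈-trans ([]-cong (accept χ₁ w p y)
          (cop-pack χ₂ (f (pack p)) y (Pos-⊆ {y} (⊆-++ʳ e) pw)))
           (≈-sym ([]-∑ (accept χ₁ w p y) (decs y) _))) ⟩
    Cut w (λ p y → Cut y (λ q r → [ accept χ₁ w p y ] [ accept χ₂ y q r ] f (pack p) (pack q) (pack r)))
      ≈⟨ Cut-cong∈ w (λ p y e → Cut-cong∈ y (λ q r e′ → ≈-reflexive (same p y q r e e′))) ⟩
    Cut w (λ p y → Cut y (λ q r → g p q r)) ≈⟨ Cut-assoc w g ⟩
    Cut w (λ y r → Cut y (λ p q → g p q r))
      ≈⟨ Cut-cong∈ w (λ y r e → Cut-cong∈ y (λ p q e′ → ≈-reflexive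
          (cong (λ z → [ accept χ₃ w z r ] [ accept χ₄ z p q ] f (pack p) (pack q) (pack r)) e′))) ⟩
    Cut w (λ y r → Cut y (λ p q → [ accept χ₃ w y r ] [ accept χ₄ y p q ] f (pack p) (pack q) (pack r)))
      ≈⟨ Cut-cong∈ w (λ y r e → ≈-trans ([]-∑ (accept χ₃ w y r) (decs y) _)
           ([]-cong (accept χ₃ w y r) (≈-sym (cop-pack χ₄ (λ p q → f p q (pack r)) y
               (Pos-⊆ {y} (⊆-++ˡ e) pw))))) ⟩
    cop χ₃ (λ y r → cop χ₄ (λ p q → f p q r) y) w ∎
    where
      g : Word → Word → Word → K
      g p q r = [ accept χ₃ w (p ++ q) r ] [ accept χ₄ (p ++ q) p q ] f (pack p) (pack q) (pack r)
      conds : ∀ p q r → accept χ₁ (p ++ q ++ r) p (q ++ r) ∧ accept χ₂ (q ++ r) q r ≡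
                        accept χ₃ (p ++ q ++ r) (p ++ q) r ∧ accept χ₄ (p ++ q) p q
      conds p q r = ≡.trans (∧-interchange (disjointB p (q ++ r)) _ _ _)
        (≡.trans (cong₂ _∧_ (disjointB-assoc p q r) (coh p q r))
            (≡.sym (∧-interchange (disjointB (p ++ q) r) _ _ _)))
      same : ∀ p y q r → p ++ y ≡ w → q ++ r ≡ y →
        [ accept χ₁ w p y ] [ accept χ₂ y q r ] f (pack p) (pack q) (pack r) ≡ g p q r
      same p _ q r refl refl =
        ≡.trans (≡.sym ([]-∧ (accept χ₁ (p ++ q ++ r) p (q ++ r)) (accept χ₂ (q ++ r) q r) _))
          (≡.trans (cong ([_] f (pack p) (pack q) (pack r)) (conds p q r))
              ([]-∧ (accept χ₃ (p ++ q ++ r) (p ++ q) r) (accept χ₄ (p ++ q) p q) _))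

  full-coherent : Coherent full full full full
  full-coherent p q r = refl

  -- The axiom (id ⊗ Δ≻) Δ≻ = (Δ ⊗ id) Δ≻: either side keeps the maximum out of both `p` and `q`.
  right-coherent : Coherent right right right full
  right-coherent p q r = bool-ext fwd bwd
    where
      m = maxW (p ++ q ++ r)
      fwd : not (memb m p) ∧ not (memb (maxW (q ++ r)) q) ≡ true → not (memb m (p ++ q)) ∧ true ≡ true
      fwd e with memb m p in e₁ | memb (maxW (q ++ r)) q in e₂
      ... | false | false = cong (λ b → not b ∧ true) (∉⇒memb notin)
        where
          notin : m ∉ p ++ q
          notin i with ∈-++⁻ p i
          ... | inj₁ j = memb⇒∉ e₁ j
          ... | inj₂ j = memb⇒∉ e₂ (subst (_∈ q) (≡.sym (maxW-⊆ {q ++ r} (∈-++⁺ʳ p) (∈-++⁺ˡ j))) j)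
      bwd : not (memb m (p ++ q)) ∧ true ≡ true → not (memb m p) ∧ not (memb (maxW (q ++ r)) q) ≡ true
      bwd e with memb m (p ++ q) in e₁
      ... | false = ∧-join (cong not (∉⇒memb {m} {p} (λ i → memb⇒∉ {m} {p ++ q} e₁ (∈-++⁺ˡ i))))
          (cong not (∉⇒memb {_} {q} notin))
        where
          notin : maxW (q ++ r) ∉ q
          notin i with ∈-++⁻ p {q ++ r} (∈⇒maxW-∈ (∈-++⁺ʳ p (∈-++⁺ˡ {ys = r} i)))
          ... | inj₁ j = memb⇒∉ e₁ (∈-++⁺ˡ j)
          ... | inj₂ j = memb⇒∉ e₁ (∈-++⁺ʳ p (subst (_∈ q) (maxW-⊆ {q ++ r} (∈-++⁺ʳ p) j) i))

  -- The axiom (id ⊗ Δ) Δ≺ = (Δ≺ ⊗ id) Δ≺: either side puts the maximum into `p`.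
  left-coherent : Coherent left full left left
  left-coherent p q r = bool-ext fwd bwd
    where
      m = maxW (p ++ q ++ r)
      sub : (p ++ q) ⊆ʷ (p ++ q ++ r)
      sub i with ∈-++⁻ p i
      ... | inj₁ j = ∈-++⁺ˡ j
      ... | inj₂ j = ∈-++⁺ʳ p (∈-++⁺ˡ j)
      fwd : memb m p ∧ true ≡ true → memb m (p ++ q) ∧ memb (maxW (p ++ q)) p ≡ true
      fwd e with ∧-split (memb m p) e
      ... | e₁ , _ = ∧-join (∈⇒memb (∈-++⁺ˡ i)) (∈⇒memb (subst (_∈ p) (≡.sym (maxW-⊆ sub (∈-++⁺ˡ i))) i))
        where
          i : m ∈ p
          i = memb⇒∈ p e₁
      bwd : memb m (p ++ q) ∧ memb (maxW (p ++ q)) p ≡ true → memb m p ∧ true ≡ true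
      bwd e with ∧-split (memb m (p ++ q)) e
      ... | e₁ , e₂ = ∧-join (∈⇒memb (subst (_∈ p) (maxW-⊆ sub (memb⇒∈ (p ++ q) e₁)) (memb⇒∈ p e₂))) refl

  -- Products of elements, degrees, and coproducts of products with primitive factors

  ⟪R⟫ : ∀ w f → ⟪ R w , f ⟫ ≈ f w
  ⟪R⟫ w f = ≈-trans (+-identityʳ _) (*-identityˡ _)

  ⟪bilin⟫ : ∀ op x y f → ⟪ bilin op x y , f ⟫ ≈ ⟪ x , (λ u → ⟪ y , (λ v → ∑ (op u v) f) ⟫) ⟫
  ⟪bilin⟫ op x y f = begin
    ⟪ bilin op x y , f ⟫ ≈⟨ ∑-concatMap _ x _ ⟩
    ∑ x (λ p → ∑ (concatMap (λ q → map (λ w → proj₁ p ⊛ proj₁ q , w) (op (proj₂ p) (proj₂ q))) y)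
        (λ r → proj₁ r ⊛ f (proj₂ r)))
      ≈⟨ ∑-cong x (λ p → ∑-concatMap _ y _) ⟩
    ∑ x (λ p → ∑ y (λ q → ∑ (map (λ w → proj₁ p ⊛ proj₁ q , w) (op (proj₂ p) (proj₂ q)))
        (λ r → proj₁ r ⊛ f (proj₂ r))))
      ≈⟨ ∑-cong x (λ p → ∑-cong y (λ q → ≈-trans (∑-map _ (op (proj₂ p) (proj₂ q)) _)
           (≈-trans (≈-sym (∑-⊛ _ (op (proj₂ p) (proj₂ q)) f)) (*-assoc _ _ _)))) ⟩
    ∑ x (λ p → ∑ y (λ q → proj₁ p ⊛ (proj₁ q ⊛ ∑ (op (proj₂ p) (proj₂ q)) f)))
      ≈⟨ ∑-cong x (λ p → ≈-sym (∑-⊛ _ y _)) ⟩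
    ⟪ x , (λ u → ⟪ y , (λ v → ∑ (op u v) f) ⟫) ⟫ ∎

  last-just : ∀ {A : Set} (u : List A) → u ≢ [] → ∃[ z ] last u ≡ just z
  last-just [] n = ⊥-elim (n refl)
  last-just (x ∷ []) n = x , refl
  last-just (x ∷ y ∷ u) n = last-just (y ∷ u) (λ ())

  low∉shift : ∀ {z} u v → Pos v → z ∈ u → z ∉ shift (maxW u) v
  low∉shift u v pv i j with ∈-map⁻ (maxW u +_) j
  ... | c , r , refl = ℕ.<⇒≱ (ℕ.m<m+n (maxW u) (All.lookup pv r)) (All.lookup (≤maxW u) i)

  precW≡shuf : ∀ u v → u ≢ [] → Pos v → precW u v ≡ shuf P u (shift (maxW u) v)
  precW≡shuf u v n pv with last-just u n
  ... | z , e = ≡.trans (cong₂ (λ l k → filter (λ w → last w ≟M l) k) e (shuffles≡shuf u _))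
                        (filter-last-P u _ z e (low∉shift u v pv (last-∈ u e)))

  map-≢[] : ∀ {k} v → v ≢ [] → shift k v ≢ []
  map-≢[] [] n = λ _ → n refl
  map-≢[] (x ∷ v) n ()

  succW≡shuf : ∀ u v → v ≢ [] → Pos v → succW u v ≡ shuf Q u (shift (maxW u) v)
  succW≡shuf u v n pv with last-just (shift (maxW u) v) (map-≢[] v n)
  ... | z , e = ≡.trans (cong₂ (λ l k → filter (λ w → last w ≟M l) k) e (shuffles≡shuf u _))
                        (filter-last-Q u _ z e (λ i → low∉shift u v pv i (last-∈ _ e)))

  ⟪≺⟫ : ∀ {x y} → Supp (_≢ []) x → Supp Pos y → ∀ f → ⟪ x ≺ y , f ⟫ ≈
      ⟪ x , (λ u → ⟪ y , (λ v → M• P u v f) ⟫) ⟫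
  ⟪≺⟫ {x} {y} nx py f = ≈-trans (⟪bilin⟫ precW x y f)
    (⟪⟫-congᴬ {x = x} (All.map (λ {p} n → ⟪⟫-congᴬ {x = y} (All.map (λ {q} pos →
      ≈-reflexive (cong (λ l → ∑ l f) (precW≡shuf (proj₂ p) (proj₂ q) n pos))) py)) nx))

  ⟪≻⟫ : ∀ {x y} → Supp (_≢ []) y → Supp Pos y → ∀ f → ⟪ x ≻ y , f ⟫ ≈
      ⟪ x , (λ u → ⟪ y , (λ v → M• Q u v f) ⟫) ⟫
  ⟪≻⟫ {x} {y} ny py f = ≈-trans (⟪bilin⟫ succW x y f)
    (⟪⟫-cong x (λ u → ⟪⟫-congᴬ {x = y} (All.zipWith (λ {q} np →
      ≈-reflexive (cong (λ l → ∑ l f) (succW≡shuf u (proj₂ q) (proj₁ np) (proj₂ np)))) (ny , py))))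

  -- Stronger than `InDeg`: every listed word is packed of length `n`, even if its coefficients
  -- cancel. This gives access to each term separately and is preserved by all constructions below.
  Deg : ℕ → V → Set c
  Deg n = Supp (PW n)

  All-concatMap : ∀ {a b p} {A : Set a} {B : Set b} {T : B → Set p} (f : A → List B) {l} → All
      (λ x → All T (f x)) l → All T (concatMap f l)
  All-concatMap f h = Allₚ.concat⁺ (Allₚ.map⁺ h)

  Deg-R[] : Deg 0 (R [])
  Deg-R[] = (([] , λ { j (s≤s _) () }) , refl) ∷ []

  Deg-bilin : ∀ {op m n x y} → (∀ u v → All (_∈ shuffles u (shift (maxW u) v)) (op u v)) →
              Deg m x → Deg n y → Deg (m + n) (bilin op x y)
  Deg-bilin sub dx dy = All-concatMap _ (All.map (λ {p} pu → All-concatMap _ (All.map (λ {q} pv →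
      Allₚ.map⁺ (All.map (word (proj₂ p) (proj₂ q) pu pv) (sub (proj₂ p) (proj₂ q)))) dy)) dx)
    where
      word : ∀ {m n} u v → PW m u → PW n v → ∀ {w} → w ∈ shuffles u (shift (maxW u) v) → PW (m + n) w
      word u v (pu , lu) (pv , lv) {w} i = Packed-product pu pv perm ,
          ≡.trans (↭-length perm) (≡.trans (length-++ u) (cong₂ _+_ lu (≡.trans (length-map _ v) lv)))
        where
          perm : w ↭ u ++ shift (maxW u) v
          perm = All.lookup (shuf-↭ S u _) (subst (w ∈_) (shuffles≡shuf u _) i)

  Deg-≺ : ∀ {m n x y} → Deg m x → Deg n y → Deg (m + n) (x ≺ y)
  Deg-≺ {x = x} {y} = Deg-bilin {x = x} {y} (λ u v → Allₚ.filter⁺ _ (All.tabulate (λ i → i)))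

  Deg-≻ : ∀ {m n x y} → Deg m x → Deg n y → Deg (m + n) (x ≻ y)
  Deg-≻ {x = x} {y} = Deg-bilin {x = x} {y} (λ u v → Allₚ.filter⁺ _ (All.tabulate (λ i → i)))

  Deg-scale : ∀ {n k x} → Deg n x → Deg n (scale k x)
  Deg-scale d = Allₚ.map⁺ d

  PW-pos : ∀ {n w} → PW n w → Pos w
  PW-pos d = proj₁ (proj₁ d)

  PW-≢[] : ∀ {n w} → 1 ≤ n → PW n w → w ≢ []
  PW-≢[] (s≤s _) (_ , ()) refl

  Deg-pos : ∀ {n x} → Deg n x → Supp Pos x
  Deg-pos = All.map PW-pos

  Deg-≢[] : ∀ {n x} → 1 ≤ n → Deg n x → Supp (_≢ []) x
  Deg-≢[] p = All.map (PW-≢[] p)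

  ⟪⟫-cop : ∀ {a} {A : Set a} (y : List (K × A)) χ (h : Word → Word → A → K) u →
    ⟪ y , (λ v → cop χ (λ p s → h p s v) u) ⟫ ≈ cop χ (λ p s → ⟪ y , h p s ⟫) u
  ⟪⟫-cop y χ h u = ≈-trans (⟪⟫-∑ y (decs u) _) (Cut-cong u (λ p s → ⟪⟫-[] (accept χ u p s) y _))

  -- Coproduct tests vanishing on the trivial cuts

  inner : (Word → Word → K) → Word → Word → K
  inner g [] s = 0#
  inner g (a ∷ p) [] = 0#
  inner g (a ∷ p) (b ∷ s) = g (a ∷ p) (b ∷ s)

  inner-[]ʳ : ∀ g p → inner g p [] ≈ 0#
  inner-[]ʳ g [] = ≈-refl
  inner-[]ʳ g (a ∷ p) = ≈-refl

  disjointB-[] : ∀ w → disjointB w [] ≡ true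
  disjointB-[] w = ⇒disjointB w [] (λ _ ())

  -- With an empty left part the maximum lies on the right, with an empty right part on the left;
  -- hence the weights `χ false` and `χ true` of the two trivial cuts.
  cop-split : ∀ χ g {w} → Packed w → w ≢ [] →
    cop χ g w ≈ [ χ false ] g [] w ⊕ ([ χ true ] g w [] ⊕ cop χ (inner g) w)
  cop-split χ g {[]} pk n = ⊥-elim (n refl)
  cop-split χ g {w@(a ∷ w′)} pk n = begin
    cop χ g w ≈⟨ cop-cong χ w split ⟩
    cop χ (λ p s → first p s ⊕ (final p s ⊕ inner g p s)) w ≈⟨ ≈-trans
        (cop-⊕ χ w first (λ p s → final p s ⊕ inner g p s)) (+-congˡ (cop-⊕ χ w final (inner g))) ⟩
    cop χ first w ⊕ (cop χ final w ⊕ cop χ (inner g) w) ≈⟨ +-cong firstEq (+-congʳ finalEq) ⟩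
    [ χ false ] g [] w ⊕ ([ χ true ] g w [] ⊕ cop χ (inner g) w) ∎
    where
      first final : Word → Word → K
      first [] s = g [] s
      first (a ∷ p) s = 0#
      final [] s = 0#
      final (a ∷ p) [] = g (a ∷ p) []
      final (a ∷ p) (b ∷ s) = 0#
      split : ∀ p s → length p + length s ≡ length w → g p s ≈ first p s ⊕ (final p s ⊕ inner g p s)
      split [] s e = ≈-sym (≈-trans (+-congˡ (+-identityˡ _)) (+-identityʳ _))
      split (a ∷ p) [] e = ≈-sym (≈-trans (+-identityˡ _) (+-identityʳ _))
      split (a ∷ p) (b ∷ s) e = ≈-sym (≈-trans (+-identityˡ _) (+-identityˡ _))
      first0 : ∀ p s → p ≢ [] → first (pack p) (pack s) ≈ 0#
      first0 [] s n = ⊥-elim (n refl)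
      first0 (_ ∷ p) s n = ≈-refl
      final0 : ∀ p s → s ≢ [] → final (pack p) (pack s) ≈ 0#
      final0 [] s n = ≈-refl
      final0 (_ ∷ p) [] n = ⊥-elim (n refl)
      final0 (_ ∷ p) (_ ∷ s) n = ≈-refl
      firstEq : cop χ first w ≈ [ χ false ] g [] w
      firstEq = ≈-trans (Cut-first w _ (λ p s _ n → ≈-trans ([]-cong (accept χ w p s) (first0 p s n))
          ([]-zero (accept χ w p s))))
                        (≈-reflexive (cong (λ z → [ χ false ] g [] z) (pack-packed pk)))
      finalEq : cop χ final w ≈ [ χ true ] g w []
      finalEq = ≈-trans (Cut-last w _ (λ p s _ n → ≈-trans ([]-cong (accept χ w p s) (final0 p s n))
          ([]-zero (accept χ w p s))))
        (≈-reflexive (≡.trans (cong ([_] final (pack w) [])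
            (cong₂ (λ b d → b ∧ χ d) (disjointB-[] w) (∈⇒memb (maxW-∈ a w′))))
                              (cong (λ z → [ χ true ] final z []) (pack-packed pk))))

  -- The vanishing of Δ_χ on nontrivial cuts, expressed by tests that ignore the trivial ones. For
  -- `full` this is primitivity, for `left` and `right` together total primitivity.
  Kills : (Bool → Bool) → V → Set _
  Kills χ x = ∀ f → (∀ v → f [] v ≈ 0#) → (∀ u → f u [] ≈ 0#) → ⟪ x , cop χ f ⟫ ≈ 0#

  Kills-cop : ∀ {χ n x} → Kills χ x → 1 ≤ n → Deg n x → ∀ g →
    ⟪ x , cop χ g ⟫ ≈ [ χ false ] ⟪ x , g [] ⟫ ⊕ [ χ true ] ⟪ x , (λ u → g u []) ⟫
  Kills-cop {χ} {n} {x} prim p d g = begin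
    ⟪ x , cop χ g ⟫ ≈⟨ ⟪⟫-congᴬ {x = x} (All.map (λ pw → cop-split χ g (proj₁ pw) (PW-≢[] p pw)) d) ⟩
    ⟪ x , (λ w → [ χ false ] g [] w ⊕ ([ χ true ] g w [] ⊕ cop χ (inner g) w)) ⟫
      ≈⟨ ≈-trans (⟪⟫-⊕ x _ _) (+-congˡ (⟪⟫-⊕ x _ _)) ⟩
    ⟪ x , (λ w → [ χ false ] g [] w) ⟫ ⊕ (⟪ x , (λ w → [ χ true ] g w []) ⟫ ⊕ ⟪ x , cop χ (inner g) ⟫)
      ≈⟨ +-cong (⟪⟫-[] (χ false) x _) (≈-trans (+-cong (⟪⟫-[] (χ true) x _)
          (prim (inner g) (λ _ → ≈-refl) (inner-[]ʳ g))) (+-identityʳ _)) ⟩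
    [ χ false ] ⟪ x , g [] ⟫ ⊕ [ χ true ] ⟪ x , (λ u → g u []) ⟫ ∎

  shift0 : ∀ v → shift 0 v ≡ v
  shift0 v = map-id v

  M•-[] : ∀ m v f → M• m [] v f ≈ M m [] v f
  M•-[] m v f = ≈-reflexive (cong (λ z → M m [] z f) (shift0 v))

  Δ-≺ : ∀ {χ m n x y} → 1 ≤ m → Deg m x → Deg n y → Supp (Compatible χ) y → ∀ f → (∀ p → f p [] ≈ 0#) →
    ⟪ x ≺ y , cop χ f ⟫ ≈ ⟪ x , cop full (λ u₁ u₂ →
        ⟪ y , cop χ (λ v₁ v₂ → M• S u₁ v₁ (λ w₁ → M• P u₂ v₂ (f w₁))) ⟫) ⟫
  Δ-≺ {χ} {x = x} {y} 1≤m dx dy cy f f0 = ≈-trans (⟪≺⟫ {x} {y} (Deg-≢[] 1≤m dx) (Deg-pos dy) _)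
    (⟪⟫-congᴬ {x = x} (All.map (λ {p} pu → ≈-trans
      (⟪⟫-congᴬ {x = y} (All.zipWith (λ {q} (pv , cq) → cop-M χ P (proj₂ p) (proj₂ q) f (PW-pos pu)
          (PW-pos pv) cq f0) (dy , cy)))
      (⟪⟫-cop y full (λ u₁ u₂ → cop χ (λ v₁ v₂ → M• S u₁ v₁ (λ w₁ → M• P u₂ v₂ (f w₁)))) (proj₂ p))) dx))

  Δ-≻ : ∀ {χ m n x y} → 1 ≤ n → Deg m x → Deg n y → ∀ f → (∀ p → f p [] ≈ 0#) →
    ⟪ x ≻ y , cop χ f ⟫ ≈ ⟪ x , cop full (λ u₁ u₂ →
        ⟪ y , cop χ (λ v₁ v₂ → M• S u₁ v₁ (λ w₁ → M• Q u₂ v₂ (f w₁))) ⟫) ⟫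
  Δ-≻ {χ} {x = x} {y} 1≤n dx dy f f0 = ≈-trans (⟪≻⟫ {x} {y} (Deg-≢[] 1≤n dy) (Deg-pos dy) _)
    (⟪⟫-congᴬ {x = x} (All.map (λ {p} pu → ≈-trans
      (⟪⟫-congᴬ {x = y} (All.map (λ {q} pv → cop-M χ Q (proj₂ p) (proj₂ q) f (PW-pos pu) (PW-pos pv)
          (inj₁ (PW-≢[] 1≤n pv)) f0) dy))
      (⟪⟫-cop y full (λ u₁ u₂ → cop χ (λ v₁ v₂ → M• S u₁ v₁ (λ w₁ → M• Q u₂ v₂ (f w₁)))) (proj₂ p))) dx))

  -- A primitive `x` goes as a whole to one side of the cut. On the left side it would leave no
  -- letter of `x` to end the right part, which mode `P` requires, so it stays on the right.
  Δ-prim≺ : ∀ {χ m n x y} → Kills full x → 1 ≤ m → Deg m x → Deg n y → Supp (Compatible χ) y → ∀ f →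
      (∀ p → f p [] ≈ 0#) →
    ⟪ x ≺ y , cop χ f ⟫ ≈ ⟪ x , (λ u → ⟪ y , cop χ (λ v₁ v₂ → M• P u v₂ (f v₁)) ⟫) ⟫
  Δ-prim≺ {χ} {x = x} {y} prim 1≤m dx dy cy f f0 = begin
    ⟪ x ≺ y , cop χ f ⟫ ≈⟨ Δ-≺ {x = x} {y} 1≤m dx dy cy f f0 ⟩
    ⟪ x , cop full g ⟫ ≈⟨ Kills-cop {x = x} prim 1≤m dx g ⟩
    ⟪ x , g [] ⟫ ⊕ ⟪ x , (λ u → g u []) ⟫
      ≈⟨ +-cong (⟪⟫-cong x (λ u → ⟪⟫-cong y (λ v → cop-cong χ v
          (λ v₁ v₂ _ → ≈-trans (M•-[] S v₁ (λ w₁ → M• P u v₂ (f w₁)))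
          (S-unitˡ v₁ (λ w₁ → M• P u v₂ (f w₁)))))))
                (⟪⟫-zero x (λ u → ⟪⟫-zero y (λ v → cop-zero χ v
                    (λ v₁ v₂ _ → ∑-zero (shuf S u (shift (maxW u) v₁)) (λ w → ≈-refl))))) ⟩
    ⟪ x , (λ u → ⟪ y , cop χ (λ v₁ v₂ → M• P u v₂ (f v₁)) ⟫) ⟫ ⊕ 0# ≈⟨ +-identityʳ _ ⟩
    ⟪ x , (λ u → ⟪ y , cop χ (λ v₁ v₂ → M• P u v₂ (f v₁)) ⟫) ⟫ ∎
    where
      g : Word → Word → K
      g u₁ u₂ = ⟪ y , cop χ (λ v₁ v₂ → M• S u₁ v₁ (λ w₁ → M• P u₂ v₂ (f w₁))) ⟫

  -- Now `y` must supply the last letter of the right part and hence lies entirely there. This is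
  -- the trivial cut of `y` with the maximum on the right, accepted because of `χ false ≡ true`.
  Δ-≻prim : ∀ {χ m n x y} → χ false ≡ true → Kills χ y → 1 ≤ n → Deg m x → Deg n y → ∀ f →
      (∀ p → f p [] ≈ 0#) →
    ⟪ x ≻ y , cop χ f ⟫ ≈ ⟪ x , cop full (λ u₁ u₂ → ⟪ y , (λ v → M• Q u₂ v (f u₁)) ⟫) ⟫
  Δ-≻prim {χ} {x = x} {y} χf prim 1≤n dx dy f f0 = ≈-trans (Δ-≻ {χ} {x = x} {y} 1≤n dx dy f f0)
    (⟪⟫-cong x (λ u → cop-cong full u (λ u₁ u₂ _ → begin
      ⟪ y , cop χ (g u₁ u₂) ⟫
        ≈⟨ Kills-cop {χ} {x = y} prim 1≤n dy (g u₁ u₂) ⟩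
      [ χ false ] ⟪ y , g u₁ u₂ [] ⟫ ⊕ [ χ true ] ⟪ y , (λ v → g u₁ u₂ v []) ⟫
        ≈⟨ +-cong (≈-reflexive (cong ([_] ⟪ y , g u₁ u₂ [] ⟫) χf))
             (≈-trans ([]-cong (χ true) (⟪⟫-zero y (λ v → ∑-zero (shuf S u₁ (shift (maxW u₁) v))
                 (λ w → Q-zero u₂ _)))) ([]-zero (χ true))) ⟩
      ⟪ y , g u₁ u₂ [] ⟫ ⊕ 0# ≈⟨ +-identityʳ _ ⟩
      ⟪ y , g u₁ u₂ [] ⟫ ≈⟨ ⟪⟫-cong y (λ v → S-unitʳ u₁ (λ w₁ → M• Q u₂ v (f w₁))) ⟩
      ⟪ y , (λ v → M• Q u₂ v (f u₁)) ⟫ ∎)))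
    where
      g : Word → Word → Word → Word → K
      g u₁ u₂ v₁ v₂ = M• S u₁ v₁ (λ w₁ → M• Q u₂ v₂ (f w₁))

  infix 4 _≋_
  _≋_ : V → V → Set _
  x ≋ y = ∀ f → ⟪ x , f ⟫ ≈ ⟪ y , f ⟫

  bilin-cong : ∀ op {x x′ y y′} → x ≋ x′ → y ≋ y′ → bilin op x y ≋ bilin op x′ y′
  bilin-cong op {x} {x′} {y} {y′} p q f = ≈-trans (⟪bilin⟫ op x y f)
    (≈-trans (≈-trans (p _) (⟪⟫-cong x′ (λ u → q _))) (≈-sym (⟪bilin⟫ op x′ y′ f)))

  ≺-unit : ∀ {x} → Supp (_≢ []) x → x ≺ R [] ≋ x
  ≺-unit {x} nx f = ≈-trans (⟪≺⟫ {x} {R []} nx ([] ∷ []) f)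
    (⟪⟫-congᴬ {x = x} (All.map (λ {p} n → ≈-trans (⟪R⟫ [] (λ v → M• P (proj₂ p) v f))
        (P-unit (proj₂ p) f n)) nx))

  ≻-unit : ∀ {y} → Supp (_≢ []) y → Supp Pos y → R [] ≻ y ≋ y
  ≻-unit {y} ny py f = ≈-trans (⟪≻⟫ {R []} {y} ny py f) (≈-trans (⟪R⟫ [] (λ u → ⟪ y , (λ v → M• Q u v f) ⟫))
    (⟪⟫-congᴬ {x = y} (All.map (λ {q} n → ≈-trans (M•-[] Q (proj₂ q) f) (Q-unit (proj₂ q) f n)) ny)))

  -- Adapts a test to the product formulas, which assume that it vanishes on an empty right part;
  -- `cop-strip` accounts for the term lost.
  strip : (Word → Word → K) → Word → Word → K
  strip f p [] = 0#
  strip f p (b ∷ s) = f p (b ∷ s)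

  strip-≢[] : ∀ f p {s} → s ≢ [] → strip f p s ≈ f p s
  strip-≢[] f p {[]} n = ⊥-elim (n refl)
  strip-≢[] f p {_ ∷ _} n = ≈-refl

  cop-strip : ∀ χ f {w} → Packed w → cop χ f w ≈ cop χ (strip f) w ⊕ [ χ (memb (maxW w) w) ] f w []
  cop-strip χ f {w} pk = begin
    cop χ f w ≈⟨ cop-cong χ w (λ p s _ → split p s) ⟩
    cop χ (λ p s → strip f p s ⊕ final p s) w ≈⟨ cop-⊕ χ w (strip f) final ⟩
    cop χ (strip f) w ⊕ cop χ final w ≈⟨ +-congˡ finalEq ⟩
    cop χ (strip f) w ⊕ [ χ (memb (maxW w) w) ] f w [] ∎
    where
      final : Word → Word → K
      final p [] = f p []
      final p (b ∷ s) = 0#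
      split : ∀ p s → f p s ≈ strip f p s ⊕ final p s
      split p [] = ≈-sym (+-identityˡ _)
      split p (b ∷ s) = ≈-sym (+-identityʳ _)
      final0 : ∀ p s → s ≢ [] → final (pack p) (pack s) ≈ 0#
      final0 p [] n = ⊥-elim (n refl)
      final0 p (_ ∷ s) n = ≈-refl
      finalEq : cop χ final w ≈ [ χ (memb (maxW w) w) ] f w []
      finalEq = ≈-trans (Cut-last w _ (λ p s _ n → ≈-trans ([]-cong (accept χ w p s) (final0 p s n))
          ([]-zero (accept χ w p s))))
        (≈-reflexive (≡.trans (cong (λ b → [ b ∧ χ (memb (maxW w) w) ] f (pack w) []) (disjointB-[] w))
                              (cong (λ z → [ χ (memb (maxW w) w) ] f z []) (pack-packed pk))))

  ⟪⟫-strip : ∀ {n x} → Deg n x → ∀ f → ⟪ x , cop full f ⟫ ≈ ⟪ x , cop full (strip f) ⟫ ⊕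
      ⟪ x , (λ w → f w []) ⟫
  ⟪⟫-strip {x = x} d f = ≈-trans (⟪⟫-congᴬ {x = x} (All.map (λ pw → cop-strip full f (proj₁ pw)) d))
      (⟪⟫-⊕ x (cop full (strip f)) _)

  -- Nested products

  Ln Rn : Forest → V
  Ln [] = R []
  Ln (t ∷ ts) = ℙ t ≺ Ln ts
  Rn = foldl (λ x t → x ≻ ℙ t) (R [])

  Rn-∷ʳ : ∀ ts t → Rn (ts ∷ʳ t) ≡ Rn ts ≻ ℙ t
  Rn-∷ʳ ts t = foldl-++ _ (R []) ts (t ∷ [])

  record Primitive (t : Tree) : Set (c ⊔ˡ ℓ) where
    field
      ω-pos : 1 ≤ ω t
      ℙ-deg : Deg (ω t) (ℙ t)
      ℙ-prim : Kills full (ℙ t)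
  open Primitive

  ωF-++ : ∀ ts ss → ωF (ts ++ ss) ≡ ωF ts + ωF ss
  ωF-++ [] ss = refl
  ωF-++ (t ∷ ts) ss = ≡.trans (cong (ω t +_) (ωF-++ ts ss)) (≡.sym (ℕ.+-assoc (ω t) _ _))

  ωF-pos : ∀ {ts} → All Primitive ts → ts ≢ [] → 1 ≤ ωF ts
  ωF-pos [] n = ⊥-elim (n refl)
  ωF-pos (p ∷ ps) n = ≤-trans (ω-pos p) (ℕ.m≤m+n _ _)

  Deg-Ln : ∀ {ts} → All Primitive ts → Deg (ωF ts) (Ln ts)
  Deg-Ln [] = Deg-R[]
  Deg-Ln {t ∷ ts} (p ∷ ps) = Deg-≺ {x = ℙ t} (ℙ-deg p) (Deg-Ln ps)

  Deg-Rn : ∀ {ts} → All Primitive ts → Deg (ωF ts) (Rn ts)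
  Deg-Rn ps = go (R []) ps Deg-R[]
    where
      go : ∀ {k ts} x → All Primitive ts → Deg k x → Deg (k + ωF ts) (foldl (λ x t → x ≻ ℙ t) x ts)
      go {k} x [] d = subst (λ n → Deg n x) (≡.sym (ℕ.+-identityʳ k)) d
      go {k} {t ∷ ts} x (p ∷ ps) d = subst (λ n → Deg n (foldl (λ x t → x ≻ ℙ t) (x ≻ ℙ t) ts))
          (ℕ.+-assoc k (ω t) (ωF ts))
        (go (x ≻ ℙ t) ps (Deg-≻ {x = x} d (ℙ-deg p)))

  Supp-full : ∀ {x : V} → Supp (Compatible full) x
  Supp-full {x} = All.universal (λ _ → inj₂ (λ _ → refl)) x

  cop-R[] : ∀ f → ⟪ R [] , cop full f ⟫ ≈ f [] []
  cop-R[] f = ≈-trans (⟪R⟫ [] (cop full f)) (+-identityʳ _)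

  ⟪R⟫⟪R⟫ : ∀ (f : Word → Word → K) → ⟪ R [] , (λ u → ⟪ R [] , f u ⟫) ⟫ ≈ f [] []
  ⟪R⟫⟪R⟫ f = ≈-trans (⟪R⟫ [] (λ u → ⟪ R [] , f u ⟫)) (⟪R⟫ [] (f []))

  -- By `Δ-prim≺` the head of the nest always joins the right factor unless everything is on the
  -- left. The order is thus reversed: the prefix `a` of `ts` goes to the right tensor factor, the
  -- rest to the left one.
  Δ-Ln : ∀ {ts} → All Primitive ts → ∀ f → ⟪ Ln ts , cop full f ⟫ ≈ Cut ts
      (λ a b → ⟪ Ln b , (λ u → ⟪ Ln a , f u ⟫) ⟫)
  Δ-Ln [] f = ≈-trans (cop-R[] f) (≈-sym (≈-trans (Cut-[] (λ a b → ⟪ Ln b , (λ u → ⟪ Ln a , f u ⟫) ⟫))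
      (⟪R⟫⟪R⟫ f)))
  Δ-Ln {t ∷ ts} (p ∷ ps) f = begin
    ⟪ Ln (t ∷ ts) , cop full f ⟫ ≈⟨ ⟪⟫-strip {x = Ln (t ∷ ts)} (Deg-Ln (p ∷ ps)) f ⟩
    ⟪ Ln (t ∷ ts) , cop full f° ⟫ ⊕ ⟪ Ln (t ∷ ts) , (λ w → f w []) ⟫ ≈⟨ +-comm _ _ ⟩
    ⟪ Ln (t ∷ ts) , (λ w → f w []) ⟫ ⊕ ⟪ Ln (t ∷ ts) , cop full f° ⟫
      ≈⟨ +-cong (⟪⟫-cong (Ln (t ∷ ts)) (λ w → ≈-sym (⟪R⟫ [] (f w)))) rest ⟩
    ⟪ Ln (t ∷ ts) , (λ u → ⟪ Ln [] , f u ⟫) ⟫ ⊕ Cut ts (λ a b → ⟪ Ln b , (λ u → ⟪ Ln (t ∷ a) , f u ⟫) ⟫)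
        ≈⟨ Cut-∷ t ts _ ⟨
    Cut (t ∷ ts) (λ a b → ⟪ Ln b , (λ u → ⟪ Ln a , f u ⟫) ⟫) ∎
    where
      f° = strip f
      back : ∀ {a b} → All Primitive a → ⟪ ℙ t , (λ u →
          ⟪ Ln b , (λ v₁ → ⟪ Ln a , (λ v₂ → M• P u v₂ (f° v₁)) ⟫) ⟫) ⟫ ≈
          ⟪ Ln b , (λ u → ⟪ Ln (t ∷ a) , f u ⟫) ⟫
      back {a} {b} pa = ≈-trans (⟪⟫-⟪⟫ (ℙ t) (Ln b) _) (⟪⟫-cong (Ln b) (λ v₁ →
        ≈-trans (≈-sym (⟪≺⟫ {ℙ t} {Ln a} (Deg-≢[] (ω-pos p) (ℙ-deg p)) (Deg-pos (Deg-Ln pa)) (f° v₁)))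
                (⟪⟫-congᴬ {x = Ln (t ∷ a)} (All.map (strip-≢[] f v₁)
                    (Deg-≢[] (≤-trans (ω-pos p) (ℕ.m≤m+n _ _)) (Deg-Ln {t ∷ a} (p ∷ pa)))))))
      rest : ⟪ Ln (t ∷ ts) , cop full f° ⟫ ≈ Cut ts (λ a b → ⟪ Ln b , (λ u → ⟪ Ln (t ∷ a) , f u ⟫) ⟫)
      rest = begin
        ⟪ Ln (t ∷ ts) , cop full f° ⟫
          ≈⟨ Δ-prim≺ {full} {x = ℙ t} {Ln ts} (ℙ-prim p) (ω-pos p) (ℙ-deg p) (Deg-Ln ps)
              (Supp-full {Ln ts}) f° (λ _ → ≈-refl) ⟩
        ⟪ ℙ t , (λ u → ⟪ Ln ts , cop full (λ v₁ v₂ → M• P u v₂ (f° v₁)) ⟫) ⟫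
          ≈⟨ ⟪⟫-cong (ℙ t) (λ u → Δ-Ln ps (λ v₁ v₂ → M• P u v₂ (f° v₁))) ⟩
        ⟪ ℙ t , (λ u → Cut ts (λ a b → ⟪ Ln b , (λ v₁ → ⟪ Ln a , (λ v₂ → M• P u v₂ (f° v₁)) ⟫) ⟫)) ⟫
          ≈⟨ ⟪⟫-∑ (ℙ t) (decs ts) _ ⟩
        Cut ts (λ a b → ⟪ ℙ t , (λ u → ⟪ Ln b , (λ v₁ → ⟪ Ln a , (λ v₂ → M• P u v₂ (f° v₁)) ⟫) ⟫) ⟫)
          ≈⟨ Cut-cong∈ ts (λ a b e → back {a} {b} (Allₚ.++⁻ˡ a (subst (All Primitive) (≡.sym e) ps))) ⟩
        Cut ts (λ a b → ⟪ Ln b , (λ u → ⟪ Ln (t ∷ a) , f u ⟫) ⟫) ∎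

  -- The mirror image, peeling off the last tree by `Δ-≻prim`; here prefixes stay in the left tensor
  -- factor.
  Δ-Rn : ∀ {ts} → All Primitive ts → ∀ f → ⟪ Rn ts , cop full f ⟫ ≈ Cut ts
      (λ a b → ⟪ Rn a , (λ u → ⟪ Rn b , f u ⟫) ⟫)
  Δ-Rn {ts} ps f = go (reverseView ts) ps f
    where
      go : ∀ {ts} → Reverse ts → All Primitive ts → ∀ f → ⟪ Rn ts , cop full f ⟫ ≈ Cut ts
          (λ a b → ⟪ Rn a , (λ u → ⟪ Rn b , f u ⟫) ⟫)
      go [] ps f = ≈-trans (cop-R[] f) (≈-sym (≈-trans
          (Cut-[] (λ a b → ⟪ Rn a , (λ u → ⟪ Rn b , f u ⟫) ⟫)) (⟪R⟫⟪R⟫ f)))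
      go (ts ∶ rs ∶ʳ t) pst f with Allₚ.∷ʳ⁻ pst
      ... | ps , p = begin
        ⟪ Rn (ts ∷ʳ t) , cop full f ⟫ ≈⟨ ⟪⟫-strip {x = Rn (ts ∷ʳ t)} (Deg-Rn pst) f ⟩
        ⟪ Rn (ts ∷ʳ t) , cop full f° ⟫ ⊕ ⟪ Rn (ts ∷ʳ t) , (λ w → f w []) ⟫
          ≈⟨ +-cong rest (⟪⟫-cong (Rn (ts ∷ʳ t)) (λ w → ≈-sym (⟪R⟫ [] (f w)))) ⟩
        Cut ts (λ a b → ⟪ Rn a , (λ u → ⟪ Rn (b ∷ʳ t) , f u ⟫) ⟫) ⊕
            ⟪ Rn (ts ∷ʳ t) , (λ u → ⟪ Rn [] , f u ⟫) ⟫ ≈⟨ Cut-∷ʳ ts t _ ⟨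
        Cut (ts ∷ʳ t) (λ a b → ⟪ Rn a , (λ u → ⟪ Rn b , f u ⟫) ⟫) ∎
        where
          f° = strip f
          back : ∀ {a b} → All Primitive b → ⟪ Rn a ,
              (λ u₁ → ⟪ Rn b , (λ u₂ → ⟪ ℙ t , (λ v → M• Q u₂ v (f° u₁)) ⟫) ⟫) ⟫ ≈
              ⟪ Rn a , (λ u → ⟪ Rn (b ∷ʳ t) , f u ⟫) ⟫
          back {a} {b} pb = ⟪⟫-cong (Rn a) (λ u₁ → begin
            ⟪ Rn b , (λ u₂ → ⟪ ℙ t , (λ v → M• Q u₂ v (f° u₁)) ⟫) ⟫
              ≈⟨ ⟪≻⟫ {Rn b} {ℙ t} (Deg-≢[] (ω-pos p) (ℙ-deg p)) (Deg-pos (ℙ-deg p)) (f° u₁) ⟨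
            ⟪ Rn b ≻ ℙ t , f° u₁ ⟫
              ≈⟨ ⟪⟫-congᴬ {x = Rn b ≻ ℙ t} (All.map (strip-≢[] f u₁)
                  (Deg-≢[] (≤-trans (ω-pos p) (ℕ.m≤n+m _ (ωF b))) (Deg-≻ {x = Rn b} (Deg-Rn pb) (ℙ-deg p)))) ⟩
            ⟪ Rn b ≻ ℙ t , f u₁ ⟫
              ≡⟨ cong (λ z → ⟪ z , f u₁ ⟫) (Rn-∷ʳ b t) ⟨
            ⟪ Rn (b ∷ʳ t) , f u₁ ⟫ ∎)
          rest : ⟪ Rn (ts ∷ʳ t) , cop full f° ⟫ ≈ Cut ts (λ a b → ⟪ Rn a , (λ u → ⟪ Rn (b ∷ʳ t) , f u ⟫) ⟫)
          rest = begin
            ⟪ Rn (ts ∷ʳ t) , cop full f° ⟫ ≡⟨ cong (λ z → ⟪ z , cop full f° ⟫) (Rn-∷ʳ ts t) ⟩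
            ⟪ Rn ts ≻ ℙ t , cop full f° ⟫
              ≈⟨ Δ-≻prim {full} {x = Rn ts} {ℙ t} refl (ℙ-prim p) (ω-pos p) (Deg-Rn ps) (ℙ-deg p) f°
                  (λ _ → ≈-refl) ⟩
            ⟪ Rn ts , cop full (λ u₁ u₂ → ⟪ ℙ t , (λ v → M• Q u₂ v (f° u₁)) ⟫) ⟫
              ≈⟨ go rs ps _ ⟩
            Cut ts (λ a b → ⟪ Rn a , (λ u₁ → ⟪ Rn b , (λ u₂ → ⟪ ℙ t , (λ v → M• Q u₂ v (f° u₁)) ⟫) ⟫) ⟫)
              ≈⟨ Cut-cong∈ ts (λ a b e → back {a} {b} (Allₚ.++⁻ʳ a (subst (All Primitive) (≡.sym e) ps))) ⟩
            Cut ts (λ a b → ⟪ Rn a , (λ u → ⟪ Rn (b ∷ʳ t) , f u ⟫) ⟫) ∎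

  -- Dendriform axioms for the shifted products

  shift-+ : ∀ k l v → shift (k + l) v ≡ shift k (shift l v)
  shift-+ k l v = ≡.trans (map-cong (λ a → ℕ.+-assoc k l a) v) (map-∘ v)

  M•-assoc : ∀ {m₁ m₂ m₃ m₄} → (∀ (u v w : Word) f → M m₁ u v (λ p → M m₂ p w f) ≈ M m₃ v w
      (λ q → M m₄ u q f)) →
    ∀ u v w f → M• m₁ u v (λ p → M• m₂ p w f) ≈ M• m₃ v w (λ q → M• m₄ u q f)
  M•-assoc {m₁} {m₂} {m₃} {m₄} assoc u v w f = begin
    M m₁ u (shift (maxW u) v) (λ p → M• m₂ p w f)
      ≈⟨ M-cong∈ m₁ u (shift (maxW u) v) (λ p e → ≈-reflexive (cong (λ z → M m₂ p z f)
           (≡.trans (cong (λ n → shift n w) (maxW-product u v e)) (shift-+ (maxW u) (maxW v) w)))) ⟩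
    M m₁ u (shift (maxW u) v) (λ p → M m₂ p (shift (maxW u) (shift (maxW v) w)) f)
      ≈⟨ assoc u (shift (maxW u) v) (shift (maxW u) (shift (maxW v) w)) f ⟩
    M m₃ (shift (maxW u) v) (shift (maxW u) (shift (maxW v) w)) (λ q → M m₄ u q f)
      ≈⟨ M-map (maxW u +_) m₃ v (shift (maxW v) w) (λ q → M m₄ u q f) ⟩
    M• m₃ v w (λ q → M• m₄ u q f) ∎

  prod : V → V → (Word → K) → K
  prod x y ψ = ⟪ x , (λ u → ⟪ y , (λ v → M• S u v ψ) ⟫) ⟫

  ⟪⟫-M• : ∀ {a} {A : Set a} (x : List (K × A)) m u v (h : A → Word → K) →
    ⟪ x , (λ a → M• m u v (h a)) ⟫ ≈ M• m u v (λ w → ⟪ x , (λ a → h a w) ⟫)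
  ⟪⟫-M• x m u v h = ⟪⟫-∑ x (shuf m u (shift (maxW u) v)) h

  -- For mode `S` this is, up to a global sign, the alternating sum of products that makes braces
  -- primitive; the other modes are its two halves.
  altHalf : Mode → Forest → (Word → K) → K
  altHalf m ts ψ = Cut ts (λ l r → sgn (length r) ⊛ ⟪ Ln l , (λ u → ⟪ Rn r , (λ v → M• m u v ψ) ⟫) ⟫)

  alt : Forest → (Word → K) → K
  alt = altHalf S

  alt-[] : ∀ ψ → alt [] ψ ≈ ψ []
  alt-[] ψ = ≈-trans (Cut-[] (λ l r → sgn (length r) ⊛ prod (Ln l) (Rn r) ψ)) (≈-trans (*-identityˡ _)
    (≈-trans (⟪R⟫⟪R⟫ (λ u v → M• S u v ψ)) (S-unitˡ [] ψ)))

  alt-split : ∀ {ts} → All Primitive ts → ts ≢ [] → ∀ ψ → alt ts ψ ≈ altHalf P ts ψ ⊕ altHalf Q ts ψ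
  alt-split {ts} ps n ψ = ≈-trans (Cut-cong∈ ts term) (Cut-⊕ ts _ _)
    where
      term : ∀ l r → l ++ r ≡ ts → sgn (length r) ⊛ prod (Ln l) (Rn r) ψ ≈
        sgn (length r) ⊛ ⟪ Ln l , (λ u → ⟪ Rn r , (λ v → M• P u v ψ) ⟫) ⟫ ⊕ sgn (length r) ⊛
            ⟪ Ln l , (λ u → ⟪ Rn r , (λ v → M• Q u v ψ) ⟫) ⟫
      term l r refl = ≈-trans (*-congˡ (≈-trans
        (⟪⟫-congᴬ {x = Ln l} (All.map (λ {p} pu → ≈-trans (⟪⟫-congᴬ {x = Rn r} (All.map (λ {q} pv →
            S≈P⊕Q (proj₂ p) (shift (maxW (proj₂ p)) (proj₂ q)) ψ (subst (1 ≤_) (len pu pv) (ωF-pos ps n)))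
                (Deg-Rn (Allₚ.++⁻ʳ l ps))))
            (⟪⟫-⊕ (Rn r) _ _)) (Deg-Ln (Allₚ.++⁻ˡ l ps))))
        (⟪⟫-⊕ (Ln l) _ _))) (distribˡ _ _ _)
        where
          len : ∀ {u v} → PW (ωF l) u → PW (ωF r) v → ωF (l ++ r) ≡ length u + length (shift (maxW u) v)
          len {u} {v} (_ , eu) (_ , ev) = ≡.trans (ωF-++ l r)
              (≡.sym (cong₂ _+_ eu (≡.trans (length-map _ v) ev)))

  -- By (t ≺ l) ≺ r = t ≺ (l · r) the tree `t` factors out on the left. The term with empty `l`
  -- disappears, since mode `P` needs a last letter from its left word.
  alt-P : ∀ {t ts} → All Primitive (t ∷ ts) → ∀ ψ → altHalf P (t ∷ ts) ψ ≈
      ⟪ ℙ t , (λ a → alt ts (λ q → M• P a q ψ)) ⟫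
  alt-P {t} {ts} (p ∷ ps) ψ = begin
    altHalf P (t ∷ ts) ψ ≈⟨ Cut-∷ t ts _ ⟩
    sgn (length (t ∷ ts)) ⊛ ⟪ R [] , (λ u → ⟪ Rn (t ∷ ts) , (λ v → M• P u v ψ) ⟫) ⟫ ⊕ Cut ts
        (λ l r → sgn (length r) ⊛ ⟪ Ln (t ∷ l) , (λ u → ⟪ Rn r , (λ v → M• P u v ψ) ⟫) ⟫)
      ≈⟨ +-cong (≈-trans (*-congˡ (≈-trans (⟪R⟫ [] (λ u → ⟪ Rn (t ∷ ts) , (λ v → M• P u v ψ) ⟫))
          (⟪⟫-zero (Rn (t ∷ ts)) (λ v → ≈-refl)))) (zeroʳ _))
                (Cut-cong∈ ts (λ l r e → term l r (Allₚ.++⁻ˡ l (subst (All Primitive) (≡.sym e) ps)))) ⟩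
    0# ⊕ Cut ts (λ l r → ⟪ ℙ t , (λ a → sgn (length r) ⊛ prod (Ln l) (Rn r) (λ q → M• P a q ψ)) ⟫) ≈⟨
        +-identityˡ _ ⟩
    Cut ts (λ l r → ⟪ ℙ t , (λ a → sgn (length r) ⊛ prod (Ln l) (Rn r) (λ q → M• P a q ψ)) ⟫) ≈⟨ ⟪⟫-∑
        (ℙ t) (decs ts) _ ⟨
    ⟪ ℙ t , (λ a → alt ts (λ q → M• P a q ψ)) ⟫ ∎
    where
      term : ∀ l r → All Primitive l → sgn (length r) ⊛
          ⟪ Ln (t ∷ l) , (λ u → ⟪ Rn r , (λ v → M• P u v ψ) ⟫) ⟫ ≈
                      ⟪ ℙ t , (λ a → sgn (length r) ⊛ prod (Ln l) (Rn r) (λ q → M• P a q ψ)) ⟫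
      term l r pl = ≈-trans (*-congˡ (begin
        ⟪ ℙ t ≺ Ln l , (λ u → ⟪ Rn r , (λ v → M• P u v ψ) ⟫) ⟫
          ≈⟨ ⟪≺⟫ {ℙ t} {Ln l} (Deg-≢[] (ω-pos p) (ℙ-deg p)) (Deg-pos (Deg-Ln pl)) _ ⟩
        ⟪ ℙ t , (λ a → ⟪ Ln l , (λ b → M• P a b (λ u → ⟪ Rn r , (λ v → M• P u v ψ) ⟫)) ⟫) ⟫
          ≈⟨ ⟪⟫-cong (ℙ t) (λ a → ⟪⟫-cong (Ln l) (λ b → ≈-trans
              (≈-sym (⟪⟫-M• (Rn r) P a b (λ v u → M• P u v ψ)))
               (⟪⟫-cong (Rn r) (λ v → M•-assoc {P} {P} {S} {P} P-assoc a b v ψ)))) ⟩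
        ⟪ ℙ t , (λ a → prod (Ln l) (Rn r) (λ q → M• P a q ψ)) ⟫ ∎)) (≈-sym (⟪⟫-⊛ _ (ℙ t) _))

  -- By l ≻ (r ≻ t) = (l · r) ≻ t the last tree factors out on the right; its removal shortens each
  -- right list by one and so changes the sign.
  alt-Q : ∀ {t ts} → All Primitive (ts ∷ʳ t) → ∀ ψ → altHalf Q (ts ∷ʳ t) ψ ≈ ⊖ alt ts
      (λ p → ⟪ ℙ t , (λ b → M• Q p b ψ) ⟫)
  alt-Q {t} {ts} pst ψ = begin
    altHalf Q (ts ∷ʳ t) ψ ≈⟨ Cut-∷ʳ ts t _ ⟩
    Cut ts (λ l r → sgn (length (r ∷ʳ t)) ⊛ ⟪ Ln l , (λ u → ⟪ Rn (r ∷ʳ t) , (λ v → M• Q u v ψ) ⟫) ⟫) ⊕ 1#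
        ⊛ ⟪ Ln (ts ∷ʳ t) , (λ u → ⟪ R [] , (λ v → M• Q u v ψ) ⟫) ⟫
      ≈⟨ +-cong (Cut-cong ts term) (≈-trans (*-identityˡ _)
          (⟪⟫-zero (Ln (ts ∷ʳ t)) (λ u → ≈-trans (⟪R⟫ [] (λ v → M• Q u v ψ)) (Q-zero u ψ)))) ⟩
    Cut ts (λ l r → ⊖ (sgn (length r) ⊛ prod (Ln l) (Rn r) ψ′)) ⊕ 0# ≈⟨ +-identityʳ _ ⟩
    Cut ts (λ l r → ⊖ (sgn (length r) ⊛ prod (Ln l) (Rn r) ψ′)) ≈⟨ ∑-⊖ (decs ts) _ ⟩
    ⊖ alt ts ψ′ ∎
    where
      p : Primitive t
      p = proj₂ (Allₚ.∷ʳ⁻ pst)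
      ψ′ : Word → K
      ψ′ p = ⟪ ℙ t , (λ b → M• Q p b ψ) ⟫
      ∑-⊖ : ∀ {a} {A : Set a} (l : List A) (f : A → K) → ∑ l (λ x → ⊖ f x) ≈ ⊖ ∑ l f
      ∑-⊖ [] f = ≈-sym -0#≈0#
      ∑-⊖ (x ∷ l) f = ≈-trans (+-congˡ (∑-⊖ l f)) (-‿+-comm _ _)
      term : ∀ l r → sgn (length (r ∷ʳ t)) ⊛ ⟪ Ln l , (λ u → ⟪ Rn (r ∷ʳ t) , (λ v → M• Q u v ψ) ⟫) ⟫ ≈ ⊖
          (sgn (length r) ⊛ prod (Ln l) (Rn r) ψ′)
      term l r = ≈-trans (*-cong (≈-reflexive (cong sgn (≡.trans (length-++ r) (ℕ.+-comm (length r) 1))))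
          (⟪⟫-cong (Ln l) (λ u → begin
        ⟪ Rn (r ∷ʳ t) , (λ v → M• Q u v ψ) ⟫ ≡⟨ cong (λ z → ⟪ z , (λ v → M• Q u v ψ) ⟫) (Rn-∷ʳ r t) ⟩
        ⟪ Rn r ≻ ℙ t , (λ v → M• Q u v ψ) ⟫ ≈⟨ ⟪≻⟫ {Rn r} {ℙ t} (Deg-≢[] (ω-pos p) (ℙ-deg p))
            (Deg-pos (ℙ-deg p)) _ ⟩
        ⟪ Rn r , (λ b → ⟪ ℙ t , (λ c → M• Q b c (λ v → M• Q u v ψ)) ⟫) ⟫
          ≈⟨ ⟪⟫-cong (Rn r) (λ b → ≈-trans (⟪⟫-cong (ℙ t)
              (λ c → ≈-sym (M•-assoc {S} {Q} {Q} {Q} Q-assoc u b c ψ)))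
              (⟪⟫-M• (ℙ t) S u b (λ c p → M• Q p c ψ))) ⟩
        ⟪ Rn r , (λ b → M• S u b ψ′) ⟫ ∎))) (≈-sym (-‿distribˡ-* _ _))

  -- For a single tree the two halves are `ℙ t` and its negative. With more trees each half contains
  -- the alternating sum of a shorter nonempty list as a factor and vanishes by itself.
  alt-zero : ∀ n {ts} → length ts ≡ suc n → All Primitive ts → ∀ ψ → alt ts ψ ≈ 0#
  alt-zero n {ts} len ps ψ = ≈-trans (alt-split ps (ne len) ψ) (go n ts len ps)
    where
      ne : ∀ {ts n} → length {A = Tree} ts ≡ suc n → ts ≢ []
      ne () refl
      go : ∀ n ts → length ts ≡ suc n → All Primitive ts → altHalf P ts ψ ⊕ altHalf Q ts ψ ≈ 0#
      go zero (t ∷ []) _ ps@(p ∷ []) = ≈-trans (+-cong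
        (≈-trans (alt-P ps ψ) (≈-trans (⟪⟫-cong (ℙ t) (λ a → alt-[] (λ q → M• P a q ψ)))
           (⟪⟫-congᴬ {x = ℙ t} (All.map (λ {q} m → P-unit (proj₂ q) ψ m) (Deg-≢[] (ω-pos p) (ℙ-deg p))))))
        (≈-trans (alt-Q {t} {[]} ps ψ) (-‿cong (≈-trans (alt-[] (λ p → ⟪ ℙ t , (λ b → M• Q p b ψ) ⟫))
           (⟪⟫-congᴬ {x = ℙ t} (All.map (λ {q} m → ≈-trans (M•-[] Q (proj₂ q) ψ) (Q-unit (proj₂ q) ψ m))
               (Deg-≢[] (ω-pos p) (ℙ-deg p))))))))
        (-‿inverseʳ _)
      go (suc n) (t ∷ ts) len ps = ⊕-zero
        (≈-trans (alt-P ps ψ) (⟪⟫-zero (ℙ t) (λ a → alt-zero n (ℕ.suc-injective len) (All.tail ps)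
            (λ q → M• P a q ψ))))
        (qzero (reverseView (t ∷ ts)) len ps)
        where
          qzero : ∀ {ts} → Reverse ts → length ts ≡ suc (suc n) → All Primitive ts → altHalf Q ts ψ ≈ 0#
          qzero (ss ∶ _ ∶ʳ s) len ps = ≈-trans (alt-Q {s} {ss} ps ψ) (≈-trans (-‿cong (alt-zero n
            (ℕ.suc-injective (≡.trans (≡.sym (≡.trans (length-++ ss) (ℕ.+-comm (length ss) 1))) len))
                (proj₁ (Allₚ.∷ʳ⁻ ps)) _)) -0#≈0#)

  -- Brace brackets: primitivity and leading component

  ∑-upTo-Cut : ∀ {a} {A : Set a} (l : List A) (G : List A → List A → K) →
    ∑ (upTo (suc (length l))) (λ i → G (take i l) (drop i l)) ≈ Cut l G
  ∑-upTo-Cut [] G = ≈-refl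
  ∑-upTo-Cut (x ∷ l) G = ≈-trans (+-congˡ (begin
    ∑ (applyUpTo suc (suc (length l))) (λ i → G (take i (x ∷ l)) (drop i (x ∷ l)))
      ≡⟨ cong (λ z → ∑ z (λ i → G (take i (x ∷ l)) (drop i (x ∷ l))))
          (≡.sym (map-upTo suc (suc (length l)))) ⟩
    ∑ (map suc (upTo (suc (length l)))) (λ i → G (take i (x ∷ l)) (drop i (x ∷ l)))
      ≈⟨ ∑-map suc (upTo (suc (length l))) _ ⟩
    ∑ (upTo (suc (length l))) (λ i → G (x ∷ take i l) (drop i l))
      ≈⟨ ∑-upTo-Cut l (λ p s → G (x ∷ p) s) ⟩
    Cut l (λ p s → G (x ∷ p) s) ∎)) (≈-sym (Cut-∷ x l G))

  ℙs≡map : ∀ ts → ℙs ts ≡ map ℙ ts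
  ℙs≡map [] = refl
  ℙs≡map (t ∷ ts) = cong (ℙ t ∷_) (ℙs≡map ts)

  nest : Tree → Forest → V
  nest t [] = ℙ t
  nest t (s ∷ ts) = ℙ t ≺ nest s ts

  leftNest≡ : ∀ t ts → leftNest (map ℙ (t ∷ ts)) ≡ just (nest t ts)
  leftNest≡ t [] = refl
  leftNest≡ t (s ∷ ts) = cong (Maybe.map (ℙ t ≺_)) (leftNest≡ s ts)

  nest≋Ln : ∀ {t ts} → All Primitive (t ∷ ts) → nest t ts ≋ Ln (t ∷ ts)
  nest≋Ln {t} {[]} (p ∷ []) f = ≈-sym (≺-unit {ℙ t} (Deg-≢[] (ω-pos p) (ℙ-deg p)) f)
  nest≋Ln {t} {s ∷ ts} (p ∷ ps) = bilin-cong precW {ℙ t} {ℙ t} {nest s ts} {Ln (s ∷ ts)} (λ _ → ≈-refl)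
      (nest≋Ln ps)

  foldl≋ : ∀ {x y} ts → x ≋ y → foldl _≻_ x (map ℙ ts) ≋ foldl (λ z t → z ≻ ℙ t) y ts
  foldl≋ [] h = h
  foldl≋ {x} {y} (t ∷ ts) h = foldl≋ {x ≻ ℙ t} {y ≻ ℙ t} ts
      (bilin-cong succW {x} {y} {ℙ t} {ℙ t} h (λ _ → ≈-refl))

  rightNest≋ : ∀ {t ts} → All Primitive (t ∷ ts) → foldl _≻_ (ℙ t) (map ℙ ts) ≋ Rn (t ∷ ts)
  rightNest≋ {t} {ts} (p ∷ ps) = foldl≋ {ℙ t} {R [] ≻ ℙ t} ts
      (λ f → ≈-sym (≻-unit {ℙ t} (Deg-≢[] (ω-pos p) (ℙ-deg p)) (Deg-pos (ℙ-deg p)) f))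

  braceTerm-∷ : ∀ t l rs q → braceTerm (map ℙ (t ∷ l)) rs q ≡ nest t l ≻ braceTerm [] rs q
  braceTerm-∷ t l rs q = cong (λ m → apply m (braceTerm [] rs q)) (leftNest≡ t l)
    where
      apply : Maybe V → V → V
      apply nothing y = y
      apply (just x) y = x ≻ y

  module _ {k q} (1≤k : 1 ≤ k) (dq : Deg k q) where

    -- The four shapes of a summand, with either outer factor possibly omitted, become one after
    -- inserting the unit by x ≺ 1 = x and 1 ≻ x = x for `x` of positive degree.
    braceTerm≋ : ∀ {l r} → All Primitive l → All Primitive r → braceTerm (map ℙ l) (map ℙ r) q ≋ Ln l ≻
        (q ≺ Rn r)
    braceTerm≋ {[]} {[]} pl pr f = ≈-sym (≈-trans (≻-unit {q ≺ R []}
        (Deg-≢[] (≤-trans 1≤k (ℕ.m≤m+n k 0)) (Deg-≺ {x = q} {R []} dq Deg-R[]))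
        (Deg-pos (Deg-≺ {x = q} {R []} dq Deg-R[])) f)
      (≺-unit {q} (Deg-≢[] 1≤k dq) f))
    braceTerm≋ {[]} {t ∷ r} pl pr f = ≈-trans (bilin-cong precW {q} {q} {foldl _≻_ (ℙ t) (map ℙ r)}
        {Rn (t ∷ r)} (λ _ → ≈-refl) (rightNest≋ pr) f)
      (≈-sym (≻-unit {q ≺ Rn (t ∷ r)} (Deg-≢[] (≤-trans 1≤k (ℕ.m≤m+n k (ωF (t ∷ r)))) d) (Deg-pos d) f))
      where d = Deg-≺ {x = q} {Rn (t ∷ r)} dq (Deg-Rn pr)
    braceTerm≋ {t ∷ l} {[]} pl pr rewrite braceTerm-∷ t l [] q =
      bilin-cong succW {nest t l} {Ln (t ∷ l)} {q} {q ≺ R []} (nest≋Ln pl)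
          (λ f → ≈-sym (≺-unit {q} (Deg-≢[] 1≤k dq) f))
    braceTerm≋ {t ∷ l} {s ∷ r} pl pr rewrite braceTerm-∷ t l (map ℙ (s ∷ r)) q =
      bilin-cong succW {nest t l} {Ln (t ∷ l)} {q ≺ foldl _≻_ (ℙ s) (map ℙ r)} {q ≺ Rn (s ∷ r)} (nest≋Ln pl)
        (bilin-cong precW {q} {q} {foldl _≻_ (ℙ s) (map ℙ r)} {Rn (s ∷ r)} (λ _ → ≈-refl) (rightNest≋ pr))

    ⟪brace⟫ : ∀ {ts} → All Primitive ts → ∀ f → ⟪ brace (ℙs ts) q , f ⟫ ≈ Cut ts
        (λ l r → sgn (length r) ⊛ ⟪ Ln l ≻ (q ≺ Rn r) , f ⟫)
    ⟪brace⟫ {ts} ps f = begin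
      ⟪ brace (ℙs ts) q , f ⟫ ≡⟨ cong (λ z → ⟪ brace z q , f ⟫) (ℙs≡map ts) ⟩
      ⟪ brace xs q , f ⟫ ≈⟨ ∑-concatMap (λ i → scale (sgn (length xs ∸ i))
          (braceTerm (take i xs) (drop i xs) q)) (upTo (suc (length xs))) (λ p → proj₁ p ⊛ f (proj₂ p)) ⟩
      ∑ (upTo (suc (length xs))) (λ i → ⟪ scale (sgn (length xs ∸ i))
          (braceTerm (take i xs) (drop i xs) q) , f ⟫)
        ≈⟨ ∑-cong (upTo (suc (length xs))) (λ i → ≈-trans
            (⟪⟫-scale (sgn (length xs ∸ i)) (braceTerm (take i xs) (drop i xs) q) f)
             (*-congʳ (≈-reflexive (cong sgn (≡.sym (length-drop i xs)))))) ⟩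
      ∑ (upTo (suc (length xs))) (λ i → sgn (length (drop i xs)) ⊛
          ⟪ braceTerm (take i xs) (drop i xs) q , f ⟫)
        ≈⟨ ∑-upTo-Cut xs (λ p s → sgn (length s) ⊛ ⟪ braceTerm p s q , f ⟫) ⟩
      Cut xs (λ p s → sgn (length s) ⊛ ⟪ braceTerm p s q , f ⟫) ≈⟨ Cut-map ℙ ts _ ⟩
      Cut ts (λ l r → sgn (length (map ℙ r)) ⊛ ⟪ braceTerm (map ℙ l) (map ℙ r) q , f ⟫)
        ≈⟨ Cut-cong∈ ts (λ l r e → *-cong (≈-reflexive (cong sgn (length-map ℙ r)))
             (braceTerm≋ {l} {r} (Allₚ.++⁻ˡ l (subst (All Primitive) (≡.sym e) ps))
                 (Allₚ.++⁻ʳ l (subst (All Primitive) (≡.sym e) ps)) f)) ⟩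
      Cut ts (λ l r → sgn (length r) ⊛ ⟪ Ln l ≻ (q ≺ Rn r) , f ⟫) ∎
      where xs = map ℙ ts

    Deg-brace : ∀ {ts} → All Primitive ts → Deg (ωF ts + k) (brace (ℙs ts) q)
    Deg-brace {ts} ps rewrite ℙs≡map ts = All-concatMap _
        (All.universal (λ i → Deg-scale {k = sgn (length (map ℙ ts) ∸ i)}
        {x = braceTerm (take i (map ℙ ts)) (drop i (map ℙ ts)) q} (term i)) (upTo (suc (length (map ℙ ts)))))
      where
        nestDeg : ∀ {t l} → All Primitive (t ∷ l) → Deg (ωF (t ∷ l)) (nest t l)
        nestDeg {t} {[]} (p ∷ []) = subst (λ n → Deg n (ℙ t)) (≡.sym (ℕ.+-identityʳ _)) (ℙ-deg p)
        nestDeg {t} {s ∷ l} (p ∷ ps) = Deg-≺ {x = ℙ t} {nest s l} (ℙ-deg p) (nestDeg ps)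
        foldDeg : ∀ {n} x l → Deg n x → All Primitive l → Deg (n + ωF l) (foldl _≻_ x (map ℙ l))
        foldDeg {n} x [] d [] = subst (λ n → Deg n x) (≡.sym (ℕ.+-identityʳ n)) d
        foldDeg {n} x (t ∷ l) d (p ∷ ps) = subst (λ n → Deg n (foldl _≻_ (x ≻ ℙ t) (map ℙ l)))
            (ℕ.+-assoc n (ω t) (ωF l)) (foldDeg (x ≻ ℙ t) l (Deg-≻ {x = x} d (ℙ-deg p)) ps)
        arrange : ∀ a b → a + (k + b) ≡ (a + b) + k
        arrange a b = ≡.trans (cong (a +_) (ℕ.+-comm k b)) (≡.sym (ℕ.+-assoc a b k))
        bt : ∀ l r → All Primitive l → All Primitive r → Deg ((ωF l + ωF r) + k)
            (braceTerm (map ℙ l) (map ℙ r) q)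
        bt [] [] pl pr = dq
        bt [] (t ∷ r) pl pr = subst (λ n → Deg n (q ≺ foldl _≻_ (ℙ t) (map ℙ r))) (ℕ.+-comm k _)
            (Deg-≺ {x = q} {foldl _≻_ (ℙ t) (map ℙ r)} dq
            (foldDeg (ℙ t) r (ℙ-deg (All.head pr)) (All.tail pr)))
        bt (t ∷ l) [] pl pr rewrite braceTerm-∷ t l [] q = subst (λ n → Deg n (nest t l ≻ q))
            (cong (_+ k) (≡.sym (ℕ.+-identityʳ (ωF (t ∷ l))))) (Deg-≻ {x = nest t l} {q} (nestDeg pl) dq)
        bt (t ∷ l) (s ∷ r) pl pr rewrite braceTerm-∷ t l (map ℙ (s ∷ r)) q = subst
            (λ n → Deg n (nest t l ≻ (q ≺ foldl _≻_ (ℙ s) (map ℙ r)))) (arrange (ωF (t ∷ l)) (ωF (s ∷ r)))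
          (Deg-≻ {x = nest t l} {q ≺ foldl _≻_ (ℙ s) (map ℙ r)} (nestDeg pl)
              (Deg-≺ {x = q} {foldl _≻_ (ℙ s) (map ℙ r)} dq
              (foldDeg (ℙ s) r (ℙ-deg (All.head pr)) (All.tail pr))))
        term : ∀ i → Deg (ωF ts + k) (braceTerm (take i (map ℙ ts)) (drop i (map ℙ ts)) q)
        term i rewrite take-map {f = ℙ} i ts | drop-map {f = ℙ} i ts =
          subst (λ n → Deg (n + k) (braceTerm (map ℙ (take i ts)) (map ℙ (drop i ts)) q))
              (≡.trans (≡.sym (ωF-++ (take i ts) (drop i ts))) (cong ωF (take++drop≡id i ts)))
            (bt (take i ts) (drop i ts) (Allₚ.take⁺ i ps) (Allₚ.drop⁺ i ps))

    -- The element `Ln l ≻ (q ≺ Rn r)` tested on `h`, with its products unfolded.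
    middle : Forest → Forest → (Word → K) → K
    middle l r h = ⟪ Ln l , (λ u → ⟪ q , (λ t → ⟪ Rn r , (λ v → M• P t v (λ w → M• Q u w h)) ⟫) ⟫) ⟫

    -- The primitive `q` stays on the right. Since `Ln` deconcatenates in reversed order, the left
    -- factor receives `l₂` and `r₁`, which are the neighbours of the place where `q` sits in the
    -- list.
    Δ-term : Kills full q → ∀ {l r} → All Primitive l → All Primitive r → ∀ f → (∀ p → f p [] ≈ 0#) →
      ⟪ Ln l ≻ (q ≺ Rn r) , cop full f ⟫ ≈
      Cut l (λ l₁ l₂ → Cut r (λ r₁ r₂ → prod (Ln l₂) (Rn r₁) (λ w → middle l₁ r₂ (f w))))
    Δ-term prim {l} {r} pl pr f f0 = begin
      ⟪ Ln l ≻ (q ≺ Rn r) , cop full f ⟫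
        ≈⟨ Δ-≻ {full} {x = Ln l} {q ≺ Rn r} (≤-trans 1≤k (ℕ.m≤m+n k (ωF r))) (Deg-Ln pl)
            (Deg-≺ {x = q} {Rn r} dq (Deg-Rn pr)) f f0 ⟩
      ⟪ Ln l , cop full (λ u₁ u₂ → ⟪ q ≺ Rn r , cop full (g u₁ u₂) ⟫) ⟫
        ≈⟨ ⟪⟫-cong (Ln l) (λ u → cop-cong full u (λ u₁ u₂ _ → ≈-trans
             (Δ-prim≺ {full} {x = q} {Rn r} prim 1≤k dq (Deg-Rn pr) (Supp-full {Rn r}) (g u₁ u₂) (g0 u₁ u₂))
             (⟪⟫-cong q (λ t → Δ-Rn pr (λ v₁ v₂ → M• P t v₂ (g u₁ u₂ v₁)))))) ⟩
      ⟪ Ln l , cop full (λ u₁ u₂ → ⟪ q , (λ t → Cut r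
          (λ r₁ r₂ → ⟪ Rn r₁ , (λ v₁ → ⟪ Rn r₂ , (λ v₂ → M• P t v₂ (g u₁ u₂ v₁)) ⟫) ⟫)) ⟫) ⟫
        ≈⟨ Δ-Ln pl (λ u₁ u₂ → ⟪ q , (λ t → Cut r (λ r₁ r₂ →
            ⟪ Rn r₁ , (λ v₁ → ⟪ Rn r₂ , (λ v₂ → M• P t v₂ (g u₁ u₂ v₁)) ⟫) ⟫)) ⟫) ⟩
      Cut l (λ l₁ l₂ → ⟪ Ln l₂ , (λ u₁ → ⟪ Ln l₁ , (λ u₂ →
          ⟪ q , (λ t → Cut r (λ r₁ r₂ → ⟪ Rn r₁ , (λ v₁ → ⟪ Rn r₂ , (λ v₂ → M• P t v₂ (g u₁ u₂ v₁)) ⟫) ⟫))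
          ⟫) ⟫) ⟫)
        ≈⟨ Cut-cong l (λ l₁ l₂ → pull l₁ l₂) ⟩
      Cut l (λ l₁ l₂ → Cut r (λ r₁ r₂ → prod (Ln l₂) (Rn r₁) (λ w → middle l₁ r₂ (f w)))) ∎
      where
        g : Word → Word → Word → Word → K
        g u₁ u₂ v₁ v₂ = M• S u₁ v₁ (λ w₁ → M• Q u₂ v₂ (f w₁))
        g0 : ∀ u₁ u₂ p → g u₁ u₂ p [] ≈ 0#
        g0 u₁ u₂ p = ∑-zero (shuf S u₁ (shift (maxW u₁) p)) (λ w → Q-zero u₂ (f w))
        regroup : ∀ l₁ r₁ r₂ u₁ →
          ⟪ Ln l₁ , (λ u₂ → ⟪ q , (λ t → ⟪ Rn r₁ , (λ v₁ → ⟪ Rn r₂ , (λ v₂ → M• P t v₂ (g u₁ u₂ v₁)) ⟫) ⟫)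
              ⟫) ⟫ ≈
          ⟪ Rn r₁ , (λ v₁ → M• S u₁ v₁ (λ w → middle l₁ r₂ (f w))) ⟫
        regroup l₁ r₁ r₂ u₁ = begin
          ⟪ Ln l₁ , (λ u₂ → ⟪ q , (λ t → ⟪ Rn r₁ , (λ v₁ → ⟪ Rn r₂ , (λ v₂ → M• P t v₂ (g u₁ u₂ v₁)) ⟫) ⟫)
              ⟫) ⟫
            ≈⟨ ⟪⟫-cong (Ln l₁) (λ u₂ → ⟪⟫-⟪⟫ q (Rn r₁) _) ⟩
          ⟪ Ln l₁ , (λ u₂ → ⟪ Rn r₁ , (λ v₁ → ⟪ q , (λ t → ⟪ Rn r₂ , (λ v₂ → M• P t v₂ (g u₁ u₂ v₁)) ⟫) ⟫)
              ⟫) ⟫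
            ≈⟨ ⟪⟫-⟪⟫ (Ln l₁) (Rn r₁) _ ⟩
          ⟪ Rn r₁ , (λ v₁ → ⟪ Ln l₁ , (λ u₂ → ⟪ q , (λ t → ⟪ Rn r₂ , (λ v₂ → M• P t v₂ (g u₁ u₂ v₁)) ⟫) ⟫)
              ⟫) ⟫
            ≈⟨ ⟪⟫-cong (Rn r₁) (λ v₁ → begin
              ⟪ Ln l₁ , (λ u₂ → ⟪ q , (λ t → ⟪ Rn r₂ , (λ v₂ → M• P t v₂ (g u₁ u₂ v₁)) ⟫) ⟫) ⟫
                ≈⟨ ⟪⟫-cong (Ln l₁) (λ u₂ → ⟪⟫-cong q (λ t → ⟪⟫-cong (Rn r₂) (λ v₂ →
                     ∑-swap (shuf P t (shift (maxW t) v₂)) (shuf S u₁ (shift (maxW u₁) v₁)) _))) ⟩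
              ⟪ Ln l₁ , (λ u₂ → ⟪ q , (λ t → ⟪ Rn r₂ ,
                  (λ v₂ → M• S u₁ v₁ (λ w₁ → M• P t v₂ (λ w₂ → M• Q u₂ w₂ (f w₁)))) ⟫) ⟫) ⟫
                ≈⟨ ⟪⟫-cong (Ln l₁) (λ u₂ → ≈-trans (⟪⟫-cong q
                    (λ t → ⟪⟫-M• (Rn r₂) S u₁ v₁ (λ v₂ w₁ → M• P t v₂ (λ w₂ → M• Q u₂ w₂ (f w₁)))))
                     (⟪⟫-M• q S u₁ v₁ (λ t w₁ → ⟪ Rn r₂ , (λ v₂ → M• P t v₂ (λ w₂ → M• Q u₂ w₂ (f w₁))) ⟫))) ⟩
              ⟪ Ln l₁ , (λ u₂ → M• S u₁ v₁ (λ w₁ → ⟪ q ,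
                  (λ t → ⟪ Rn r₂ , (λ v₂ → M• P t v₂ (λ w₂ → M• Q u₂ w₂ (f w₁))) ⟫) ⟫)) ⟫
                ≈⟨ ⟪⟫-M• (Ln l₁) S u₁ v₁ (λ u₂ w₁ →
                    ⟪ q , (λ t → ⟪ Rn r₂ , (λ v₂ → M• P t v₂ (λ w₂ → M• Q u₂ w₂ (f w₁))) ⟫) ⟫) ⟩
              M• S u₁ v₁ (λ w → middle l₁ r₂ (f w)) ∎) ⟩
          ⟪ Rn r₁ , (λ v₁ → M• S u₁ v₁ (λ w → middle l₁ r₂ (f w))) ⟫ ∎
        pull : ∀ l₁ l₂ →
          ⟪ Ln l₂ , (λ u₁ → ⟪ Ln l₁ , (λ u₂ → ⟪ q ,
              (λ t → Cut r (λ r₁ r₂ → ⟪ Rn r₁ , (λ v₁ → ⟪ Rn r₂ , (λ v₂ → M• P t v₂ (g u₁ u₂ v₁)) ⟫) ⟫))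
              ⟫) ⟫) ⟫ ≈
          Cut r (λ r₁ r₂ → prod (Ln l₂) (Rn r₁) (λ w → middle l₁ r₂ (f w)))
        pull l₁ l₂ = ≈-trans (⟪⟫-cong (Ln l₂) (λ u₁ → ≈-trans
          (≈-trans (⟪⟫-cong (Ln l₁) (λ u₂ → ⟪⟫-∑ q (decs r) _)) (⟪⟫-∑ (Ln l₁) (decs r) _))
          (Cut-cong r (λ r₁ r₂ → regroup l₁ r₁ r₂ u₁)))) (⟪⟫-∑ (Ln l₂) (decs r) _)

    sgn-+ : ∀ a b → sgn (a + b) ≈ sgn b ⊛ sgn a
    sgn-+ zero b = ≈-sym (*-identityʳ _)
    sgn-+ (suc a) b = ≈-trans (-‿cong (sgn-+ a b)) (-‿distribʳ-* _ _)

    brace-primitive : Kills full q → ∀ {ts} → All Primitive ts → Kills full (brace (ℙs ts) q)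
    brace-primitive prim {ts} ps f fˡ fʳ = begin
      ⟪ brace (ℙs ts) q , cop full f ⟫ ≈⟨ ⟪brace⟫ ps (cop full f) ⟩
      Cut ts (λ l r → sgn (length r) ⊛ ⟪ Ln l ≻ (q ≺ Rn r) , cop full f ⟫)
        ≈⟨ Cut-cong∈ ts (λ l r e → ≈-trans (*-congˡ
            (Δ-term prim {l} {r} (Allₚ.++⁻ˡ l (subst (All Primitive) (≡.sym e) ps))
            (Allₚ.++⁻ʳ l (subst (All Primitive) (≡.sym e) ps)) f fʳ))
             (≈-trans (∑-⊛ _ (decs l) _) (Cut-cong l
                 (λ l₁ l₂ → ≈-trans (∑-⊛ _ (decs r) _)
                 (Cut-cong∈ r (λ r₁ r₂ e′ → signs l₁ l₂ r r₁ r₂ e′)))))) ⟩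
      -- Regrouped as `l₁`, then `m` made of `l₂` and `r₁`, then `r₂`, the sum over the place of `q`
      -- inside `m` is the alternating sum of `m`.
      Cut ts (λ l r → Cut l (λ l₁ l₂ → Cut r (λ r₁ r₂ → G l₁ l₂ r₁ r₂))) ≈⟨ Cut-assoc ts
          (λ l₁ l₂ r → Cut r (G l₁ l₂)) ⟨
      Cut ts (λ l₁ y → Cut y (λ l₂ r → Cut r (λ r₁ r₂ → G l₁ l₂ r₁ r₂))) ≈⟨ Cut-cong ts
          (λ l₁ y → Cut-assoc y (G l₁)) ⟩
      Cut ts (λ l₁ y → Cut y (λ m r₂ → Cut m (λ l₂ r₁ → G l₁ l₂ r₁ r₂)))
        ≈⟨ Cut-zero∈ ts (λ l₁ y e → Cut-zero∈ y (λ m r₂ e′ → ≈-trans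
            (≈-sym (∑-⊛ (sgn (length r₂)) (decs m) _))
             (≈-trans (*-congˡ (vanishing l₁ m r₂ (Allₚ.++⁻ˡ m
                 (subst (All Primitive) (≡.sym e′) (Allₚ.++⁻ʳ l₁ (subst (All Primitive) (≡.sym e) ps))))))
                 (zeroʳ _)))) ⟩
      0# ∎
      where
        G : Forest → Forest → Forest → Forest → K
        G l₁ l₂ r₁ r₂ = sgn (length r₂) ⊛ (sgn (length r₁) ⊛ prod (Ln l₂) (Rn r₁) (λ w → middle l₁ r₂ (f w)))
        signs : ∀ l₁ l₂ r r₁ r₂ → r₁ ++ r₂ ≡ r → sgn (length r) ⊛ prod (Ln l₂) (Rn r₁)
            (λ w → middle l₁ r₂ (f w)) ≈ G l₁ l₂ r₁ r₂
        signs l₁ l₂ r r₁ r₂ refl = ≈-trans (*-congʳ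
            (≈-trans (≈-reflexive (cong sgn (length-++ r₁))) (sgn-+ (length r₁) (length r₂)))) (*-assoc _ _ _)
        -- An empty block `m` means an empty left tensor factor, which `f` ignores.
        vanishing : ∀ l₁ m r₂ → All Primitive m → alt m (λ w → middle l₁ r₂ (f w)) ≈ 0#
        vanishing l₁ [] r₂ pm = ≈-trans (alt-[] (λ w → middle l₁ r₂ (f w)))
            (⟪⟫-zero (Ln l₁) (λ u → ⟪⟫-zero q (λ t → ⟪⟫-zero (Rn r₂) (λ v →
          ∑-zero (shuf P t (shift (maxW t) v)) (λ w → ∑-zero (shuf Q u (shift (maxW u) w)) fˡ)))))
        vanishing l₁ (t ∷ m) r₂ pm = alt-zero (length m) refl pm (λ w → middle l₁ r₂ (f w))

    private
      -- A nonempty right factor keeps at least one letter beyond q in every cut counted by right.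
      lower : Kills full q → ∀ {l r} → All Primitive l → All Primitive r → r ≢ [] → ∀ f →
          (∀ p → f p [] ≈ 0#) →
        (∀ u v → length u < ωF l + ωF r → f u v ≈ 0#) → ⟪ Ln l ≻ (q ≺ Rn r) , cop right f ⟫ ≈ 0#
      lower prim {l} {r} pl pr ne f f0 small = begin
        ⟪ Ln l ≻ (q ≺ Rn r) , cop right f ⟫
          ≈⟨ Δ-≻ {right} {x = Ln l} {q ≺ Rn r} (≤-trans 1≤k (ℕ.m≤m+n k (ωF r))) (Deg-Ln pl)
              (Deg-≺ {x = q} {Rn r} dq (Deg-Rn pr)) f f0 ⟩
        ⟪ Ln l , cop full (λ u₁ u₂ → ⟪ q ≺ Rn r , cop right (g u₁ u₂) ⟫) ⟫
          ≈⟨ ⟪⟫-zeroᴬ {x = Ln l} (All.map (λ {p} pu → cop-zero full (proj₂ p) (λ u₁ u₂ e → ≈-trans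
               (Δ-prim≺ {right} {x = q} {Rn r} prim 1≤k dq (Deg-Rn pr) (All.map inj₁ ner) (g u₁ u₂)
                   (λ p → ∑-zero (shuf S u₁ (shift (maxW u₁) p)) (λ w → Q-zero u₂ (f w))))
               (⟪⟫-zero q (λ t → ⟪⟫-zeroᴬ {x = Rn r}
                   (All.zipWith (λ {v} (pv , nv) → zeroAt u₁ u₂ t (proj₂ v)
                   (≤-trans (ℕ.m≤m+n _ _) (ℕ.≤-reflexive (≡.trans e (proj₂ pu)))) pv nv)
                   (Deg-Rn pr , ner)))))) (Deg-Ln pl)) ⟩
        0# ∎
        where
          g : Word → Word → Word → Word → K
          g u₁ u₂ v₁ v₂ = M• S u₁ v₁ (λ w₁ → M• Q u₂ v₂ (f w₁))
          ner : Supp (_≢ []) (Rn r)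
          ner = Deg-≢[] (ωF-pos pr ne) (Deg-Rn pr)
          zeroAt : ∀ u₁ u₂ t v → length u₁ ≤ ωF l → PW (ωF r) v → v ≢ [] → cop right
              (λ v₁ v₂ → M• P t v₂ (g u₁ u₂ v₁)) v ≈ 0#
          zeroAt u₁ u₂ t v le pv nv = ≈-trans (cop-strip right h (proj₁ pv)) (⊕-zero
            (cop-zero right v small′) (≈-reflexive (cong (λ b → [ not b ] h v []) (∈⇒memb (nonempty-∈ nv)))))
            where
              h : Word → Word → K
              h v₁ v₂ = M• P t v₂ (g u₁ u₂ v₁)
              small′ : ∀ p s → length p + length s ≡ length v → strip h p s ≈ 0#
              small′ p [] e = ≈-refl
              small′ p (b ∷ s) e = ∑-zero (shuf P t (shift (maxW t) (b ∷ s)))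
                  (λ w₂ → M-zero∈ S u₁ (shift (maxW u₁) p) (λ w₁ e₁ →
                ∑-zero (shuf Q u₂ (shift (maxW u₂) w₂))
                    (λ w → small w₁ w (subst (_< ωF l + ωF r)
                    (≡.sym (≡.trans (↭-length e₁) (≡.trans (length-++ u₁)
                    (cong (length u₁ +_) (length-map _ p)))))
                  (ℕ.+-mono-≤-< le (subst (length p <_) (≡.trans e (proj₂ pv))
                      (ℕ.m<m+n (length p) (s≤s z≤n))))))))

    -- Half of the coproduct is used because the whole of it vanishes on nontrivial cuts of a brace.
    -- By `lower` only the summand with all of `ts` before `q` counts; there `q` remains on the
    -- right, and in left degree at least `ωF ts` all of `ts` must be on the left.
    brace-leading : Kills full q → Kills right q → ∀ {ts} → All Primitive ts → ∀ f → (∀ p → f p [] ≈ 0#) →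
      (∀ u v → length u < ωF ts → f u v ≈ 0#) → ⟪ brace (ℙs ts) q , cop right f ⟫ ≈
          ⟪ Ln ts , (λ u → ⟪ q , f u ⟫) ⟫
    brace-leading prim rprim {ts} ps f f0 small = begin
      ⟪ brace (ℙs ts) q , cop right f ⟫ ≈⟨ ⟪brace⟫ ps (cop right f) ⟩
      Cut ts (λ l r → sgn (length r) ⊛ ⟪ Ln l ≻ (q ≺ Rn r) , cop right f ⟫)
        ≈⟨ Cut-last ts _ (λ l r e n → ≈-trans (*-congˡ
            (lower prim {l} {r} (Allₚ.++⁻ˡ l (subst (All Primitive) (≡.sym e) ps))
            (Allₚ.++⁻ʳ l (subst (All Primitive) (≡.sym e) ps)) n f f0
             (λ u v lt → small u v (subst (length u <_) (≡.trans (≡.sym (ωF-++ l r)) (cong ωF e)) lt))))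
                 (zeroʳ _)) ⟩
      1# ⊛ ⟪ Ln ts ≻ (q ≺ R []) , cop right f ⟫ ≈⟨ *-identityˡ _ ⟩
      ⟪ Ln ts ≻ (q ≺ R []) , cop right f ⟫ ≈⟨ bilin-cong succW {Ln ts} {Ln ts} {q ≺ R []} {q}
          (λ _ → ≈-refl) (≺-unit {q} (Deg-≢[] 1≤k dq)) (cop right f) ⟩
      ⟪ Ln ts ≻ q , cop right f ⟫ ≈⟨ Δ-≻prim {right} {x = Ln ts} {q} refl rprim 1≤k (Deg-Ln ps) dq f f0 ⟩
      ⟪ Ln ts , cop full g ⟫ ≈⟨ ⟪⟫-strip {x = Ln ts} (Deg-Ln ps) g ⟩
      ⟪ Ln ts , cop full (strip g) ⟫ ⊕ ⟪ Ln ts , (λ w → g w []) ⟫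
        ≈⟨ +-cong (⟪⟫-zeroᴬ {x = Ln ts} (All.map (λ {p} pw → cop-zero full (proj₂ p)
            (zeroAt {proj₂ p} (proj₂ pw))) (Deg-Ln ps)))
             (⟪⟫-cong (Ln ts) (λ u → ⟪⟫-congᴬ {x = q}
                 (All.map (λ {p} n → ≈-trans (M•-[] Q (proj₂ p) (f u)) (Q-unit (proj₂ p) (f u) n))
                 (Deg-≢[] 1≤k dq)))) ⟩
      0# ⊕ ⟪ Ln ts , (λ u → ⟪ q , f u ⟫) ⟫ ≈⟨ +-identityˡ _ ⟩
      ⟪ Ln ts , (λ u → ⟪ q , f u ⟫) ⟫ ∎
      where
        g : Word → Word → K
        g u₁ u₂ = ⟪ q , (λ v → M• Q u₂ v (f u₁)) ⟫
        zeroAt : ∀ {w : Word} → length w ≡ ωF ts → ∀ p s → length p + length s ≡ length w → strip g p s ≈ 0#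
        zeroAt e p [] e′ = ≈-refl
        zeroAt e p (b ∷ s) e′ = ⟪⟫-zero q (λ v → ∑-zero (shuf Q (b ∷ s) (shift (maxW (b ∷ s)) v)) (λ w →
          small p w (subst (length p <_) (≡.trans e′ e) (ℕ.m<m+n (length p) (s≤s z≤n)))))

  -- Half-coproducts after removal of the maximal letters

  []-yes : ∀ {p} {A : Set p} (d : Dec A) {x} → A → [ ⌊ d ⌋ ] x ≈ x
  []-yes (yes _) a = ≈-refl
  []-yes (no n) a = ⊥-elim (n a)

  []-no : ∀ {p} {A : Set p} (d : Dec A) {x} → ¬ A → [ ⌊ d ⌋ ] x ≈ 0#
  []-no (yes a) n = ⊥-elim (n a)
  []-no (no _) n = ≈-refl

  memb-∷-miss : ∀ {m x} a → x ≢ m → memb m (x ∷ a) ≡ memb m a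
  memb-∷-miss {m} {x} a n = memb-ext (x ∷ a) a (λ { (here e) → ⊥-elim (n (≡.sym e)) ; (there i) → i }) there

  -- The cuts before the first occurrence of `m` survive the deletion of `m` with unchanged left
  -- part. Positions being counted from `k`, a left part `a` ends before position `i` exactly if
  -- `k + length a ≤ i`.
  Cut-avoidˡ : ∀ m k W i I (H : Word → Word → K) → posFrom k m W ≡ i ∷ I →
    Cut W (λ a b → [ not (memb m a) ] H a (del m b)) ≈ Cut (del m W) (λ a b → [ ⌊ k + length a ≤? i ⌋ ] H a b)
  Cut-avoidˡ m k [] i I H ()
  Cut-avoidˡ m k (x ∷ W) i I H e = go (x ≟ m)
    where
      Goal = Cut (x ∷ W) (λ a b → [ not (memb m a) ] H a (del m b)) ≈ Cut (del m (x ∷ W))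
          (λ a b → [ ⌊ k + length a ≤? i ⌋ ] H a b)
      -- At the first occurrence of `m` only the empty left part still avoids it.
      hit : x ≡ m → k ∷ posFrom (suc k) m W ≡ i ∷ I → Goal
      hit refl refl = begin
        Cut (x ∷ W) (λ a b → [ not (memb x a) ] H a (del x b)) ≈⟨ Cut-first (x ∷ W) _
            (λ a b e n → ≈-reflexive (cong (λ z → [ not z ] H a (del x b)) (∈⇒memb (inHead a b e n)))) ⟩
        H [] (del x (x ∷ W)) ≈⟨ []-yes (k + 0 ≤? k) (ℕ.≤-reflexive (ℕ.+-identityʳ k)) ⟨
        [ ⌊ k + 0 ≤? k ⌋ ] H [] (del x (x ∷ W))
          ≈⟨ Cut-first (del x (x ∷ W)) (λ a b → [ ⌊ k + length a ≤? k ⌋ ] H a b)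
              (λ { [] b _ n → ⊥-elim (n refl) ; (y ∷ a) b _ n → []-no (k + suc (length a) ≤? k)
              (ℕ.m+1+n≰m k) }) ⟨
        Cut (del x (x ∷ W)) (λ a b → [ ⌊ k + length a ≤? k ⌋ ] H a b) ∎
        where
          inHead : ∀ a b → a ++ b ≡ x ∷ W → a ≢ [] → x ∈ a
          inHead [] b e n = ⊥-elim (n refl)
          inHead (y ∷ a) b refl n = here refl
      miss : x ≢ m → posFrom (suc k) m W ≡ i ∷ I → Goal
      miss x≢m e = begin
        Cut (x ∷ W) (λ a b → [ not (memb m a) ] H a (del m b)) ≈⟨ Cut-∷ x W
            (λ a b → [ not (memb m a) ] H a (del m b)) ⟩
        H [] (del m (x ∷ W)) ⊕ Cut W (λ a b → [ not (memb m (x ∷ a)) ] H (x ∷ a) (del m b))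
          ≈⟨ +-cong (≈-trans (≈-reflexive (cong (H []) (del-∷-miss W x≢m))) (≈-sym ([]-yes (k + 0 ≤? i) k≤i)))
               (≈-trans (Cut-cong W (λ a b → ≈-reflexive
                   (cong (λ z → [ not z ] H (x ∷ a) (del m b)) (memb-∷-miss a x≢m))))
                        (≈-trans (Cut-avoidˡ m (suc k) W i I (λ a → H (x ∷ a)) e)
                                 (Cut-cong (del m W)
                                     (λ a b → ≈-reflexive
                                     (cong (λ z → [ ⌊ z ≤? i ⌋ ] H (x ∷ a) b)
                                     (≡.sym (+-suc k (length a)))))))) ⟩
        [ ⌊ k + 0 ≤? i ⌋ ] H [] (x ∷ del m W) ⊕ Cut (del m W)
            (λ a b → [ ⌊ k + suc (length a) ≤? i ⌋ ] H (x ∷ a) b)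
          ≈⟨ Cut-∷ x (del m W) (λ a b → [ ⌊ k + length a ≤? i ⌋ ] H a b) ⟨
        Cut (x ∷ del m W) (λ a b → [ ⌊ k + length a ≤? i ⌋ ] H a b)
          ≡⟨ cong (λ z → Cut z (λ a b → [ ⌊ k + length a ≤? i ⌋ ] H a b)) (≡.sym (del-∷-miss W x≢m)) ⟩
        Cut (del m (x ∷ W)) (λ a b → [ ⌊ k + length a ≤? i ⌋ ] H a b) ∎
        where
          k≤i : k + 0 ≤ i
          k≤i = ≤-trans (ℕ.≤-reflexive (ℕ.+-identityʳ k))
              (ℕ.<⇒≤ (proj₁ (subst (Sorted (suc k)) e (posFrom-sorted (suc k) m W))))
      go : Dec (x ≡ m) → Goal
      go (yes p) = hit p (≡.trans (≡.sym (subst (λ z → posFrom k z (x ∷ W) ≡ k ∷ posFrom (suc k) z W) p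
          (posFrom-∷-hit k x W))) e)
      go (no n) = miss n (≡.trans (≡.sym (posFrom-∷-miss k W n)) e)

  -- Such cuts lie after the last occurrence of `m`, so deletion shortens their left part by all
  -- `suc (length I)` occurrences and the original cut is recovered from the length that remains.
  -- The bound says that it lies past the last position.
  Cut-avoidʳ : ∀ m k W i I (H : Word → Word → K) → posFrom k m W ≡ i ∷ I →
    Cut W (λ a b → [ not (memb m b) ] H (del m a) b) ≈ Cut (del m W)
        (λ a b → [ ⌊ lastOr i I <? k + (length a + suc (length I)) ⌋ ] H a b)
  Cut-avoidʳ m k [] i I H ()
  Cut-avoidʳ m k (x ∷ W) i I H e = ≈-trans (Cut-∷ x W _)
      (≈-trans (+-congʳ headZero) (≈-trans (+-identityˡ _) (go e)))
    where
      headZero : [ not (memb m (x ∷ W)) ] H (del m []) (x ∷ W) ≈ 0#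
      headZero = ≈-reflexive (cong (λ z → [ not z ] H [] (x ∷ W))
          (∈⇒memb (posFrom⇒∈ k (x ∷ W) (λ z → nonempty i I (≡.trans (≡.sym e) z)))))
        where
          nonempty : (i : ℕ) (I : List ℕ) → _≢_ {A = List ℕ} (i ∷ I) []
          nonempty i I ()
      go : posFrom k m (x ∷ W) ≡ i ∷ I →
           Cut W (λ a b → [ not (memb m b) ] H (del m (x ∷ a)) b) ≈ Cut (del m (x ∷ W))
               (λ a b → [ ⌊ lastOr i I <? k + (length a + suc (length I)) ⌋ ] H a b)
      go e with x ≟ m
      go refl | yes refl with posFrom (suc k) x W in eq
      -- The head is the last occurrence, so all cuts of the rest qualify.
      ... | [] = begin
        Cut W (λ a b → [ not (memb x b) ] H (del x a) b)
          ≈⟨ Cut-cong∈ W (λ a b e → ≈-reflexive (cong₂ (λ z y → [ not z ] H y b)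
              (∉⇒memb {x} {b} (λ j → x∉W (⊆-++ʳ e j))) (del-∉ a (λ j → x∉W (⊆-++ˡ e j))))) ⟩
        Cut W H
          ≡⟨ cong (λ z → Cut z H) (≡.sym (del-∉ W x∉W)) ⟩
        Cut (del x W) H
          ≈⟨ Cut-cong (del x W) (λ a b → ≈-sym ([]-yes (k <? k + (length a + 1))
              (subst (k <_) (cong (k +_) (ℕ.+-comm 1 (length a))) (ℕ.m<m+n k (s≤s z≤n))))) ⟩
        Cut (del x W) (λ a b → [ ⌊ k <? k + (length a + 1) ⌋ ] H a b) ∎
        where
          x∉W : x ∉ W
          x∉W j = posFrom-∈ (suc k) j eq
      ... | j ∷ J = ≈-trans (Cut-avoidʳ x (suc k) W j J H eq)
        (Cut-cong (del x W) (λ a b → ≈-reflexive (cong (λ z → [ ⌊ lastOr j J <? z ⌋ ] H a b)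
          (≡.trans (≡.sym (+-suc k _)) (cong (k +_) (≡.sym (+-suc (length a) (suc (length J)))))))))
      go e | no x≢m = begin
        Cut W (λ a b → [ not (memb m b) ] H (x ∷ del m a) b)
          ≈⟨ Cut-avoidʳ m (suc k) W i I (λ a → H (x ∷ a)) e ⟩
        Cut (del m W) (λ a b → [ ⌊ lastOr i I <? suc k + (length a + suc (length I)) ⌋ ] H (x ∷ a) b)
          ≈⟨ Cut-cong (del m W) (λ a b → ≈-reflexive
              (cong (λ z → [ ⌊ lastOr i I <? z ⌋ ] H (x ∷ a) b) (≡.sym (+-suc k _)))) ⟩
        Cut (del m W) (λ a b → [ ⌊ lastOr i I <? k + (suc (length a) + suc (length I)) ⌋ ] H (x ∷ a) b)
          ≈⟨ +-identityˡ _ ⟨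
        -- The zero stands for the cut with empty left part: its bound fails, since the positions
        -- are all larger than `k` and the last of them is at least `k + suc (length I)`.
        0# ⊕ Cut (del m W) (λ a b → [ ⌊ lastOr i I <? k + (suc (length a) + suc (length I)) ⌋ ] H (x ∷ a) b)
          ≈⟨ +-congʳ ([]-no (lastOr i I <? k + suc (length I))
              (ℕ.≤⇒≯ (≤-trans (ℕ.≤-reflexive (+-suc k (length I)))
              (last-lower i I (subst (Sorted (suc k)) e (posFrom-sorted (suc k) m W)))))) ⟨
        [ ⌊ lastOr i I <? k + suc (length I) ⌋ ] H [] (x ∷ del m W) ⊕ Cut (del m W)
            (λ a b → [ ⌊ lastOr i I <? k + (suc (length a) + suc (length I)) ⌋ ] H (x ∷ a) b)
          ≈⟨ Cut-∷ x (del m W) (λ a b → [ ⌊ lastOr i I <? k + (length a + suc (length I)) ⌋ ] H a b) ⟨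
        Cut (x ∷ del m W) (λ a b → [ ⌊ lastOr i I <? k + (length a + suc (length I)) ⌋ ] H a b) ∎

  map-∸-+ : ∀ k J → map (_∸ k) (map (k +_) J) ≡ J
  map-∸-+ k J = ≡.trans (≡.sym (map-∘ J)) (≡.trans (map-cong (λ j → ℕ.m+n∸m≡n k j) J) (map-id J))

  -- In a cut counted by Δ≻ the right part contains all maximal letters, at positions lowered by the
  -- length of the left part. `G` is the test with its right argument given by positions and
  -- remainder, which transfers the cut to `rem W`.
  cop-right-pos : ∀ W i I → Packed W → W ≢ [] → pos W ≡ i ∷ I → ∀ f (G : Word → List ℕ → Word → K) →
    (∀ u v → Packed v → v ≢ [] → f u v ≈ G u (pos v) (rem v)) →
    cop right f W ≈ cop full (λ u v → [ ⌊ length u <? i ⌋ ] G u (map (_∸ length u) (i ∷ I)) v) (rem W)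
  cop-right-pos W i I pk ne e f G fG = begin
    cop right f W ≈⟨ Cut-cong∈ W term ⟩
    Cut W (λ a b → [ not (memb m a) ] H a (del m b)) ≈⟨ Cut-avoidˡ m 1 W i I H e ⟩
    Cut (rem W) (λ a b → [ ⌊ suc (length a) ≤? i ⌋ ] H a b) ≈⟨ Cut-cong (rem W)
        (λ a b → ≈-reflexive (flip a b)) ⟩
    cop full (λ u v → [ ⌊ length u <? i ⌋ ] G u (map (_∸ length u) (i ∷ I)) v) (rem W) ∎
    where
      m = maxW W
      H : Word → Word → K
      H a b = [ disjointB a b ∧ true ] G (pack a) (map (_∸ length (pack a)) (i ∷ I)) (pack b)
      flip : ∀ a b → [ ⌊ suc (length a) ≤? i ⌋ ] H a b ≡
        [ disjointB a b ∧ true ] [ ⌊ length (pack a) <? i ⌋ ] G (pack a)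
            (map (_∸ length (pack a)) (i ∷ I)) (pack b)
      flip a b = ≡.trans ([]-swap ⌊ suc (length a) ≤? i ⌋ (disjointB a b ∧ true) _)
        (cong (λ n → [ disjointB a b ∧ true ] [ ⌊ suc n ≤? i ⌋ ] G (pack a)
            (map (_∸ length (pack a)) (i ∷ I)) (pack b)) (≡.sym (length-pack a)))
      term : ∀ a b → a ++ b ≡ W → [ disjointB a b ∧ not (memb m a) ] f (pack a) (pack b) ≈ [ not
          (memb m a) ] H a (del m b)
      term a b eW with memb m a in eq
      ... | true = ≈-reflexive (cong ([_] f (pack a) (pack b)) (∧-zero (disjointB a b)))
        where
          ∧-zero : ∀ b → b ∧ false ≡ false
          ∧-zero true = refl
          ∧-zero false = refl
      ... | false = ≈-trans ([]-cong (disjointB a b ∧ true) value)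
            (≈-reflexive (cong (λ z → [ z ∧ true ] G (pack a) (map (_∸ length (pack a)) (i ∷ I))
                (pack (del m b))) dis))
        where
          m∉a : m ∉ a
          m∉a = memb⇒∉ {m} {a} eq
          m∈b : m ∈ b
          m∈b with ∈-++⁻ a (subst (m ∈_) (≡.sym eW) (nonempty-∈ ne))
          ... | inj₁ j = ⊥-elim (m∉a j)
          ... | inj₂ j = j
          b≢[] : b ≢ []
          b≢[] refl with m∈b
          ... | ()
          max-b : maxW b ≡ m
          max-b = maxW-⊆ {b} {W} (⊆-++ʳ eW) m∈b
          pos-b : Pos b
          pos-b = Pos-⊆ (⊆-++ʳ eW) (proj₁ pk)
          dis : disjointB a b ≡ disjointB a (del m b)
          dis = disjointB-ext (λ d i j → d i (proj₁ (∈-del⁻ b j)))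
              (λ d i j → d i (∈-del⁺ j (λ { refl → m∉a i })))
          positions : pos b ≡ map (_∸ length (pack a)) (i ∷ I)
          positions = ≡.sym (≡.trans (cong (λ n → map (_∸ n) (i ∷ I)) (length-pack a))
                (≡.trans (cong (map (_∸ length a)) step) (map-∸-+ (length a) (pos b))))
            where
              step : i ∷ I ≡ map (length a +_) (pos b)
              step = ≡.trans (≡.sym e) (≡.trans (cong (posFrom 1 m) (≡.sym eW)) (≡.trans (posFrom-++ 1 m a b)
                (≡.trans (cong (_++ posFrom (1 + length a) m b) (posFrom-∉ 1 a m∉a))
                  (≡.trans (cong (λ n → posFrom n m b) (ℕ.+-comm 1 (length a)))
                    (≡.trans (posFrom-+ (length a) 1 m b)
                        (cong (λ n → map (length a +_) (posFrom 1 n b)) (≡.sym max-b)))))))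
          value : f (pack a) (pack b) ≈ G (pack a) (map (_∸ length (pack a)) (i ∷ I)) (pack (del m b))
          value = ≈-trans (fG (pack a) (pack b) (Packed-pack pos-b) (pack-≢[] b b≢[]))
            (≈-reflexive (cong₂ (G (pack a)) (≡.trans (pos-pack pos-b b≢[]) positions)
              (≡.trans (rem-pack pos-b b≢[]) (cong (λ n → pack (del n b)) max-b))))

  -- In a cut counted by Δ≺ the left part contains all maximal letters, at their old positions. For
  -- a left part `u` of the remainder this needs i_p to be at most the length of `u` plus p.
  cop-left-pos : ∀ W i I → Packed W → W ≢ [] → pos W ≡ i ∷ I → ∀ f (G : List ℕ → Word → Word → K) →
    (∀ u v → Packed u → u ≢ [] → f u v ≈ G (pos u) (rem u) v) →
    cop left f W ≈ cop full (λ u v → [ ⌊ lastOr i I <? suc (length u + suc (length I)) ⌋ ] G (i ∷ I) u v)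
        (rem W)
  cop-left-pos W i I pk ne e f G fG = begin
    cop left f W ≈⟨ Cut-cong∈ W term ⟩
    Cut W (λ a b → [ not (memb m b) ] H (del m a) b) ≈⟨ Cut-avoidʳ m 1 W i I H e ⟩
    Cut (rem W) (λ a b → [ ⌊ lastOr i I <? suc (length a + suc (length I)) ⌋ ] H a b) ≈⟨ Cut-cong (rem W)
        (λ a b → ≈-reflexive (flip a b)) ⟩
    cop full (λ u v → [ ⌊ lastOr i I <? suc (length u + suc (length I)) ⌋ ] G (i ∷ I) u v) (rem W) ∎
    where
      m = maxW W
      H : Word → Word → K
      H a b = [ disjointB a b ∧ true ] G (i ∷ I) (pack a) (pack b)
      flip : ∀ a b → [ ⌊ lastOr i I <? suc (length a + suc (length I)) ⌋ ] H a b ≡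
        [ disjointB a b ∧ true ] [ ⌊ lastOr i I <? suc (length (pack a) + suc (length I)) ⌋ ] G (i ∷ I)
            (pack a) (pack b)
      flip a b = ≡.trans ([]-swap ⌊ lastOr i I <? suc (length a + suc (length I)) ⌋ (disjointB a b ∧ true) _)
        (cong (λ n → [ disjointB a b ∧ true ] [ ⌊ lastOr i I <? suc (n + suc (length I)) ⌋ ] G (i ∷ I)
            (pack a) (pack b)) (≡.sym (length-pack a)))
      term : ∀ a b → a ++ b ≡ W → [ disjointB a b ∧ memb m a ] f (pack a) (pack b) ≈ [ not (memb m b) ] H
          (del m a) b
      term a b eW with memb m b in eq
      ... | true = ≈-reflexive (cong ([_] f (pack a) (pack b))
          (bool-ext {disjointB a b ∧ memb m a} {false} (λ t → ⊥-elim (contra (∧-split (disjointB a b) t)))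
          (λ ())))
        where
          contra : disjointB a b ≡ true × memb m a ≡ true → ⊥
          contra (d , i) = disjointB⇒ a b d (memb⇒∈ a i) (memb⇒∈ b eq)
      ... | false = ≈-trans (≈-reflexive (cong (λ z → [ disjointB a b ∧ z ] f (pack a) (pack b))
          (∈⇒memb m∈a)))
            (≈-trans ([]-cong (disjointB a b ∧ true) value)
            (≈-reflexive (cong (λ z → [ z ∧ true ] G (i ∷ I) (pack (del m a)) (pack b)) dis)))
        where
          m∉b : m ∉ b
          m∉b = memb⇒∉ {m} {b} eq
          m∈a : m ∈ a
          m∈a with ∈-++⁻ a (subst (m ∈_) (≡.sym eW) (nonempty-∈ ne))
          ... | inj₁ j = j
          ... | inj₂ j = ⊥-elim (m∉b j)
          a≢[] : a ≢ []
          a≢[] refl with m∈a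
          ... | ()
          max-a : maxW a ≡ m
          max-a = maxW-⊆ {a} {W} (⊆-++ˡ eW) m∈a
          pos-a : Pos a
          pos-a = Pos-⊆ (⊆-++ˡ eW) (proj₁ pk)
          dis : disjointB a b ≡ disjointB (del m a) b
          dis = disjointB-ext (λ d i j → d (proj₁ (∈-del⁻ a i)) j)
              (λ d i j → d (∈-del⁺ i (λ { refl → m∉b j })) j)
          positions : pos a ≡ i ∷ I
          positions = ≡.trans (cong (λ n → posFrom 1 n a) max-a) (≡.trans (≡.sym (++-identityʳ _))
            (≡.trans (cong (posFrom 1 m a ++_) (≡.sym (posFrom-∉ (1 + length a) b m∉b)))
              (≡.trans (≡.sym (posFrom-++ 1 m a b)) (≡.trans (cong (posFrom 1 m) eW) e))))
          value : f (pack a) (pack b) ≈ G (i ∷ I) (pack (del m a)) (pack b)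
          value = ≈-trans (fG (pack a) (pack b) (Packed-pack pos-a) (pack-≢[] a a≢[]))
            (≈-reflexive (cong₂ (λ J z → G J z (pack b)) (≡.trans (pos-pack pos-a a≢[]) positions)
              (≡.trans (rem-pack pos-a a≢[]) (cong (λ n → pack (del n a)) max-a))))

  cop-halves : ∀ f w → cop full f w ≈ cop right f w ⊕ cop left f w
  cop-halves f w = ≈-trans (Cut-cong w (λ p s → halves (disjointB p s) (memb (maxW w) p) _)) (Cut-⊕ w _ _)
    where
      halves : ∀ d b x → [ d ∧ true ] x ≈ [ d ∧ not b ] x ⊕ [ d ∧ b ] x
      halves false b x = ≈-sym (+-identityˡ _)
      halves true true x = ≈-sym (+-identityˡ _)
      halves true false x = ≈-sym (+-identityʳ _)

  -- The transpose of `Φ I`; the value 0 stands for the words on which `Φ I` vanishes.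
  phiK : List ℕ → (Word → K) → Word → K
  phiK I f w = maybe f 0# (phiW I w)

  phiK-zero : ∀ I w {f : Word → K} → (∀ W → f W ≈ 0#) → phiK I f w ≈ 0#
  phiK-zero I w h with phiW I w
  ... | just W = h W
  ... | nothing = ≈-refl

  private
    single : K → Maybe Word → V
    single a = maybe (λ w′ → (a , w′) ∷ []) []

  ⟪Φ⟫ : ∀ I x f → ⟪ Φ I x , f ⟫ ≈ ⟪ x , phiK I f ⟫
  ⟪Φ⟫ I x f = ≈-trans (∑-concatMap (λ p → single (proj₁ p) (phiW I (proj₂ p))) x
      (λ r → proj₁ r ⊛ f (proj₂ r))) (∑-cong x (λ p → term (proj₁ p) (phiW I (proj₂ p))))
    where
      term : ∀ a (r : Maybe Word) → ∑ (single a r) (λ r → proj₁ r ⊛ f (proj₂ r)) ≈ a ⊛ maybe f 0# r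
      term a (just W) = +-identityʳ _
      term a nothing = ≈-sym (zeroʳ _)

  Deg-Φ : ∀ {n x} I → Sorted 1 I → I ≢ [] → Deg n x → Deg (length I + n) (Φ I x)
  Deg-Φ {n} I s ne d = All-concatMap (λ p → single (proj₁ p) (phiW I (proj₂ p)))
      (All.map (λ {p} pw → term (proj₁ p) (proj₂ p) pw (phiW I (proj₂ p)) refl) d)
    where
      term : ∀ a w → PW n w → (r : Maybe Word) → phiW I w ≡ r → Deg (length I + n) (single a r)
      term a w (pk , len) nothing eq = []
      term a w (pk , len) (just W) eq = (phi-packed s ne eq pk , ≡.trans (phi-length s ne eq)
          (cong (length I +_) len)) ∷ []

  -- Independence, spanning and tensor products of families

  mutual
    _≟T_ : DecidableEquality Tree
    node I l r ≟T node I′ l′ r′ with I ≟W I′ | l ≟F l′ | r ≟F r′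
    ... | yes refl | yes refl | yes refl = yes refl
    ... | no n | _ | _ = no (λ { refl → n refl })
    ... | yes _ | no n | _ = no (λ { refl → n refl })
    ... | yes _ | yes _ | no n = no (λ { refl → n refl })

    _≟F_ : DecidableEquality Forest
    [] ≟F [] = yes refl
    [] ≟F (_ ∷ _) = no (λ ())
    (_ ∷ _) ≟F [] = no (λ ())
    (t ∷ ts) ≟F (s ∷ ss) with t ≟T s | ts ≟F ss
    ... | yes refl | yes refl = yes refl
    ... | no n | _ = no (λ { refl → n refl })
    ... | yes _ | no n = no (λ { refl → n refl })

  module CW = Coeff _≟W_
  module CT = Coeff _≟T_
  module CF = Coeff _≟F_

  -- Independence is stated for formal combinations with possibly repeated indices:
  -- their collected coefficients vanish.
  Indep : {X : Set} → DecidableEquality X → (X → Set) → (X → V) → Set _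
  Indep {X} _≟_ Idx e = ∀ (cs : List (K × X)) → Supp Idx cs → (∀ f → ⟪ cs , (λ y → ⟪ e y , f ⟫) ⟫ ≈ 0#) →
                        ∀ y → Idx y → ⟪ cs , Coeff.δ _≟_ y ⟫ ≈ 0#

  Span : {X : Set} → (X → Set) → (X → V) → V → Set _
  Span {X} Idx e x = Σ[ cs ∈ List (K × X) ] (Supp Idx cs × (∀ f → ⟪ cs , (λ y → ⟪ e y , f ⟫) ⟫ ≈ ⟪ x , f ⟫))

  ⟪lincomb⟫ : ∀ {X : Set} (e : X → V) cs f → ⟪ lincomb e cs , f ⟫ ≈ ⟪ cs , (λ y → ⟪ e y , f ⟫) ⟫
  ⟪lincomb⟫ e cs f = ≈-trans (∑-concatMap (λ p → scale (proj₁ p) (e (proj₂ p))) cs _)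
      (∑-cong cs (λ p → ⟪⟫-scale (proj₁ p) (e (proj₂ p)) f))

  reindex : ∀ {a b} {A : Set a} {B : Set b} → (A → List B) → List (K × A) → List (K × B)
  reindex h = concatMap (λ p → map (proj₁ p ,_) (h (proj₂ p)))

  ⟪reindex⟫ : ∀ {a b} {A : Set a} {B : Set b} (h : A → List B) cs f → ⟪ reindex h cs , f ⟫ ≈
      ⟪ cs , (λ x → ∑ (h x) f) ⟫
  ⟪reindex⟫ h cs f = ≈-trans (∑-concatMap (λ p → map (proj₁ p ,_) (h (proj₂ p))) cs _) (∑-cong cs (λ p →
    ≈-trans (∑-map (proj₁ p ,_) (h (proj₂ p)) _) (≈-sym (∑-⊛ (proj₁ p) (h (proj₂ p)) f))))

  Supp-reindex : ∀ {a b p} {A : Set a} {B : Set b} {T : B → Set p} (h : A → List B) {cs} → Supp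
      (λ x → All T (h x)) cs → Supp T (reindex h cs)
  Supp-reindex h s = All-concatMap (λ p → map (proj₁ p ,_) (h (proj₂ p))) (All.map (λ a → Allₚ.map⁺ a) s)

  keep : ∀ {a} {A : Set a} → Bool → A → List A
  keep b x = if b then x ∷ [] else []

  ∑-keep : ∀ {a} {A : Set a} b (x : A) f → ∑ (keep b x) f ≈ [ b ] f x
  ∑-keep true x f = +-identityʳ _
  ∑-keep false x f = ≈-refl

  All-keep : ∀ {a p q} {A : Set a} {P : Set p} {T : A → Set q} (d : Dec P) {x : A} → (P → T x) → All T
      (keep ⌊ d ⌋ x)
  All-keep (yes q) h = h q ∷ []
  All-keep (no _) h = []

  module _ {X Y : Set} {_≟X_ : DecidableEquality X} {_≟Y_ : DecidableEquality Y}
           {IX : X → Set} {IY : Y → Set} {eX : X → V} {eY : Y → V} where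

    private
      module X = Coeff _≟X_
      module Y = Coeff _≟Y_

    -- Contracting the first factor with a fixed form leaves a relation among the `eY`, whose
    -- coefficients vanish. For fixed `y` these coefficients, as the form varies, express a relation
    -- among the `eX`. Tests of the form `f u ⊛ h v` are enough.
    tensor-indep : Indep _≟X_ IX eX → Indep _≟Y_ IY eY →
      ∀ (ts : List (K × (X × Y))) → Supp (λ p → IX (proj₁ p) × IY (proj₂ p)) ts →
      (∀ g → ⟪ ts , (λ p → ⟪ eX (proj₁ p) , (λ u → ⟪ eY (proj₂ p) , g u ⟫) ⟫) ⟫ ≈ 0#) →
      ∀ x y → IX x → IY y → ⟪ ts , (λ p → X.δ x (proj₁ p) ⊛ Y.δ y (proj₂ p)) ⟫ ≈ 0#
    tensor-indep indX indY ts sup zero₂ x y ix iy = begin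
      ⟪ ts , (λ p → X.δ x (proj₁ p) ⊛ Y.δ y (proj₂ p)) ⟫ ≈⟨ ≈-trans (⟪weigh⟫ _ proj₁ _)
          (∑-cong ts (λ p → *-congˡ (*-comm _ _))) ⟨
      ⟪ weigh (λ p → Y.δ y (proj₂ p)) proj₁ , X.δ x ⟫ ≈⟨ indX (weigh (λ p → Y.δ y (proj₂ p)) proj₁)
          (Supp-weigh _ proj₁ (All.map proj₁ sup)) zeroˡ-part x ix ⟩
      0# ∎
      where
        weigh : ∀ {Z : Set} → (X × Y → K) → (X × Y → Z) → List (K × Z)
        weigh k π = map (λ p → proj₁ p ⊛ k (proj₂ p) , π (proj₂ p)) ts
        ⟪weigh⟫ : ∀ {Z : Set} k (π : X × Y → Z) f → ⟪ weigh k π , f ⟫ ≈ ⟪ ts , (λ p → k p ⊛ f (π p)) ⟫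
        ⟪weigh⟫ k π f = ≈-trans (∑-map _ ts _) (∑-cong ts (λ p → *-assoc _ _ _))
        Supp-weigh : ∀ {Z : Set} {T : Z → Set} k (π : X × Y → Z) → Supp (λ p → T (π p)) ts → Supp T
            (weigh k π)
        Supp-weigh k π s = Allₚ.map⁺ s
        zeroʳ-part : ∀ f → ⟪ ts , (λ p → ⟪ eX (proj₁ p) , f ⟫ ⊛ Y.δ y (proj₂ p)) ⟫ ≈ 0#
        zeroʳ-part f = ≈-trans (≈-sym (⟪weigh⟫ (λ p → ⟪ eX (proj₁ p) , f ⟫) proj₂ (Y.δ y)))
          (indY (weigh (λ p → ⟪ eX (proj₁ p) , f ⟫) proj₂) (Supp-weigh _ proj₂ (All.map proj₂ sup))
              (λ h → begin
            ⟪ weigh (λ p → ⟪ eX (proj₁ p) , f ⟫) proj₂ , (λ z → ⟪ eY z , h ⟫) ⟫ ≈⟨ ⟪weigh⟫ _ proj₂ _ ⟩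
            ⟪ ts , (λ p → ⟪ eX (proj₁ p) , f ⟫ ⊛ ⟪ eY (proj₂ p) , h ⟫) ⟫
              ≈⟨ ⟪⟫-cong ts (λ p → ≈-trans (*-comm _ _) (≈-trans (≈-sym (⟪⟫-⊛ _ (eX (proj₁ p)) f))
                   (⟪⟫-cong (eX (proj₁ p)) (λ u → ≈-trans (*-comm _ _)
                       (≈-sym (⟪⟫-⊛ (f u) (eY (proj₂ p)) h)))))) ⟩
            ⟪ ts , (λ p → ⟪ eX (proj₁ p) , (λ u → ⟪ eY (proj₂ p) , (λ v → f u ⊛ h v) ⟫) ⟫) ⟫ ≈⟨ zero₂
                (λ u v → f u ⊛ h v) ⟩
            0# ∎) y iy)
        zeroˡ-part : ∀ f → ⟪ weigh (λ p → Y.δ y (proj₂ p)) proj₁ , (λ z → ⟪ eX z , f ⟫) ⟫ ≈ 0#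
        zeroˡ-part f = ≈-trans (⟪weigh⟫ _ proj₁ _) (≈-trans (⟪⟫-cong ts (λ p → *-comm _ _)) (zeroʳ-part f))

  -- The component R u ⊗ ? of the coproduct

  slice : (Bool → Bool) → Word → V → V
  slice χ u = reindex (λ w → concatMap (λ p → keep (accept χ w (proj₁ p) (proj₂ p) ∧ ⌊ pack (proj₁ p) ≟W u
      ⌋) (pack (proj₂ p))) (decs w))

  ⟪slice⟫ : ∀ χ u x g → ⟪ slice χ u x , g ⟫ ≈ ⟪ x , cop χ (λ p s → [ ⌊ p ≟W u ⌋ ] g s) ⟫
  ⟪slice⟫ χ u x g = ≈-trans (⟪reindex⟫ (λ w → concatMap (cut w) (decs w)) x g) (⟪⟫-cong x (λ w →
    ≈-trans (∑-concatMap (cut w) (decs w) g) (∑-cong (decs w) (λ p →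
      ≈-trans (∑-keep (accept χ w (proj₁ p) (proj₂ p) ∧ ⌊ pack (proj₁ p) ≟W u ⌋) (pack (proj₂ p)) g)
          (≈-reflexive ([]-∧ (accept χ w (proj₁ p) (proj₂ p)) _ _))))))
    where
      cut : Word → Word × Word → List Word
      cut w p = keep (accept χ w (proj₁ p) (proj₂ p) ∧ ⌊ pack (proj₁ p) ≟W u ⌋) (pack (proj₂ p))

  Deg-slice : ∀ {n x} χ u → Deg n x → Deg (n ∸ length u) (slice χ u x)
  Deg-slice {n} χ u d = Supp-reindex _ (All.map (λ {q} pw → All-concatMap _
      (All.map (λ {p} e → word (proj₂ q) (proj₁ p) (proj₂ p) pw e) (decs-++ (proj₂ q)))) d)
    where
      word : ∀ w p s → PW n w → p ++ s ≡ w → All (PW (n ∸ length u))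
          (keep (accept χ w p s ∧ ⌊ pack p ≟W u ⌋) (pack s))
      word w p s (pk , len) e with accept χ w p s | pack p ≟W u
      ... | false | _ = []
      ... | true | no _ = []
      ... | true | yes refl = (Packed-pack (Pos-⊆ (⊆-++ʳ e) (proj₁ pk)) ,
          ≡.trans (length-pack s) (≡.sym (≡.trans (cong₂ _∸_
              (≡.trans (≡.sym len) (≡.trans (cong length (≡.sym e)) (length-++ p))) (length-pack p))
              (ℕ.m+n∸m≡n (length p) (length s))))) ∷ []

  subtract : V → V → V
  subtract x y = x ++ scale (⊖ 1#) y

  ⟪subtract⟫ : ∀ x y f → ⟪ subtract x y , f ⟫ ≈ ⟪ x , f ⟫ ⊕ ⊖ ⟪ y , f ⟫
  ⟪subtract⟫ x y f = ≈-trans (⟪⟫-++ x (scale (⊖ 1#) y) f)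
      (+-congˡ (≈-trans (⟪⟫-scale (⊖ 1#) y f) (≈-trans (≈-sym (-‿distribˡ-* _ _)) (-‿cong (*-identityˡ _)))))

  -- Triangularity with respect to leading coproduct components

  ∑-unique : ∀ {A : Set} (_≟_ : DecidableEquality A) {U : List A} {p} → Unique U → p ∈ U → ∀ (g : A → K) →
      ∑ U (λ u → [ ⌊ p ≟ u ⌋ ] g u) ≈ g p
  ∑-unique _≟_ {u ∷ U} {p} (f ∷ un) (here refl) g = ≈-trans
      (+-cong ([]-yes (p ≟ p) refl) (∑-zeroᴬ (All.map (λ n → []-no (p ≟ _) n) f))) (+-identityʳ _)
  ∑-unique _≟_ {u ∷ U} {p} (f ∷ un) (there i) g = ≈-trans
      (+-cong ([]-no (p ≟ u) (λ e → All.lookup f i (≡.sym e))) (∑-unique _≟_ un i g)) (+-identityˡ _)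

  ∑-absent : ∀ {U : List Word} {p} → p ∉ U → ∀ (g : Word → K) → ∑ U (λ u → [ ⌊ p ≟W u ⌋ ] g u) ≈ 0#
  ∑-absent {U} {p} n g = ∑-zeroᴬ (All.tabulate (λ {u} i → []-no (p ≟W u) (λ { refl → n i })))

  -- An index `z` amounts to the pair `lft z`, `rgt z`, and the leading component of Δ_χ on `e z` is
  -- `ℙF (lft z)` tensor `ℙ (rgt z)`. `Good` cuts out the space to be spanned, `Factor` is the
  -- property that right factors inherit. The condition on `χ` keeps the trivial cut with empty left
  -- part, which makes level 0 meaningful. The instances use `full` for forests and `right` for
  -- trees.
  record FilteredFamily (n : ℕ) : Set (lsuc (c ⊔ˡ ℓ)) where
    field
      1≤n : 1 ≤ n
      χ : Bool → Bool
      χ-false : χ false ≡ true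
      Good : V → Set (c ⊔ˡ ℓ)
      Factor : ℕ → V → Set (c ⊔ˡ ℓ)
      IL : ℕ → Forest → Set
      IR : ℕ → Tree → Set
      X : Set
      _≟X_ : DecidableEquality X
      Idx : X → Set
      e : X → V
      lft : X → Forest
      rgt : X → Tree
      mk : Forest → Tree → X
      lft-idx : ∀ {z} → Idx z → IL (ωF (lft z)) (lft z)
      rgt-idx : ∀ {z} → Idx z → IR (n ∸ ωF (lft z)) (rgt z)
      lev-< : ∀ {z} → Idx z → ωF (lft z) < n
      mk-idx : ∀ {c h t} → c < n → IL c h → IR (n ∸ c) t → Idx (mk h t)
      lft-mk : ∀ h t → lft (mk h t) ≡ h
      rgt-mk : ∀ {c t} h → IR c t → rgt (mk h t) ≡ t
      mk-eta : ∀ {z} → Idx z → mk (lft z) (rgt z) ≡ z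
      IL-weight : ∀ {c h} → IL c h → ωF h ≡ c
      IL-deg : ∀ {c h} → IL c h → Deg c (ℙF h)
      IR-deg : ∀ {c t} → IR c t → Deg c (ℙ t)
      e-deg : ∀ {z} → Idx z → Deg n (e z)
      lead : ∀ {z} → Idx z → ∀ f → (∀ p → f p [] ≈ 0#) → (∀ u v → length u < ωF (lft z) → f u v ≈ 0#) →
             ⟪ e z , cop χ f ⟫ ≈ ⟪ ℙF (lft z) , (λ u → ⟪ ℙ (rgt z) , f u ⟫) ⟫
      indL : ∀ {c} → c < n → Indep _≟F_ (IL c) ℙF
      spanL : ∀ {c} → c < n → ∀ x → Deg c x → Span (IL c) ℙF x
      indR : ∀ {k} → 1 ≤ k → k ≤ n → Indep _≟T_ (IR k) ℙ
      spanR : ∀ {k} → 1 ≤ k → k ≤ n → ∀ x → Deg k x → Factor k x → Span (IR k) ℙ x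
      Good-sub : ∀ {x y} → Good x → Good y → Good (subtract x y)
      Good-lin : ∀ {cs} → Supp Idx cs → Good (lincomb e cs)
      slice-Factor : ∀ {x c} → Good x → Deg n x → c < n →
        (∀ c′ → c < c′ → c′ < n → ∀ g → (∀ u v → length u ≢ c′ → g u v ≈ 0#) → ⟪ x , cop χ g ⟫ ≈ 0#) →
        ∀ u → length u ≡ c → Factor (n ∸ c) (slice χ u x)

  module Filtration {n : ℕ} (family : FilteredFamily n) where
    open FilteredFamily family

    private
      module X = Coeff _≟X_

      lev : X → ℕ
      lev z = ωF (lft z)

      Below : ℕ → V → Set _
      Below c x = ∀ c′ → c ≤ c′ → c′ < n → ∀ g → (∀ u v → length u ≢ c′ → g u v ≈ 0#) → ⟪ x , cop χ g ⟫ ≈ 0#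

      -- On degree n, a test supported on left degree c < n never sees the trivial right-hand cut.
      strip-eq : ∀ {c x} → c < n → Deg n x → ∀ g → (∀ u v → length u ≢ c → g u v ≈ 0#) → ⟪ x , cop χ g ⟫ ≈
          ⟪ x , cop χ (strip g) ⟫
      strip-eq {c} {x} c<n d g g0 = ⟪⟫-congᴬ {x = x}
          (All.map (λ {q} pw → cop-cong χ (proj₂ q) {g} {strip g}
          (λ { p [] eq → g0 p [] (λ e′ → ℕ.<⇒≢ c<n (≡.trans (≡.sym e′)
          (≡.trans (≡.sym (ℕ.+-identityʳ _)) (≡.trans eq (proj₂ pw))))) ; p (_ ∷ _) eq → ≈-refl })) d)

      lead-at : ∀ {z c} → Idx z → c < n → lev z ≤ c → ∀ g → (∀ u v → length u ≢ c → g u v ≈ 0#) →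
        ⟪ e z , cop χ g ⟫ ≈ ⟪ ℙF (lft z) , (λ u → ⟪ ℙ (rgt z) , g u ⟫) ⟫
      lead-at {z} {c} iz c<n le g g0 = begin
        ⟪ e z , cop χ g ⟫ ≈⟨ strip-eq {x = e z} c<n (e-deg iz) g g0 ⟩
        ⟪ e z , cop χ (strip g) ⟫ ≈⟨ lead iz (strip g) (λ _ → ≈-refl) small ⟩
        ⟪ ℙF (lft z) , (λ u → ⟪ ℙ (rgt z) , strip g u ⟫) ⟫
          ≈⟨ ⟪⟫-cong (ℙF (lft z)) (λ u → ⟪⟫-congᴬ {x = ℙ (rgt z)}
              (All.map (strip-≢[] g u) (Deg-≢[] (ℕ.m<n⇒0<n∸m (lev-< iz)) (IR-deg (rgt-idx iz))))) ⟩
        ⟪ ℙF (lft z) , (λ u → ⟪ ℙ (rgt z) , g u ⟫) ⟫ ∎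
        where
          small : ∀ u v → length u < lev z → strip g u v ≈ 0#
          small u [] lt = ≈-refl
          small u (_ ∷ _) lt = g0 u _ (λ { refl → ℕ.<⇒≱ lt le })

      lead-zero : ∀ {z c} → Idx z → c < n → lev z < c → ∀ g → (∀ u v → length u ≢ c → g u v ≈ 0#) →
          ⟪ e z , cop χ g ⟫ ≈ 0#
      lead-zero {z} iz c<n lt g g0 = ≈-trans (lead-at iz c<n (ℕ.<⇒≤ lt) g g0)
        (⟪⟫-zeroᴬ {x = ℙF (lft z)} (All.map (λ {q} pw → ⟪⟫-zero (ℙ (rgt z))
            (λ v → g0 (proj₂ q) v (λ e′ → ℕ.<⇒≢ lt (≡.trans (≡.sym (proj₂ pw)) e′)))) (IL-deg (lft-idx iz))))

      -- Descending induction on the level `c`, with `d` as the distance to `n`. In left degree `c`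
      -- the indices of lower level contribute nothing, those of higher level have zero coefficients
      -- already, and the remaining leading tensors are independent.
      independent-from : ∀ {cs} → Supp Idx cs → (∀ f → ⟪ cs , (λ y → ⟪ e y , f ⟫) ⟫ ≈ 0#) →
        ∀ d {c} → c + d ≡ n → ∀ y → Idx y → c ≤ lev y → ⟪ cs , X.δ y ⟫ ≈ 0#
      independent-from {cs} sup zero₁ zero {c} eq y iy le = ⊥-elim
          (ℕ.<⇒≱ (lev-< iy) (subst (_≤ lev y) (≡.trans (≡.sym (ℕ.+-identityʳ c)) eq) le))
      independent-from {cs} sup zero₁ (suc d) {c} eq y iy le with c ≟ lev y
      ... | no ne = independent-from sup zero₁ d (≡.trans (≡.sym (ℕ.+-suc c d)) eq) y iy (ℕ.≤∧≢⇒< le ne)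
      ... | yes refl = begin
        ⟪ cs , X.δ y ⟫
          ≈⟨ ⟪⟫-congᴬ {x = cs} (All.map (λ {q} iz → ≈-trans (collect (proj₂ q) iz)
              (≈-sym (∑-keep ⌊ lev (proj₂ q) ≟ c ⌋ (lft (proj₂ q) , rgt (proj₂ q)) test))) sup) ⟩
        ⟪ cs , (λ z → ∑ (pairs z) test) ⟫ ≈⟨ ⟪reindex⟫ pairs cs test ⟨
        ⟪ ts , test ⟫
          ≈⟨ tensor-indep {_≟X_ = _≟F_} {_≟T_} {IL c} {IR (n ∸ c)} {ℙF} {ℙ} (indL c<n)
              (indR (ℕ.m<n⇒0<n∸m c<n) (ℕ.m∸n≤m n c)) ts
               (Supp-reindex pairs (All.map (λ {q} iz → All-keep (lev (proj₂ q) ≟ c)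
                   (λ eq′ → subst (λ k → IL k (lft (proj₂ q))) eq′ (lft-idx iz) , subst
                   (λ k → IR (n ∸ k) (rgt (proj₂ q))) eq′ (rgt-idx iz))) sup))
               tensor-zero (lft y) (rgt y) (lft-idx iy) (rgt-idx iy) ⟩
        0# ∎
        where
          c<n : c < n
          c<n = lev-< iy
          pairs : X → List (Forest × Tree)
          pairs z = keep ⌊ lev z ≟ c ⌋ (lft z , rgt z)
          ts = reindex pairs cs
          test : Forest × Tree → K
          test p = CF.δ (lft y) (proj₁ p) ⊛ CT.δ (rgt y) (proj₂ p)
          collect : ∀ z → Idx z → X.δ y z ≈ [ ⌊ lev z ≟ c ⌋ ] test (lft z , rgt z)
          collect z iz with lft z ≟F lft y | rgt z ≟T rgt y
          ... | yes p | yes q with ≡.trans (≡.sym (mk-eta iz)) (≡.trans (cong₂ mk p q) (mk-eta iy))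
          ... | refl = ≈-trans (X.δ-≡ y) (≈-sym (≈-trans ([]-yes (c ≟ c) refl) (*-identityˡ _)))
          collect z iz | yes p | no q = ≈-trans (X.δ-≢ {y} {z} (λ { refl → q refl }))
              (≈-sym (≈-trans ([]-cong ⌊ lev z ≟ c ⌋ (zeroʳ _)) ([]-zero ⌊ lev z ≟ c ⌋)))
          collect z iz | no p | _ = ≈-trans (X.δ-≢ {y} {z} (λ { refl → p refl }))
              (≈-sym (≈-trans ([]-cong ⌊ lev z ≟ c ⌋ (zeroˡ _)) ([]-zero ⌊ lev z ≟ c ⌋)))
          tensor-zero : ∀ g → ⟪ ts , (λ p → ⟪ ℙF (proj₁ p) , (λ u → ⟪ ℙ (proj₂ p) , g u ⟫) ⟫) ⟫ ≈ 0#
          tensor-zero g = begin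
            ⟪ ts , pairing ⟫ ≈⟨ ⟪reindex⟫ pairs cs pairing ⟩
            ⟪ cs , (λ z → ∑ (pairs z) pairing) ⟫ ≈⟨ ⟪⟫-cong cs
                (λ z → ∑-keep ⌊ lev z ≟ c ⌋ (lft z , rgt z) pairing) ⟩
            ⟪ cs , top ⟫ ≈⟨ +-identityʳ _ ⟨
            ⟪ cs , top ⟫ ⊕ 0# ≈⟨ +-congˡ (≈-trans (-‿cong (zero₁ (cop χ g′))) -0#≈0#) ⟨
            ⟪ cs , top ⟫ ⊕ ⊖ ⟪ cs , whole ⟫ ≈⟨ +-congˡ (⟪⟫-⊖ cs whole) ⟨
            ⟪ cs , top ⟫ ⊕ ⟪ cs , (λ z → ⊖ whole z) ⟫ ≈⟨ ⟪⟫-⊕ cs top (λ z → ⊖ whole z) ⟨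
            ⟪ cs , (λ z → top z ⊕ ⊖ whole z) ⟫ ≈⟨ X.vanish cs (λ z → top z ⊕ ⊖ whole z)
                (All.map (λ {q} iz → compare (proj₂ q) iz) sup) ⟩
            0# ∎
            where
              pairing : Forest × Tree → K
              pairing p = ⟪ ℙF (proj₁ p) , (λ u → ⟪ ℙ (proj₂ p) , g u ⟫) ⟫
              g′ : Word → Word → K
              g′ u v = [ ⌊ length u ≟ c ⌋ ] g u v
              g′0 : ∀ u v → length u ≢ c → g′ u v ≈ 0#
              g′0 u v ne = []-no (length u ≟ c) ne
              top whole : X → K
              top z = [ ⌊ lev z ≟ c ⌋ ] pairing (lft z , rgt z)
              whole z = ⟪ e z , cop χ g′ ⟫
              cancel : ∀ {a b} → a ≈ b → a ⊕ ⊖ b ≈ 0#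
              cancel p = ≈-trans (+-congʳ p) (-‿inverseʳ _)
              -- The alternative that `vanish` needs: above level `c` the coefficient is zero, and
              -- up to level `c` the test `whole` agrees with the masked leading component `top`.
              compare : ∀ z → Idx z → ⟪ cs , X.δ z ⟫ ≈ 0# ⊎ top z ⊕ ⊖ whole z ≈ 0#
              compare z iz with ℕ.<-cmp (lev z) c
              ... | tri< lt ne _ = inj₂ (cancel (≈-trans ([]-no (lev z ≟ c) ne)
                  (≈-sym (lead-zero iz c<n lt g′ g′0))))
              ... | tri> _ _ gt = inj₁ (independent-from sup zero₁ d (≡.trans (≡.sym (ℕ.+-suc c d)) eq) z
                  iz gt)
              ... | tri≈ _ eq′ _ = inj₂ (cancel (≈-trans ([]-yes (lev z ≟ c) eq′) (≈-trans
                    (⟪⟫-congᴬ {x = ℙF (lft z)} (All.map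
                        (λ {q} pw → ⟪⟫-cong (ℙ (rgt z))
                        (λ v → ≈-sym ([]-yes (length (proj₂ q) ≟ c) (≡.trans (proj₂ pw) eq′))))
                        (IL-deg (lft-idx iz))))
                    (≈-sym (lead-at iz c<n (ℕ.≤-reflexive eq′) g′ g′0)))))

    independent : Indep _≟X_ Idx e
    independent cs sup zero₁ y iy = independent-from sup zero₁ n refl y iy z≤n

    private
      -- The component of Δ_χ in left degree 0 is `R []` tensor `x`, so its vanishing makes `x`
      -- itself zero.
      span-zero : ∀ x → Deg n x → Below 0 x → Span Idx e x
      span-zero x d below = [] , [] , λ f → ≈-sym (begin
        ⟪ x , f ⟫ ≈⟨ ⟪⟫-congᴬ {x = x} (All.map (λ {q} pw → point f pw) d) ⟩
        ⟪ x , cop χ (g f) ⟫ ≈⟨ below 0 z≤n 1≤n (g f)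
            (λ { [] v ne → ⊥-elim (ne refl) ; (_ ∷ _) v ne → ≈-refl }) ⟩
        0# ∎)
        where
          g : (Word → K) → Word → Word → K
          g f [] v = f v
          g f (_ ∷ _) v = 0#
          inner0 : ∀ f p s → inner (g f) p s ≈ 0#
          inner0 f [] s = ≈-refl
          inner0 f (_ ∷ _) [] = ≈-refl
          inner0 f (_ ∷ _) (_ ∷ _) = ≈-refl
          point : ∀ f {w} → PW n w → f w ≈ cop χ (g f) w
          point f {[]} pw = ⊥-elim (PW-≢[] 1≤n pw refl)
          point f {w@(_ ∷ _)} pw = ≈-sym (begin
            cop χ (g f) w ≈⟨ cop-split χ (g f) (proj₁ pw) (λ ()) ⟩
            [ χ false ] f w ⊕ ([ χ true ] 0# ⊕ cop χ (inner (g f)) w) ≈⟨ +-cong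
                (≈-reflexive (cong ([_] f w) χ-false))
                (⊕-zero ([]-zero (χ true)) (cop-zero χ w (λ p s _ → inner0 f p s))) ⟩
            f w ⊕ 0# ≈⟨ +-identityʳ _ ⟩
            f w ∎)

      cancel-sub : ∀ a b → (a ⊕ ⊖ b) ⊕ b ≈ a
      cancel-sub a b = ≈-trans (+-assoc _ _ _) (≈-trans (+-congˡ (-‿inverseˡ b)) (+-identityʳ a))

      -- One subtraction. The component of Δ_χ on `x` in left degree `c` is the sum of `R u` tensor
      -- `slice χ u x`; expanding both factors in the families already known gives a combination `Z`
      -- with the same component.
      module Step {x c} (sx : Good x) (dx : Deg n x) (c<n : c < n) (below : Below (suc c) x) where

        lefts : List Word
        lefts = concatMap (λ q → map (λ p → pack (proj₁ p)) (decs (proj₂ q))) x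

        -- The possible left factors of length `c`, without repetition so that each cut is matched
        -- by one entry only.
        U : List Word
        U = deduplicate _≟W_ (filter (λ u → length u ≟ c) lefts)

        U-length : ∀ {u} → u ∈ U → length u ≡ c
        U-length i = proj₂ (∈-filter⁻ (λ u → length u ≟ c) {xs = lefts}
            (∈-deduplicate⁻ _≟W_ (filter (λ u → length u ≟ c) lefts) i))

        lefts-packed : All Packed lefts
        lefts-packed = All-concatMap _ (All.map (λ {q} pw → Allₚ.map⁺
            (All.map (λ {p} eq → Packed-pack (Pos-⊆ {proj₁ p} (⊆-++ˡ eq) (PW-pos pw)))
            (decs-++ (proj₂ q)))) dx)

        U-PW : ∀ {u} → u ∈ U → PW c u
        U-PW i = All.lookup lefts-packed (proj₁ (∈-filter⁻ (λ u → length u ≟ c) {xs = lefts}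
            (∈-deduplicate⁻ _≟W_ (filter (λ u → length u ≟ c) lefts) i))) , U-length i

        left-span : ∀ {u} → u ∈ U → Span (IL c) ℙF (R u)
        left-span {u} i = spanL c<n (R u) (U-PW i ∷ [])

        right-span : ∀ {u} → u ∈ U → Span (IR (n ∸ c)) ℙ (slice χ u x)
        right-span {u} i = spanR (ℕ.m<n⇒0<n∸m c<n) (ℕ.m∸n≤m n c) (slice χ u x)
          (subst (λ k → Deg (n ∸ k) (slice χ u x)) (U-length i) (Deg-slice {x = x} χ u dx))
          (slice-Factor sx dx c<n below u (U-length i))

        product : List (K × Forest) → List (K × Tree) → List (K × X)
        product ds cs = concatMap (λ p → map (λ q → proj₁ p ⊛ proj₁ q , mk (proj₂ p) (proj₂ q)) cs) ds

        ⟪product⟫ : ∀ ds cs f → ⟪ product ds cs , f ⟫ ≈ ⟪ ds , (λ h → ⟪ cs , (λ t → f (mk h t)) ⟫) ⟫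
        ⟪product⟫ ds cs f = ≈-trans (∑-concatMap _ ds _) (∑-cong ds (λ p → ≈-trans (∑-map _ cs _)
          (≈-trans (∑-cong cs (λ q → *-assoc _ _ _)) (≈-sym (∑-⊛ _ cs _)))))

        combination : ∀ (us : List Word) → (∀ {u} → u ∈ us → u ∈ U) → Σ[ Z ∈ List (K × X) ]
            (Supp (λ z → Idx z × lev z ≡ c) Z ×
          (∀ (g : Word → Word → K) → ⟪ Z , (λ z → ⟪ ℙF (lft z) , (λ u → ⟪ ℙ (rgt z) , g u ⟫) ⟫) ⟫ ≈ ∑ us
              (λ u → ⟪ slice χ u x , g u ⟫)))
        combination [] sub = [] , [] , λ g → ≈-refl
        combination (u ∷ us) sub with left-span (sub (here refl)) | right-span (sub (here refl))
            | combination us (λ i → sub (there i))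
        ... | ds , supD , eqD | cs , supC , eqC | Z , supZ , eqZ = product ds cs ++ Z , Allₚ.++⁺ supP
            supZ , total
          where
            supP : Supp (λ z → Idx z × lev z ≡ c) (product ds cs)
            supP = All-concatMap _ (All.map (λ {p} il → Allₚ.map⁺
                (All.map (λ {q} ir → mk-idx c<n il ir , ≡.trans (cong ωF (lft-mk (proj₂ p) (proj₂ q)))
                (IL-weight il)) supC)) supD)
            total : ∀ (g : Word → Word → K) → ⟪ product ds cs ++ Z ,
                (λ z → ⟪ ℙF (lft z) , (λ u → ⟪ ℙ (rgt z) , g u ⟫) ⟫) ⟫ ≈ ∑ (u ∷ us)
                (λ u → ⟪ slice χ u x , g u ⟫)
            total g = ≈-trans (⟪⟫-++ (product ds cs) Z _) (+-cong (begin
              ⟪ product ds cs , (λ z → ⟪ ℙF (lft z) , (λ u → ⟪ ℙ (rgt z) , g u ⟫) ⟫) ⟫ ≈⟨ ⟪product⟫ ds cs _ ⟩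
              ⟪ ds , (λ h → ⟪ cs , (λ t → ⟪ ℙF (lft (mk h t)) , (λ u → ⟪ ℙ (rgt (mk h t)) , g u ⟫) ⟫) ⟫) ⟫
                ≈⟨ ⟪⟫-cong ds (λ h → ⟪⟫-congᴬ {x = cs}
                    (All.map (λ {q} ir → ≈-reflexive
                    (cong₂ (λ h t → ⟪ ℙF h , (λ u → ⟪ ℙ t , g u ⟫) ⟫) (lft-mk h (proj₂ q)) (rgt-mk h ir)))
                    supC)) ⟩
              ⟪ ds , (λ h → ⟪ cs , (λ t → ⟪ ℙF h , (λ u → ⟪ ℙ t , g u ⟫) ⟫) ⟫) ⟫ ≈⟨ ⟪⟫-cong ds
                  (λ h → ⟪⟫-⟪⟫ cs (ℙF h) _) ⟩
              ⟪ ds , (λ h → ⟪ ℙF h , (λ u → ⟪ cs , (λ t → ⟪ ℙ t , g u ⟫) ⟫) ⟫) ⟫ ≈⟨ eqD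
                  (λ u → ⟪ cs , (λ t → ⟪ ℙ t , g u ⟫) ⟫) ⟩
              ⟪ R u , (λ u → ⟪ cs , (λ t → ⟪ ℙ t , g u ⟫) ⟫) ⟫ ≈⟨ ⟪R⟫ u
                  (λ u → ⟪ cs , (λ t → ⟪ ℙ t , g u ⟫) ⟫) ⟩
              ⟪ cs , (λ t → ⟪ ℙ t , g u ⟫) ⟫ ≈⟨ eqC (g u) ⟩
              ⟪ slice χ u x , g u ⟫ ∎) (eqZ g))

        Z : List (K × X)
        Z = proj₁ (combination U (λ i → i))

        supZ : Supp (λ z → Idx z × lev z ≡ c) Z
        supZ = proj₁ (proj₂ (combination U (λ i → i)))

        leading : ∀ g → (∀ u v → length u ≢ c → g u v ≈ 0#) → ⟪ x , cop χ g ⟫ ≈ ∑ U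
            (λ u → ⟪ slice χ u x , g u ⟫)
        leading g g0 = begin
          ⟪ x , cop χ g ⟫
            ≈⟨ ⟪⟫-congᴬ {x = x} (All.tabulate (λ {q} i → ∑-congᴬ
                (All.tabulate (λ {p} j → []-cong (accept χ (proj₂ q) (proj₁ p) (proj₂ p))
                (expand q p i j))))) ⟩
          ⟪ x , cop χ (λ p s → ∑ U (λ u → [ ⌊ p ≟W u ⌋ ] g u s)) ⟫
            ≈⟨ ⟪⟫-cong x (λ w → ≈-trans (Cut-cong w (λ p s → ≈-sym ([]-∑ (accept χ w p s) U _)))
                (∑-swap (decs w) U _)) ⟩
          ⟪ x , (λ w → ∑ U (λ u → cop χ (λ p s → [ ⌊ p ≟W u ⌋ ] g u s) w)) ⟫ ≈⟨ ⟪⟫-∑ x U _ ⟩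
          ∑ U (λ u → ⟪ x , cop χ (λ p s → [ ⌊ p ≟W u ⌋ ] g u s) ⟫) ≈⟨ ∑-cong U (λ u → ⟪slice⟫ χ u x (g u)) ⟨
          ∑ U (λ u → ⟪ slice χ u x , g u ⟫) ∎
          where
            expand : ∀ q p → q ∈ x → p ∈ decs (proj₂ q) → g (pack (proj₁ p)) (pack (proj₂ p)) ≈ ∑ U
                (λ u → [ ⌊ pack (proj₁ p) ≟W u ⌋ ] g u (pack (proj₂ p)))
            expand q p i j with length (pack (proj₁ p)) ≟ c
            ... | yes len = ≈-sym (∑-unique _≟W_ (Uniqueₚ.deduplicate-! _≟W_ _)
                (∈-deduplicate⁺ _≟W_ (∈-filter⁺ (λ u → length u ≟ c)
                    (∈-concatMap⁺ (λ q → map (λ p → pack (proj₁ p)) (decs (proj₂ q)))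
                        (Any.map (λ { refl → ∈-map⁺ (λ p → pack (proj₁ p)) j }) i)) len))
                        (λ u → g u (pack (proj₂ p))))
            ... | no ne = ≈-trans (g0 _ _ ne) (≈-sym
                (∑-absent {U} (λ i → ne (U-length i)) (λ u → g u (pack (proj₂ p)))))

        below′ : Below c (subtract x (lincomb e Z))
        below′ c′ le c′<n g g0 = ≈-trans (⟪subtract⟫ x (lincomb e Z) (cop χ g))
            (≈-trans (+-congˡ (-‿cong (⟪lincomb⟫ e Z (cop χ g)))) (go (ℕ.m≤n⇒m<n∨m≡n le)))
          where
            go : c < c′ ⊎ c ≡ c′ → ⟪ x , cop χ g ⟫ ⊕ ⊖ ⟪ Z , (λ z → ⟪ e z , cop χ g ⟫) ⟫ ≈ 0#
            go (inj₁ lt) = ⊕-zero (below c′ lt c′<n g g0)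
                (≈-trans (-‿cong (⟪⟫-zeroᴬ {x = Z} (All.map
                (λ { (iz , eq) → lead-zero iz c′<n (subst (_< c′) (≡.sym eq) lt) g g0 }) supZ))) -0#≈0#)
            go (inj₂ refl) = ≈-trans (+-cong (leading g g0) (-‿cong (≈-trans
              (⟪⟫-congᴬ {x = Z} (All.map (λ { (iz , eq) → lead-at iz c<n (ℕ.≤-reflexive eq) g g0 }) supZ))
                  (proj₂ (proj₂ (combination U (λ i → i))) g)))) (-‿inverseʳ _)

        supIdx : Supp Idx Z
        supIdx = All.map proj₁ supZ

      Deg-lincomb : ∀ {cs} → Supp Idx cs → Deg n (lincomb e cs)
      Deg-lincomb sup = All-concatMap _ (All.map (λ {q} iz → Deg-scale {k = proj₁ q} {x = e (proj₂ q)}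
          (e-deg iz)) sup)

      spanning-below : ∀ c → c ≤ n → ∀ x → Good x → Deg n x → Below c x → Span Idx e x
      spanning-below zero le x sx dx below = span-zero x dx below
      spanning-below (suc c) c<n x sx dx below = combine (spanning-below c (ℕ.<⇒≤ c<n) (subtract x y)
          (Good-sub sx (Good-lin supIdx)) (Allₚ.++⁺ dx
              (Deg-scale {k = ⊖ 1#} {x = y} (Deg-lincomb supIdx))) below′)
        where
          open Step sx dx c<n below
          y = lincomb e Z
          combine : Span Idx e (subtract x y) → Span Idx e x
          combine (cs , sup , eq) = cs ++ Z , Allₚ.++⁺ sup supIdx , λ f → begin
            ⟪ cs ++ Z , (λ z → ⟪ e z , f ⟫) ⟫ ≈⟨ ⟪⟫-++ cs Z _ ⟩
            ⟪ cs , (λ z → ⟪ e z , f ⟫) ⟫ ⊕ ⟪ Z , (λ z → ⟪ e z , f ⟫) ⟫ ≈⟨ +-cong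
                (≈-trans (eq f) (⟪subtract⟫ x y f)) (≈-sym (⟪lincomb⟫ e Z f)) ⟩
            (⟪ x , f ⟫ ⊕ ⊖ ⟪ y , f ⟫) ⊕ ⟪ y , f ⟫ ≈⟨ cancel-sub _ _ ⟩
            ⟪ x , f ⟫ ∎

    spanning : ∀ x → Good x → Deg n x → Span Idx e x
    spanning x sx dx = spanning-below n ℕ.≤-refl x sx dx (λ c′ le lt → ⊥-elim (ℕ.<⇒≱ lt le))

  -- Forests as nested products

  goF≋Ln : ∀ {x a} ts → x ≋ Ln a → goF x ts ≋ Ln (reverse ts ++ a)
  goF≋Ln [] h = h
  goF≋Ln {x} {a} (t ∷ ts) h f = ≈-trans (goF≋Ln {ℙ t ≺ x} {t ∷ a} ts
      (bilin-cong precW {ℙ t} {ℙ t} {x} {Ln a} (λ _ → ≈-refl) h) f)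
    (≈-reflexive (cong (λ z → ⟪ Ln z , f ⟫) (≡.sym (≡.trans (cong (_++ a) (unfold-reverse t ts))
        (++-assoc (reverse ts) (t ∷ []) a)))))

  ℙF≋Ln : ∀ {h} → All Primitive h → ℙF h ≋ Ln (reverse h)
  ℙF≋Ln [] f = ≈-refl
  ℙF≋Ln {t ∷ ts} (p ∷ ps) f = ≈-trans (goF≋Ln {ℙ t} {t ∷ []} ts
      (λ f → ≈-sym (≺-unit {ℙ t} (Deg-≢[] (ω-pos p) (ℙ-deg p)) f)) f)
    (≈-reflexive (cong (λ z → ⟪ Ln z , f ⟫) (≡.sym (unfold-reverse t ts))))

  Deg-ℙF : ∀ {h} → All Primitive h → Deg (ωF h) (ℙF h)
  Deg-ℙF [] = Deg-R[]
  Deg-ℙF {t ∷ ts} (p ∷ ps) = go (ℙ t) ps (ℙ-deg p)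
    where
      go : ∀ {k ts} x → All Primitive ts → Deg k x → Deg (k + ωF ts) (goF x ts)
      go {k} x [] d = subst (λ n → Deg n x) (≡.sym (ℕ.+-identityʳ k)) d
      go {k} {t ∷ ts} x (p ∷ ps) d = subst (λ n → Deg n (goF (ℙ t ≺ x) ts))
        (≡.trans (cong (_+ ωF ts) (ℕ.+-comm (ω t) k)) (ℕ.+-assoc k (ω t) (ωF ts)))
            (go (ℙ t ≺ x) ps (Deg-≺ {x = ℙ t} {x} (ℙ-deg p) d))

  -- The last tree of a forest is the outermost factor of its nest, which reverses the order; the
  -- reversal in `Δ-Ln` undoes this.
  Δ-ℙF : ∀ {h} → All Primitive h → ∀ f → ⟪ ℙF h , cop full f ⟫ ≈ Cut h
      (λ a b → ⟪ ℙF a , (λ u → ⟪ ℙF b , f u ⟫) ⟫)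
  Δ-ℙF {h} ps f = begin
    ⟪ ℙF h , cop full f ⟫ ≈⟨ ℙF≋Ln ps (cop full f) ⟩
    ⟪ Ln (reverse h) , cop full f ⟫ ≈⟨ Δ-Ln (All-resp-↭ (↭-sym (↭-reverse h)) ps) f ⟩
    Cut (reverse h) (λ a b → ⟪ Ln b , (λ u → ⟪ Ln a , f u ⟫) ⟫) ≈⟨ Cut-reverse h _ ⟩
    Cut h (λ a b → ⟪ Ln (reverse a) , (λ u → ⟪ Ln (reverse b) , f u ⟫) ⟫) ≈⟨ Cut-cong∈ h back ⟩
    Cut h (λ a b → ⟪ ℙF a , (λ u → ⟪ ℙF b , f u ⟫) ⟫) ∎
    where
      back : ∀ a b → a ++ b ≡ h → ⟪ Ln (reverse a) , (λ u → ⟪ Ln (reverse b) , f u ⟫) ⟫ ≈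
          ⟪ ℙF a , (λ u → ⟪ ℙF b , f u ⟫) ⟫
      back a b refl = ≈-trans (⟪⟫-cong (Ln (reverse a)) (λ u → ≈-sym (ℙF≋Ln (Allₚ.++⁻ʳ a ps) (f u))))
          (≈-sym (ℙF≋Ln (Allₚ.++⁻ˡ a ps) (λ u → ⟪ ℙF b , f u ⟫)))

  -- Labels of red-packed trees

  lastOr-∈ : ∀ {A : Set} (x : A) xs → lastOr x xs ∈ x ∷ xs
  lastOr-∈ x [] = here refl
  lastOr-∈ x (y ∷ xs) = there (lastOr-∈ y xs)

  -- What makes `Φ (i ∷ I)` nonzero on every packed word of length `n`: the second field says that
  -- i_p is at most n + p.
  record ValidLabel (i : ℕ) (I : List ℕ) (n : ℕ) : Set where
    field
      sorted : Sorted 1 (i ∷ I)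
      last-bound : lastOr i I < suc (n + suc (length I))
  open ValidLabel

  0<∸⇒< : ∀ m n → 0 < m ∸ n → n < m
  0<∸⇒< m n p with n <? m
  ... | yes q = q
  ... | no q = ⊥-elim (ℕ.<⇒≢ p (≡.sym (ℕ.m≤n⇒m∸n≡0 (ℕ.≮⇒≥ q))))

  redPacked-label : ∀ {i I ls fr} → RedPacked (node (i ∷ I) ls fr) → ValidLabel i I (ωF fr)
  redPacked-label {i} {I} (rp-noRight _ lab eq) = record
    { sorted = label-sorted lab
    ; last-bound = All.lookup (subst (All (_< suc (suc (length I)))) (≡.sym eq)
        (Allₚ.map⁺ (All.map s≤s (Allₚ.applyUpTo⁺₁ (λ x → x) (suc (length I)) (λ lt → lt))))) (lastOr-∈ i I) }
  redPacked-label {i} {I} {fr = fr} (rp-right _ _ lab _ _ le _) = record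
    { sorted = label-sorted lab
    ; last-bound = subst (lastOr i I <_) (≡.trans (ℕ.+-comm _ 1)
        (cong suc (ℕ.+-comm (suc (length I)) (ωF fr)))) (0<∸⇒< _ _ le) }

  phi-defined : ∀ {i I n w} → ValidLabel i I n → PW n w → ∃[ W ] phiW (i ∷ I) w ≡ just W
  phi-defined {i} {I} {n} {w} v (_ , len) = phiGo-just (suc (maxW w)) 1 i I w (sorted v)
      (subst (λ k → lastOr i I < suc (k + suc (length I))) (≡.sym len) (last-bound v))

  phiK-defined : ∀ {i I n w} → ValidLabel i I n → PW n w → ∀ f → Σ[ W ∈ Word ]
      (PW (suc (length I) + n) W × pos W ≡ i ∷ I × rem W ≡ w × phiK (i ∷ I) f w ≈ f W)
  phiK-defined {i} {I} {n} {w} v pw f with phi-defined v pw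
  ... | W , eq = W , (phi-packed {w = w} (sorted v) (λ ()) eq (proj₁ pw) , ≡.trans
      (phi-length {w = w} (sorted v) (λ ()) eq) (cong (suc (length I) +_) (proj₂ pw)))
        , proj₁ (proj₂ (maxW-phi {w = w} (sorted v) (λ ()) eq)) , proj₂
            (proj₂ (maxW-phi {w = w} (sorted v) (λ ()) eq)) , ≈-reflexive (cong (maybe f 0#) eq)

  phiK-pos : ∀ {v} → Packed v → v ≢ [] → ∀ f → phiK (pos v) f (rem v) ≈ f v
  phiK-pos pk n f = ≈-reflexive (cong (maybe f 0#) (phiW-pos pk n))

  length-≢[] : ∀ {A : Set} {n} {w : List A} → length w ≡ suc n → w ≢ []
  length-≢[] () refl

  phiK-right : ∀ {i I n w} → ValidLabel i I n → PW n w → ∀ f →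
    phiK (i ∷ I) (cop right f) w ≈ cop full (λ u v → [ ⌊ length u <? i ⌋ ] phiK
        (map (_∸ length u) (i ∷ I)) (f u) v) w
  phiK-right {i} {I} v pw f with phiK-defined v pw (cop right f)
  ... | W , (pk , len) , refl′ , refl , eq = ≈-trans eq
      (cop-right-pos W i I pk (length-≢[] len) refl′ f (λ u J z → phiK J (f u) z)
      (λ u z pz nz → ≈-sym (phiK-pos pz nz (f u))))

  phiK-left : ∀ {i I n w} → ValidLabel i I n → PW n w → ∀ f →
    phiK (i ∷ I) (cop left f) w ≈ cop full (λ u v → [ ⌊ lastOr i I <? suc (length u + suc (length I)) ⌋ ]
        phiK (i ∷ I) (λ z → f z v) u) w
  phiK-left {i} {I} v pw f with phiK-defined v pw (cop left f)
  ... | W , (pk , len) , refl′ , refl , eq = ≈-trans eq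
      (cop-left-pos W i I pk (length-≢[] len) refl′ f (λ J u v → phiK J (λ z → f z v) u)
      (λ u z pz nz → ≈-sym (phiK-pos pz nz (λ y → f y z))))

  -- Total primitivity of ℙ (node I [] fr)

  ω-last≤ : ∀ {r rs} a b → a ++ b ≡ r ∷ rs → b ≢ [] → ω (lastOr r rs) ≤ ωF b
  ω-last≤ [] (t ∷ ts) refl n = last≤ t ts
    where
      last≤ : ∀ t ts → ω (lastOr t ts) ≤ ωF (t ∷ ts)
      last≤ t [] = ℕ.m≤m+n _ _
      last≤ t (s ∷ ts) = ≤-trans (last≤ s ts) (ℕ.m≤n+m _ (ω t))
  ω-last≤ (t ∷ []) [] refl n = ⊥-elim (n refl)
  ω-last≤ (t ∷ []) (s ∷ b) refl n = ω-last≤ [] (s ∷ b) refl n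
  ω-last≤ (t ∷ s ∷ a) b refl n = ω-last≤ (s ∷ a) b refl n

  -- A cut counted by Δ≻ takes fewer than i₁ letters of `ℙF fr`. But `ℙF fr` is cut between trees
  -- only, and a nonempty prefix weighs at least as much as the first tree, which the label
  -- condition makes at least i₁.
  core-right : ∀ {i I fr} → RedPacked (node (i ∷ I) [] fr) → All Primitive fr → Kills right
      (Φ (i ∷ I) (ℙF fr))
  core-right {i} {I} {fr} rp ps f fˡ fʳ = begin
    ⟪ Φ (i ∷ I) (ℙF fr) , cop right f ⟫ ≈⟨ ⟪Φ⟫ (i ∷ I) (ℙF fr) (cop right f) ⟩
    ⟪ ℙF fr , phiK (i ∷ I) (cop right f) ⟫ ≈⟨ ⟪⟫-congᴬ {x = ℙF fr}
        (All.map (λ pw → phiK-right (redPacked-label rp) pw f) (Deg-ℙF ps)) ⟩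
    ⟪ ℙF fr , cop full g ⟫ ≈⟨ Δ-ℙF ps g ⟩
    Cut fr (λ a b → ⟪ ℙF a , (λ u → ⟪ ℙF b , g u ⟫) ⟫) ≈⟨ Cut-zero∈ fr zeroAt ⟩
    0# ∎
    where
      g : Word → Word → K
      g u v = [ ⌊ length u <? i ⌋ ] phiK (map (_∸ length u) (i ∷ I)) (f u) v
      first-bound : ∀ {fr} → RedPacked (node (i ∷ I) [] fr) → ∀ t a b → (t ∷ a) ++ b ≡ fr → i ≤ ωF (t ∷ a)
      first-bound (rp-right _ _ _ _ le _ _) t a b refl = ≤-trans le (ℕ.m≤m+n _ _)
      zeroAt : ∀ a b → a ++ b ≡ fr → ⟪ ℙF a , (λ u → ⟪ ℙF b , g u ⟫) ⟫ ≈ 0#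
      zeroAt [] b e = ≈-trans (⟪R⟫ [] (λ u → ⟪ ℙF b , g u ⟫)) (⟪⟫-zero (ℙF b) (λ v →
        ≈-trans ([]-cong ⌊ 0 <? i ⌋ (phiK-zero (map (_∸ 0) (i ∷ I)) v fˡ)) ([]-zero ⌊ 0 <? i ⌋)))
      zeroAt (t ∷ a) b e = ⟪⟫-zeroᴬ {x = ℙF (t ∷ a)} (All.map (λ {q} pw → ⟪⟫-zero (ℙF b) (λ v →
        []-no (length (proj₂ q) <? i) (λ lt → ℕ.<⇒≱ (subst (_< i) (proj₂ pw) lt) (first-bound rp t a b e))))
        (Deg-ℙF (Allₚ.++⁻ˡ (t ∷ a) (subst (All Primitive) (≡.sym e) ps))))

  -- A cut counted by Δ≺ with left forest `a` needs i_p at most p plus the weight of `a`. If `a`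
  -- omits at least the last tree, the label condition gives the opposite strict inequality; if it
  -- omits nothing, the right part is empty.
  core-left : ∀ {i I fr} → RedPacked (node (i ∷ I) [] fr) → All Primitive fr → Kills left (Φ (i ∷ I) (ℙF fr))
  core-left {i} {I} {fr} rp ps f fˡ fʳ = begin
    ⟪ Φ (i ∷ I) (ℙF fr) , cop left f ⟫ ≈⟨ ⟪Φ⟫ (i ∷ I) (ℙF fr) (cop left f) ⟩
    ⟪ ℙF fr , phiK (i ∷ I) (cop left f) ⟫ ≈⟨ ⟪⟫-congᴬ {x = ℙF fr}
        (All.map (λ pw → phiK-left (redPacked-label rp) pw f) (Deg-ℙF ps)) ⟩
    ⟪ ℙF fr , cop full g ⟫ ≈⟨ Δ-ℙF ps g ⟩
    Cut fr (λ a b → ⟪ ℙF a , (λ u → ⟪ ℙF b , g u ⟫) ⟫) ≈⟨ Cut-zero∈ fr zeroAt ⟩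
    0# ∎
    where
      g : Word → Word → K
      g u v = [ ⌊ lastOr i I <? suc (length u + suc (length I)) ⌋ ] phiK (i ∷ I) (λ z → f z v) u
      last-far : ∀ {fr} → RedPacked (node (i ∷ I) [] fr) → ∀ a t b → a ++ t ∷ b ≡ fr → suc
          (ωF a + suc (length I)) ≤ lastOr i I
      last-far (rp-noRight _ _ _) [] t b ()
      last-far (rp-noRight _ _ _) (_ ∷ _) t b ()
      last-far {r ∷ rs} (rp-right _ _ _ _ _ _ le) a t b e = ℕ.+-cancelʳ-≤ (ωF (t ∷ b))
          (suc (ωF a + suc (length I))) (lastOr i I)
        (≤-trans (ℕ.≤-reflexive arith) (≤-trans (ℕ.m≤n+m∸n _ (lastOr i I))
            (ℕ.+-monoʳ-≤ (lastOr i I) (≤-trans le (ω-last≤ a (t ∷ b) e (λ ()))))))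
        where
          arith : suc (ωF a + suc (length I)) + ωF (t ∷ b) ≡ suc (length I) + ωF (r ∷ rs) + 1
          arith = ≡.trans (cong suc (≡.trans (cong (_+ ωF (t ∷ b)) (ℕ.+-comm (ωF a) (suc (length I))))
              (≡.trans (ℕ.+-assoc (suc (length I)) (ωF a) _)
            (cong (suc (length I) +_) (≡.trans (≡.sym (ωF-++ a (t ∷ b))) (cong ωF e)))))) (ℕ.+-comm 1 _)
      zeroAt : ∀ a b → a ++ b ≡ fr → ⟪ ℙF a , (λ u → ⟪ ℙF b , g u ⟫) ⟫ ≈ 0#
      zeroAt a [] e = ⟪⟫-zero (ℙF a) (λ u → ≈-trans (⟪R⟫ [] (g u))
          (≈-trans ([]-cong ⌊ lastOr i I <? suc (length u + suc (length I)) ⌋ (phiK-zero (i ∷ I) u fʳ))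
          ([]-zero ⌊ lastOr i I <? suc (length u + suc (length I)) ⌋)))
      zeroAt a (t ∷ b) e = ⟪⟫-zeroᴬ {x = ℙF a} (All.map (λ {q} pw → ⟪⟫-zero (ℙF (t ∷ b)) (λ v →
        []-no (lastOr i I <? suc (length (proj₂ q) + suc (length I)))
            (ℕ.≤⇒≯ (subst (λ k → suc (k + suc (length I)) ≤ lastOr i I) (≡.sym (proj₂ pw))
            (last-far rp a t b e)))))
        (Deg-ℙF (Allₚ.++⁻ˡ a (subst (All Primitive) (≡.sym e) ps))))

  Kills-halves : ∀ {x} → Kills right x → Kills left x → Kills full x
  Kills-halves {x} kr kl f fˡ fʳ = ≈-trans (⟪⟫-cong x (cop-halves f))
      (≈-trans (⟪⟫-⊕ x (cop right f) (cop left f)) (⊕-zero (kr f fˡ fʳ) (kl f fˡ fʳ)))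

  Deg-core : ∀ {i I fr} → RedPacked (node (i ∷ I) [] fr) → All Primitive fr → Deg (suc (length I) + ωF fr)
      (Φ (i ∷ I) (ℙF fr))
  Deg-core {i} {I} rp ps = Deg-Φ (i ∷ I) (sorted (redPacked-label rp)) (λ ()) (Deg-ℙF ps)

  core : ∀ {I ls fr} → RedPacked (node I ls fr) → RedPacked (node I [] fr)
  core (rp-noRight _ a b) = rp-noRight [] a b
  core (rp-right _ a b c d e f) = rp-right [] a b c d e f

  ℙ≋brace : ∀ I ls fr → ℙ (node I ls fr) ≋ brace (ℙs ls) (Φ I (ℙF fr))
  ℙ≋brace I [] fr f = ≈-sym (≈-trans (⟪⟫-++ (scale 1# (Φ I (ℙF fr))) [] f)
      (≈-trans (+-identityʳ _) (≈-trans (⟪⟫-scale 1# (Φ I (ℙF fr)) f) (*-identityˡ _))))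
  ℙ≋brace I (l ∷ ls) fr f = ≈-refl

  node-deg : ∀ {i I ls fr} → RedPacked (node (i ∷ I) ls fr) → All Primitive ls → All Primitive fr → Deg
      (ω (node (i ∷ I) ls fr)) (ℙ (node (i ∷ I) ls fr))
  node-deg {i} {I} {[]} {fr} rp pl pr = subst (λ n → Deg n (Φ (i ∷ I) (ℙF fr)))
      (cong (_+ ωF fr) (≡.sym (ℕ.+-identityʳ (suc (length I))))) (Deg-core rp pr)
  node-deg {i} {I} {l ∷ ls} {fr} rp pl pr = subst (λ n → Deg n (ℙ (node (i ∷ I) (l ∷ ls) fr)))
    (≡.trans (≡.sym (ℕ.+-assoc (ωF (l ∷ ls)) (suc (length I)) (ωF fr)))
        (cong (_+ ωF fr) (ℕ.+-comm (ωF (l ∷ ls)) (suc (length I)))))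
    (Deg-brace (s≤s z≤n) (Deg-core (core rp) pr) pl)

  node-primitive : ∀ {i I ls fr} → RedPacked (node (i ∷ I) ls fr) → All Primitive ls → All Primitive fr →
      Primitive (node (i ∷ I) ls fr)
  node-primitive {i} {I} {ls} {fr} rp pl pr = record
    { ω-pos = s≤s z≤n
    ; ℙ-deg = node-deg rp pl pr
    ; ℙ-prim = λ f fˡ fʳ → ≈-trans (ℙ≋brace (i ∷ I) ls fr (cop full f))
        (brace-primitive (s≤s z≤n) (Deg-core (core rp) pr)
            (Kills-halves {Φ (i ∷ I) (ℙF fr)} (core-right (core rp) pr) (core-left (core rp) pr)) pl f fˡ
            fʳ) }

  mutual
    redPacked-primitive : ∀ {t} → RedPacked t → Primitive t
    redPacked-primitive rp@(rp-noRight ls _ _) = node-primitive rp (redPacked-primitives ls) []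
    redPacked-primitive rp@(rp-right ls rs _ _ _ _ _) = node-primitive rp (redPacked-primitives ls)
        (redPacked-primitives rs)

    redPacked-primitives : ∀ {ts} → All RedPacked ts → All Primitive ts
    redPacked-primitives [] = []
    redPacked-primitives (r ∷ rs) = redPacked-primitive r ∷ redPacked-primitives rs

  -- Totally primitive elements from forests of lower degree

  ForestIdx : ℕ → Forest → Set
  ForestIdx n f = RedPackedForest f × ωF f ≡ n

  TreeIdx CoreIdx : ℕ → Tree → Set
  TreeIdx n t = RedPacked t × ω t ≡ n
  CoreIdx n t = (RedPacked t × RootLeftEmpty t) × ω t ≡ n

  record ForestBasis (n : ℕ) : Set (c ⊔ˡ ℓ) where
    field
      indep : Indep _≟F_ (ForestIdx n) ℙF
      span : ∀ x → Deg n x → Span (ForestIdx n) ℙF x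
  open ForestBasis

  label : Tree → List ℕ
  label (node I _ _) = I

  rightForest : Tree → Forest
  rightForest (node _ _ r) = r

  rightForest-redPacked : ∀ {I l r} → RedPacked (node I l r) → RedPackedForest r
  rightForest-redPacked (rp-noRight _ _ _) = []
  rightForest-redPacked (rp-right _ rs _ _ _ _ _) = rs

  CoreIdx-right : ∀ {n t} → CoreIdx n t → ForestIdx (n ∸ length (label t)) (rightForest t)
  CoreIdx-right {n} {node I _ r} ((rp , refl) , eq) = rightForest-redPacked rp , ≡.sym
      (≡.trans (cong (_∸ length I) (≡.trans (≡.sym eq) (cong (_+ ωF r) (ℕ.+-identityʳ (length I)))))
      (ℕ.m+n∸m≡n (length I) (ωF r)))

  core-component : ∀ {n t} → CoreIdx n t → ∀ J g →
    ⟪ ℙ t , (λ W → [ ⌊ pos W ≟W J ⌋ ] g (rem W)) ⟫ ≈ [ ⌊ label t ≟W J ⌋ ] ⟪ ℙF (rightForest t) , g ⟫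
  core-component {n} {node [] _ r} ((() , _) , eq) J g
  core-component {n} {node (i ∷ I) _ r} ix@((rp , refl) , eq) J g = begin
    ⟪ Φ (i ∷ I) (ℙF r) , φ ⟫ ≈⟨ ⟪Φ⟫ (i ∷ I) (ℙF r) φ ⟩
    ⟪ ℙF r , phiK (i ∷ I) φ ⟫ ≈⟨ ⟪⟫-congᴬ {x = ℙF r}
        (All.map point (Deg-ℙF (redPacked-primitives (proj₁ (CoreIdx-right {n} {node (i ∷ I) [] r} ix))))) ⟩
    ⟪ ℙF r , (λ w → [ ⌊ (i ∷ I) ≟W J ⌋ ] g w) ⟫ ≈⟨ ⟪⟫-[] ⌊ (i ∷ I) ≟W J ⌋ (ℙF r) g ⟩
    [ ⌊ (i ∷ I) ≟W J ⌋ ] ⟪ ℙF r , g ⟫ ∎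
    where
      φ : Word → K
      φ W = [ ⌊ pos W ≟W J ⌋ ] g (rem W)
      point : ∀ {w} → PW (ωF r) w → phiK (i ∷ I) φ w ≈ [ ⌊ (i ∷ I) ≟W J ⌋ ] g w
      point pw with phiK-defined (redPacked-label rp) pw φ
      ... | W , _ , e₁ , e₂ , eq = ≈-trans eq (≈-reflexive (cong₂ (λ a b → [ ⌊ a ≟W J ⌋ ] g b) e₁ e₂))

  label-pos : ∀ {n t} → CoreIdx n t → 1 ≤ length (label t) × length (label t) ≤ n
  label-pos {n} {node [] _ r} ((() , _) , eq)
  label-pos {n} {node (i ∷ I) _ r} (_ , eq) = s≤s z≤n , subst (suc (length I) ≤_) eq
      (≤-trans (ℕ.m≤m+n _ _) (ℕ.m≤m+n _ (ωF r)))

  -- The root label is visible in `ℙ t` as the positions of the maximal letters, so a relation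
  -- splits by labels. For one label, removing these letters leaves a relation among the `ℙF` of the
  -- right forests, whose degree is smaller because labels are nonempty.
  core-indep : ∀ {n} → (∀ {m} → m < n → ForestBasis m) → Indep _≟T_ (CoreIdx n) ℙ
  core-indep {n} basis cs sup zero₁ y iy = begin
    ⟪ cs , CT.δ y ⟫ ≈⟨ ⟪⟫-congᴬ {x = cs} (All.map (λ {q} iz → collect (proj₂ q) iz) sup) ⟩
    ⟪ cs , (λ z → [ ⌊ label z ≟W J ⌋ ] CF.δ (rightForest y) (rightForest z)) ⟫
      ≈⟨ ⟪⟫-cong cs (λ z → ∑-keep ⌊ label z ≟W J ⌋ (rightForest z) (CF.δ (rightForest y))) ⟨
    ⟪ cs , (λ z → ∑ (part z) (CF.δ (rightForest y))) ⟫ ≈⟨ ⟪reindex⟫ part cs _ ⟨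
    ⟪ reindex part cs , CF.δ (rightForest y) ⟫
      ≈⟨ indep (basis small) (reindex part cs)
           (Supp-reindex part (All.map (λ {q} iz → All-keep (label (proj₂ q) ≟W J)
               (λ e → subst (λ I → ForestIdx (n ∸ length I) (rightForest (proj₂ q))) e
               (CoreIdx-right iz))) sup))
           zero₂ (rightForest y) (CoreIdx-right iy) ⟩
    0# ∎
    where
      J = label y
      small : n ∸ length J < n
      small = ℕ.∸-monoʳ-< {n} {length J} {0} (proj₁ (label-pos iy)) (proj₂ (label-pos iy))
      part : Tree → List Forest
      part z = keep ⌊ label z ≟W J ⌋ (rightForest z)
      ext : ∀ z y → RootLeftEmpty z → RootLeftEmpty y → label z ≡ label y → rightForest z ≡ rightForest y
          → z ≡ y
      ext (node _ _ _) (node _ _ _) refl refl refl refl = refl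
      collect : ∀ z → CoreIdx n z → CT.δ y z ≈ [ ⌊ label z ≟W J ⌋ ] CF.δ (rightForest y) (rightForest z)
      collect z iz = go (label z ≟W J) (rightForest z ≟F rightForest y)
        where
          go : Dec (label z ≡ J) → Dec (rightForest z ≡ rightForest y) → CT.δ y z ≈ [ ⌊ label z ≟W J ⌋ ]
              CF.δ (rightForest y) (rightForest z)
          go (no n) _ = ≈-trans (CT.δ-≢ {y} {z} (λ { refl → n refl })) (≈-sym ([]-no (label z ≟W J) n))
          go (yes _) (no n) = ≈-trans (CT.δ-≢ {y} {z} (λ { refl → n refl }))
              (≈-sym (≈-trans ([]-cong ⌊ label z ≟W J ⌋ (CF.δ-≢ {rightForest y} {rightForest z} n))
              ([]-zero ⌊ label z ≟W J ⌋)))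
          go (yes p) (yes q) with ext z y (proj₂ (proj₁ iz)) (proj₂ (proj₁ iy)) p q
          ... | refl = ≈-trans (CT.δ-≡ y) (≈-sym (≈-trans ([]-yes (J ≟W J) refl) (CF.δ-≡ (rightForest y))))
      zero₂ : ∀ g → ⟪ reindex part cs , (λ h → ⟪ ℙF h , g ⟫) ⟫ ≈ 0#
      zero₂ g = begin
        ⟪ reindex part cs , (λ h → ⟪ ℙF h , g ⟫) ⟫ ≈⟨ ⟪reindex⟫ part cs (λ h → ⟪ ℙF h , g ⟫) ⟩
        ⟪ cs , (λ z → ∑ (part z) (λ h → ⟪ ℙF h , g ⟫)) ⟫
          ≈⟨ ⟪⟫-congᴬ {x = cs} (All.map (λ {q} iz → ≈-trans
              (∑-keep ⌊ label (proj₂ q) ≟W J ⌋ (rightForest (proj₂ q)) (λ h → ⟪ ℙF h , g ⟫))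
              (≈-sym (core-component iz J g))) sup) ⟩
        ⟪ cs , (λ z → ⟪ ℙ z , (λ W → [ ⌊ pos W ≟W J ⌋ ] g (rem W)) ⟫) ⟫ ≈⟨ zero₁ _ ⟩
        0# ∎

  δF-∷ : ∀ x a t b → CF.δ (x ∷ a) (t ∷ b) ≈ [ ⌊ t ≟T x ⌋ ] CF.δ a b
  δF-∷ x a t b = go (t ≟T x) (b ≟F a)
    where
      go : Dec (t ≡ x) → Dec (b ≡ a) → CF.δ (x ∷ a) (t ∷ b) ≈ [ ⌊ t ≟T x ⌋ ] CF.δ a b
      go (no n) _ = ≈-trans (CF.δ-≢ {x ∷ a} {t ∷ b} (λ e → n (∷-injectiveˡ e))) (≈-sym ([]-no (t ≟T x) n))
      go (yes _) (no n) = ≈-trans (CF.δ-≢ {x ∷ a} {t ∷ b} (λ e → n (∷-injectiveʳ e)))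
          (≈-sym (≈-trans ([]-cong ⌊ t ≟T x ⌋ (CF.δ-≢ {a} {b} n)) ([]-zero ⌊ t ≟T x ⌋)))
      go (yes refl) (yes refl) = ≈-trans (CF.δ-≡ (x ∷ a)) (≈-sym (≈-trans ([]-yes (x ≟T x) refl) (CF.δ-≡ a)))

  Cut-δ : ∀ f a b → Cut f (λ p s → CF.δ a p ⊛ CF.δ b s) ≈ CF.δ (a ++ b) f
  Cut-δ [] [] b = ≈-trans (Cut-[] (λ p s → CF.δ [] p ⊛ CF.δ b s)) (*-identityˡ _)
  Cut-δ [] (x ∷ a) b = ≈-trans (Cut-[] (λ p s → CF.δ (x ∷ a) p ⊛ CF.δ b s)) (zeroˡ _)
  Cut-δ (t ∷ f) [] b = ≈-trans (Cut-∷ t f (λ p s → CF.δ [] p ⊛ CF.δ b s))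
      (≈-trans (+-cong (*-identityˡ _) (∑-zero (decs f) (λ _ → zeroˡ _))) (+-identityʳ _))
  Cut-δ (t ∷ f) (x ∷ a) b = begin
    Cut (t ∷ f) (λ p s → CF.δ (x ∷ a) p ⊛ CF.δ b s) ≈⟨ Cut-∷ t f (λ p s → CF.δ (x ∷ a) p ⊛ CF.δ b s) ⟩
    CF.δ (x ∷ a) [] ⊛ CF.δ b (t ∷ f) ⊕ Cut f (λ p s → CF.δ (x ∷ a) (t ∷ p) ⊛ CF.δ b s)
      ≈⟨ +-cong (zeroˡ _) (Cut-cong f (λ p s → ≈-trans (*-congʳ (δF-∷ x a t p))
          (≈-trans (*-comm _ _) (≈-trans ([]-⊛ ⌊ t ≟T x ⌋ _ _) ([]-cong ⌊ t ≟T x ⌋ (*-comm _ _)))))) ⟩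
    0# ⊕ Cut f (λ p s → [ ⌊ t ≟T x ⌋ ] (CF.δ a p ⊛ CF.δ b s)) ≈⟨ ≈-trans (+-identityˡ _)
        ([]-∑ ⌊ t ≟T x ⌋ (decs f) _) ⟩
    [ ⌊ t ≟T x ⌋ ] Cut f (λ p s → CF.δ a p ⊛ CF.δ b s) ≈⟨ []-cong ⌊ t ≟T x ⌋ (Cut-δ f a b) ⟩
    [ ⌊ t ≟T x ⌋ ] CF.δ (a ++ b) f ≈⟨ δF-∷ x (a ++ b) t f ⟨
    CF.δ ((x ∷ a) ++ b) (t ∷ f) ∎

  -- Deconcatenation loses no information: a forest that can be cut at weight `k` is determined by
  -- its two pieces, and the tensors of `ℙF` of the pieces are independent. So a vanishing coproduct
  -- component kills the coefficients of all forests that can be cut there.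
  cut-coefficient : ∀ {m k l cs} → k + l ≡ m → ForestBasis k → ForestBasis l → Supp (ForestIdx m) cs →
    (∀ g → (∀ u v → length u ≢ k → g u v ≈ 0#) → ⟪ cs , (λ f → ⟪ ℙF f , cop full g ⟫) ⟫ ≈ 0#) →
    ∀ a b → ForestIdx k a → ForestIdx l b → ⟪ cs , CF.δ (a ++ b) ⟫ ≈ 0#
  cut-coefficient {m} {k} {l} {cs} k+l basisK basisL sup zero₁ a b ia ib = begin
    ⟪ cs , CF.δ (a ++ b) ⟫ ≈⟨ ⟪⟫-cong cs (λ f → ≈-trans (≈-sym (Cut-δ f a b)) (Cut-cong f redundant)) ⟩
    ⟪ cs , (λ f → Cut f (λ p s → [ ⌊ ωF p ≟ k ⌋ ] (CF.δ a p ⊛ CF.δ b s))) ⟫ ≈⟨ ⟪cuts⟫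
        (λ p → CF.δ a (proj₁ p) ⊛ CF.δ b (proj₂ p)) ⟨
    ⟪ reindex cuts cs , (λ p → CF.δ a (proj₁ p) ⊛ CF.δ b (proj₂ p)) ⟫
      ≈⟨ tensor-indep {_≟X_ = _≟F_} {_≟F_} {ForestIdx k} {ForestIdx l} {ℙF} {ℙF} (indep basisK)
          (indep basisL) (reindex cuts cs) supports zero₂ a b ia ib ⟩
    0# ∎
    where
      cuts : Forest → List (Forest × Forest)
      cuts f = concatMap (λ p → keep ⌊ ωF (proj₁ p) ≟ k ⌋ p) (decs f)
      ⟪cuts⟫ : ∀ Ψ → ⟪ reindex cuts cs , Ψ ⟫ ≈ ⟪ cs , (λ f → Cut f (λ p s → [ ⌊ ωF p ≟ k ⌋ ] Ψ (p , s))) ⟫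
      ⟪cuts⟫ Ψ = ≈-trans (⟪reindex⟫ cuts cs Ψ) (⟪⟫-cong cs
          (λ f → ≈-trans (∑-concatMap (λ p → keep ⌊ ωF (proj₁ p) ≟ k ⌋ p) (decs f) Ψ)
        (∑-cong (decs f) (λ p → ∑-keep ⌊ ωF (proj₁ p) ≟ k ⌋ p Ψ))))
      redundant : ∀ p s → CF.δ a p ⊛ CF.δ b s ≈ [ ⌊ ωF p ≟ k ⌋ ] (CF.δ a p ⊛ CF.δ b s)
      redundant p s = go (p ≟F a)
        where
          go : Dec (p ≡ a) → CF.δ a p ⊛ CF.δ b s ≈ [ ⌊ ωF p ≟ k ⌋ ] (CF.δ a p ⊛ CF.δ b s)
          go (yes refl) = ≈-sym ([]-yes (ωF p ≟ k) (proj₂ ia))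
          go (no n) = ≈-trans z (≈-sym (≈-trans ([]-cong ⌊ ωF p ≟ k ⌋ z) ([]-zero ⌊ ωF p ≟ k ⌋)))
            where
              z : CF.δ a p ⊛ CF.δ b s ≈ 0#
              z = ≈-trans (*-congʳ (CF.δ-≢ {a} {p} n)) (zeroˡ _)
      supports : Supp (λ p → ForestIdx k (proj₁ p) × ForestIdx l (proj₂ p)) (reindex cuts cs)
      supports = Supp-reindex cuts (All.map (λ {q} idx → All-concatMap (λ p → keep ⌊ ωF (proj₁ p) ≟ k ⌋ p)
          (All.map (λ {p} e → All-keep (ωF (proj₁ p) ≟ k) (pieces (proj₁ p) (proj₂ p) idx e))
          (decs-++ (proj₂ q)))) sup)
        where
          pieces : ∀ {f} p s → ForestIdx m f → p ++ s ≡ f → ωF p ≡ k → ForestIdx k p × ForestIdx l s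
          pieces p s (rp , eq) refl ek = (Allₚ.++⁻ˡ p rp , ek) ,
              (Allₚ.++⁻ʳ p rp , ℕ.+-cancelˡ-≡ k (ωF s) l
              (≡.trans (cong (_+ ωF s) (≡.sym ek)) (≡.trans (≡.sym (ωF-++ p s)) (≡.trans eq (≡.sym k+l)))))
      zero₂ : ∀ g → ⟪ reindex cuts cs , (λ p → ⟪ ℙF (proj₁ p) , (λ u → ⟪ ℙF (proj₂ p) , g u ⟫) ⟫) ⟫ ≈ 0#
      zero₂ g = begin
        ⟪ reindex cuts cs , (λ p → ⟪ ℙF (proj₁ p) , (λ u → ⟪ ℙF (proj₂ p) , g u ⟫) ⟫) ⟫ ≈⟨ ⟪cuts⟫
            (λ p → ⟪ ℙF (proj₁ p) , (λ u → ⟪ ℙF (proj₂ p) , g u ⟫) ⟫) ⟩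
        ⟪ cs , (λ f → Cut f (λ p s → [ ⌊ ωF p ≟ k ⌋ ] ⟪ ℙF p , (λ u → ⟪ ℙF s , g u ⟫) ⟫)) ⟫
          ≈⟨ ⟪⟫-congᴬ {x = cs} (All.map (λ {q} idx → ≈-trans
              (Cut-cong∈ (proj₂ q) (λ p s e → mask p s
              (Allₚ.++⁻ˡ p (subst (All RedPacked) (≡.sym e) (proj₁ idx)))))
               (≈-sym (Δ-ℙF (redPacked-primitives (proj₁ idx)) g′))) sup) ⟩
        ⟪ cs , (λ f → ⟪ ℙF f , cop full g′ ⟫) ⟫ ≈⟨ zero₁ g′ (λ u v ne → []-no (length u ≟ k) ne) ⟩
        0# ∎
        where
          g′ : Word → Word → K
          g′ u v = [ ⌊ length u ≟ k ⌋ ] g u v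
          mask : ∀ p s → All RedPacked p → [ ⌊ ωF p ≟ k ⌋ ] ⟪ ℙF p , (λ u → ⟪ ℙF s , g u ⟫) ⟫ ≈
              ⟪ ℙF p , (λ u → ⟪ ℙF s , g′ u ⟫) ⟫
          mask p s rp = ≈-trans (≈-sym (⟪⟫-[] ⌊ ωF p ≟ k ⌋ (ℙF p) _))
              (⟪⟫-congᴬ {x = ℙF p} (All.map (λ {q} pw →
            ≈-trans (≈-reflexive (cong (λ n → [ ⌊ n ≟ k ⌋ ] ⟪ ℙF s , g (proj₂ q) ⟫) (≡.sym (proj₂ pw))))
                (≈-sym (⟪⟫-[] ⌊ length (proj₂ q) ≟ k ⌋ (ℙF s) (g (proj₂ q)))))
                (Deg-ℙF (redPacked-primitives rp))))

  component : List ℕ → V → V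
  component I = reindex (λ W → keep ⌊ pos W ≟W I ⌋ (rem W))

  ⟪component⟫ : ∀ I x g → ⟪ component I x , g ⟫ ≈ ⟪ x , (λ W → [ ⌊ pos W ≟W I ⌋ ] g (rem W)) ⟫
  ⟪component⟫ I x g = ≈-trans (⟪reindex⟫ (λ W → keep ⌊ pos W ≟W I ⌋ (rem W)) x g)
      (⟪⟫-cong x (λ W → ∑-keep ⌊ pos W ≟W I ⌋ (rem W) g))

  map-∸-injective : ∀ {k} I J → All (k ≤_) I → All (k ≤_) J → map (_∸ k) I ≡ map (_∸ k) J → I ≡ J
  map-∸-injective [] [] _ _ e = refl
  map-∸-injective {k} (i ∷ I) (j ∷ J) (p ∷ ps) (q ∷ qs) e = cong₂ _∷_
    (ℕ.∸-cancelʳ-≡ p q (proj₁ (∷-injective e))) (map-∸-injective I J ps qs (proj₂ (∷-injective e)))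

  sorted-above : ∀ {k} I → Sorted k I → All (k ≤_) I
  sorted-above [] s = []
  sorted-above (i ∷ I) (p , s) = p ∷ All.map (λ q → ≤-trans (ℕ.m≤n⇒m≤1+n p) q) (sorted-above I s)

  <∸⇒+< : ∀ a b {d} → a < d ∸ b → a + b < d
  <∸⇒+< a b {d} lt = subst (a + b <_) (ℕ.m∸n+n≡m (ℕ.<⇒≤ (0<∸⇒< d b (ℕ.≤-<-trans z≤n lt)))) (ℕ.+-monoˡ-< b lt)

  -- A position list occurring in degree n: the word bounds its entries.
  record Realised (i : ℕ) (I : List ℕ) (n : ℕ) : Set where
    field
      word : Word
      word-PW : PW n word
      word-pos : pos word ≡ i ∷ I

  module CoreSpan {n} (1≤n : 1 ≤ n) (basis : ∀ {m} → m < n → ForestBasis m)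
                  {x : V} (dx : Deg n x) (kr : Kills right x) (kl : Kills left x) where

    module At {i I} (real : Realised i I n) where
      open Realised

      private
        m : ℕ
        m = n ∸ suc (length I)

        W₀ = word real

        lengths : ∀ {W} → PW n W → pos W ≡ i ∷ I → suc (length I) + length (rem W) ≡ n
        lengths {W} (_ , len) e = ≡.trans (cong (λ J → length J + length (rem W)) (≡.sym e))
            (≡.trans (length-posFrom 1 (maxW W) W) len)

        p+m : suc (length I) + m ≡ n
        p+m = ℕ.m+[n∸m]≡n (subst (suc (length I) ≤_) (lengths (word-PW real) (word-pos real)) (ℕ.m≤m+n _ _))

        m<n : m < n
        m<n = subst (m <_) p+m (s≤s (ℕ.m≤n+m m (length I)))

        length-rem : ∀ {W} → PW n W → pos W ≡ i ∷ I → length (rem W) ≡ m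
        length-rem {W} pw e = ℕ.+-cancelˡ-≡ (suc (length I)) _ _ (≡.trans (lengths pw e) (≡.sym p+m))

        I-sorted : Sorted 1 (i ∷ I)
        I-sorted = subst (Sorted 1) (word-pos real) (posFrom-sorted 1 (maxW W₀) W₀)

        I-last : lastOr i I ≤ n
        I-last = ℕ.≤-pred (subst (λ k → lastOr i I < suc k) (proj₂ (word-PW real))
          (All.lookup (subst (All (_< suc (length W₀))) (word-pos real) (posFrom-bound 1 (maxW W₀) W₀))
              (lastOr-∈ i I)))

        y : V
        y = component (i ∷ I) x

        Deg-y : Deg m y
        Deg-y = Supp-reindex (λ W → keep ⌊ pos W ≟W (i ∷ I) ⌋ (rem W))
            (All.map (λ {q} pw → All-keep (pos (proj₂ q) ≟W (i ∷ I)) (λ e →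
          Packed-rem (proj₁ pw) (PW-≢[] 1≤n pw) , length-rem pw e)) dx)

        -- Comes from Δ≻ of `x`: behind a left part of length `k` before the first maximal letter,
        -- the lowered positions still determine the original ones, so a test on the right part can
        -- isolate the component `y`.
        cut-right : ∀ {k} → 1 ≤ k → k < i → ∀ g → (∀ u v → length u ≢ k → g u v ≈ 0#) → ⟪ y , cop full g ⟫
            ≈ 0#
        cut-right {k} 1≤k k<i g g0 = ≈-trans (⟪component⟫ (i ∷ I) x (cop full g))
          (≈-trans (⟪⟫-congᴬ {x = x} (All.map (λ {q} pw → point (proj₂ q) pw (pos (proj₂ q)) refl) dx))
              (kr f (λ v → f[] v) f[]ʳ))
          where
            -- The positions of the maximal letters as seen in the right part after `k` letters have
            -- been cut off.
            target : List ℕ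
            target = map (_∸ k) (i ∷ I)
            G : Word → List ℕ → Word → K
            G u J v = [ ⌊ J ≟W target ⌋ ] g u v
            f : Word → Word → K
            f u v = G u (pos v) (rem v)
            f[] : ∀ v → f [] v ≈ 0#
            f[] v = ≈-trans ([]-cong ⌊ pos v ≟W target ⌋ (g0 [] (rem v) (ℕ.<⇒≢ 1≤k)))
                ([]-zero ⌊ pos v ≟W target ⌋)
            f[]ʳ : ∀ u → f u [] ≈ 0#
            f[]ʳ u = []-no ([] ≟W target) {g u []} (λ ())
            point : ∀ W → PW n W → ∀ J → pos W ≡ J → [ ⌊ pos W ≟W (i ∷ I) ⌋ ] cop full g (rem W) ≈ cop
                right f W
            point W pw [] e = ⊥-elim (pos-≢[] (PW-≢[] 1≤n pw) e)
            point W pw (j ∷ J) e = ≈-sym (≈-trans (cop-right-pos W j J (proj₁ pw) (PW-≢[] 1≤n pw) e f G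
                (λ u v _ _ → ≈-refl))
              (≈-trans (go ((j ∷ J) ≟W (i ∷ I))) (≈-reflexive
                  (cong (λ z → [ ⌊ z ≟W (i ∷ I) ⌋ ] cop full g (rem W)) (≡.sym e)))))
              where
                g″ : Word → Word → K
                g″ u v = [ ⌊ length u <? j ⌋ ] G u (map (_∸ length u) (j ∷ J)) v
                J-sorted : Sorted 1 (j ∷ J)
                J-sorted = subst (Sorted 1) e (posFrom-sorted 1 (maxW W) W)
                vanish-at : ∀ u v → length u ≢ k → g″ u v ≈ 0#
                vanish-at u v ne = ≈-trans ([]-cong ⌊ length u <? j ⌋
                    (≈-trans ([]-cong ⌊ map (_∸ length u) (j ∷ J) ≟W target ⌋ (g0 u v ne))
                    ([]-zero ⌊ map (_∸ length u) (j ∷ J) ≟W target ⌋))) ([]-zero ⌊ length u <? j ⌋)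
                go : Dec (j ∷ J ≡ i ∷ I) → cop full g″ (rem W) ≈ [ ⌊ (j ∷ J) ≟W (i ∷ I) ⌋ ] cop full g (rem W)
                go (yes refl) = ≈-trans (cop-cong full (rem W) {g″} {g}
                    (λ u v _ → same u v (length u ≟ k))) (≈-sym ([]-yes ((i ∷ I) ≟W (i ∷ I)) refl))
                  where
                    same : ∀ u v → Dec (length u ≡ k) → g″ u v ≈ g u v
                    same u v (no ne) = ≈-trans (vanish-at u v ne) (≈-sym (g0 u v ne))
                    same u v (yes refl) = ≈-trans ([]-yes (length u <? i) k<i)
                        ([]-yes (target ≟W target) refl)
                go (no ne) = ≈-trans (cop-zero full (rem W) {g″}
                    (λ u v _ → none u v (length u ≟ k) (length u <? j)))
                    (≈-sym ([]-no ((j ∷ J) ≟W (i ∷ I)) ne))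
                  where
                    none : ∀ u v → Dec (length u ≡ k) → Dec (length u < j) → g″ u v ≈ 0#
                    none u v (no nk) _ = vanish-at u v nk
                    none u v (yes _) (no nl) = []-no (length u <? j) nl
                    none u v (yes refl) (yes lt) = ≈-trans
                        ([]-cong ⌊ length u <? j ⌋ ([]-no (map (_∸ length u) (j ∷ J) ≟W target) (λ eq →
                      ne (map-∸-injective {length u} (j ∷ J) (i ∷ I)
                          (sorted-above (j ∷ J) (ℕ.<⇒≤ lt , proj₂ J-sorted))
                          (sorted-above (i ∷ I) (ℕ.<⇒≤ k<i , proj₂ I-sorted)) eq))))
                          ([]-zero ⌊ length u <? j ⌋)

        -- Comes from Δ≺ of `x`: here the positions appear unchanged in the left part, and `far`
        -- guarantees that a cut leaving `k` other letters on the left lies past all of them.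
        cut-left : ∀ {k} → k < m → lastOr i I < suc (k + suc (length I)) → ∀ g →
            (∀ u v → length u ≢ k → g u v ≈ 0#) → ⟪ y , cop full g ⟫ ≈ 0#
        cut-left {k} k<m far g g0 = ≈-trans (⟪component⟫ (i ∷ I) x (cop full g))
          (≈-trans (⟪⟫-congᴬ {x = x} (All.map (λ {q} pw → point (proj₂ q) pw (pos (proj₂ q)) refl) dx))
              (kl f f[] f[]ʳ))
          where
            G : List ℕ → Word → Word → K
            -- Stripping makes the test admissible for `Kills`; it changes nothing, because `k < m`
            -- already makes `g` vanish where the right part is empty.
            G J u v = [ ⌊ J ≟W (i ∷ I) ⌋ ] strip g u v
            f : Word → Word → K
            f u v = G (pos u) (rem u) v
            f[] : ∀ v → f [] v ≈ 0#
            f[] v = []-no ([] ≟W (i ∷ I)) {strip g [] v} (λ ())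
            f[]ʳ : ∀ u → f u [] ≈ 0#
            f[]ʳ u = []-zero ⌊ pos u ≟W (i ∷ I) ⌋
            point : ∀ W → PW n W → ∀ J → pos W ≡ J → [ ⌊ pos W ≟W (i ∷ I) ⌋ ] cop full g (rem W) ≈ cop
                left f W
            point W pw [] e = ⊥-elim (pos-≢[] (PW-≢[] 1≤n pw) e)
            point W pw (j ∷ J) e = ≈-sym (≈-trans (cop-left-pos W j J (proj₁ pw) (PW-≢[] 1≤n pw) e f G
                (λ u v _ _ → ≈-refl))
              (≈-trans (go ((j ∷ J) ≟W (i ∷ I))) (≈-reflexive
                  (cong (λ z → [ ⌊ z ≟W (i ∷ I) ⌋ ] cop full g (rem W)) (≡.sym e)))))
              where
                g″ : Word → Word → K
                g″ u v = [ ⌊ lastOr j J <? suc (length u + suc (length J)) ⌋ ] G (j ∷ J) u v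
                go : Dec (j ∷ J ≡ i ∷ I) → cop full g″ (rem W) ≈ [ ⌊ (j ∷ J) ≟W (i ∷ I) ⌋ ] cop full g (rem W)
                go (no ne) = ≈-trans (cop-zero full (rem W) {g″}
                    (λ u v _ → ≈-trans ([]-cong ⌊ lastOr j J <? suc (length u + suc (length J)) ⌋
                    ([]-no ((j ∷ J) ≟W (i ∷ I)) ne))
                    ([]-zero ⌊ lastOr j J <? suc (length u + suc (length J)) ⌋)))
                    (≈-sym ([]-no ((j ∷ J) ≟W (i ∷ I)) ne))
                go (yes refl) = ≈-trans (cop-cong full (rem W) {g″} {g}
                    (λ u v len → same u v len (length u ≟ k))) (≈-sym ([]-yes ((i ∷ I) ≟W (i ∷ I)) refl))
                  where
                    strip-at : ∀ u v → length u + length v ≡ length (rem W) → strip g u v ≈ g u v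
                    strip-at u [] len = ≈-sym (g0 u []
                        (λ { refl → ℕ.<⇒≢ k<m (≡.trans (≡.sym (ℕ.+-identityʳ _))
                        (≡.trans len (length-rem pw e))) }))
                    strip-at u (_ ∷ _) len = ≈-refl
                    same : ∀ u v → length u + length v ≡ length (rem W) → Dec (length u ≡ k) → g″ u v ≈ g u v
                    same u v len (yes refl) = ≈-trans
                        ([]-yes (lastOr i I <? suc (length u + suc (length I))) far)
                        (≈-trans ([]-yes ((i ∷ I) ≟W (i ∷ I)) refl) (strip-at u v len))
                    same u v len (no ne) = ≈-trans ([]-cong ⌊ lastOr i I <? suc
                        (length u + suc (length I)) ⌋
                        (≈-trans ([]-yes ((i ∷ I) ≟W (i ∷ I)) refl) (≈-trans (strip-at u v len) (g0 u v ne))))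
                      (≈-trans ([]-zero ⌊ lastOr i I <? suc (length u + suc (length I)) ⌋)
                          (≈-sym (g0 u v ne)))

        -- The label conditions of a red-packed tree that do not hold automatically for the
        -- positions of the maximal letters in a word of length `n`.
        Fits : Forest → Set
        Fits [] = ⊤
        Fits (r ∷ rs) = i ≤ ω r × (suc (length I) + ωF (r ∷ rs) + 1) ∸ lastOr i I ≤ ω (lastOr r rs)

        fits? : ∀ f → Dec (Fits f)
        fits? [] = yes tt
        fits? (r ∷ rs) = (i ≤? ω r) ×-dec ((suc (length I) + ωF (r ∷ rs) + 1) ∸ lastOr i I ≤? ω (lastOr r rs))

        fits-idx : ∀ f → ForestIdx m f → Fits f → CoreIdx n (node (i ∷ I) [] f)
        fits-idx [] (rp , e) _ = (rp-noRight [] (sorted-label (i ∷ I) ℕ.≤-refl I-sorted) all-max , refl) ,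
            ≡.trans (cong (_+ 0) (ℕ.+-identityʳ (suc (length I)))) (≡.trans (cong (suc (length I) +_) e) p+m)
          where
            rem-empty : ∀ w → length w ≡ 0 → w ≡ []
            rem-empty [] _ = refl
            all-max : i ∷ I ≡ map suc (upTo (length (i ∷ I)))
            all-max = subst (λ J → J ≡ map suc (upTo (length J))) (word-pos real)
              (posFrom-all (maxW W₀) W₀ (rem-empty (rem W₀)
                  (≡.trans (length-rem (word-PW real) (word-pos real)) (≡.sym e))))
        fits-idx (r ∷ rs) (rp , e) (le₁ , le₂) = (rp-right [] rp (sorted-label (i ∷ I) ℕ.≤-refl I-sorted)
            (proj₁ I-sorted) le₁
            (ℕ.m<n⇒0<n∸m (subst (lastOr i I <_) (≡.sym total) (s≤s I-last))) le₂ , refl)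
            , ≡.trans (cong (_+ ωF (r ∷ rs)) (ℕ.+-identityʳ (suc (length I))))
                (≡.trans (cong (suc (length I) +_) e) p+m)
          where
            total : suc (length I) + ωF (r ∷ rs) + 1 ≡ suc n
            total = ≡.trans (ℕ.+-comm _ 1) (cong suc (≡.trans (cong (suc (length I) +_) e) p+m))

        unsnoc : ∀ r rs → Σ[ a ∈ Forest ] (a ++ lastOr r rs ∷ [] ≡ r ∷ rs)
        unsnoc r [] = [] , refl
        unsnoc r (s ∷ rs) with unsnoc s rs
        ... | a , e = r ∷ a , cong (r ∷_) e

        module _ {cs} (sup : Supp (ForestIdx m) cs) (eq : ∀ f → ⟪ cs , (λ h → ⟪ ℙF h , f ⟫) ⟫ ≈ ⟪ y , f ⟫)
            where

          -- A forest whose first tree is too light is cut after that tree, where `cut-right`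
          -- applies; one whose last tree is too light is cut before that tree, where `cut-left`
          -- applies. In both cases its coefficient in the expansion of `y` vanishes by
          -- `cut-coefficient`.
          unfit-zero : ∀ f → ForestIdx m f → ¬ Fits f → ⟪ cs , CF.δ f ⟫ ≈ 0#
          unfit-zero [] _ n = ⊥-elim (n tt)
          unfit-zero (r ∷ rs) (rp@(pr ∷ prs) , e) unfit with i ≤? ω r
          ... | no big = cut-coefficient (≡.trans (≡.sym (ωF-++ (r ∷ []) rs)) e)
              (basis (ℕ.≤-<-trans small m<n)) (basis (ℕ.≤-<-trans rest m<n)) sup
                (λ g g0 → ≈-trans (eq (cop full g))
                    (cut-right (≤-trans (ω-pos (redPacked-primitive pr)) (ℕ.m≤m+n _ _))
                    (subst (_< i) (≡.sym (ℕ.+-identityʳ (ω r))) (ℕ.≰⇒> big)) g g0))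
                (r ∷ []) rs (pr ∷ [] , refl) (prs , refl)
            where
              small : ωF (r ∷ []) ≤ m
              small = subst (ωF (r ∷ []) ≤_) (≡.trans (≡.sym (ωF-++ (r ∷ []) rs)) e) (ℕ.m≤m+n _ _)
              rest : ωF rs ≤ m
              rest = subst (ωF rs ≤_) e (ℕ.m≤n+m _ (ω r))
          ... | yes ok with unsnoc r rs
          ... | a , ea = subst (λ f → ⟪ cs , CF.δ f ⟫ ≈ 0#) ea
              (cut-coefficient weights (basis (ℕ.<-trans small m<n)) (basis (ℕ.≤-<-trans rest m<n)) sup
                  (λ g g0 → ≈-trans (eq (cop full g)) (cut-left small far g g0)) a (lastOr r rs ∷ [])
                      (Allₚ.++⁻ˡ a rp′ , refl) (Allₚ.++⁻ʳ a rp′ , refl))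
            where
              t = lastOr r rs
              rp′ : All RedPacked (a ++ t ∷ [])
              rp′ = subst (All RedPacked) (≡.sym ea) rp
              weights : ωF a + ωF (t ∷ []) ≡ m
              weights = ≡.trans (≡.sym (ωF-++ a (t ∷ []))) (≡.trans (cong ωF ea) e)
              t-pos : 1 ≤ ωF (t ∷ [])
              t-pos = ≤-trans (ω-pos (redPacked-primitive (All.head (Allₚ.++⁻ʳ a rp′)))) (ℕ.m≤m+n _ _)
              small : ωF a < m
              small = subst (ωF a <_) weights (ℕ.m<m+n (ωF a) t-pos)
              rest : ωF (t ∷ []) ≤ m
              rest = subst (ωF (t ∷ []) ≤_) weights (ℕ.m≤n+m _ (ωF a))
              over : ω t < (suc (length I) + ωF (r ∷ rs) + 1) ∸ lastOr i I
              over = ℕ.≰⇒> (λ le → unfit (ok , le))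
              far : lastOr i I < suc (ωF a + suc (length I))
              far = ℕ.+-cancelʳ-< (ω t) (lastOr i I) (suc (ωF a + suc (length I)))
                (subst (lastOr i I + ω t <_) arith (subst (_< suc (length I) + ωF (r ∷ rs) + 1)
                    (ℕ.+-comm (ω t) (lastOr i I)) (<∸⇒+< (ω t) (lastOr i I) over)))
                where
                  arith : suc (length I) + ωF (r ∷ rs) + 1 ≡ suc (ωF a + suc (length I)) + ω t
                  arith = ≡.trans (ℕ.+-comm _ 1) (cong suc
                      (≡.trans (cong (suc (length I) +_)
                      (≡.trans (cong ωF (≡.sym ea))
                      (≡.trans (ωF-++ a (t ∷ [])) (cong (ωF a +_) (ℕ.+-identityʳ (ω t))))))
                    (≡.trans (≡.sym (ℕ.+-assoc (suc (length I)) (ωF a) (ω t)))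
                        (cong (_+ ω t) (ℕ.+-comm (suc (length I)) (ωF a))))))

          tree : Forest → List Tree
          tree f = keep ⌊ fits? f ⌋ (node (i ∷ I) [] f)

          component-eq : ∀ φ → ⟪ reindex tree cs , (λ t → ⟪ ℙ t , φ ⟫) ⟫ ≈ ⟪ Φ (i ∷ I) y , φ ⟫
          component-eq φ = begin
            ⟪ reindex tree cs , (λ t → ⟪ ℙ t , φ ⟫) ⟫
              ≈⟨ ≈-trans (⟪reindex⟫ tree cs (λ t → ⟪ ℙ t , φ ⟫))
                  (⟪⟫-cong cs (λ f → ≈-trans (∑-keep ⌊ fits? f ⌋ (node (i ∷ I) [] f) (λ t → ⟪ ℙ t , φ ⟫))
                  ([]-cong ⌊ fits? f ⌋ (⟪Φ⟫ (i ∷ I) (ℙF f) φ)))) ⟩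
            ⟪ cs , (λ f → [ ⌊ fits? f ⌋ ] value f) ⟫ ≈⟨ difference ⟩
            ⟪ cs , value ⟫ ≈⟨ eq (phiK (i ∷ I) φ) ⟩
            ⟪ y , phiK (i ∷ I) φ ⟫ ≈⟨ ⟪Φ⟫ (i ∷ I) y φ ⟨
            ⟪ Φ (i ∷ I) y , φ ⟫ ∎
            where
              value : Forest → K
              value f = ⟪ ℙF f , phiK (i ∷ I) φ ⟫
              excess : Forest → K
              excess f = [ ⌊ fits? f ⌋ ] value f ⊕ ⊖ value f
              excess-zero : ∀ f → ForestIdx m f → Dec (Fits f) → ⟪ cs , CF.δ f ⟫ ≈ 0# ⊎ excess f ≈ 0#
              excess-zero f idx (yes p) = inj₂ (≈-trans (+-congʳ ([]-yes (fits? f) p)) (-‿inverseʳ _))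
              excess-zero f idx (no p) = inj₁ (unfit-zero f idx p)
              difference : ⟪ cs , (λ f → [ ⌊ fits? f ⌋ ] value f) ⟫ ≈ ⟪ cs , value ⟫
              difference = begin
                ⟪ cs , (λ f → [ ⌊ fits? f ⌋ ] value f) ⟫
                  ≈⟨ ⟪⟫-cong cs (λ f → ≈-trans (+-assoc _ _ _)
                      (≈-trans (+-congˡ (-‿inverseˡ _)) (+-identityʳ _))) ⟨
                ⟪ cs , (λ f → excess f ⊕ value f) ⟫ ≈⟨ ⟪⟫-⊕ cs excess value ⟩
                ⟪ cs , excess ⟫ ⊕ ⟪ cs , value ⟫ ≈⟨ +-congʳ
                    (CF.vanish cs excess (All.map (λ {q} idx → excess-zero (proj₂ q) idx
                    (fits? (proj₂ q))) sup)) ⟩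
                0# ⊕ ⟪ cs , value ⟫ ≈⟨ +-identityˡ _ ⟩
                ⟪ cs , value ⟫ ∎

          component-sup : Supp (CoreIdx n) (reindex tree cs)
          component-sup = Supp-reindex tree (All.map
              (λ {q} idx → All-keep (fits? (proj₂ q)) (fits-idx (proj₂ q) idx)) sup)

      component-span : Span (CoreIdx n) ℙ (Φ (i ∷ I) y)
      component-span with span (basis m<n) y Deg-y
      ... | cs , sup , eq = reindex (tree sup eq) cs , component-sup sup eq , component-eq sup eq

    U : List (List ℕ)
    U = deduplicate _≟W_ (map (λ q → pos (proj₂ q)) x)

    pieces : ∀ (Is : List (List ℕ)) → (∀ {I} → I ∈ Is → I ∈ U) →
      Σ[ cs ∈ List (K × Tree) ] (Supp (CoreIdx n) cs ×
          (∀ φ → ⟪ cs , (λ t → ⟪ ℙ t , φ ⟫) ⟫ ≈ ∑ Is (λ I → ⟪ Φ I (component I x) , φ ⟫)))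
    pieces [] sub = [] , [] , λ φ → ≈-refl
    pieces (I ∷ Is) sub with one I (∈-map⁻ (λ q → pos (proj₂ q))
        (∈-deduplicate⁻ _≟W_ (map (λ q → pos (proj₂ q)) x) (sub (here refl)))) | pieces Is
        (λ i → sub (there i))
      where
        one : ∀ I → ∃[ q ] (q ∈ x × I ≡ pos (proj₂ q)) → Span (CoreIdx n) ℙ (Φ I (component I x))
        one [] (q , i , e) = ⊥-elim (pos-≢[] (PW-≢[] 1≤n (All.lookup dx i)) (≡.sym e))
        one (j ∷ J) (q , i , e) = At.component-span {j} {J}
            (record { word = proj₂ q ; word-PW = All.lookup dx i ; word-pos = ≡.sym e })
    ... | cs , sup , eq | ds , supD , eqD = cs ++ ds , Allₚ.++⁺ sup supD , λ φ → ≈-trans (⟪⟫-++ cs ds _)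
        (+-cong (eq φ) (eqD φ))

    recompose : ∀ φ → ∑ U (λ I → ⟪ Φ I (component I x) , φ ⟫) ≈ ⟪ x , φ ⟫
    recompose φ = begin
      ∑ U (λ I → ⟪ Φ I (component I x) , φ ⟫)
        ≈⟨ ∑-cong U (λ I → ≈-trans (⟪Φ⟫ I (component I x) φ) (⟪component⟫ I x (phiK I φ))) ⟩
      ∑ U (λ I → ⟪ x , (λ W → [ ⌊ pos W ≟W I ⌋ ] phiK I φ (rem W)) ⟫) ≈⟨ ⟪⟫-∑ x U
          (λ W I → [ ⌊ pos W ≟W I ⌋ ] phiK I φ (rem W)) ⟨
      ⟪ x , (λ W → ∑ U (λ I → [ ⌊ pos W ≟W I ⌋ ] phiK I φ (rem W))) ⟫
        ≈⟨ ⟪⟫-congᴬ {x = x} (All.tabulate (λ {q} i → ≈-trans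
            (∑-unique _≟W_ (Uniqueₚ.deduplicate-! _≟W_ _)
            (∈-deduplicate⁺ _≟W_ (∈-map⁺ (λ q → pos (proj₂ q)) i)) (λ I → phiK I φ (rem (proj₂ q))))
             (phiK-pos (proj₁ (All.lookup dx i)) (PW-≢[] 1≤n (All.lookup dx i)) φ))) ⟩
      ⟪ x , φ ⟫ ∎

    core-span : Span (CoreIdx n) ℙ x
    core-span with pieces U (λ i → i)
    ... | cs , sup , eq = cs , sup , λ φ → ≈-trans (eq φ) (recompose φ)

  -- Slices of the leading coproduct component

  VanishAbove : ℕ → ℕ → (Bool → Bool) → V → Set _
  VanishAbove n k χ x = ∀ k′ → k < k′ → k′ < n → ∀ g → (∀ u v → length u ≢ k′ → g u v ≈ 0#) →
      ⟪ x , cop χ g ⟫ ≈ 0#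

  -- `VanishAbove` speaks about tests in a single left degree, so `G` is split by the length of its
  -- left argument; the layers up to `k` are zero by assumption on `G`.
  vanish-above : ∀ {n k χ x} → Deg n x → VanishAbove n k χ x → ∀ G → (∀ u v → length u ≤ k → G u v ≈ 0#) →
      (∀ u → G u [] ≈ 0#) →
    ⟪ x , cop χ G ⟫ ≈ 0#
  vanish-above {n} {k} {χ} {x} dx above G small G[] = begin
    ⟪ x , cop χ G ⟫
      ≈⟨ ⟪⟫-congᴬ {x = x} (All.map (λ {q} pw → cop-cong χ (proj₂ q) {G}
          {λ u v → ∑ (upTo n) (λ j → layer j u v)} (λ u v len → layers u v (≡.trans len (proj₂ pw)))) dx) ⟩
    ⟪ x , cop χ (λ u v → ∑ (upTo n) (λ j → layer j u v)) ⟫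
      ≈⟨ ⟪⟫-cong x (λ w → ≈-trans (Cut-cong w (λ p s → ≈-sym
          ([]-∑ (accept χ w p s) (upTo n) (λ j → layer j (pack p) (pack s))))) (∑-swap (decs w) (upTo n) _)) ⟩
    ⟪ x , (λ w → ∑ (upTo n) (λ j → cop χ (layer j) w)) ⟫ ≈⟨ ⟪⟫-∑ x (upTo n) (λ w j → cop χ (layer j) w) ⟩
    ∑ (upTo n) (λ j → ⟪ x , cop χ (layer j) ⟫) ≈⟨ ∑-zeroᴬ
        (Allₚ.applyUpTo⁺₁ (λ j → j) n (λ {j} lt → zeroAt j lt (k <? j))) ⟩
    0# ∎
    where
      layer : ℕ → Word → Word → K
      layer j u v = [ ⌊ length u ≟ j ⌋ ] G u v
      layers : ∀ u v → length u + length v ≡ n → G u v ≈ ∑ (upTo n) (λ j → layer j u v)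
      layers u [] len = ≈-trans (G[] u) (≈-sym (∑-zero (upTo n)
          (λ j → ≈-trans ([]-cong ⌊ length u ≟ j ⌋ (G[] u)) ([]-zero ⌊ length u ≟ j ⌋))))
      layers u (a ∷ v) len = ≈-sym (∑-unique _≟_ (upTo⁺ n)
          (∈-upTo⁺ (subst (length u <_) len (ℕ.m<m+n (length u) (s≤s z≤n)))) (λ _ → G u (a ∷ v)))
      zeroAt : ∀ j → j < n → Dec (k < j) → ⟪ x , cop χ (layer j) ⟫ ≈ 0#
      zeroAt j lt (yes k<j) = above j k<j lt (layer j) (λ u v ne → []-no (length u ≟ j) ne)
      zeroAt j lt (no k≮j) = ⟪⟫-zero x (λ w → cop-zero χ w {layer j} (λ u v _ → low u v (length u ≟ j)))
        where
          low : ∀ u v → Dec (length u ≡ j) → layer j u v ≈ 0#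
          low u v (yes refl) = ≈-trans ([]-yes (length u ≟ length u) refl) (small u v (ℕ.≮⇒≥ k≮j))
          low u v (no ne) = []-no (length u ≟ j) ne

  cop-[] : ∀ b χ f w → cop χ (λ p s → [ b ] f p s) w ≈ [ b ] cop χ f w
  cop-[] true χ f w = ≈-refl
  cop-[] false χ f w = cop-zero χ w (λ _ _ _ → ≈-refl)

  pinned : Word → (Word → Word → K) → Word → Word → Word → K
  pinned u f p q r = [ ⌊ p ≟W u ⌋ ] f q r

  slice-cop : ∀ χ χ₂ u x f → ⟪ slice χ u x , cop χ₂ f ⟫ ≈ ⟪ x , cop χ (λ p y → cop χ₂ (pinned u f p) y) ⟫
  slice-cop χ χ₂ u x f = ≈-trans (⟪slice⟫ χ u x (cop χ₂ f))
      (⟪⟫-cong x (λ w → cop-cong χ w {λ p y → [ ⌊ p ≟W u ⌋ ] cop χ₂ f y} {λ p y → cop χ₂ (pinned u f p) y}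
      (λ p y _ → ≈-sym (cop-[] ⌊ p ≟W u ⌋ χ₂ f y))))

  pinned-small : ∀ χ u f → (∀ v → f [] v ≈ 0#) → ∀ y r → length y ≤ length u → cop χ
      (λ p q → pinned u f p q r) y ≈ 0#
  pinned-small χ u f fˡ y r le = cop-zero χ y {λ p q → pinned u f p q r} (λ p q len → go p q len (p ≟W u))
    where
      go : ∀ p q → length p + length q ≡ length y → Dec (p ≡ u) → pinned u f p q r ≈ 0#
      go p q len (no ne) = []-no (p ≟W u) ne
      go p [] len (yes _) = ≈-trans ([]-cong ⌊ p ≟W u ⌋ (fˡ r)) ([]-zero ⌊ p ≟W u ⌋)
      go p (a ∷ q) len (yes refl) = ⊥-elim (ℕ.<⇒≱ (subst (length u <_) len (ℕ.m<m+n (length p) (s≤s z≤n))) le)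

  pinned-[]ʳ : ∀ χ u f → (∀ p → f p [] ≈ 0#) → ∀ y → cop χ (λ p q → pinned u f p q []) y ≈ 0#
  pinned-[]ʳ χ u f fʳ y = cop-zero χ y {λ p q → pinned u f p q []}
      (λ p q _ → ≈-trans ([]-cong ⌊ p ≟W u ⌋ (fʳ q)) ([]-zero ⌊ p ≟W u ⌋))

  -- By coassociativity a nontrivial cut of the right factor of a slice moves letters to its left
  -- factor, of length `k`, and so lands in left degrees above `k`, where Δ_χ of `x` vanishes.
  slice-kills : ∀ {n k χ χ₂ χ₄ x} → Coherent χ χ₂ χ χ₄ → Deg n x → VanishAbove n k χ x → ∀ u → length u ≡
      k → Kills χ₂ (slice χ u x)
  slice-kills {χ = χ} {χ₂} {χ₄} {x} coh dx above u refl f fˡ fʳ = begin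
    ⟪ slice χ u x , cop χ₂ f ⟫ ≈⟨ slice-cop χ χ₂ u x f ⟩
    ⟪ x , cop χ (λ p y → cop χ₂ (pinned u f p) y) ⟫ ≈⟨ ⟪⟫-congᴬ {x = x}
        (All.map (λ {q} pw → cop-coassoc {χ} {χ₂} {χ} {χ₄} coh (pinned u f) (proj₂ q) (PW-pos pw)) dx) ⟩
    ⟪ x , cop χ (λ y r → cop χ₄ (λ p q → pinned u f p q r) y) ⟫
      ≈⟨ vanish-above {χ = χ} {x} dx above (λ y r → cop χ₄ (λ p q → pinned u f p q r) y)
          (pinned-small χ₄ u f fˡ) (pinned-[]ʳ χ₄ u f fʳ) ⟩
    0# ∎

  cop-first : ∀ {n χ w} → 1 ≤ n → χ false ≡ true → PW n w → ∀ (φ : Word → K) → cop χ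
      (λ p s → [ ⌊ p ≟W [] ⌋ ] φ s) w ≈ φ w
  cop-first {w = []} 1≤n χf pw φ = ⊥-elim (PW-≢[] 1≤n pw refl)
  cop-first {χ = χ} {w@(_ ∷ _)} 1≤n χf pw φ = begin
    cop χ g w ≈⟨ cop-split χ g (proj₁ pw) (λ ()) ⟩
    [ χ false ] φ w ⊕ ([ χ true ] 0# ⊕ cop χ (inner g) w) ≈⟨ +-cong (≈-reflexive (cong ([_] φ w) χf))
        (⊕-zero ([]-zero (χ true)) (cop-zero χ w {inner g} (λ p s _ → inner0 p s))) ⟩
    φ w ⊕ 0# ≈⟨ +-identityʳ _ ⟩
    φ w ∎
    where
      g : Word → Word → K
      g p s = [ ⌊ p ≟W [] ⌋ ] φ s
      inner0 : ∀ p s → inner g p s ≈ 0#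
      inner0 [] s = ≈-refl
      inner0 (_ ∷ _) [] = ≈-refl
      inner0 (_ ∷ _) (_ ∷ _) = ≈-refl

  -- Here Δ≺ x = - Δ≻ x on nontrivial cuts is used twice, around the coassociativity of Δ≺.
  slice-kills-full : ∀ {n k x} → 1 ≤ n → Kills full x → Deg n x → VanishAbove n k right x → ∀ u → length u
      ≡ k → Kills full (slice right u x)
  slice-kills-full {x = x} 1≤n kx dx above [] refl f fˡ fʳ = ≈-trans (⟪slice⟫ right [] x (cop full f))
    (≈-trans (⟪⟫-congᴬ {x = x} (All.map (λ pw → cop-first {χ = right} 1≤n refl pw (cop full f)) dx))
        (kx f fˡ fʳ))
  -- For nonempty `u` the test `H` vanishes on an empty left part, as the exchange of Δ≻ and Δ≺
  -- requires. The slice at the empty word, which is `x` itself, has to be treated apart.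
  slice-kills-full {x = x} 1≤n kx dx above u@(_ ∷ _) refl f fˡ fʳ = begin
    ⟪ slice right u x , cop full f ⟫ ≈⟨ slice-cop right full u x f ⟩
    ⟪ x , cop right H ⟫ ≈⟨ opposite H (λ y → cop-zero full y {pinned u f []} (λ _ _ _ → ≈-refl))
        (λ p → pinned-at-[] p) ⟩
    ⊖ ⟪ x , cop left H ⟫ ≈⟨ -‿cong (⟪⟫-congᴬ {x = x}
        (All.map (λ {q} pw → cop-coassoc {left} {full} {left} {left} left-coherent (pinned u f) (proj₂ q)
        (PW-pos pw)) dx)) ⟩
    ⊖ ⟪ x , cop left G ⟫ ≈⟨ opposite G (λ r → pinned-small left u f fˡ [] r z≤n) (pinned-[]ʳ left u f fʳ) ⟨
    ⟪ x , cop right G ⟫ ≈⟨ vanish-above {χ = right} {x} dx above G (pinned-small left u f fˡ)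
        (pinned-[]ʳ left u f fʳ) ⟩
    0# ∎
    where
      H G : Word → Word → K
      H p y = cop full (pinned u f p) y
      G y r = cop left (λ p q → pinned u f p q r) y
      pinned-at-[] : ∀ p → H p [] ≈ 0#
      pinned-at-[] p = cop-zero full [] {pinned u f p}
          (λ { [] r _ → ≈-trans ([]-cong ⌊ p ≟W u ⌋ (fˡ r)) ([]-zero ⌊ p ≟W u ⌋) ; (_ ∷ _) r () })
      opposite : ∀ E → (∀ v → E [] v ≈ 0#) → (∀ p → E p [] ≈ 0#) → ⟪ x , cop right E ⟫ ≈ ⊖ ⟪ x , cop left E ⟫
      opposite E Eˡ Eʳ = begin
        ⟪ x , cop right E ⟫ ≈⟨ +-identityʳ _ ⟨
        ⟪ x , cop right E ⟫ ⊕ 0# ≈⟨ +-congˡ (-‿inverseʳ _) ⟨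
        ⟪ x , cop right E ⟫ ⊕ (⟪ x , cop left E ⟫ ⊕ ⊖ ⟪ x , cop left E ⟫) ≈⟨ +-assoc _ _ _ ⟨
        (⟪ x , cop right E ⟫ ⊕ ⟪ x , cop left E ⟫) ⊕ ⊖ ⟪ x , cop left E ⟫
          ≈⟨ +-congʳ (≈-trans (≈-sym (⟪⟫-⊕ x (cop right E) (cop left E)))
              (≈-trans (≈-sym (⟪⟫-cong x (cop-halves E))) (kx E Eˡ Eʳ))) ⟩
        0# ⊕ ⊖ ⟪ x , cop left E ⟫ ≈⟨ +-identityˡ _ ⟩
        ⊖ ⟪ x , cop left E ⟫ ∎

  Kills-left : ∀ {x} → Kills full x → Kills right x → Kills left x
  Kills-left {x} kf kr f fˡ fʳ = begin
    ⟪ x , cop left f ⟫ ≈⟨ +-identityˡ _ ⟨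
    0# ⊕ ⟪ x , cop left f ⟫ ≈⟨ +-congʳ (kr f fˡ fʳ) ⟨
    ⟪ x , cop right f ⟫ ⊕ ⟪ x , cop left f ⟫ ≈⟨ ⟪⟫-⊕ x (cop right f) (cop left f) ⟨
    ⟪ x , (λ w → cop right f w ⊕ cop left f w) ⟫ ≈⟨ ⟪⟫-cong x (cop-halves f) ⟨
    ⟪ x , cop full f ⟫ ≈⟨ kf f fˡ fʳ ⟩
    0# ∎

  Kills-subtract : ∀ {χ x y} → Kills χ x → Kills χ y → Kills χ (subtract x y)
  Kills-subtract {χ} {x} {y} kx ky f fˡ fʳ = ≈-trans (⟪subtract⟫ x y (cop χ f))
      (⊕-zero (kx f fˡ fʳ) (≈-trans (-‿cong (ky f fˡ fʳ)) -0#≈0#))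

  Kills-lincomb : ∀ {χ} {X : Set} {e : X → V} {cs} → Supp (λ y → Kills χ (e y)) cs → Kills χ (lincomb e cs)
  Kills-lincomb {χ} {e = e} {cs} sup f fˡ fʳ = ≈-trans (⟪lincomb⟫ e cs (cop χ f))
      (⟪⟫-zeroᴬ {x = cs} (All.map (λ k → k f fˡ fʳ) sup))

  -- Primitive elements from totally primitive ones

  ωF-reverse : ∀ h → ωF (reverse h) ≡ ωF h
  ωF-reverse [] = refl
  ωF-reverse (t ∷ h) = ≡.trans (cong ωF (unfold-reverse t h))
      (≡.trans (ωF-++ (reverse h) (t ∷ [])) (≡.trans (cong₂ _+_ (ωF-reverse h) (ℕ.+-identityʳ (ω t)))
      (ℕ.+-comm (ωF h) (ω t))))

  All-reverse : ∀ {p} {T : Tree → Set p} {h} → All T h → All T (reverse h)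
  All-reverse {h = h} = All-resp-↭ (↭-sym (↭-reverse h))

  leftForest-redPacked : ∀ {I l r} → RedPacked (node I l r) → All RedPacked l
  leftForest-redPacked (rp-noRight ls _ _) = ls
  leftForest-redPacked (rp-right ls _ _ _ _ _ _) = ls

  graft : ∀ {I h r} → RedPacked (node I [] r) → All RedPacked h → RedPacked (node I h r)
  graft (rp-noRight _ a b) ls = rp-noRight ls a b
  graft (rp-right _ a b c d e f) ls = rp-right ls a b c d e f

  record TreeBasis (n : ℕ) : Set (c ⊔ˡ ℓ) where
    field
      indep : Indep _≟T_ (TreeIdx n) ℙ
      span : ∀ x → Deg n x → Kills full x → Span (TreeIdx n) ℙ x

  module TreeLevel {n} (1≤n : 1 ≤ n) (basis : ∀ {m} → m < n → ForestBasis m) where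

    -- Reversed because the leading left factor of the brace is `Ln l`, and `ℙF` nests its trees in
    -- the opposite order.
    lft : Tree → Forest
    lft (node I l r) = reverse l
    rgt : Tree → Tree
    rgt (node I l r) = node I [] r
    mk : Forest → Tree → Tree
    mk h (node I l r) = node I (reverse h) r

    weight : ∀ I l r → ω (node I l r) ≡ ωF (reverse l) + ω (node I [] r)
    weight I l r = ≡.trans (cong (_+ ωF r) (ℕ.+-comm (length I) (ωF l)))
        (≡.trans (ℕ.+-assoc (ωF l) (length I) (ωF r))
      (cong₂ _+_ (≡.sym (ωF-reverse l)) (cong (_+ ωF r) (≡.sym (ℕ.+-identityʳ (length I))))))

    rgt-weight : ∀ {I l r} → ω (node I l r) ≡ n → ω (node I [] r) ≡ n ∸ ωF (reverse l)
    rgt-weight {I} {l} {r} e = ≡.sym (≡.trans (cong (_∸ ωF (reverse l))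
        (≡.trans (≡.sym e) (weight I l r))) (ℕ.m+n∸m≡n (ωF (reverse l)) _))

    lead : ∀ {z} → TreeIdx n z → ∀ f → (∀ p → f p [] ≈ 0#) → (∀ u v → length u < ωF (lft z) → f u v ≈ 0#) →
      ⟪ ℙ z , cop right f ⟫ ≈ ⟪ ℙF (lft z) , (λ u → ⟪ ℙ (rgt z) , f u ⟫) ⟫
    lead {node [] l r} (() , _)
    lead {node (i ∷ I) l r} (rp , _) f f0 small = begin
      ⟪ ℙ (node (i ∷ I) l r) , cop right f ⟫ ≈⟨ ℙ≋brace (i ∷ I) l r (cop right f) ⟩
      ⟪ brace (ℙs l) q , cop right f ⟫
        ≈⟨ brace-leading (s≤s z≤n) (Deg-core (core rp) pr) (Kills-halves {q} kr (core-left (core rp) pr))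
            kr pl f f0 (λ u v lt → small u v (subst (length u <_) (≡.sym (ωF-reverse l)) lt)) ⟩
      ⟪ Ln l , (λ u → ⟪ q , f u ⟫) ⟫ ≡⟨ cong (λ h → ⟪ Ln h , (λ u → ⟪ q , f u ⟫) ⟫)
          (≡.sym (reverse-involutive l)) ⟩
      ⟪ Ln (reverse (reverse l)) , (λ u → ⟪ q , f u ⟫) ⟫ ≈⟨ ℙF≋Ln (All-reverse pl) (λ u → ⟪ q , f u ⟫) ⟨
      ⟪ ℙF (reverse l) , (λ u → ⟪ q , f u ⟫) ⟫ ∎
      where
        q = Φ (i ∷ I) (ℙF r)
        pl : All Primitive l
        pl = redPacked-primitives (leftForest-redPacked rp)
        pr : All Primitive r
        pr = redPacked-primitives (rightForest-redPacked rp)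
        kr : Kills right q
        kr = core-right (core rp) pr

    family : FilteredFamily n
    family = record
      { 1≤n = 1≤n ; χ = right ; χ-false = refl
      ; Good = Kills full ; Factor = λ _ y → Kills right y × Kills left y
      ; IL = ForestIdx ; IR = CoreIdx ; X = Tree ; _≟X_ = _≟T_ ; Idx = TreeIdx n ; e = ℙ
      ; lft = lft ; rgt = rgt ; mk = mk
      ; lft-idx = λ { {node I l r} (rp , _) → All-reverse (leftForest-redPacked rp) , refl }
      ; rgt-idx = λ { {node I l r} (rp , e) → (core rp , refl) , rgt-weight {I} {l} {r} e }
      ; lev-< = λ { {node [] l r} (() , _) ; {node (i ∷ I) l r} (rp , e) → subst (ωF (reverse l) <_)
          (≡.trans (≡.sym (weight (i ∷ I) l r)) e) (ℕ.m<m+n (ωF (reverse l)) (s≤s z≤n)) }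
      ; mk-idx = λ { {c} {h} {node I _ r} c<n (rp , ec) ((rt , refl) , e) → graft rt (All-reverse rp) ,
          ≡.trans (weight I (reverse h) r) (≡.trans
              (cong₂ _+_ (≡.trans (cong ωF (reverse-involutive h)) ec) e) (ℕ.m+[n∸m]≡n (ℕ.<⇒≤ c<n))) }
      ; lft-mk = λ { h (node I l r) → reverse-involutive h }
      ; rgt-mk = λ { {t = node I _ r} h ((rt , refl) , _) → refl }
      ; mk-eta = λ { {node I l r} _ → cong (λ h → node I h r) (reverse-involutive l) }
      ; IL-weight = proj₂
      ; IL-deg = λ { {h = h} (rp , e) → subst (λ k → Deg k (ℙF h)) e (Deg-ℙF (redPacked-primitives rp)) }
      ; IR-deg = λ { {t = t} ((rp , _) , e) → subst (λ k → Deg k (ℙ t)) e (ℙ-deg (redPacked-primitive rp)) }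
      ; e-deg = λ { {t} (rp , e) → subst (λ k → Deg k (ℙ t)) e (ℙ-deg (redPacked-primitive rp)) }
      ; lead = λ {z} → lead {z}
      ; indL = λ lt → indep (basis lt)
      ; spanL = λ lt → span (basis lt)
      ; indR = λ {k} _ le → core-indep (λ lt → basis (≤-trans lt le))
      ; spanR = λ {k} 1≤k le x d kills → CoreSpan.core-span 1≤k (λ lt → basis (≤-trans lt le)) d
          (proj₁ kills) (proj₂ kills)
      ; Good-sub = λ {x} {y} → Kills-subtract {full} {x} {y}
      ; Good-lin = λ {cs} sup → Kills-lincomb {full} {e = ℙ} {cs}
          (All.map (λ idx → ℙ-prim (redPacked-primitive (proj₁ idx))) sup)
      ; slice-Factor = λ {x} {k} kx dx lt above u len → let kr = slice-kills {χ = right} {right} {full} {x} right-coherent dx above u len in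
          kr , Kills-left {slice right u x} (slice-kills-full {x = x} 1≤n kx dx above u len) kr
      }

    treeBasis : TreeBasis n
    treeBasis = record { indep = Filtration.independent family ; span = λ x d k → Filtration.spanning
        family x k d }

  -- All elements from primitive ones

  initF : Forest → Forest
  initF [] = []
  initF (t ∷ []) = []
  initF (t ∷ s ∷ ts) = t ∷ initF (s ∷ ts)

  -- The value at [] is never used.
  lastF : Forest → Tree
  lastF [] = node [] [] []
  lastF (t ∷ ts) = lastOr t ts

  initF-lastF : ∀ h → h ≢ [] → initF h ∷ʳ lastF h ≡ h
  initF-lastF [] n = ⊥-elim (n refl)
  initF-lastF (t ∷ []) n = refl
  initF-lastF (t ∷ s ∷ ts) n = cong (t ∷_) (initF-lastF (s ∷ ts) (λ ()))

  initF-∷ʳ : ∀ h t → initF (h ∷ʳ t) ≡ h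
  initF-∷ʳ [] t = refl
  initF-∷ʳ (s ∷ []) t = refl
  initF-∷ʳ (s ∷ r ∷ h) t = cong (s ∷_) (initF-∷ʳ (r ∷ h) t)

  lastF-∷ʳ : ∀ h t → lastF (h ∷ʳ t) ≡ t
  lastF-∷ʳ [] t = refl
  lastF-∷ʳ (s ∷ []) t = refl
  lastF-∷ʳ (s ∷ r ∷ h) t = lastF-∷ʳ (r ∷ h) t

  module ForestLevel {n} (1≤n : 1 ≤ n) (basis : ∀ {m} → m < n → ForestBasis m) where

    nonempty : ∀ {h} → ForestIdx n h → h ≢ []
    nonempty (_ , e) refl = ℕ.<⇒≢ 1≤n e

    view : ∀ {h} → ForestIdx n h → RedPackedForest (initF h) × RedPacked (lastF h) × ωF (initF h) + ω
        (lastF h) ≡ n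
    view {h} idx@(rp , e) = Allₚ.++⁻ˡ (initF h) rp′ , All.head (Allₚ.++⁻ʳ (initF h) rp′) ,
        ≡.trans (cong (ωF (initF h) +_) (≡.sym (ℕ.+-identityʳ _)))
            (≡.trans (≡.sym (ωF-++ (initF h) (lastF h ∷ [])))
            (≡.trans (cong ωF (initF-lastF h (nonempty idx))) e))
      where
        rp′ : All RedPacked (initF h ∷ʳ lastF h)
        rp′ = subst (All RedPacked) (≡.sym (initF-lastF h (nonempty idx))) rp

    lead : ∀ {z} → ForestIdx n z → ∀ f → (∀ p → f p [] ≈ 0#) →
        (∀ u v → length u < ωF (initF z) → f u v ≈ 0#) →
      ⟪ ℙF z , cop full f ⟫ ≈ ⟪ ℙF (initF z) , (λ u → ⟪ ℙ (lastF z) , f u ⟫) ⟫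
    lead {z} idx f f0 small = begin
      ⟪ ℙF z , cop full f ⟫ ≈⟨ Δ-ℙF (redPacked-primitives (proj₁ idx)) f ⟩
      Cut z (λ p s → ⟪ ℙF p , (λ u → ⟪ ℙF s , f u ⟫) ⟫) ≡⟨ cong
          (λ y → Cut y (λ p s → ⟪ ℙF p , (λ u → ⟪ ℙF s , f u ⟫) ⟫)) (≡.sym (initF-lastF z (nonempty idx))) ⟩
      Cut (h ∷ʳ t) (λ p s → ⟪ ℙF p , (λ u → ⟪ ℙF s , f u ⟫) ⟫) ≈⟨ Cut-∷ʳ h t
          (λ p s → ⟪ ℙF p , (λ u → ⟪ ℙF s , f u ⟫) ⟫) ⟩
      Cut h (λ p s → ⟪ ℙF p , (λ u → ⟪ ℙF (s ∷ʳ t) , f u ⟫) ⟫) ⊕ ⟪ ℙF (h ∷ʳ t) , (λ u → ⟪ R [] , f u ⟫) ⟫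
        ≈⟨ +-cong (Cut-last h (λ p s → ⟪ ℙF p , (λ u → ⟪ ℙF (s ∷ʳ t) , f u ⟫) ⟫) lower)
            (⟪⟫-zero (ℙF (h ∷ʳ t)) (λ u → ≈-trans (⟪R⟫ [] (f u)) (f0 u))) ⟩
      ⟪ ℙF h , (λ u → ⟪ ℙ t , f u ⟫) ⟫ ⊕ 0# ≈⟨ +-identityʳ _ ⟩
      ⟪ ℙF h , (λ u → ⟪ ℙ t , f u ⟫) ⟫ ∎
      where
        h = initF z
        t = lastF z
        lower : ∀ p s → p ++ s ≡ h → s ≢ [] → ⟪ ℙF p , (λ u → ⟪ ℙF (s ∷ʳ t) , f u ⟫) ⟫ ≈ 0#
        lower p s e n = ⟪⟫-zeroᴬ {x = ℙF p} (All.map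
            (λ {q} pw → ⟪⟫-zero (ℙF (s ∷ʳ t)) (λ v → small (proj₂ q) v
            (subst (_< ωF h) (≡.sym (proj₂ pw)) (subst (ωF p <_) (≡.trans (≡.sym (ωF-++ p s)) (cong ωF e))
                (ℕ.m<m+n (ωF p) (ωF-pos ps n)))))) (Deg-ℙF pp))
          where
            pa : All Primitive (p ++ s)
            pa = subst (All Primitive) (≡.sym e) (redPacked-primitives (proj₁ (view idx)))
            pp = Allₚ.++⁻ˡ p pa
            ps = Allₚ.++⁻ʳ p pa

    trees : ∀ {k} → 1 ≤ k → k ≤ n → TreeBasis k
    trees 1≤k le = TreeLevel.treeBasis 1≤k (λ lt → basis (≤-trans lt le))

    family : FilteredFamily n
    family = record
      { 1≤n = 1≤n ; χ = full ; χ-false = refl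
      ; Good = λ _ → ⊤ₚ ; Factor = λ _ → Kills full
      ; IL = ForestIdx ; IR = TreeIdx ; X = Forest ; _≟X_ = _≟F_ ; Idx = ForestIdx n ; e = ℙF
      ; lft = initF ; rgt = lastF ; mk = _∷ʳ_
      ; lft-idx = λ idx → proj₁ (view idx) , refl
      ; rgt-idx = λ {z} idx → proj₁ (proj₂ (view idx)) , ≡.sym
          (≡.trans (cong (_∸ ωF (initF z)) (≡.sym (proj₂ (proj₂ (view idx))))) (ℕ.m+n∸m≡n (ωF (initF z)) _))
      ; lev-< = λ {z} idx → subst (ωF (initF z) <_) (proj₂ (proj₂ (view idx)))
          (ℕ.m<m+n (ωF (initF z)) (ω-pos (redPacked-primitive (proj₁ (proj₂ (view idx))))))
      ; mk-idx = λ { {c} {h} {t} c<n (rp , ec) (rt , e) → Allₚ.++⁺ rp (rt ∷ []) ,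
          ≡.trans (ωF-++ h (t ∷ [])) (≡.trans (cong₂ _+_ ec (≡.trans (ℕ.+-identityʳ (ω t)) e))
              (ℕ.m+[n∸m]≡n (ℕ.<⇒≤ c<n))) }
      ; lft-mk = initF-∷ʳ
      ; rgt-mk = λ {_} {t} h _ → lastF-∷ʳ h t
      ; mk-eta = λ {z} idx → initF-lastF z (nonempty idx)
      ; IL-weight = proj₂
      ; IL-deg = λ { {h = h} (rp , e) → subst (λ k → Deg k (ℙF h)) e (Deg-ℙF (redPacked-primitives rp)) }
      ; IR-deg = λ { {t = t} (rp , e) → subst (λ k → Deg k (ℙ t)) e (ℙ-deg (redPacked-primitive rp)) }
      ; e-deg = λ { {h} (rp , e) → subst (λ k → Deg k (ℙF h)) e (Deg-ℙF (redPacked-primitives rp)) }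
      ; lead = lead
      ; indL = λ lt → indep (basis lt)
      ; spanL = λ lt → span (basis lt)
      ; indR = λ 1≤k le → TreeBasis.indep (trees 1≤k le)
      ; spanR = λ 1≤k le → TreeBasis.span (trees 1≤k le)
      ; Good-sub = λ _ _ → ttₚ
      ; Good-lin = λ _ → ttₚ
      ; slice-Factor = λ {x} {k} _ dx lt above u len → slice-kills {χ = full} {full} {full} {x}
          full-coherent dx above u len
      }

    forestBasis-suc : ForestBasis n
    forestBasis-suc = record { indep = Filtration.independent family ; span = λ x d → Filtration.spanning
        family x ttₚ d }

  forestBasis-zero : ForestBasis 0
  forestBasis-zero = record { indep = ind ; span = sp }
    where
      empty : ∀ {h} → ForestIdx 0 h → h ≡ []
      empty {[]} _ = refl
      empty {t ∷ h} (rp , e) = ⊥-elim (ℕ.<⇒≢ (ωF-pos (redPacked-primitives rp) (λ ())) (≡.sym e))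
      ind : Indep _≟F_ (ForestIdx 0) ℙF
      ind cs sup zero₁ y iy with empty iy
      ... | refl = ≈-trans (⟪⟫-congᴬ {x = cs} (All.map (λ {q} idx → same (proj₂ q) (empty idx)) sup))
          (zero₁ (λ _ → 1#))
        where
          same : ∀ h → h ≡ [] → CF.δ [] h ≈ ⟪ ℙF h , (λ _ → 1#) ⟫
          same [] refl = ≈-sym (⟪R⟫ [] (λ _ → 1#))
      sp : ∀ x → Deg 0 x → Span (ForestIdx 0) ℙF x
      sp x dx = reindex (λ _ → [] ∷ []) x , Supp-reindex (λ _ → [] ∷ [])
          (All.map (λ _ → ([] , refl) ∷ []) dx) , λ f →
        ≈-trans (⟪reindex⟫ (λ _ → [] ∷ []) x (λ h → ⟪ ℙF h , f ⟫))
            (⟪⟫-congᴬ {x = x} (All.map (λ {q} pw → ≈-trans (+-identityʳ _)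
            (≈-trans (⟪R⟫ [] f) (same f (proj₂ q) (proj₂ pw)))) dx))
        where
          same : ∀ (f : Word → K) w → length w ≡ 0 → f [] ≈ f w
          same f [] _ = ≈-refl

  -- Only forests need to be carried through the induction: the tree basis in degree `k` is built
  -- from forests of weight less than `k`.
  forestBasis : ∀ n → ForestBasis n
  forestBasis = <-rec ForestBasis step
    where
      step : ∀ n → (∀ {m} → m < n → ForestBasis m) → ForestBasis n
      step zero basis = forestBasis-zero
      step (suc n) basis = ForestLevel.forestBasis-suc (s≤s z≤n) basis

  -- From tests back to coefficients and to the coproducts of the statement

  coeff-⟪⟫ : ∀ x w → coeff x w ≈ ⟪ x , CW.δ w ⟫
  coeff-⟪⟫ [] w = ≈-refl
  coeff-⟪⟫ ((a , u) ∷ x) w with u ≟W w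
  ... | yes _ = +-cong (≈-sym (*-identityʳ a)) (coeff-⟪⟫ x w)
  ... | no _ = ≈-trans (coeff-⟪⟫ x w) (≈-sym (≈-trans (+-congʳ (zeroʳ a)) (+-identityˡ _)))

  ≈V⇒≋ : ∀ {x y} → x ≈V y → x ≋ y
  ≈V⇒≋ {x} {y} h f = begin
    ⟪ x , f ⟫ ≈⟨ +-identityʳ _ ⟨
    ⟪ x , f ⟫ ⊕ 0# ≈⟨ +-congˡ (-‿inverseˡ _) ⟨
    ⟪ x , f ⟫ ⊕ (⊖ ⟪ y , f ⟫ ⊕ ⟪ y , f ⟫) ≈⟨ +-assoc _ _ _ ⟨
    (⟪ x , f ⟫ ⊕ ⊖ ⟪ y , f ⟫) ⊕ ⟪ y , f ⟫ ≈⟨ +-congʳ (⟪subtract⟫ x y f) ⟨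
    ⟪ subtract x y , f ⟫ ⊕ ⟪ y , f ⟫ ≈⟨ +-congʳ (CW.vanish (subtract x y) f
        (All.universal (λ q → inj₁ (zeroAt (proj₂ q))) (subtract x y))) ⟩
    0# ⊕ ⟪ y , f ⟫ ≈⟨ +-identityˡ _ ⟩
    ⟪ y , f ⟫ ∎
    where
      zeroAt : ∀ w → ⟪ subtract x y , CW.δ w ⟫ ≈ 0#
      zeroAt w = ≈-trans (⟪subtract⟫ x y (CW.δ w)) (≈-trans
          (+-congʳ (≈-trans (≈-sym (coeff-⟪⟫ x w)) (≈-trans (h w) (coeff-⟪⟫ y w)))) (-‿inverseʳ _))

  ≋⇒≈V : ∀ {x y} → x ≋ y → x ≈V y
  ≋⇒≈V {x} {y} h w = ≈-trans (coeff-⟪⟫ x w) (≈-trans (h (CW.δ w)) (≈-sym (coeff-⟪⟫ y w)))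

  -- Homogeneous elements have a representative supported on packed words

  PW? : ∀ n w → Dec (PW n w)
  PW? n w with all? (1 ≤?_) w | pack w ≟W w | length w ≟ n
  ... | yes p | yes e | yes l = yes (subst Packed e (Packed-pack p) , l)
  ... | no p | _ | _ = no (λ pw → p (PW-pos pw))
  ... | yes _ | no e | _ = no (λ pw → e (pack-packed (proj₁ pw)))
  ... | yes _ | yes _ | no l = no (λ pw → l (proj₂ pw))

  restrict : ℕ → V → V
  restrict n = reindex (λ w → keep ⌊ PW? n w ⌋ w)

  Deg-restrict : ∀ n x → Deg n (restrict n x)
  Deg-restrict n x = Supp-reindex (λ w → keep ⌊ PW? n w ⌋ w)
      (All.universal (λ q → All-keep (PW? n (proj₂ q)) (λ p → p)) x)

  restrict-≋ : ∀ {n x} → InDeg n x → restrict n x ≋ x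
  restrict-≋ {n} {x} d f = begin
    ⟪ restrict n x , f ⟫ ≈⟨ ≈-trans (⟪reindex⟫ (λ w → keep ⌊ PW? n w ⌋ w) x f)
        (⟪⟫-cong x (λ w → ∑-keep ⌊ PW? n w ⌋ w f)) ⟩
    ⟪ x , (λ w → [ ⌊ PW? n w ⌋ ] f w) ⟫ ≈⟨ +-identityʳ _ ⟨
    ⟪ x , (λ w → [ ⌊ PW? n w ⌋ ] f w) ⟫ ⊕ 0# ≈⟨ +-congˡ
        (CW.vanish x rest (All.universal (λ q → zeroAt (proj₂ q) (PW? n (proj₂ q))) x)) ⟨
    ⟪ x , (λ w → [ ⌊ PW? n w ⌋ ] f w) ⟫ ⊕ ⟪ x , rest ⟫ ≈⟨ ⟪⟫-⊕ x (λ w → [ ⌊ PW? n w ⌋ ] f w) rest ⟨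
    ⟪ x , (λ w → [ ⌊ PW? n w ⌋ ] f w ⊕ rest w) ⟫ ≈⟨ ⟪⟫-cong x (λ w → halves ⌊ PW? n w ⌋ (f w)) ⟩
    ⟪ x , f ⟫ ∎
    where
      rest : Word → K
      rest w = [ not ⌊ PW? n w ⌋ ] f w
      halves : ∀ b k → [ b ] k ⊕ [ not b ] k ≈ k
      halves true k = +-identityʳ _
      halves false k = +-identityˡ _
      zeroAt : ∀ w → Dec (PW n w) → ⟪ x , CW.δ w ⟫ ≈ 0# ⊎ rest w ≈ 0#
      zeroAt w (no p) = inj₁ (≈-trans (≈-sym (coeff-⟪⟫ x w)) (d w p))
      zeroAt w (yes p) with PW? n w
      ... | yes _ = inj₂ ≈-refl
      ... | no q = ⊥-elim (q p)

  Deg⇒InDeg : ∀ {n x} → Deg n x → InDeg n x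
  Deg⇒InDeg {n} {x} d w np = ≈-trans (coeff-⟪⟫ x w)
      (⟪⟫-zeroᴬ {x = x} (All.map (λ {q} pw → CW.δ-≢ {w} {proj₂ q} (λ { refl → np pw })) d))

  -- The coproducts of the statement and cop

  ∑-splits : ∀ w (G : Word → Word → K) → (∀ s → G [] s ≈ 0#) → (∀ p → G p [] ≈ 0#) →
    ∑ (splits w) (λ s → G (proj₁ s) (proj₂ s)) ≈ Cut w G
  ∑-splits [] G Gˡ Gʳ = ≈-sym (≈-trans (Cut-[] G) (Gˡ []))
  ∑-splits w@(a ∷ w′) G Gˡ Gʳ = ≈-sym (begin
    Cut w G ≈⟨ ∑-upTo-Cut w G ⟨
    at 0 ⊕ ∑ (applyUpTo suc (length w)) at ≈⟨ +-congʳ (Gˡ w) ⟩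
    0# ⊕ ∑ (applyUpTo suc (length w)) at ≈⟨ +-identityˡ _ ⟩
    ∑ (applyUpTo suc (length w)) at ≡⟨ cong (λ l → ∑ l at)
        (≡.trans (≡.sym (map-upTo suc (length w))) (cong (map suc) (≡.sym (upTo-∷ʳ k)))) ⟩
    ∑ (map suc (upTo k ∷ʳ k)) at ≡⟨ cong (λ l → ∑ l at) (map-++ suc (upTo k) (k ∷ [])) ⟩
    ∑ (map suc (upTo k) ++ suc k ∷ []) at ≈⟨ ∑-++ (map suc (upTo k)) (suc k ∷ []) at ⟩
    ∑ (map suc (upTo k)) at ⊕ (at (suc k) ⊕ 0#) ≈⟨ +-congˡ
        (≈-trans (+-identityʳ _) (≈-trans (≈-reflexive
        (cong (G (take (suc k) w)) (drop-all (suc k) w ℕ.≤-refl))) (Gʳ _))) ⟩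
    ∑ (map suc (upTo k)) at ⊕ 0# ≈⟨ +-identityʳ _ ⟩
    ∑ (map suc (upTo k)) at ≈⟨ ∑-map (λ i → take i w , drop i w) (map suc (upTo k))
        (λ s → G (proj₁ s) (proj₂ s)) ⟨
    ∑ (splits w) (λ s → G (proj₁ s) (proj₂ s)) ∎)
    where
      k = length w′
      at : ℕ → K
      at i = G (take i w) (drop i w)

  side : Bool → Bool → Bool
  side true = left
  side false = right

  ∑-filter : ∀ {a} {A : Set a} (b : A → Bool) l (f : A → K) → ∑ (filter (λ s → b s ≟ᵇ true) l) f ≈ ∑ l
      (λ s → [ b s ] f s)
  ∑-filter b [] f = ≈-refl
  ∑-filter b (s ∷ l) f with b s
  ... | true = +-congˡ (∑-filter b l f)
  ... | false = ≈-trans (∑-filter b l f) (≈-sym (+-identityˡ _))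

  -- The coproducts of the statement omit the trivial cuts; masking the test by `inner` gives the
  -- same effect in `cop`.
  ⟪Δ⟫ : ∀ b x (ψ : Word × Word → K) → ⟪ Δ b x , ψ ⟫ ≈ ⟪ x , cop (side b) (inner (λ p s → ψ (p , s))) ⟫
  ⟪Δ⟫ b x ψ = ≈-trans (∑-concatMap (λ p → map (λ s → proj₁ p , pack (proj₁ s) , pack (proj₂ s))
      (ΔW b (proj₂ p))) x (λ p → proj₁ p ⊛ ψ (proj₂ p)))
    (∑-cong x (λ p → ≈-trans (∑-map (λ s → proj₁ p , pack (proj₁ s) , pack (proj₂ s)) (ΔW b (proj₂ p))
        (λ p → proj₁ p ⊛ ψ (proj₂ p)))
      (≈-trans (≈-sym (∑-⊛ (proj₁ p) (ΔW b (proj₂ p)) (λ s → ψ (pack (proj₁ s) , pack (proj₂ s)))))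
          (*-congˡ (word (proj₂ p))))))
    where
      same-side : ∀ b d → ⌊ d ≟ᵇ b ⌋ ≡ side b d
      same-side true true = refl
      same-side true false = refl
      same-side false true = refl
      same-side false false = refl
      cut : Word → Word → Word → K
      cut w p s = [ accept (side b) w p s ] inner (λ p s → ψ (p , s)) (pack p) (pack s)
      split-inner : ∀ w → All (λ s → proj₁ s ≢ [] × proj₂ s ≢ []) (splits w)
      split-inner w = Allₚ.map⁺ (Allₚ.map⁺ (Allₚ.applyUpTo⁺₁ (λ i → i) (length w ∸ 1) (λ lt → nonempty w lt)))
        where
          drop-≢[] : ∀ i (w : Word) → i < length w → drop i w ≢ []
          drop-≢[] zero (_ ∷ _) _ ()
          drop-≢[] (suc i) (_ ∷ w) (s≤s lt) = drop-≢[] i w lt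
          nonempty : ∀ w {i} → i < length w ∸ 1 → take (suc i) w ≢ [] × drop (suc i) w ≢ []
          nonempty [] ()
          nonempty (a ∷ w) {i} lt = (λ ()) , drop-≢[] i w lt
      inner-pack : ∀ p s → p ≢ [] → s ≢ [] → ψ (pack p , pack s) ≈ inner (λ p s → ψ (p , s)) (pack p) (pack s)
      inner-pack [] s n _ = ⊥-elim (n refl)
      inner-pack (_ ∷ _) [] _ n = ⊥-elim (n refl)
      inner-pack (_ ∷ _) (_ ∷ _) _ _ = ≈-refl
      word : ∀ w → ∑ (ΔW b w) (λ s → ψ (pack (proj₁ s) , pack (proj₂ s))) ≈ cop (side b)
          (inner (λ p s → ψ (p , s))) w
      word w = begin
        ∑ (ΔW b w) (λ s → ψ (pack (proj₁ s) , pack (proj₂ s)))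
          ≈⟨ ∑-filter (λ s → disjointB (proj₁ s) (proj₂ s) ∧ ⌊ memb (maxW w) (proj₁ s) ≟ᵇ b ⌋) (splits w)
              (λ s → ψ (pack (proj₁ s) , pack (proj₂ s))) ⟩
        ∑ (splits w) (λ s → [ disjointB (proj₁ s) (proj₂ s) ∧ ⌊ memb (maxW w) (proj₁ s) ≟ᵇ b ⌋ ] ψ
            (pack (proj₁ s) , pack (proj₂ s)))
          ≈⟨ ∑-congᴬ (All.map (λ {s} n → ≈-trans (≈-reflexive
              (cong (λ d → [ disjointB (proj₁ s) (proj₂ s) ∧ d ] ψ (pack (proj₁ s) , pack (proj₂ s)))
              (same-side b (memb (maxW w) (proj₁ s)))))
               ([]-cong (accept (side b) w (proj₁ s) (proj₂ s))
                   (inner-pack (proj₁ s) (proj₂ s) (proj₁ n) (proj₂ n)))) (split-inner w)) ⟩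
        ∑ (splits w) (λ s → cut w (proj₁ s) (proj₂ s))
          ≈⟨ ∑-splits w (cut w) (λ s → []-zero (accept (side b) w [] s))
              (λ p → ≈-trans ([]-cong (accept (side b) w p []) (inner-[]ʳ (λ p s → ψ (p , s)) (pack p)))
              ([]-zero (accept (side b) w p []))) ⟩
        cop (side b) (inner (λ p s → ψ (p , s))) w ∎

  _≟²_ : DecidableEquality (Word × Word)
  _≟²_ = ×-≡-dec _≟W_ _≟W_

  module C² = Coeff _≟²_

  coeff2-⟪⟫ : ∀ x u v → coeff2 x u v ≈ ⟪ x , C².δ (u , v) ⟫
  coeff2-⟪⟫ [] u v = ≈-refl
  coeff2-⟪⟫ ((a , p , s) ∷ x) u v = ≈-trans (pull (⌊ p ≟W u ⌋ ∧ ⌊ s ≟W v ⌋) (coeff2 x u v))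
      (+-cong (*-congˡ (pair (p ≟W u) (s ≟W v))) (coeff2-⟪⟫ x u v))
    where
      pull : ∀ b k → (if b then a ⊕ k else k) ≈ a ⊛ [ b ] 1# ⊕ k
      pull true k = +-congʳ (≈-sym (*-identityʳ a))
      pull false k = ≈-sym (≈-trans (+-congʳ (zeroʳ a)) (+-identityˡ k))
      pair : Dec (p ≡ u) → Dec (s ≡ v) → [ ⌊ p ≟W u ⌋ ∧ ⌊ s ≟W v ⌋ ] 1# ≈ C².δ (u , v) (p , s)
      pair d e = ≈-trans (≈-reflexive ([]-∧ ⌊ p ≟W u ⌋ ⌊ s ≟W v ⌋ 1#)) (go d e)
        where
          go : Dec (p ≡ u) → Dec (s ≡ v) → [ ⌊ p ≟W u ⌋ ] [ ⌊ s ≟W v ⌋ ] 1# ≈ C².δ (u , v) (p , s)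
          go (yes refl) (yes refl) = ≈-trans ([]-yes (p ≟W p) refl)
              (≈-trans ([]-yes (s ≟W s) refl) (≈-sym (C².δ-≡ (p , s))))
          go (no n) _ = ≈-trans ([]-no (p ≟W u) n) (≈-sym (C².δ-≢ {u , v} {p , s} (λ q → n (cong proj₁ q))))
          go (yes refl) (no n) = ≈-trans ([]-yes (p ≟W p) refl)
              (≈-trans ([]-no (s ≟W v) n) (≈-sym (C².δ-≢ {u , v} {p , s} (λ q → n (cong proj₂ q)))))

  inner-≈ : ∀ f → (∀ v → f [] v ≈ 0#) → (∀ u → f u [] ≈ 0#) → ∀ p s → inner f p s ≈ f p s
  inner-≈ f fˡ fʳ [] s = ≈-sym (fˡ s)
  inner-≈ f fˡ fʳ (a ∷ p) [] = ≈-sym (fʳ (a ∷ p))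
  inner-≈ f fˡ fʳ (a ∷ p) (b ∷ s) = ≈-refl

  IsZero2⇒ : ∀ {y} → IsZero2 y → ∀ ψ → ⟪ y , ψ ⟫ ≈ 0#
  IsZero2⇒ {y} z ψ = C².vanish y ψ (All.universal (λ
      { (_ , u , v) → inj₁ (≈-trans (≈-sym (coeff2-⟪⟫ y u v)) (z u v)) }) y)

  Δ-Kills : ∀ b {x} → IsZero2 (Δ b x) → Kills (side b) x
  Δ-Kills b {x} z f fˡ fʳ = ≈-trans (⟪⟫-cong x (λ w → cop-cong (side b) w {f} {inner f}
      (λ p s _ → ≈-sym (inner-≈ f fˡ fʳ p s))))
    (≈-trans (≈-sym (⟪Δ⟫ b x (λ p → f (proj₁ p) (proj₂ p)))) (IsZero2⇒ {Δ b x} z _))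

  Kills-Δ : ∀ b {x} → Kills (side b) x → IsZero2 (Δ b x)
  Kills-Δ b {x} k u v = ≈-trans (coeff2-⟪⟫ (Δ b x) u v)
      (≈-trans (⟪Δ⟫ b x (C².δ (u , v))) (k (inner (λ p s → C².δ (u , v) (p , s))) (λ _ → ≈-refl)
      (inner-[]ʳ (λ p s → C².δ (u , v) (p , s)))))

  ⟪Δ≺Δ≻⟫ : ∀ x ψ → ⟪ Δ≺ x ++ Δ≻ x , ψ ⟫ ≈ ⟪ x , cop full (inner (λ p s → ψ (p , s))) ⟫
  ⟪Δ≺Δ≻⟫ x ψ = begin
    ⟪ Δ≺ x ++ Δ≻ x , ψ ⟫ ≈⟨ ⟪⟫-++ (Δ≺ x) (Δ≻ x) ψ ⟩
    ⟪ Δ≺ x , ψ ⟫ ⊕ ⟪ Δ≻ x , ψ ⟫ ≈⟨ +-cong (⟪Δ⟫ true x ψ) (⟪Δ⟫ false x ψ) ⟩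
    ⟪ x , cop left ψ° ⟫ ⊕ ⟪ x , cop right ψ° ⟫ ≈⟨ +-comm _ _ ⟩
    ⟪ x , cop right ψ° ⟫ ⊕ ⟪ x , cop left ψ° ⟫ ≈⟨ ⟪⟫-⊕ x (cop right ψ°) (cop left ψ°) ⟨
    ⟪ x , (λ w → cop right ψ° w ⊕ cop left ψ° w) ⟫ ≈⟨ ⟪⟫-cong x (cop-halves ψ°) ⟨
    ⟪ x , cop full ψ° ⟫ ∎
    where
      ψ° : Word → Word → K
      ψ° = inner (λ p s → ψ (p , s))

  Prim-Kills : ∀ {x} → IsZero2 (Δ≺ x ++ Δ≻ x) → Kills full x
  Prim-Kills {x} z f fˡ fʳ = ≈-trans (⟪⟫-cong x (λ w → cop-cong full w {f} {inner f}
      (λ p s _ → ≈-sym (inner-≈ f fˡ fʳ p s))))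
    (≈-trans (≈-sym (⟪Δ≺Δ≻⟫ x (λ p → f (proj₁ p) (proj₂ p)))) (IsZero2⇒ {Δ≺ x ++ Δ≻ x} z _))

  Kills-Prim : ∀ {x} → Kills full x → IsZero2 (Δ≺ x ++ Δ≻ x)
  Kills-Prim {x} k u v = ≈-trans (coeff2-⟪⟫ (Δ≺ x ++ Δ≻ x) u v)
      (≈-trans (⟪Δ≺Δ≻⟫ x (C².δ (u , v))) (k (inner (λ p s → C².δ (u , v) (p , s))) (λ _ → ≈-refl)
      (inner-[]ʳ (λ p s → C².δ (u , v) (p , s)))))

  Kills-≋ : ∀ {χ x y} → y ≋ x → Kills χ x → Kills χ y
  Kills-≋ {χ} h k f fˡ fʳ = ≈-trans (h (cop χ f)) (k f fˡ fʳ)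

  unique-coefficient : ∀ {X : Set} (_≟_ : DecidableEquality X) {cs : List (K × X)} → Unique (map proj₂ cs)
      → ∀ {q} → q ∈ cs → ⟪ cs , Coeff.δ _≟_ (proj₂ q) ⟫ ≈ proj₁ q
  unique-coefficient _≟_ {q ∷ cs} (fresh ∷ un) (here refl) = ≈-trans
      (+-cong (≈-trans (*-congˡ (Coeff.δ-≡ _≟_ (proj₂ q))) (*-identityʳ _))
    (⟪⟫-zeroᴬ {x = cs} (All.map (λ {r} n → Coeff.δ-≢ _≟_ {proj₂ q} {proj₂ r} (λ e → n (≡.sym e)))
        (Allₚ.map⁻ fresh)))) (+-identityʳ _)
  unique-coefficient _≟_ {r ∷ cs} (fresh ∷ un) {q} (there i) = ≈-trans
      (+-cong (≈-trans (*-congˡ (Coeff.δ-≢ _≟_ {proj₂ q} {proj₂ r} (All.lookup fresh (∈-map⁺ proj₂ i))))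
      (zeroʳ _))
    (unique-coefficient _≟_ un i)) (+-identityˡ _)

  -- For a list of distinct indices the collected coefficient of an index is its own coefficient, so
  -- `Indep` gives linear independence. Spanning is asked only for `restrict n v`, which has the
  -- same pairings as `v` but lists packed words only.
  isBasis : ∀ {X : Set} (_≟_ : DecidableEquality X) {n} {Idx : X → Set} {e : X → V} {T : V → Set ℓ} →
    (∀ x → Idx x → T (e x)) → Indep _≟_ Idx e →
    (∀ v → T v → InDeg n v) → (∀ v → T v → Span Idx e (restrict n v)) → IsBasis Idx e T
  isBasis _≟_ {n} {Idx} {e} member ind deg sp = member ,
    (λ cs sup un zero₁ → All.tabulate (λ {q} i → ≈-trans (≈-sym (unique-coefficient _≟_ un i))
      (ind cs sup (λ f → ≈-trans (≈-sym (⟪lincomb⟫ e cs f)) (≈V⇒≋ {lincomb e cs} {[]} zero₁ f)) (proj₂ q)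
          (All.lookup sup i)))) ,
    (λ v tv → let cs , sup , eq = sp v tv in cs , sup , ≋⇒≈V {lincomb e cs} {v} (λ f → ≈-trans (⟪lincomb⟫ e cs f) (≈-trans (eq f) (restrict-≋ {n} {v} (deg v tv) f))))

  -- The three bases

  forest-theorem : ∀ n → IsBasis (ForestIdx n) ℙF (InWQSym n)
  forest-theorem n = isBasis _≟F_ (λ { h (rp , refl) → Deg⇒InDeg {x = ℙF h}
      (Deg-ℙF (redPacked-primitives rp)) })
    (ForestBasis.indep (forestBasis n)) (λ v d → d)
        (λ v d → ForestBasis.span (forestBasis n) (restrict n v) (Deg-restrict n v))

  tree-theorem : ∀ n → 1 ≤ n → IsBasis (TreeIdx n) ℙ (InPrim n)
  tree-theorem n 1≤n = isBasis _≟T_ (λ { t (rp , refl) → let p = redPacked-primitive rp in Deg⇒InDeg {x = ℙ t} (ℙ-deg p) , Kills-Prim {ℙ t} (ℙ-prim p) })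
    (TreeBasis.indep basis) (λ v s → proj₁ s)
    (λ v s → TreeBasis.span basis (restrict n v) (Deg-restrict n v)
        (Kills-≋ {full} {v} {restrict n v} (restrict-≋ {n} {v} (proj₁ s)) (Prim-Kills {v} (proj₂ s))))
    where
      basis : TreeBasis n
      basis = TreeLevel.treeBasis 1≤n (λ {m} _ → forestBasis m)

  core-theorem : ∀ n → 1 ≤ n → IsBasis (CoreIdx n) ℙ (InTPrim n)
  core-theorem n 1≤n = isBasis _≟T_ member (core-indep (λ {m} _ → forestBasis m)) (λ v s → proj₁ s)
    (λ v s → CoreSpan.core-span 1≤n (λ {m} _ → forestBasis m) {restrict n v} (Deg-restrict n v)
      (Kills-≋ {right} {v} {restrict n v} (restrict-≋ {n} {v} (proj₁ s))
          (Δ-Kills false {v} (proj₂ (proj₂ s))))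
      (Kills-≋ {left} {v} {restrict n v} (restrict-≋ {n} {v} (proj₁ s)) (Δ-Kills true {v} (proj₁ (proj₂ s)))))
    where
      member : ∀ t → CoreIdx n t → InTPrim n (ℙ t)
      member (node [] _ r) ((() , _) , _)
      member (node (i ∷ I) _ r) ix@((rp , refl) , refl) = Deg⇒InDeg {x = ℙ (node (i ∷ I) [] r)}
          (ℙ-deg (redPacked-primitive rp)) ,
          Kills-Δ true {ℙ (node (i ∷ I) [] r)} (core-left rp pr) , Kills-Δ false {ℙ (node (i ∷ I) [] r)}
              (core-right rp pr)
        where
          pr : All Primitive r
          pr = redPacked-primitives (proj₁ (CoreIdx-right {t = node (i ∷ I) [] r} ix))

mainTheorem3 : ∀ {c ℓ : Level} (F : Field c ℓ) (n : ℕ) → 1 ≤ n →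
    let open WQSym F in
    IsBasis (λ f → RedPackedForest f × ωF f ≡ n) ℙF (InWQSym n)
    × IsBasis (λ t → RedPacked t × ω t ≡ n) ℙ (InPrim n)
    × IsBasis (λ t → (RedPacked t × RootLeftEmpty t) × ω t ≡ n) ℙ (InTPrim n)
mainTheorem3 F n 1≤n = forest-theorem n , tree-theorem n 1≤n , core-theorem n 1≤n
  where open Bases F
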